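{- For all positive integers $r<s<d$ with $d=r+s$ and every integer $n$ with $r,s<n$, there is an $(n,(r,s))$-cover-free family of size $$N(r,s)^{1+o(1)}\cdot\log n$$ (an almost optimal one), and it can be constructed in linear time, that is, deterministically in time $$O\left(N(r,s)^{1+o(1)}\cdot n\cdot\log n\right).$$
   Context: An $(n,(r,s))$-cover-free family (CFF), with $d=r+s$, is a set $\mathcal F\subseteq\{0,1\}^n$ such that for every $1\le i_1<\cdots<i_d\le n$ and every $J\subset[d]$ with $|J|=r$ there is $a\in\mathcal F$ with $a_{i_j}=1$ for all $j\in J$ and $a_{i_k}=0$ for all $k\in[d]\setminus J$. Define $N(r,s):=\dfrac{d\binom{d}{r}}{\log\binom{d}{r}}$ where $d=r+s$; logarithms are to base 2. The notation $o(1)$ stands for a term that is independent of $n$ and tends to $0$ as $d=r+s\to\infty$ (uniformly over the choice of $r,s$ with $r+s=d$). Thus the size bound means: there is a function $\varepsilon(d)\to0$ such that the family has size at most $N(r,s)^{1+\varepsilon(d)}\log n$. "Constructed in time $T$" means that there is a deterministic algorithm which, given $n,r,s$, outputs all vectors of the family in time $T$. -}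

module Defs where

open import Algebra.Definitions.RawSemiring using () renaming (_^_ to power)
open import Data.Bool using (Bool; true; false)
import Data.Bool.Properties as Bool
open import Data.Fin using (Fin)
import Data.Fin as Fin
open import Data.Fin.Subset as Subset using (Subset) renaming (_∈_ to _∈ˢ_; _∉_ to _∉ˢ_)
open import Data.Integer using (+_; -[1+_]; ∣_∣)
open import Data.List using (List; []; _∷_; _∷ʳ_; length; deduplicate; head; drop)
open import Data.List.Membership.Propositional using (_∈_)
open import Data.Maybe using (Maybe; just; nothing)
import Data.Maybe as Maybe
open import Data.Nat using (ℕ; zero; suc; _+_; _*_; _∸_; _^_; _/_; _%_; _<_; _≤_; _≡ᵇ_)
open import Data.Nat.Combinatorics using (_C_)
open import Data.Nat.Logarithm using (⌈log₂_⌉)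
open import Data.Nat.Properties using (m^n≢0)
open import Data.Product using (∃; _×_)
open import Data.Rational as ℚ using (ℚ; 0ℚ; 1ℚ; ↥_; ↧ₙ_)
open import Data.Vec using (Vec; lookup)
open import Data.Vec.Properties using (≡-dec)
open import Relation.Binary.PropositionalEquality using (_≡_)

-- A finite set of vectors is given by a listing, possibly with repetitions.
Family : ℕ → Set
Family n = List (Vec Bool n)

-- Number of distinct members.
size : ∀ {n} → Family n → ℕ
size F = length (deduplicate (≡-dec Bool._≟_) F)

StrictlyIncreasing : ∀ {d n} → (Fin d → Fin n) → Set
StrictlyIncreasing i = ∀ {j k} → j Fin.< k → i j Fin.< i k

IsCFF : (n r s : ℕ) → Family n → Set
IsCFF n r s F =
  (i : Fin (r + s) → Fin n) → StrictlyIncreasing i →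
  (J : Subset (r + s)) → Subset.∣ J ∣ ≡ r →
  ∃ λ a → a ∈ F × (∀ j → j ∈ˢ J → lookup a (i j) ≡ true)
                × (∀ k → k ∉ˢ J → lookup a (i k) ≡ false)

-- A real x ≥ 0 is given by its two cuts: lower q means 0 < q < x and
-- upper q means q > 0 and x < q.  The cut axioms are not part of the record;
-- every real built below satisfies them, as long as ⁻¹ and ^ʳ are applied to
-- positive reals only.
record ℝ≥0 : Set₁ where
  field
    lower upper : ℚ → Set

open ℝ≥0 public

infix  4 _≤ʳ_
infixl 7 _*ʳ_ _/ʳ_
infixr 8 _^ʳ_ _^ⁿ_
infix  9 _⁻¹

_≤ʳ_ : ℝ≥0 → ℝ≥0 → Set
x ≤ʳ y = ∀ q → upper y q → upper x q

_^ⁿ_ : ℚ → ℕ → ℚ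
_^ⁿ_ = power ℚ.+-*-rawSemiring

fromℕ : ℕ → ℝ≥0
lower (fromℕ m) q = 0ℚ ℚ.< q × q ℚ.< (+ m) ℚ./ 1
upper (fromℕ m) q = 0ℚ ℚ.< q × (+ m) ℚ./ 1 ℚ.< q

-- The logarithm to base 2 of m ≥ 1: for positive integers a and b,
-- a/b < log₂ m if and only if 2 ^ a < m ^ b.
log₂ : ℕ → ℝ≥0
lower (log₂ m) q = 0ℚ ℚ.< q × 2 ^ ∣ ↥ q ∣ < m ^ ↧ₙ q
upper (log₂ m) q = 0ℚ ℚ.< q × m ^ ↧ₙ q < 2 ^ ∣ ↥ q ∣

_*ʳ_ : ℝ≥0 → ℝ≥0 → ℝ≥0
lower (x *ʳ y) q = 0ℚ ℚ.< q × ∃ λ u → ∃ λ v → lower x u × lower y v × q ℚ.< u ℚ.* v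
upper (x *ʳ y) q = 0ℚ ℚ.< q × ∃ λ u → ∃ λ v → upper x u × upper y v × u ℚ.* v ℚ.< q

_⁻¹ : ℝ≥0 → ℝ≥0
lower (x ⁻¹) q = 0ℚ ℚ.< q × ∃ λ u → upper x u × q ℚ.* u ℚ.< 1ℚ
upper (x ⁻¹) q = 0ℚ ℚ.< q × ∃ λ u → lower x u × 1ℚ ℚ.< q ℚ.* u

_/ʳ_ : ℝ≥0 → ℝ≥0 → ℝ≥0
x /ʳ y = x *ʳ y ⁻¹

-- fractionalPower x a b is x to the power a / b, where b ≥ 1.
fractionalPower : ℝ≥0 → ℕ → ℕ → ℝ≥0
lower (fractionalPower x a b) q = 0ℚ ℚ.< q × ∃ λ u → lower x u × q ^ⁿ b ℚ.< u ^ⁿ a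
upper (fractionalPower x a b) q = 0ℚ ℚ.< q × ∃ λ u → upper x u × u ^ⁿ a ℚ.< q ^ⁿ b

_^ʳ_ : ℝ≥0 → ℚ → ℝ≥0
x ^ʳ e with ↥ e
... | + a      = fractionalPower x a (↧ₙ e)
... | -[1+ a ] = fractionalPower (x ⁻¹) (suc a) (↧ₙ e)

N : ℕ → ℕ → ℝ≥0
N r s = fromℕ ((r + s) * ((r + s) C r)) /ʳ log₂ ((r + s) C r)

-- An o(1) term as a function of d.  Rational values suffice for upper bounds
-- of the form N r s ^ (1 + o(1)): as N r s ≥ 1, a real-valued term may be
-- replaced by a rational one exceeding it by at most 1/d.
TendsToZero : (ℕ → ℚ) → Set
TendsToZero ε = ∀ η → 0ℚ ℚ.< η → ∃ λ D → ∀ d → D ≤ d → ℚ.∣ ε d ∣ ℚ.< η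

-- Deterministic algorithms are programs for the unit-cost word RAM.
data Op : Set where
  add sub mul quo : Op

-- All operands are memory addresses, except for the second argument of const
-- (a literal) and of jumpZero (a program position).
data Instruction : Set where
  const    : ℕ → ℕ → Instruction
  arith    : Op → ℕ → ℕ → ℕ → Instruction
  load     : ℕ → ℕ → Instruction
  store    : ℕ → ℕ → Instruction
  jumpZero : ℕ → ℕ → Instruction
  emit     : ℕ → Instruction

Program : Set
Program = List Instruction

record State : Set where
  constructor state
  field
    pc     : ℕ
    memory : ℕ → ℕ
    output : List Bool

open State public

⟦_⟧ : Op → ℕ → ℕ → ℕ
⟦ add ⟧ x y       = x + y
⟦ sub ⟧ x y       = x ∸ y
⟦ mul ⟧ x y       = x * y
⟦ quo ⟧ x zero    = 0
⟦ quo ⟧ x (suc y) = x / suc y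

isNonZero : ℕ → Bool
isNonZero zero    = false
isNonZero (suc _) = true

-- Memory cells hold w-bit words: whatever is written is reduced modulo 2 ^ w.
write : (w : ℕ) → ℕ → ℕ → (ℕ → ℕ) → (ℕ → ℕ)
write w a v M x with x ≡ᵇ a
... | true  = _%_ v (2 ^ w) ⦃ m^n≢0 2 w ⦄
... | false = M x

execute : (w : ℕ) → Instruction → State → State
execute w (const a v)      (state p M o) = state (suc p) (write w a v M) o
execute w (arith op a b c) (state p M o) = state (suc p) (write w a (⟦ op ⟧ (M b) (M c)) M) o
execute w (load a b)       (state p M o) = state (suc p) (write w a (M (M b)) M) o
execute w (store a b)      (state p M o) = state (suc p) (write w (M a) (M b) M) o
execute w (jumpZero a l)   (state p M o) with M a
... | zero  = state l M o
... | suc _ = state (suc p) M o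
execute w (emit a)         (state p M o) = state (suc p) M (o ∷ʳ isNonZero (M a))

-- The machine halts when the program counter leaves the program.
step : (w : ℕ) → Program → State → Maybe State
step w P σ = Maybe.map (λ I → execute w I σ) (head (drop (pc σ) P))

-- Run w P σ t o: started in σ, the machine halts after exactly t steps,
-- having output o.
data Run (w : ℕ) (P : Program) : State → ℕ → List Bool → Set where
  halt : ∀ {σ} → step w P σ ≡ nothing → Run w P σ 0 (output σ)
  next : ∀ {σ σ′ t o} → step w P σ ≡ just σ′ → Run w P σ′ t o → Run w P σ (suc t) o

initial : (w n r s : ℕ) → State
initial w n r s = state 0 (write w 0 n (write w 1 r (write w 2 s (λ _ → 0)))) []

-- The usual word length: proportional to the logarithm of the input and output
-- sizes.  Here N r s lies between (r + s) C r and its square, so these are words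
-- of O(log (n · N r s)) bits.
wordSize : (c n r s : ℕ) → ℕ
wordSize c n r s = suc c * ⌈log₂ (n * ((r + s) C r)) ⌉

{-# OPTIONS --safe #-}
-- The set [n] is hashed into q = O(rs) cells by F₂-linear maps, chosen greedily so
-- that some map separates any r points from any s others; it then suffices to cover
-- the patterns on q cells and to pull the rows back along Θ(q log n) maps.  With
-- ℓ = lg d, if r ≤ ℓ² one lists all r-tuples of cells.  Otherwise [q] is cut into
-- intervals of bounded load, one interval is hashed once more and covered there,
-- either by tuples of at most ℓ ones (r < 2 ^ (10 (ℓ / 12))) or by a greedy cover,
-- and the rows for single intervals are spliced at all possible cut points.  Tagging
-- rows by their number of ones and discarding those above r keeps the number of
-- splices within (d C r) ^ (1 + 1 / m) as long as ℓ ^ (400 m) ≤ 2 ^ (ℓ / 12).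
--
-- The algorithm is written in a small loop language over lists whose cost semantics
-- is preserved, up to the stated constants, by compilation to the word RAM.
module Submission where

open import Defs hiding (N)
open import Algebra.Bundles using (CommutativeRing)
import Algebra.Properties.CommutativeSemiring.Exp
open import Data.Bool using (Bool; true; false; T; _∧_; if_then_else_)
open import Data.Empty using (⊥-elim)
open import Data.Fin as Fin using (Fin; zero; suc; toℕ; #_)
open import Data.Fin.Patterns
open import Data.Fin.Properties using (toℕ-injective; toℕ<n)
open import Data.Fin.Subset as Subset using (Subset) renaming (_∈_ to _∈ˢ_; _∉_ to _∉ˢ_)
import Data.Integer as ℤ
import Data.Integer.Properties as ℤₚ
open import Data.List as List using (List; []; _∷_; _++_; _∷ʳ_; length; drop; head; concatMap; applyUpTo)
open import Data.List.Membership.Propositional using (_∈_)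
open import Data.List.Membership.Propositional.Properties using (∈-++⁺ˡ; ∈-++⁺ʳ)
open import Data.List.Properties using (length-++; drop-drop; ++-assoc)
open import Data.List.Relation.Unary.All as LAll using () renaming (All to LAll; [] to []ᵃ; _∷_ to _∷ᵃ_)
import Data.List.Relation.Unary.All.Properties
open import Data.List.Relation.Unary.Any using (here; there)
open import Data.Maybe as Maybe using (Maybe; just; nothing)
open import Data.Nat
open import Data.Nat.Combinatorics using (nCk+nC[k+1]≡[n+1]C[k+1]; nCn≡1; nCk≡nC[n∸k]) renaming (_C_ to _choose_)
open import Data.Nat.Combinatorics.Specification using (k>n⇒nCk≡0)
import Data.Nat.Coprimality
import Data.Nat.Divisibility
open import Data.Nat.DivMod hiding (_mod_; result)
open import Data.Nat.Logarithm using (⌈log₂_⌉; ⌈log₂⌉-mono-≤; ⌈log₂⌈n/2⌉⌉≡⌈log₂n⌉∸1)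
open import Data.Nat.Properties
open import Data.Nat.Solver using (module +-*-Solver)
open import Data.Product using (∃; _×_; _,_; proj₁; proj₂)
import Data.Rational as ℚ
import Data.Rational.Properties as ℚₚ
import Data.Rational.Unnormalised as ℚᵘ
import Data.Rational.Unnormalised.Properties as ℚᵘₚ
open import Data.Sum using (_⊎_; inj₁; inj₂; [_,_]′)
open import Data.Unit using (⊤; tt)
open import Data.Vec as Vec using (Vec; []; _∷_; lookup; _[_]≔_; _[_]=_; tabulate; toList)
open import Data.Vec.Properties using (lookup∘update; lookup∘update′; lookup∘tabulate)
open import Data.Vec.Relation.Unary.All using (All; []; _∷_)
open import Function using (_∘_; case_of_; _$_)
open import Relation.Binary using (tri<; tri≈; tri>)
open import Relation.Binary.PropositionalEquality
open import Relation.Nullary using (¬_; yes; no; contradiction)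

-- One error exponent must serve all pairs (r, s). Splicing blocks naively costs the largest block
-- family once per block, far above the binomial coefficient when r is small against s. Counted by
-- tags, the product of block sizes becomes a Vandermonde sum, at most `binom (I * ω) r`, or `Q ^ r`
-- for tuples, up to a factor polynomial in d per block. The second hashing, from q to Q cells, is
-- there because the greedy search over Q cells takes time about `2 ^ (4 * Q)`, which must stay
-- below `2 ^ (r / M)`: blocks of load `2 ^ (3 * g)` keep Q and the number of rounds below
-- `2 ^ (9 * g)` up to powers of ℓ, while r is at least `2 ^ (10 * g)`. Both greedy choices replace
-- probabilities by integer potentials, `2 ^ collisions` for the hash maps and factorial weights for
-- the covers. The logarithm in N costs at most `Λ * Λ` with `Λ = r * ℓ`, so that the real bound
-- reduces to `(U * (Λ * Λ)) ^ M ≤ (d * C) ^ (1 + M)` between naturals, with error exponent `1 / M`.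
-- The constant 400 exceeds 352, the largest power of ℓ spent per required one.

infixl 5 _▹_

-- Sequences that grow at the end, and finite sums.

data Seq (A : Set) : Set where
  ε   : Seq A
  _▹_ : Seq A → A → Seq A

size# : ∀ {A : Set} → Seq A → ℕ
size# ε       = 0
size# (s ▹ _) = suc (size# s)

-- Indices count from the element pushed first; `z` is the value outside the sequence.
at : ∀ {A : Set} → A → Seq A → ℕ → A
at z ε       i = z
at z (s ▹ x) i with i ≡ᵇ size# s
... | true  = x
... | false = at z s i

toList# : ∀ {A : Set} → Seq A → List A
toList# ε       = []
toList# (s ▹ x) = toList# s ∷ʳ x

≡ᵇ-refl : ∀ n → (n ≡ᵇ n) ≡ true
≡ᵇ-refl zero    = refl
≡ᵇ-refl (suc n) = ≡ᵇ-refl n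

≢⇒≡ᵇ : ∀ {m n} → m ≢ n → (m ≡ᵇ n) ≡ false
≢⇒≡ᵇ {m} {n} m≢n with m ≡ᵇ n in eq
... | true  = ⊥-elim (m≢n (≡ᵇ⇒≡ m n (subst T (sym eq) tt)))
... | false = refl

at-last : ∀ {A : Set} (z : A) s x → at z (s ▹ x) (size# s) ≡ x
at-last z s x rewrite ≡ᵇ-refl (size# s) = refl

at-init : ∀ {A : Set} (z : A) s x {i} → i < size# s → at z (s ▹ x) i ≡ at z s i
at-init z s x {i} i< rewrite ≢⇒≡ᵇ (<⇒≢ i<) = refl

Σ< : (ℕ → ℕ) → ℕ → ℕ
Σ< f zero    = 0
Σ< f (suc n) = Σ< f n + f n

-- A loop language over six lists, with cost semantics.

Slot : Set
Slot = Fin 6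

-- In loop and fold the bound variable 0 counts up from 0; in fold,
-- variable 1 is the accumulator.
data Exp (n : ℕ) : Set where
  var  : Fin n → Exp n
  lit  : ℕ → Exp n
  op   : Op → Exp n → Exp n → Exp n
  get  : Slot → Exp n → Exp n
  len  : Slot → Exp n
  fold : Exp n → Exp n → Exp (2 + n) → Exp n

infixr 4 _⨾_

data Stmt (n : ℕ) : Set where
  push  : Slot → Exp n → Stmt n
  clear : Slot → Stmt n
  out   : Exp n → Stmt n
  _⨾_   : Stmt n → Stmt n → Stmt n
  loop  : Exp n → Stmt (1 + n) → Stmt n
  bind  : Exp n → Stmt (1 + n) → Stmt n

Store : Set
Store = Vec (Seq ℕ) 6

module Machine (w : ℕ) where

  B : ℕ
  B = 2 ^ w

  -- Every value must stay below `B`, so that reduction modulo `2 ^ w` never changes it. Costs count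
  -- the instructions that the compiled code executes, `slack` allowing overestimates. In `get`, the
  -- condition with the factor 16 keeps the computed address below `B`.
  data Eval (σ : Store) {n} (ρ : Vec ℕ n) : Exp n → ℕ → ℕ → Set where
    var  : ∀ x → lookup ρ x < B → Eval σ ρ (var x) (lookup ρ x) 2
    lit  : ∀ v → v < B → Eval σ ρ (lit v) v 1
    op   : ∀ o {e f x y c c′} → Eval σ ρ e x c → Eval σ ρ f y c′ → ⟦ o ⟧ x y < B →
           Eval σ ρ (op o e f) (⟦ o ⟧ x y) (c + (c′ + 1))
    get  : ∀ a {e i c} → Eval σ ρ e i c → i < size# (lookup σ a) → at 0 (lookup σ a) i < B →
           (2 + size# (lookup σ a)) * 16 < B →
           Eval σ ρ (get a e) (at 0 (lookup σ a) i) (c + 5)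
    len  : ∀ a → size# (lookup σ a) < B → Eval σ ρ (len a) (size# (lookup σ a)) 2
    fold : ∀ {e f b N c c′} (acc cost : ℕ → ℕ) → Eval σ ρ e N c → Eval σ ρ f (acc 0) c′ →
           (∀ i → i < N → Eval σ (i ∷ acc i ∷ ρ) b (acc (suc i)) (cost i)) → acc N < B →
           -- 1 clears the counter; each round pays 2 for moving its result into the accumulator and
           -- 6 for control; then 2 leave the loop and 2 move the accumulator.
           Eval σ ρ (fold e f b) (acc N) (c + (c′ + (1 + ((Σ< (λ i → (cost i + 2) + 6) N + 2) + 2))))
    slack : ∀ {e v c c′} → Eval σ ρ e v c → c ≤ c′ → Eval σ ρ e v c′

  -- In `loop`, `τ i` and `ω i` are the store and the output before round `i`; the limit is
  -- evaluated once, in the store `τ 0`.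
  data Exec {n} (ρ : Vec ℕ n) : Stmt n → Store → Seq Bool → Store → Seq Bool → ℕ → Set where
    push  : ∀ a {σ ω e v c} → Eval σ ρ e v c → (2 + size# (lookup σ a)) * 16 < B →
            Exec ρ (push a e) σ ω (σ [ a ]≔ (lookup σ a ▹ v)) ω (c + 7)
    clear : ∀ a {σ ω} → Exec ρ (clear a) σ ω (σ [ a ]≔ ε) ω 1
    out   : ∀ {σ ω e v c} → Eval σ ρ e v c → Exec ρ (out e) σ ω σ (ω ▹ isNonZero v) (c + 1)
    _⨾_   : ∀ {s t σ ω σ₁ ω₁ σ₂ ω₂ c c′} → Exec ρ s σ ω σ₁ ω₁ c → Exec ρ t σ₁ ω₁ σ₂ ω₂ c′ →
            Exec ρ (s ⨾ t) σ ω σ₂ ω₂ (c + c′)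
    loop  : ∀ {e s N c} (τ : ℕ → Store) (ω : ℕ → Seq Bool) (cost : ℕ → ℕ) → Eval (τ 0) ρ e N c →
            (∀ i → i < N → Exec (i ∷ ρ) s (τ i) (ω i) (τ (suc i)) (ω (suc i)) (cost i)) →
            Exec ρ (loop e s) (τ 0) (ω 0) (τ N) (ω N) (c + (1 + (Σ< (λ i → cost i + 6) N + 2)))
    bind  : ∀ {e s v σ ω σ₁ ω₁ c c′} → Eval σ ρ e v c → Exec (v ∷ ρ) s σ ω σ₁ ω₁ c′ →
            Exec ρ (bind e s) σ ω σ₁ ω₁ (c + c′)
    slack : ∀ {s σ ω σ₁ ω₁ c c′} → Exec ρ s σ ω σ₁ ω₁ c → c ≤ c′ → Exec ρ s σ ω σ₁ ω₁ c′

  Eval-< : ∀ {σ n} {ρ : Vec ℕ n} {e v c} → Eval σ ρ e v c → v < B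
  Eval-< (var x v<)            = v<
  Eval-< (lit v v<)            = v<
  Eval-< (op o _ _ v<)         = v<
  Eval-< (get a _ _ v< _)      = v<
  Eval-< (len a v<)            = v<
  Eval-< (fold _ _ _ _ _ v<)   = v<
  Eval-< (slack d _)           = Eval-< d

-- Compilation to the word RAM.

-- Registers live at the multiples of 16; list a occupies the addresses
-- congruent to a + 1, with its length in the first of these.
reg : ℕ → ℕ
reg k = k * 16

cell : Slot → ℕ → ℕ
cell a i = suc (toℕ a) + i * 16

-- Truncated subtraction `lim ∸ i` is zero exactly when the loop is over. The jump back is a
-- `jumpZero` on the register `t`, just cleared. The exit offset `2 + (length body + 4)` is the
-- length of the whole block.
loopCode : (p lim i t : ℕ) → List Instruction → List Instruction
loopCode p lim i t body =
  arith sub (reg t) (reg lim) (reg i) ∷ jumpZero (reg t) (p + (2 + (length body + 4))) ∷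
  (body ++ (const (reg t) 1 ∷ arith add (reg i) (reg i) (reg t) ∷ const (reg t) 0 ∷ jumpZero (reg t) p ∷ []))

-- A move is the addition of a freshly cleared cell; `z` may coincide with the target `t`, but must
-- differ from the source `x`.
copyReg : ℕ → ℕ → ℕ → List Instruction
copyReg z x t = const z 0 ∷ arith add t x z ∷ []

-- The offset `16 + suc (toℕ a)` skips the cell that holds the length of the list.
address : ℕ → Slot → List Instruction
address k a = const (reg (suc k)) 16 ∷ arith mul (reg k) (reg k) (reg (suc k)) ∷
              const (reg (suc k)) (16 + suc (toℕ a)) ∷ arith add (reg k) (reg k) (reg (suc k)) ∷ []

-- compileE p k δ e evaluates e into register k, using only registers from k on;
-- the variables of e are in the registers δ, and p is the position of the code.
compileE : ℕ → ℕ → ∀ {n} → Vec ℕ n → Exp n → List Instruction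
compileE p k δ (var x)  = copyReg (reg k) (reg (lookup δ x)) (reg k)
compileE p k δ (lit v)  = const (reg k) v ∷ []
compileE p k δ (op o e f) =
  let c = compileE p k δ e in
  c ++ (compileE (p + length c) (suc k) δ f ++ (arith o (reg k) (reg k) (reg (suc k)) ∷ []))
compileE p k δ (get a e) = compileE p k δ e ++ (address k a ++ (load (reg k) (reg k) ∷ []))
compileE p k δ (len a)  = copyReg (reg k) (cell a 0) (reg k)
compileE p k δ (fold e f b) =
  -- Register `k` holds the limit, `1 + k` the accumulator, `2 + k` the counter, and `3 + k`
  -- alternately the exit test and the value of the body.
  let c = compileE p k δ e
      p₁ = p + length c
      d = compileE p₁ (1 + k) δ f
      p₂ = (p₁ + length d) + 1
      body = compileE (p₂ + 2) (3 + k) (2 + k ∷ 1 + k ∷ δ) b ++ copyReg (reg (4 + k)) (reg (3 + k)) (reg (1 + k))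
  in c ++ (d ++ ((const (reg (2 + k)) 0 ∷ []) ++ (loopCode p₂ k (2 + k) (3 + k) body ++ copyReg (reg k) (reg (1 + k)) (reg k))))

compileS : ℕ → ℕ → ∀ {n} → Vec ℕ n → Stmt n → List Instruction
compileS p k δ (push a e) =
  compileE p k δ e ++
  (const (reg (2 + k)) 16 ∷ arith mul (reg (1 + k)) (cell a 0) (reg (2 + k)) ∷
   const (reg (2 + k)) (16 + suc (toℕ a)) ∷ arith add (reg (1 + k)) (reg (1 + k)) (reg (2 + k)) ∷
   store (reg (1 + k)) (reg k) ∷
   const (reg (2 + k)) 1 ∷ arith add (cell a 0) (cell a 0) (reg (2 + k)) ∷ [])
compileS p k δ (clear a) = const (cell a 0) 0 ∷ []
compileS p k δ (out e)   = compileE p k δ e ++ (emit (reg k) ∷ [])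
compileS p k δ (s ⨾ t)   = let c = compileS p k δ s in c ++ compileS (p + length c) k δ t
compileS p k δ (loop e s) =
  let c = compileE p k δ e
      p₁ = (p + length c) + 1
      body = compileS (p₁ + 2) (2 + k) (1 + k ∷ δ) s
  in c ++ ((const (reg (1 + k)) 0 ∷ []) ++ loopCode p₁ k (1 + k) (2 + k) body)
compileS p k δ (bind e s) = let c = compileE p k δ e in c ++ compileS (p + length c) (1 + k) (k ∷ δ) s

-- Memory layout, frames, and reachable states.

Memory : Set
Memory = ℕ → ℕ

reg-injective : ∀ {j k} → reg j ≡ reg k → j ≡ k
reg-injective {j} {k} = *-cancelʳ-≡ j k 16

slot<16 : ∀ (a : Slot) → suc (toℕ a) < 16
slot<16 a = s≤s (≤-trans (toℕ<n a) (m≤m+n 6 9))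

cell%16 : ∀ a i → cell a i % 16 ≡ suc (toℕ a)
cell%16 a i = trans ([m+kn]%n≡m%n (suc (toℕ a)) i 16) (m<n⇒m%n≡m (slot<16 a))

cell≢reg : ∀ a i j → cell a i ≢ reg j
cell≢reg a i j eq with trans (sym (cell%16 a i)) (trans (cong (_% 16) eq) (m*n%n≡0 j 16))
... | ()

cell-injectiveˡ : ∀ {a b i j} → cell a i ≡ cell b j → a ≡ b
cell-injectiveˡ {a} {b} {i} {j} eq =
  toℕ-injective (suc-injective (trans (sym (cell%16 a i)) (trans (cong (_% 16) eq) (cell%16 b j))))

cell-injectiveʳ : ∀ {a i j} → cell a i ≡ cell a j → i ≡ j
cell-injectiveʳ {a} {i} {j} eq = reg-injective {i} {j} (+-cancelˡ-≡ (suc (toℕ a)) _ _ eq)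

-- M′ differs from M at most in the registers from k on.
Frame : ℕ → Memory → Memory → Set
Frame k M M′ = ∀ x → (∀ j → k ≤ j → x ≢ reg j) → M′ x ≡ M x

Frame-trans : ∀ {k M M′ M″} → Frame k M M′ → Frame k M′ M″ → Frame k M M″
Frame-trans f g x h = trans (g x h) (f x h)

Frame-≤ : ∀ {k l M M′} → k ≤ l → Frame l M M′ → Frame k M M′
Frame-≤ k≤l f x h = f x (λ j l≤j → h j (≤-trans k≤l l≤j))

Frame-reg : ∀ {k M M′ j} → Frame k M M′ → j < k → M′ (reg j) ≡ M (reg j)
Frame-reg {j = j} f j<k = f (reg j) (λ i k≤i eq → <-irrefl (reg-injective {j} {i} eq) (<-≤-trans j<k k≤i))

Frame-cell : ∀ {k M M′} → Frame k M M′ → ∀ a i → M′ (cell a i) ≡ M (cell a i)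
Frame-cell f a i = f (cell a i) (λ j _ → cell≢reg a i j)

module Compile (w : ℕ) (P : Program) where

  open Machine w

  W : ℕ → ℕ → Memory → Memory
  W = write w

  W-same : ∀ a {v} M → v < B → W a v M a ≡ v
  W-same a {v} M v<B rewrite ≡ᵇ-refl a = m<n⇒m%n≡m ⦃ m^n≢0 2 w ⦄ v<B

  W-other : ∀ {a x} v M → x ≢ a → W a v M x ≡ M x
  W-other v M x≢a rewrite ≢⇒≡ᵇ x≢a = refl

  W-frame : ∀ {k} j v M → k ≤ j → Frame k M (W (reg j) v M)
  W-frame j v M k≤j x h = W-other v M (h j k≤j)

  W-reg : ∀ {i j} v M → i ≢ j → W (reg j) v M (reg i) ≡ M (reg i)
  W-reg {i} {j} v M i≢j = W-other v M (i≢j ∘ reg-injective {i} {j})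

  W-cell : ∀ a i j v M → W (reg j) v M (cell a i) ≡ M (cell a i)
  W-cell a i j v M = W-other v M (cell≢reg a i j)

  -- The index only bounds the number of steps from above, since `done` accepts any budget; this is
  -- what makes `slack` sound.
  data Reach (σ : State) : ℕ → State → Set where
    done : ∀ {c} → Reach σ c σ
    more : ∀ {c σ′ σ″} → step w P σ ≡ just σ′ → Reach σ′ c σ″ → Reach σ (suc c) σ″

  Reach-≤ : ∀ {σ σ′ c c′} → Reach σ c σ′ → c ≤ c′ → Reach σ c′ σ′
  Reach-≤ done _ = done
  Reach-≤ (more eq r) (s≤s le) = more eq (Reach-≤ r le)

  Reach-trans : ∀ {σ σ′ σ″ c c′} → Reach σ c σ′ → Reach σ′ c′ σ″ → Reach σ (c + c′) σ″
  Reach-trans {c = c} {c′} done r = Reach-≤ r (m≤n+m c′ c)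
  Reach-trans (more eq r) r′ = more eq (Reach-trans r r′)

  data At (p : ℕ) (c : List Instruction) : Set where
    located : ∀ rest → drop p P ≡ c ++ rest → At p c

  At-++ˡ : ∀ {p} c d → At p (c ++ d) → At p c
  At-++ˡ c d (located rest eq) = located (d ++ rest) (trans eq (++-assoc c d rest))

  drop-length : ∀ {A : Set} (xs ys : List A) → drop (length xs) (xs ++ ys) ≡ ys
  drop-length []       ys = refl
  drop-length (x ∷ xs) ys = drop-length xs ys

  At-++ʳ : ∀ {p} c d → At p (c ++ d) → At (p + length c) d
  At-++ʳ {p} c d (located rest eq) = located rest
    (trans (sym (drop-drop p (length c) P))
    (trans (cong (drop (length c)) (trans eq (++-assoc c d rest))) (drop-length c (d ++ rest))))

  At-tail : ∀ {p I} c → At p (I ∷ c) → At (suc p) c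
  At-tail {p} {I} c a = subst (λ q → At q c) (+-comm p 1) (At-++ʳ (I ∷ []) c a)

  fetch : ∀ {p I c M o} → At p (I ∷ c) → step w P (state p M o) ≡ just (execute w I (state p M o))
  fetch {p} {I} {c} {M} {o} (located rest eq) = cong (λ l → Maybe.map (λ J → execute w J (state p M o)) (head l)) eq

  simple : Instruction → Bool
  simple (jumpZero _ _) = false
  simple (emit _)       = false
  simple _              = true

  effect : Instruction → Memory → Memory
  effect I M = memory (execute w I (state 0 M []))

  effects : List Instruction → Memory → Memory
  effects []      M = M
  effects (I ∷ c) M = effects c (effect I M)

  allSimple : List Instruction → Bool
  allSimple []      = true
  allSimple (I ∷ c) = simple I ∧ allSimple c

  simple-step : ∀ I {p M o} → T (simple I) → execute w I (state p M o) ≡ state (suc p) (effect I M) o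
  simple-step (const _ _)     _ = refl
  simple-step (arith _ _ _ _) _ = refl
  simple-step (load _ _)      _ = refl
  simple-step (store _ _)     _ = refl

  T-∧ : ∀ {x y} → T (x ∧ y) → T x × T y
  T-∧ {true} {true} _ = tt , tt

  straight : ∀ c {p M o} → T (allSimple c) → At p c →
             Reach (state p M o) (length c) (state (p + length c) (effects c M) o)
  straight [] {p} {M} {o} _ _ rewrite +-identityʳ p = done
  straight (I ∷ c) {p} {M} {o} s a rewrite +-suc p (length c) =
    more (trans (fetch {c = c} a) (cong just (simple-step I (proj₁ (T-∧ {simple I} s)))))
         (straight c (proj₂ (T-∧ {simple I} s)) (At-tail c a))

  Does : ℕ → List Instruction → Memory → List Bool → ℕ → Memory → List Bool → Set
  Does p c M o t M′ o′ = Reach (state p M o) t (state (p + length c) M′ o′)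

  Does-++ : ∀ {p} c d {M o t M′ o′ t′ M″ o″} → Does p c M o t M′ o′ →
            Does (p + length c) d M′ o′ t′ M″ o″ → Does p (c ++ d) M o (t + t′) M″ o″
  Does-++ {p} c d r r′ rewrite length-++ c {d} | sym (+-assoc p (length c) (length d)) = Reach-trans r r′

  copyReg-does : ∀ z x t {p M o} → At p (copyReg z x t) → 0 < B → M x < B → x ≢ z →
    Does p (copyReg z x t) M o 2 (W t (W z 0 M x + W z 0 M z) (W z 0 M)) o
    × (W t (W z 0 M x + W z 0 M z) (W z 0 M) t ≡ M x)
  copyReg-does z x t {p} {M} {o} a 0<B x<B x≢z =
    straight (copyReg z x t) {M = M} tt a ,
    trans (cong (λ v → W t v (W z 0 M) t) eq) (W-same t (W z 0 M) x<B)
    where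
    eq : W z 0 M x + W z 0 M z ≡ M x
    eq = trans (cong₂ _+_ (W-other 0 M x≢z) (W-same z M 0<B)) (+-identityʳ _)

  -- The invariant rule for `loopCode`. `stable` lets the test overwrite registers from `t` on;
  -- `iterate` has to establish the next invariant in every memory that agrees with its own result
  -- outside the counter and these registers, because that is all that the tail code changes.
  module Loop (p lim i t : ℕ) (body : List Instruction) (i≢t : i ≢ t) (lim≢t : lim ≢ t)
    (at : At p (loopCode p lim i t body)) (Inv : ℕ → Memory → List Bool → Set) (N : ℕ) (N<B : N < B) (1<B : 1 < B)
    (cost : ℕ → ℕ)
    (limit : ∀ {x M o} → Inv x M o → M (reg lim) ≡ N)
    (index : ∀ {x M o} → Inv x M o → M (reg i) ≡ x)
    (stable : ∀ {x M M′ o} → Inv x M o → Frame t M M′ → Inv x M′ o)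
    (iterate : ∀ {x M o} → x < N → At (p + 2) body → Inv x M o → ∃ λ M′ → ∃ λ o′ →
               Does (p + 2) body M o (cost x) M′ o′ × M′ (reg i) ≡ x ×
               (∀ M″ → M″ (reg i) ≡ suc x → (∀ y → y ≢ reg i → (∀ j → t ≤ j → y ≢ reg j) → M″ y ≡ M′ y) → Inv (suc x) M″ o′))
    where

    tailCode : List Instruction
    tailCode = const (reg t) 1 ∷ arith add (reg i) (reg i) (reg t) ∷ const (reg t) 0 ∷ []

    end : ℕ
    end = p + (2 + (length body + 4))

    0<B : 0 < B
    0<B = ≤-trans (s≤s z≤n) 1<B

    atBody : At (p + 2) (body ++ (tailCode ++ (jumpZero (reg t) p ∷ [])))
    atBody = At-++ʳ (arith sub (reg t) (reg lim) (reg i) ∷ jumpZero (reg t) end ∷ []) _ at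

    atTail : At ((p + 2) + length body) (tailCode ++ (jumpZero (reg t) p ∷ []))
    atTail = At-++ʳ body _ atBody

    jump-zero : ∀ {q l c M o} → At q (jumpZero (reg t) l ∷ c) → M (reg t) ≡ 0 →
                step w P (state q M o) ≡ just (state l M o)
    jump-zero {q} {l} {c} {M} {o} a z with M (reg t) | fetch {c = c} {M} {o} a | z
    ... | .0 | f | refl = f

    jump-suc : ∀ {q l c M o y} → At q (jumpZero (reg t) l ∷ c) → M (reg t) ≡ suc y →
               step w P (state q M o) ≡ just (state (suc q) M o)
    jump-suc {q} {l} {c} {M} {o} a z with M (reg t) | fetch {c = c} {M} {o} a | z
    ... | .(suc _) | f | refl = f

    head-step : ∀ {x M o} → Inv x M o → let M₁ = effect (arith sub (reg t) (reg lim) (reg i)) M in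
      step w P (state p M o) ≡ just (state (suc p) M₁ o) × M₁ (reg t) ≡ N ∸ x × Inv x M₁ o
    head-step {x} {M} {o} inv =
      fetch {c = jumpZero (reg t) end ∷ _} {M} {o} at ,
      trans (cong (λ v → W (reg t) v M (reg t)) (cong₂ _∸_ (limit inv) (index inv)))
            (W-same (reg t) M (≤-<-trans (m∸n≤m N x) N<B)) ,
      stable inv (W-frame t _ M ≤-refl)

    atJump : At (suc p) (jumpZero (reg t) end ∷ (body ++ (tailCode ++ (jumpZero (reg t) p ∷ []))))
    atJump = At-tail _ at

    finish : ∀ {M o} → Inv N M o → ∃ λ M′ → Reach (state p M o) 2 (state end M′ o) × Inv N M′ o
    finish {M} {o} inv with head-step inv
    ... | s , z , inv₁ = _ , more s (more (jump-zero atJump (trans z (n∸n≡0 N))) done) , inv₁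

    once : ∀ {x M o} → x < N → Inv x M o → ∃ λ M′ → ∃ λ o′ →
           Reach (state p M o) (cost x + 6) (state p M′ o′) × Inv (suc x) M′ o′
    once {x} {M} {o} x<N inv with head-step inv
    ... | s , z , inv₁ with iterate x<N (At-++ˡ body _ atBody) inv₁
    ... | M′ , o′ , r , ix , again = _ , o′ , reach , again M₃ eqi rest
      where
      M₃ : Memory
      M₃ = effects tailCode M′
      M₁ = W (reg t) 1 M′
      M₂ = W (reg i) (M₁ (reg i) + M₁ (reg t)) M₁
      eqs : M₁ (reg i) + M₁ (reg t) ≡ suc x
      eqs = trans (cong₂ _+_ (trans (W-reg 1 M′ i≢t) ix) (W-same (reg t) M′ 1<B)) (+-comm x 1)
      eqi : M₃ (reg i) ≡ suc x
      eqi = trans (W-reg 0 M₂ i≢t) (trans (cong (λ v → W (reg i) v M₁ (reg i)) eqs) (W-same (reg i) M₁ (≤-<-trans x<N N<B)))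
      rest : ∀ y → y ≢ reg i → (∀ j → t ≤ j → y ≢ reg j) → M₃ y ≡ M′ y
      rest y y≢i y≢t = trans (W-other 0 M₂ (y≢t t ≤-refl)) (trans (W-other _ M₁ y≢i) (W-other 1 M′ (y≢t t ≤-refl)))
      back : Reach (state ((p + 2) + length body) M′ o′) 4 (state p M₃ o′)
      back = Reach-trans {c = 3} (straight tailCode tt (At-++ˡ tailCode _ atTail))
        (more {c = 0} (jump-zero (At-++ʳ tailCode _ atTail) (W-same (reg t) M₂ 0<B)) done)
      reach : Reach (state p M o) (cost x + 6) (state p M₃ o′)
      reach = subst (λ c → Reach (state p M o) c (state p M₃ o′))
        (trans (sym (+-assoc 2 (cost x) 4)) (trans (cong (_+ 4) (+-comm 2 (cost x))) (+-assoc (cost x) 2 4)))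
        -- From `x < N` the difference `N ∸ x` is a successor, so the exit test falls through.
        (more s (more (jump-suc atJump (trans z (trans (+-∸-assoc 1 x<N) refl)))
          (subst (λ q → Reach (state q (effect (arith sub (reg t) (reg lim) (reg i)) M) o) (cost x + 4) (state p M₃ o′)) (+-comm p 2) (Reach-trans r back))))

    run : ∀ x {M o} → x ≤ N → Inv 0 M o → ∃ λ M′ → ∃ λ o′ →
          Reach (state p M o) (Σ< (λ y → cost y + 6) x) (state p M′ o′) × Inv x M′ o′
    run zero    _ inv = _ , _ , done , inv
    run (suc x) x<N inv with run x (<⇒≤ x<N) inv
    ... | M′ , o′ , r , inv′ with once x<N inv′
    ... | M″ , o″ , r′ , inv″ = M″ , o″ , Reach-trans r r′ , inv″

    loop-does : ∀ {M o} → Inv 0 M o → ∃ λ M′ → ∃ λ o′ →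
      Does p (loopCode p lim i t body) M o (Σ< (λ y → cost y + 6) N + 2) M′ o′ × Inv N M′ o′
    loop-does {M} {o} inv with run N ≤-refl inv
    ... | M′ , o′ , r , inv′ with finish inv′
    ... | M″ , r′ , inv″ = M″ , o′ ,
      subst (λ l → Reach (state p M o) _ (state (p + (2 + l)) M″ o′)) (sym (length-++ body)) (Reach-trans r r′) , inv″

-- Only cells below the current length are constrained, so that clearing a list amounts to resetting
-- its length.
record Lists (σ : Store) (M : Memory) : Set where
  constructor lists
  field
    lens  : ∀ a → M (cell a 0) ≡ size# (lookup σ a)
    cells : ∀ a i → i < size# (lookup σ a) → M (cell a (suc i)) ≡ at 0 (lookup σ a) i
open Lists

record Vars (k : ℕ) {n} (δ ρ : Vec ℕ n) (M : Memory) : Set where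
  constructor vars
  field
    holds : ∀ x → lookup δ x < k × M (reg (lookup δ x)) ≡ lookup ρ x
open Vars

-- Weaker than `Frame`: a statement may change list cells as well, so only the registers below `k`
-- are promised.
Keep : ℕ → Memory → Memory → Set
Keep k M M′ = ∀ {j} → j < k → M′ (reg j) ≡ M (reg j)

Vars-keep : ∀ {k n} {δ ρ : Vec ℕ n} {M M′} → Keep k M M′ → Vars k δ ρ M → Vars k δ ρ M′
Vars-keep f (vars v) = vars (λ x → proj₁ (v x) , trans (f (proj₁ (v x))) (proj₂ (v x)))

Vars-≤ : ∀ {k l n} {δ ρ : Vec ℕ n} {M} → k ≤ l → Vars k δ ρ M → Vars l δ ρ M
Vars-≤ k≤l (vars v) = vars (λ x → <-≤-trans (proj₁ (v x)) k≤l , proj₂ (v x))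

Vars-∷ : ∀ {k j n v} {δ ρ : Vec ℕ n} {M} → j < k → M (reg j) ≡ v → Vars k δ ρ M → Vars k (j ∷ δ) (v ∷ ρ) M
Vars-∷ j<k eq (vars v) = vars (λ { zero → j<k , eq ; (suc x) → v x })

Lists-frame : ∀ {k σ M M′} → Frame k M M′ → Lists σ M → Lists σ M′
Lists-frame f (lists l c) = lists (λ a → trans (Frame-cell f a 0) (l a)) (λ a i i< → trans (Frame-cell f a (suc i)) (c a i i<))

Frame⇒Keep : ∀ {k M M′} → Frame k M M′ → Keep k M M′
Frame⇒Keep f {j} j<k = Frame-reg {j = j} f j<k

-- Correctness of the compiler.

module Correct (w : ℕ) (P : Program) (32<B : 32 < 2 ^ w) where

  open Machine w
  open Compile w P

  0<B : 0 < B
  0<B = ≤-trans (s≤s z≤n) 32<B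

  1<B : 1 < B
  1<B = ≤-trans (m≤m+n 2 31) 32<B

  small<B : ∀ {v} → v ≤ 32 → v < B
  small<B v≤ = ≤-<-trans v≤ 32<B

  cell-< : ∀ a i {L} → i < L → (2 + L) * 16 < B → cell a (suc i) < B
  cell-< a i {L} i<L h = ≤-<-trans
    (≤-trans (+-mono-≤ (<⇒≤ (slot<16 a)) (*-monoˡ-≤ 16 {suc i} {L} i<L)) (m≤n+m (16 + L * 16) 16)) h

  address-eq : ∀ a i → i * 16 + (16 + suc (toℕ a)) ≡ cell a (suc i)
  address-eq a i = trans (sym (+-assoc (i * 16) 16 (suc (toℕ a)))) (trans (+-comm (i * 16 + 16) _) (cong (suc (toℕ a) +_) (+-comm (i * 16) 16)))

  -- Induction on the cost derivation. A subexpression evaluated later uses higher registers, so its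
  -- frame property protects the results obtained before.
  evalCorrect : ∀ {n} {σ : Store} {ρ : Vec ℕ n} {e v c} → Eval σ ρ e v c → ∀ p k (δ : Vec ℕ n) {M o} →
    At p (compileE p k δ e) → Vars k δ ρ M → Lists σ M →
    ∃ λ M′ → Does p (compileE p k δ e) M o c M′ o × Frame k M M′ × M′ (reg k) ≡ v
  evalCorrect (slack d c≤c′) p k δ a vs ls with evalCorrect d p k δ a vs ls
  ... | M′ , r , f , eq = M′ , Reach-≤ r c≤c′ , f , eq
  evalCorrect (var x v<B) p k δ {M} {o} a (vars vs) ls with vs x
  ... | x<k , eq with copyReg-does (reg k) (reg (lookup δ x)) (reg k) {p} {M} {o} a 0<B (subst (_< B) (sym eq) v<B) (λ e → <-irrefl (reg-injective {lookup δ x} {k} e) x<k)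
  ... | r , eq′ = _ , r , Frame-trans {M′ = W (reg k) 0 M} (W-frame k 0 M ≤-refl) (W-frame k _ (W (reg k) 0 M) ≤-refl) , trans eq′ eq
  evalCorrect (lit v v<B) p k δ {M} a vs ls = W (reg k) v M , straight (const (reg k) v ∷ []) tt a , W-frame k v M ≤-refl , W-same (reg k) M v<B
  evalCorrect (op o {e} {f} d₁ d₂ v<B) p k δ {M} a vs ls
    with evalCorrect d₁ p k δ (At-++ˡ (compileE p k δ e) _ a) vs ls
  ... | M₁ , r₁ , f₁ , eq₁
    with evalCorrect d₂ (p + length (compileE p k δ e)) (suc k) δ (At-++ˡ (compileE _ (suc k) δ f) _ (At-++ʳ (compileE p k δ e) _ a))
           (Vars-≤ {δ = δ} (n≤1+n k) (Vars-keep {δ = δ} (Frame⇒Keep {M = M} f₁) vs)) (Lists-frame f₁ ls)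
  ... | M₂ , r₂ , f₂ , eq₂ = _ ,
    Does-++ (compileE p k δ e) _ r₁ (Does-++ (compileE (p + length (compileE p k δ e)) (suc k) δ f) _ r₂
      (straight (arith o (reg k) (reg k) (reg (suc k)) ∷ []) {M = M₂} tt (At-++ʳ (compileE _ (suc k) δ f) _ (At-++ʳ (compileE p k δ e) _ a)))) ,
    Frame-trans f₁ (Frame-trans {M′ = M₂} (Frame-≤ (n≤1+n k) f₂) (W-frame k _ M₂ ≤-refl)) ,
    trans (cong (λ v → W (reg k) v M₂ (reg k)) (cong₂ ⟦ o ⟧ (trans (Frame-reg {j = k} f₂ ≤-refl) eq₁) eq₂)) (W-same (reg k) M₂ v<B)
  evalCorrect {σ = σ} (get b {e} {i} d i<L v<B h) p k δ {M} {o} a vs ls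
    with evalCorrect d p k δ {M} {o} (At-++ˡ (compileE p k δ e) _ a) vs ls
  ... | M₁ , r₁ , f₁ , eq₁ = _ ,
    Does-++ (compileE p k δ e) _ r₁ (straight (address k b ++ (load (reg k) (reg k) ∷ [])) {M = M₁} tt (At-++ʳ (compileE p k δ e) _ a)) ,
    Frame-trans {M′ = N₄} (Frame-trans {M′ = M₁} f₁ f₄) (W-frame k (N₄ (N₄ (reg k))) N₄ ≤-refl) ,
    trans (cong (λ v → W (reg k) v N₄ (reg k)) value) (W-same (reg k) N₄ v<B)
    where
    N₁ = W (reg (suc k)) 16 M₁
    N₂ = W (reg k) (N₁ (reg k) * N₁ (reg (suc k))) N₁
    N₃ = W (reg (suc k)) (16 + suc (toℕ b)) N₂
    N₄ = W (reg k) (N₃ (reg k) + N₃ (reg (suc k))) N₃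
    k≢ : k ≢ suc k
    k≢ = <⇒≢ ≤-refl
    f₄ : Frame k M₁ N₄
    f₄ = Frame-trans {M′ = N₃} (Frame-trans {M′ = N₂} (Frame-trans {M′ = N₁} (W-frame (suc k) 16 M₁ (n≤1+n k)) (W-frame k _ N₁ ≤-refl)) (W-frame (suc k) _ N₂ (n≤1+n k))) (W-frame k _ N₃ ≤-refl)
    e₂ : N₂ (reg k) ≡ i * 16
    e₂ = trans (cong (λ v → W (reg k) v N₁ (reg k)) (cong₂ _*_ (trans (W-reg 16 M₁ k≢) eq₁) (W-same (reg (suc k)) M₁ (small<B (m≤m+n 16 16)))))
               (W-same (reg k) N₁ (≤-<-trans (*-monoˡ-≤ 16 (<⇒≤ (≤-trans i<L (m≤n+m _ 2)))) h))
    e₃ : N₃ (reg k) + N₃ (reg (suc k)) ≡ cell b (suc i)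
    e₃ = trans (cong₂ _+_ (trans (W-reg _ N₂ k≢) e₂) (W-same (reg (suc k)) N₂ (small<B (+-monoʳ-≤ 16 (<⇒≤ (slot<16 b)))))) (address-eq b i)
    value : N₄ (N₄ (reg k)) ≡ at 0 (lookup σ b) i
    value = trans (cong N₄ (trans (cong (λ v → W (reg k) v N₃ (reg k)) e₃) (W-same (reg k) N₃ (cell-< b i i<L h))))
      (trans (Frame-cell f₄ b (suc i)) (trans (Frame-cell f₁ b (suc i)) (cells ls b i i<L)))
  evalCorrect (len b v<B) p k δ {M} {o} a vs ls
    with copyReg-does (reg k) (cell b 0) (reg k) {p} {M} {o} a 0<B (subst (_< B) (sym (lens ls b)) v<B) (cell≢reg b 0 k)
  ... | r , eq′ = _ , r , Frame-trans {M′ = W (reg k) 0 M} (W-frame k 0 M ≤-refl) (W-frame k _ (W (reg k) 0 M) ≤-refl) , trans eq′ (lens ls b)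
  evalCorrect {n} {σ} {ρ} (fold {e} {f} {b} {N} {c} {c′} acc cost d₁ d₂ ds v<B) p k δ {M} {o} a vs ls
    with evalCorrect d₁ p k δ {M} {o} (At-++ˡ (compileE p k δ e) _ a) vs ls
  ... | M₁ , r₁ , f₁ , eq₁
    with evalCorrect d₂ (p + length (compileE p k δ e)) (1 + k) δ {M₁} {o} (At-++ˡ (compileE _ (1 + k) δ f) _ (At-++ʳ (compileE p k δ e) _ a))
           (Vars-≤ {δ = δ} (n≤1+n k) (Vars-keep {δ = δ} (Frame⇒Keep {M = M} f₁) vs)) (Lists-frame f₁ ls)
  ... | M₂ , r₂ , f₂ , eq₂ = _ ,
      Does-++ ce _ r₁ (Does-++ cf _ r₂ (Does-++ (const (reg (2 + k)) 0 ∷ []) (lc ++ copyReg (reg k) (reg (1 + k)) (reg k)) (straight (const (reg (2 + k)) 0 ∷ []) {M = M₂} tt (At-++ˡ (const (reg (2 + k)) 0 ∷ []) _ a₃))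
        (Does-++ lc (copyReg (reg k) (reg (1 + k)) (reg k)) (proj₁ (proj₂ looped)) (proj₁ copied)))) ,
      Frame-trans {M′ = M₄} (proj₁ inv₄) (Frame-trans {M′ = W (reg k) 0 M₄} (W-frame k 0 M₄ ≤-refl) (W-frame k _ (W (reg k) 0 M₄) ≤-refl)) ,
      trans (proj₂ copied) (proj₁ (proj₂ (proj₂ inv₄)))
    where
    ce = compileE p k δ e
    p₁ = p + length ce
    cf = compileE p₁ (1 + k) δ f
    p₂ = (p₁ + length cf) + 1
    cb = compileE (p₂ + 2) (3 + k) (2 + k ∷ 1 + k ∷ δ) b
    cc = copyReg (reg (4 + k)) (reg (3 + k)) (reg (1 + k))
    lc = loopCode p₂ k (2 + k) (3 + k) (cb ++ cc)
    a₃ = At-++ʳ cf _ (At-++ʳ ce _ a)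
    a₄ : At p₂ (lc ++ copyReg (reg k) (reg (1 + k)) (reg k))
    a₄ = At-++ʳ (const (reg (2 + k)) 0 ∷ []) _ a₃
    Inv : ℕ → Memory → List Bool → Set
    Inv x M′ o′ = Frame k M M′ × M′ (reg k) ≡ N × M′ (reg (1 + k)) ≡ acc x × M′ (reg (2 + k)) ≡ x × o′ ≡ o
    M₃ = W (reg (2 + k)) 0 M₂
    f₂₃ : Frame (2 + k) M₂ M₃
    f₂₃ = W-frame (2 + k) 0 M₂ ≤-refl
    inv₀ : Inv 0 M₃ o
    inv₀ = Frame-trans {M′ = M₁} f₁ (Frame-trans {M′ = M₂} (Frame-≤ (n≤1+n k) f₂) (Frame-≤ (m≤n+m k 2) f₂₃)) ,
      trans (Frame-reg {j = k} f₂₃ (n≤1+n _)) (trans (Frame-reg {j = k} f₂ ≤-refl) eq₁) ,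
      trans (Frame-reg {j = 1 + k} f₂₃ ≤-refl) eq₂ , W-same (reg (2 + k)) M₂ 0<B , refl
    stable : ∀ {x M M′ o} → Inv x M o → Frame (3 + k) M M′ → Inv x M′ o
    stable (f , l , s , i , q) g = Frame-trans f (Frame-≤ (m≤n+m k 3) g) , trans (Frame-reg {j = k} g (m≤n+m (suc k) 2)) l ,
      trans (Frame-reg {j = 1 + k} g (n≤1+n _)) s , trans (Frame-reg {j = 2 + k} g ≤-refl) i , q
    iterate : ∀ {x M o} → x < N → At (p₂ + 2) (cb ++ cc) → Inv x M o → ∃ λ M′ → ∃ λ o′ →
               Does (p₂ + 2) (cb ++ cc) M o (cost x + 2) M′ o′ × M′ (reg (2 + k)) ≡ x ×
               (∀ M″ → M″ (reg (2 + k)) ≡ suc x → (∀ y → y ≢ reg (2 + k) → (∀ j → 3 + k ≤ j → y ≢ reg j) → M″ y ≡ M′ y) → Inv (suc x) M″ o′)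
    iterate {x} {M′} {o′} x<N a′ (f , l , s , i , q)
      with evalCorrect (ds x x<N) (p₂ + 2) (3 + k) (2 + k ∷ 1 + k ∷ δ) {M′} {o′} (At-++ˡ cb _ a′)
        (Vars-∷ {j = 2 + k} {δ = 1 + k ∷ δ} ≤-refl i (Vars-∷ {j = 1 + k} {δ = δ} (n≤1+n _) s
          (Vars-≤ {δ = δ} (m≤n+m k 3) (Vars-keep {δ = δ} (Frame⇒Keep {M = M} f) vs)))) (Lists-frame f ls)
    ... | M₅ , r₅ , f₅ , eq₅
      with copyReg-does (reg (4 + k)) (reg (3 + k)) (reg (1 + k)) {p₂ + 2 + length cb} {M₅} {o′} (At-++ʳ cb _ a′) 0<B
             (subst (_< B) (sym eq₅) (Eval-< (ds x x<N))) (<⇒≢ ≤-refl ∘ reg-injective {3 + k} {4 + k})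
    ... | r₆ , eq₆ = M₇ , o′ , Does-++ cb _ r₅ r₆ ,
        trans (W-reg {2 + k} {1 + k} _ M₆ (>⇒≢ ≤-refl)) (trans (W-reg {2 + k} {4 + k} 0 M₅ (<⇒≢ (n≤1+n _))) (trans (Frame-reg {j = 2 + k} f₅ ≤-refl) i)) ,
        λ M″ ix rest → again M″ ix rest
      where
      M₆ = W (reg (4 + k)) 0 M₅
      M₇ = W (reg (1 + k)) (M₆ (reg (3 + k)) + M₆ (reg (4 + k))) M₆
      again : ∀ M″ → M″ (reg (2 + k)) ≡ suc x → (∀ y → y ≢ reg (2 + k) → (∀ j → 3 + k ≤ j → y ≢ reg j) → M″ y ≡ M₇ y) → Inv (suc x) M″ o′
      again M″ ix rest =
        (λ y h → trans (rest y (h (2 + k) (m≤n+m k 2)) (λ j 3+k≤j → h j (≤-trans (m≤n+m k 3) 3+k≤j)))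
          (trans (W-other _ M₆ (h (1 + k) (n≤1+n k))) (trans (W-other 0 M₅ (h (4 + k) (m≤n+m k 4)))
            (trans (f₅ y (λ j 3+k≤j → h j (≤-trans (m≤n+m k 3) 3+k≤j))) (f y h))))) ,
        trans (keep k (n≤1+n _)) (trans (W-reg {k} {1 + k} _ M₆ (<⇒≢ ≤-refl)) (trans (W-reg {k} {4 + k} 0 M₅ (<⇒≢ (m≤n+m (suc k) 3)))
          (trans (Frame-reg {j = k} f₅ (m≤n+m (suc k) 2)) l))) ,
        trans (keep (1 + k) ≤-refl) (trans eq₆ eq₅) , ix , q
        where
        keep : ∀ j → j < 2 + k → M″ (reg j) ≡ M₇ (reg j)
        keep j j< = rest (reg j) (<⇒≢ j< ∘ reg-injective {j} {2 + k}) (λ i 3+k≤i → <⇒≢ (<-trans j< 3+k≤i) ∘ reg-injective {j} {i})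
    open Loop p₂ k (2 + k) (3 + k) (cb ++ cc) (<⇒≢ ≤-refl) (<⇒≢ (m≤n+m (suc k) 2)) (At-++ˡ lc _ a₄) Inv N (Eval-< d₁) 1<B
      (λ i → cost i + 2) (λ i → proj₁ (proj₂ i)) (λ i → proj₁ (proj₂ (proj₂ (proj₂ i)))) stable iterate using (loop-does)
    looped : ∃ λ M′ → Does p₂ lc M₃ o (Σ< (λ i → (cost i + 2) + 6) N + 2) M′ o × Inv N M′ o
    looped = conclude (loop-does inv₀)
      where
      conclude : (∃ λ M′ → ∃ λ o′ → Does p₂ lc M₃ o (Σ< (λ i → (cost i + 2) + 6) N + 2) M′ o′ × Inv N M′ o′) →
        ∃ λ M′ → Does p₂ lc M₃ o (Σ< (λ i → (cost i + 2) + 6) N + 2) M′ o × Inv N M′ o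
      conclude (M′ , _ , r , f , l , s , i , refl) = M′ , r , f , l , s , i , refl
    M₄ = proj₁ looped
    inv₄ = proj₂ (proj₂ looped)
    copied = copyReg-does (reg k) (reg (1 + k)) (reg k) {p₂ + length lc} {M₄} {o} (At-++ʳ lc _ a₄) 0<B
      (subst (_< B) (sym (proj₁ (proj₂ (proj₂ inv₄)))) v<B) (>⇒≢ ≤-refl ∘ reg-injective {1 + k} {k})

  Lists-write : ∀ {σ a M M′ v} → Lists σ M →
    (∀ b i → b ≢ a → M′ (cell b i) ≡ M (cell b i)) →
    M′ (cell a 0) ≡ suc (size# (lookup σ a)) → M′ (cell a (suc (size# (lookup σ a)))) ≡ v →
    (∀ i → i < size# (lookup σ a) → M′ (cell a (suc i)) ≡ M (cell a (suc i))) →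
    Lists (σ [ a ]≔ (lookup σ a ▹ v)) M′
  Lists-write {σ} {a} {M} {M′} {v} (lists l c) other len′ last init = lists lens′ cells′
    where
    lens′ : ∀ b → M′ (cell b 0) ≡ size# (lookup (σ [ a ]≔ (lookup σ a ▹ v)) b)
    lens′ b with b Fin.≟ a
    ... | yes refl = trans len′ (cong size# (sym (lookup∘update b σ _)))
    ... | no b≢a = trans (other b 0 b≢a) (trans (l b) (cong size# (sym (lookup∘update′ b≢a σ _))))
    cells′ : ∀ b i → i < size# (lookup (σ [ a ]≔ (lookup σ a ▹ v)) b) → M′ (cell b (suc i)) ≡ at 0 (lookup (σ [ a ]≔ (lookup σ a ▹ v)) b) i
    cells′ b i i< with b Fin.≟ a
    ... | no b≢a rewrite lookup∘update′ b≢a σ (lookup σ a ▹ v) = trans (other b (suc i) b≢a) (c b i i<)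
    ... | yes refl rewrite lookup∘update b σ (lookup σ b ▹ v) with m≤n⇒m<n∨m≡n (≤-pred i<)
    ...   | Data.Sum.inj₁ i<L = trans (init i i<L) (trans (c b i i<L) (sym (at-init 0 (lookup σ b) v i<L)))
    ...   | Data.Sum.inj₂ refl = trans last (sym (at-last 0 (lookup σ b) v))

  Lists-clear : ∀ {σ a M M′} → Lists σ M → (∀ b i → b ≢ a → M′ (cell b i) ≡ M (cell b i)) →
    M′ (cell a 0) ≡ 0 → Lists (σ [ a ]≔ ε) M′
  Lists-clear {σ} {a} {M} {M′} (lists l c) other len′ = lists lens′ cells′
    where
    lens′ : ∀ b → M′ (cell b 0) ≡ size# (lookup (σ [ a ]≔ ε) b)
    lens′ b with b Fin.≟ a
    ... | yes refl = trans len′ (cong size# (sym (lookup∘update b σ _)))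
    ... | no b≢a = trans (other b 0 b≢a) (trans (l b) (cong size# (sym (lookup∘update′ b≢a σ _))))
    cells′ : ∀ b i → i < size# (lookup (σ [ a ]≔ ε) b) → M′ (cell b (suc i)) ≡ at 0 (lookup (σ [ a ]≔ ε) b) i
    cells′ b i i< with b Fin.≟ a
    ... | no b≢a rewrite lookup∘update′ b≢a σ ε = trans (other b (suc i) b≢a) (c b i i<)
    ... | yes refl rewrite lookup∘update b σ ε with i<
    ...   | ()

  execCorrect : ∀ {n} {ρ : Vec ℕ n} {s σ ω σ′ ω′ c} → Exec ρ s σ ω σ′ ω′ c → ∀ p k (δ : Vec ℕ n) {M} →
    At p (compileS p k δ s) → Vars k δ ρ M → Lists σ M →
    ∃ λ M′ → Does p (compileS p k δ s) M (toList# ω) c M′ (toList# ω′) × Keep k M M′ × Lists σ′ M′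
  execCorrect (slack d c≤c′) p k δ a vs ls with execCorrect d p k δ a vs ls
  ... | M′ , r , f , ls′ = M′ , Reach-≤ r c≤c′ , f , ls′
  execCorrect (push b {σ} {ω} {e} {v} d h) p k δ {M} a vs ls
    with evalCorrect d p k δ {M} {toList# ω} (At-++ˡ (compileE p k δ e) _ a) vs ls
  ... | M₁ , r₁ , f₁ , eq₁ = M₇ ,
    Does-++ (compileE p k δ e) _ r₁ (straight _ {M = M₁} tt (At-++ʳ (compileE p k δ e) _ a)) ,
    (λ {j} j<k → trans (keep j j<k) (Frame-reg {j = j} f₁ j<k)) ,
    Lists-write {σ} {b} {M₁} {M₇} (Lists-frame f₁ ls) others len₇ last₇ init₇
    where
    L = size# (lookup σ b)
    M₂ = W (reg (2 + k)) 16 M₁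
    M₃ = W (reg (1 + k)) (M₂ (cell b 0) * M₂ (reg (2 + k))) M₂
    M₄ = W (reg (2 + k)) (16 + suc (toℕ b)) M₃
    M₅ = W (reg (1 + k)) (M₄ (reg (1 + k)) + M₄ (reg (2 + k))) M₄
    M₆ = W (M₅ (reg (1 + k))) (M₅ (reg k)) M₅
    M₆′ = W (reg (2 + k)) 1 M₆
    M₇ = W (cell b 0) (M₆′ (cell b 0) + M₆′ (reg (2 + k))) M₆′
    1≢2 : 1 + k ≢ 2 + k
    1≢2 = <⇒≢ ≤-refl
    L16< : suc L * 16 < B
    L16< = ≤-<-trans (*-monoˡ-≤ 16 (n≤1+n (suc L))) h
    f₅ : Frame (1 + k) M₁ M₅
    f₅ = Frame-trans {M′ = M₄} (Frame-trans {M′ = M₃} (Frame-trans {M′ = M₂} (W-frame (2 + k) 16 M₁ (n≤1+n _)) (W-frame (1 + k) _ M₂ ≤-refl)) (W-frame (2 + k) _ M₃ (n≤1+n _))) (W-frame (1 + k) _ M₄ ≤-refl)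
    e₃ : M₃ (reg (1 + k)) ≡ L * 16
    e₃ = trans (cong (λ v → W (reg (1 + k)) v M₂ (reg (1 + k)))
           (cong₂ _*_ (trans (W-cell b 0 (2 + k) 16 M₁) (trans (Frame-cell f₁ b 0) (lens ls b))) (W-same (reg (2 + k)) M₁ (small<B (m≤m+n 16 16)))))
         (W-same (reg (1 + k)) M₂ (≤-<-trans (*-monoˡ-≤ 16 (m≤n+m L 2)) h))
    e₄ : M₄ (reg (1 + k)) + M₄ (reg (2 + k)) ≡ cell b (suc L)
    e₄ = trans (cong₂ _+_ (trans (W-reg _ M₃ 1≢2) e₃) (W-same (reg (2 + k)) M₃ (small<B (+-monoʳ-≤ 16 (<⇒≤ (slot<16 b)))))) (address-eq b L)
    e₅ : M₅ (reg (1 + k)) ≡ cell b (suc L)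
    e₅ = trans (cong (λ v → W (reg (1 + k)) v M₄ (reg (1 + k))) e₄) (W-same (reg (1 + k)) M₄ (≤-<-trans (+-monoˡ-≤ (16 + L * 16) (<⇒≤ (slot<16 b))) h))
    e₆ : ∀ y → M₆ y ≡ W (cell b (suc L)) v M₅ y
    e₆ y = cong₂ (λ x z → W x z M₅ y) e₅ (trans (Frame-reg {j = k} f₅ ≤-refl) eq₁)
    untouched : ∀ y → y ≢ cell b 0 → y ≢ cell b (suc L) → y ≢ reg (2 + k) → M₇ y ≡ M₅ y
    untouched y n₀ n₁ n₂ = trans (W-other _ M₆′ n₀) (trans (W-other 1 M₆ n₂) (trans (e₆ y) (W-other v M₅ n₁)))
    cellEq : ∀ c i → cell c i ≢ cell b 0 → cell c i ≢ cell b (suc L) → M₇ (cell c i) ≡ M₁ (cell c i)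
    cellEq c i n₀ n₁ = trans (untouched (cell c i) n₀ n₁ (cell≢reg c i (2 + k))) (Frame-cell f₅ c i)
    keep : ∀ j → j < k → M₇ (reg j) ≡ M₁ (reg j)
    keep j j<k = trans (untouched (reg j) (λ e → cell≢reg b 0 j (sym e)) (λ e → cell≢reg b (suc L) j (sym e))
                  (<⇒≢ (≤-trans j<k (m≤n+m k 2)) ∘ reg-injective {j} {2 + k})) (Frame-reg {j = j} f₅ (≤-trans j<k (n≤1+n k)))
    others : ∀ c i → c ≢ b → M₇ (cell c i) ≡ M₁ (cell c i)
    others c i c≢b = cellEq c i (c≢b ∘ cell-injectiveˡ {c} {b} {i} {0}) (c≢b ∘ cell-injectiveˡ {c} {b} {i} {suc L})
    len₇ : M₇ (cell b 0) ≡ suc L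
    len₇ = trans (cong (λ v → W (cell b 0) v M₆′ (cell b 0)) (trans (cong₂ _+_
        (trans (W-cell b 0 (2 + k) 1 M₆) (trans (e₆ (cell b 0)) (trans (W-other v M₅ (λ e → case cell-injectiveʳ {b} {0} {suc L} e of λ ()))
          (trans (Frame-cell f₅ b 0) (trans (Frame-cell f₁ b 0) (lens ls b)))))) (W-same (reg (2 + k)) M₆ 1<B)) (+-comm L 1)))
      (W-same (cell b 0) M₆′ (≤-<-trans (m≤m*n (suc L) 16) L16<))
    last₇ : M₇ (cell b (suc L)) ≡ v
    last₇ = trans (W-other _ M₆′ (λ e → case cell-injectiveʳ {b} {suc L} {0} e of λ ()))
      (trans (W-cell b (suc L) (2 + k) 1 M₆) (trans (e₆ (cell b (suc L))) (W-same (cell b (suc L)) M₅ (Eval-< d))))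
    init₇ : ∀ i → i < L → M₇ (cell b (suc i)) ≡ M₁ (cell b (suc i))
    init₇ i i<L = cellEq b (suc i) (λ e → case cell-injectiveʳ {b} {suc i} {0} e of λ ())
      (λ e → <-irrefl (suc-injective (cell-injectiveʳ {b} {suc i} {suc L} e)) i<L)
  execCorrect (clear b {σ} {ω}) p k δ {M} a vs ls = W (cell b 0) 0 M , straight (const (cell b 0) 0 ∷ []) {M = M} tt a ,
    (λ {j} j<k → W-other 0 M (λ e → cell≢reg b 0 j (sym e))) ,
    Lists-clear {σ} {b} {M} ls (λ c i c≢b → W-other 0 M (c≢b ∘ cell-injectiveˡ {c} {b} {i} {0})) (W-same (cell b 0) M 0<B)
  execCorrect {σ = σ} (out {ω = ω} {e} {v} d) p k δ {M} a vs ls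
    with evalCorrect d p k δ {M} {toList# ω} (At-++ˡ (compileE p k δ e) _ a) vs ls
  ... | M₁ , r₁ , f₁ , eq₁ = M₁ ,
    Does-++ (compileE p k δ e) (emit (reg k) ∷ []) r₁ (more
      (trans (fetch {c = []} (At-++ʳ (compileE p k δ e) (emit (reg k) ∷ []) a))
             (cong just (cong₂ (λ q b → state q M₁ (toList# ω ∷ʳ b)) (+-comm 1 _) (cong isNonZero eq₁)))) done) ,
    Frame⇒Keep f₁ , Lists-frame f₁ ls
  execCorrect (_⨾_ {s} {t} d₁ d₂) p k δ {M} a vs ls
    with execCorrect d₁ p k δ {M} (At-++ˡ (compileS p k δ s) _ a) vs ls
  ... | M₁ , r₁ , f₁ , ls₁
    with execCorrect d₂ (p + length (compileS p k δ s)) k δ {M₁} (At-++ʳ (compileS p k δ s) _ a) (Vars-keep {M = M} f₁ vs) ls₁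
  ... | M₂ , r₂ , f₂ , ls₂ = M₂ , Does-++ (compileS p k δ s) _ r₁ r₂ , (λ j<k → trans (f₂ j<k) (f₁ j<k)) , ls₂
  execCorrect (bind {e} {s} {ω = ω} d₁ d₂) p k δ {M} a vs ls
    with evalCorrect d₁ p k δ {M} {toList# ω} (At-++ˡ (compileE p k δ e) _ a) vs ls
  ... | M₁ , r₁ , f₁ , eq₁
    with execCorrect d₂ (p + length (compileE p k δ e)) (1 + k) (k ∷ δ) {M₁} (At-++ʳ (compileE p k δ e) _ a)
           (Vars-∷ ≤-refl eq₁ (Vars-≤ (n≤1+n k) (Vars-keep {M = M} (Frame⇒Keep {M = M} f₁) vs))) (Lists-frame f₁ ls)
  ... | M₂ , r₂ , f₂ , ls₂ = M₂ , Does-++ (compileE p k δ e) _ r₁ r₂ ,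
    (λ {j} j<k → trans (f₂ (≤-trans j<k (n≤1+n k))) (Frame-reg {j = j} f₁ j<k)) , ls₂
  execCorrect {n} {ρ} (loop {e} {s} {N} {c} τ ω cost d ds) p k δ {M} a vs ls
    with evalCorrect d p k δ {M} {toList# (ω 0)} (At-++ˡ (compileE p k δ e) _ a) vs ls
  ... | M₁ , r₁ , f₁ , eq₁ = proj₁ looped ,
      Does-++ ce _ r₁ (Does-++ (const (reg (1 + k)) 0 ∷ []) lc (straight (const (reg (1 + k)) 0 ∷ []) {M = M₁} tt (At-++ˡ (const (reg (1 + k)) 0 ∷ []) lc a₂))
        (proj₁ (proj₂ looped))) ,
      proj₁ (proj₂ (proj₂ looped)) , proj₁ (proj₂ (proj₂ (proj₂ looped)))
    where
    ce = compileE p k δ e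
    p₁ = (p + length ce) + 1
    cs = compileS (p₁ + 2) (2 + k) (1 + k ∷ δ) s
    lc = loopCode p₁ k (1 + k) (2 + k) cs
    a₂ = At-++ʳ ce _ a
    a₃ : At p₁ lc
    a₃ = At-++ʳ (const (reg (1 + k)) 0 ∷ []) lc a₂
    Inv : ℕ → Memory → List Bool → Set
    Inv x M′ o′ = Keep k M M′ × Lists (τ x) M′ × M′ (reg k) ≡ N × M′ (reg (1 + k)) ≡ x × o′ ≡ toList# (ω x)
    M₂ = W (reg (1 + k)) 0 M₁
    f₁₂ : Frame (1 + k) M₁ M₂
    f₁₂ = W-frame (1 + k) 0 M₁ ≤-refl
    inv₀ : Inv 0 M₂ (toList# (ω 0))
    inv₀ = (λ {j} j<k → trans (Frame-reg {j = j} f₁₂ (≤-trans j<k (n≤1+n k))) (Frame-reg {j = j} f₁ j<k)) ,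
      Lists-frame f₁₂ (Lists-frame f₁ ls) , trans (Frame-reg {j = k} f₁₂ ≤-refl) eq₁ , W-same (reg (1 + k)) M₁ 0<B , refl
    stable : ∀ {x M M′ o} → Inv x M o → Frame (2 + k) M M′ → Inv x M′ o
    stable (f , l , s , i , q) g = (λ {j} j<k → trans (Frame-reg {j = j} g (≤-trans j<k (m≤n+m k 2))) (f j<k)) , Lists-frame g l ,
      trans (Frame-reg {j = k} g (n≤1+n _)) s , trans (Frame-reg {j = 1 + k} g ≤-refl) i , q
    iterate : ∀ {x M o} → x < N → At (p₁ + 2) cs → Inv x M o → ∃ λ M′ → ∃ λ o′ →
               Does (p₁ + 2) cs M o (cost x) M′ o′ × M′ (reg (1 + k)) ≡ x ×
               (∀ M″ → M″ (reg (1 + k)) ≡ suc x → (∀ y → y ≢ reg (1 + k) → (∀ j → 2 + k ≤ j → y ≢ reg j) → M″ y ≡ M′ y) → Inv (suc x) M″ o′)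
    iterate {x} {M′} x<N a′ (f , l , s , i , refl)
      with execCorrect (ds x x<N) (p₁ + 2) (2 + k) (1 + k ∷ δ) {M′} a′
        (Vars-∷ {j = 1 + k} ≤-refl i (Vars-≤ (m≤n+m k 2) (Vars-keep {M = M} f vs))) l
    ... | M₅ , r₅ , f₅ , l₅ = M₅ , toList# (ω (suc x)) , r₅ , trans (f₅ {1 + k} ≤-refl) i , again
      where
      again : ∀ M″ → M″ (reg (1 + k)) ≡ suc x → (∀ y → y ≢ reg (1 + k) → (∀ j → 2 + k ≤ j → y ≢ reg j) → M″ y ≡ M₅ y) → Inv (suc x) M″ (toList# (ω (suc x)))
      again M″ ix rest =
        (λ {j} j<k → trans (low j (≤-trans j<k (n≤1+n k)) (<⇒≢ (≤-trans j<k (n≤1+n k)))) (trans (f₅ (≤-trans j<k (m≤n+m k 2))) (f j<k))) ,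
        lists (λ c → trans (cellEq c 0) (lens l₅ c)) (λ c y y< → trans (cellEq c (suc y)) (cells l₅ c y y<)) ,
        trans (low k ≤-refl (<⇒≢ ≤-refl)) (trans (f₅ {k} (n≤1+n _)) s) , ix , refl
        where
        low : ∀ j → j < 1 + k → j ≢ 1 + k → M″ (reg j) ≡ M₅ (reg j)
        low j j< j≢ = rest (reg j) (j≢ ∘ reg-injective {j} {1 + k}) (λ y 2+k≤y → <⇒≢ (<-trans j< 2+k≤y) ∘ reg-injective {j} {y})
        cellEq : ∀ c y → M″ (cell c y) ≡ M₅ (cell c y)
        cellEq c y = rest (cell c y) (cell≢reg c y (1 + k)) (λ j _ → cell≢reg c y j)
    open Loop p₁ k (1 + k) (2 + k) cs (<⇒≢ ≤-refl) (<⇒≢ (n≤1+n _)) a₃ Inv N (Eval-< d) 1<B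
      cost (λ i → proj₁ (proj₂ (proj₂ i))) (λ i → proj₁ (proj₂ (proj₂ (proj₂ i)))) stable iterate using (loop-does)
    looped : ∃ λ M′ → Does p₁ lc M₂ (toList# (ω 0)) (Σ< (λ i → cost i + 6) N + 2) M′ (toList# (ω N)) × Inv N M′ (toList# (ω N))
    looped = conclude (loop-does inv₀)
      where
      conclude : (∃ λ M′ → ∃ λ o′ → Does p₁ lc M₂ (toList# (ω 0)) (Σ< (λ i → cost i + 6) N + 2) M′ o′ × Inv N M′ o′) →
        ∃ λ M′ → Does p₁ lc M₂ (toList# (ω 0)) (Σ< (λ i → cost i + 6) N + 2) M′ (toList# (ω N)) × Inv N M′ (toList# (ω N))
      conclude (M′ , _ , r , f , l , s , i , refl) = M′ , r , f , l , s , i , refl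

-- From a statement to a whole program.

prologue : List Instruction
-- The inputs r and s arrive at addresses 1 and 2, which are the length cells of the lists 0 and 1.
-- They move to the registers 1 and 2 at addresses 16 and 32, with the help of register 3 at address
-- 48, still zero; then the two length cells are cleared. The input n already lies in register 0.
prologue = arith add 16 1 48 ∷ arith add 32 2 48 ∷ const 1 0 ∷ const 2 0 ∷ []

compile : Stmt 3 → Program
compile s = prologue ++ compileS 4 3 (0 ∷ 1 ∷ 2 ∷ []) s

none : Store
none = Vec.replicate 6 ε

lookup-none : ∀ a → lookup none a ≡ ε
lookup-none a = Data.Vec.Properties.lookup-replicate a ε

run-compile : ∀ w {s n r q σ ω c} → 32 < 2 ^ w → n < 2 ^ w → r < 2 ^ w → q < 2 ^ w →
  Machine.Exec w (n ∷ r ∷ q ∷ []) s none ε σ ω c →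
  ∃ λ t → t ≤ 4 + c × Run w (compile s) (initial w n r q) t (toList# ω)
run-compile w {s} {n} {r} {q} {ω = ω} {c} 32<B n<B r<B q<B d =
  finish (Reach-trans (straight prologue {0} {M₀} {[]} tt (At-++ˡ prologue code whole)) (proj₁ (proj₂ executed)))
  where
  open Machine w
  open Compile w (compile s)
  open Correct w (compile s) 32<B
  code = compileS 4 3 (0 ∷ 1 ∷ 2 ∷ []) s
  whole : At 0 (prologue ++ code)
  whole = located [] (sym (Data.List.Properties.++-identityʳ (compile s)))
  M₀ : Memory
  M₀ = memory (initial w n r q)
  M₁ : Memory
  M₁ = effects prologue M₀
  zero₀ : ∀ x → x ≢ 0 → x ≢ 1 → x ≢ 2 → M₀ x ≡ 0
  zero₀ x h₀ h₁ h₂ = trans (W-other n _ h₀) (trans (W-other r _ h₁) (W-other q _ h₂))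
  mod : ∀ {v} → v < B → _%_ v (2 ^ w) ⦃ m^n≢0 2 w ⦄ ≡ v
  mod = m<n⇒m%n≡m ⦃ m^n≢0 2 w ⦄
  mod+0 : ∀ {v u z} → u ≡ v → z ≡ 0 → v < B → _%_ (u + z) (2 ^ w) ⦃ m^n≢0 2 w ⦄ ≡ v
  mod+0 {v} refl refl v<B = trans (cong (λ x → _%_ x (2 ^ w) ⦃ m^n≢0 2 w ⦄) (+-identityʳ v)) (mod v<B)
  vars₁ : Vars 3 (0 ∷ 1 ∷ 2 ∷ []) (n ∷ r ∷ q ∷ []) M₁
  vars₁ = vars λ { zero → s≤s z≤n , mod n<B
                 ; (suc zero) → s≤s (s≤s z≤n) , mod+0 (mod r<B) refl r<B
                 ; (suc (suc zero)) → ≤-refl , mod+0 (mod q<B) refl q<B }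
  cell₁ : ∀ a i → M₁ (cell a i) ≡ 0
  cell₁ a i with cell a i ≟ 1 | cell a i ≟ 2
  ... | yes e | _ = trans (cong M₁ e) (mod 0<B)
  ... | no _ | yes e = trans (cong M₁ e) (mod 0<B)
  ... | no h₁ | no h₂ = trans (W-other 0 _ h₂) (trans (W-other 0 _ h₁) (trans (W-other _ _ (cell≢reg a i 2)) (trans (W-other _ M₀ (cell≢reg a i 1))
      (zero₀ (cell a i) (cell≢reg a i 0) h₁ h₂))))
  executed = execCorrect d 4 3 (0 ∷ 1 ∷ 2 ∷ []) {M₁} (At-++ʳ prologue code whole) vars₁
    (lists (λ a → trans (cell₁ a 0) (cong size# (sym (lookup-none a)))) (λ a i i< → ⊥-elim (case subst (i <_) (cong size# (lookup-none a)) i< of λ ())))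
  halts : ∀ {M o} → step w (compile s) (state (4 + length code) M o) ≡ nothing
  halts rewrite Data.List.Properties.drop-all (length code) code ≤-refl = refl
  finish : ∀ {σ c M o} → Reach σ c (state (4 + length code) M o) → ∃ λ t → t ≤ c × Run w (compile s) σ t o
  finish done = 0 , z≤n , halt halts
  finish (more e rest) with finish rest
  ... | t , t≤ , run = suc t , s≤s t≤ , next e run

-- Tabulated lists and the operations of the machine.

tab : ∀ {A : Set} → (ℕ → A) → ℕ → Seq A
tab f zero    = ε
tab f (suc n) = tab f n ▹ f n

size-tab : ∀ {A : Set} (f : ℕ → A) n → size# (tab f n) ≡ n
size-tab f zero    = refl
size-tab f (suc n) = cong suc (size-tab f n)

at-tab : ∀ {A : Set} (z : A) f n {i} → i < n → at z (tab f n) i ≡ f i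
at-tab z f (suc n) {i} i<1+n with m≤n⇒m<n∨m≡n (≤-pred i<1+n)
... | Data.Sum.inj₁ i<n = trans (at-init z (tab f n) (f n) (subst (i <_) (sym (size-tab f n)) i<n)) (at-tab z f n i<n)
... | Data.Sum.inj₂ refl = subst (λ k → at z (tab f n ▹ f n) k ≡ f n) (size-tab f n) (at-last z (tab f n) (f n))

infixl 7 _÷_ _mod_

-- Built from machine operations alone, so that each is literally the value of the expression of the
-- same shape below; `eqN` and `ltN` take the values 0 and 1.
_÷_ _mod_ eqN ltN maxN : ℕ → ℕ → ℕ
x ÷ y = ⟦ quo ⟧ x y
x mod y = x ∸ (x ÷ y) * y
eqN x y = (1 ∸ (x ∸ y)) * (1 ∸ (y ∸ x))
ltN x y = 1 ∸ (1 ∸ (y ∸ x))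
maxN x y = x + (y ∸ x)

÷-≤ : ∀ x y → x ÷ y ≤ x
÷-≤ x zero    = z≤n
÷-≤ x (suc y) = m/n≤m x (suc y)

÷*-≤ : ∀ x y → (x ÷ y) * y ≤ x
÷*-≤ x zero    = z≤n
÷*-≤ x (suc y) = m/n*n≤m x (suc y)

eqE ltE modE maxE : ∀ {n} → Exp n → Exp n → Exp n
eqE e f = op mul (op sub (lit 1) (op sub e f)) (op sub (lit 1) (op sub f e))
ltE e f = op sub (lit 1) (op sub (lit 1) (op sub f e))
modE e f = op sub e (op mul (op quo e f) f)
maxE e f = op add e (op sub f e)

pow2E : ∀ {n} → Exp n → Exp n
pow2E e = fold e (lit 1) (op add (var (suc zero)) (var (suc zero)))

-- Cost factors; positivity absorbs additive constants, as in `a ≤ a * val M`.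
record Pos : Set where
  constructor _⁺_
  field
    val : ℕ
    pos : 1 ≤ val
open Pos public

one : Pos
one = 1 ⁺ ≤-refl

infixl 7 _⊗_
_⊗_ : Pos → Pos → Pos
(m ⁺ 1≤m) ⊗ (n ⁺ 1≤n) = (m * n) ⁺ *-mono-≤ 1≤m 1≤n

two^ : ℕ → Pos
two^ i = (2 ^ i) ⁺ m^n>0 2 i

succ : ℕ → Pos
succ n = suc n ⁺ s≤s z≤n

Σ-const : ∀ f a n → (∀ i → i < n → f i ≤ a) → Σ< f n ≤ n * a
Σ-const f a zero    h = z≤n
Σ-const f a (suc n) h = ≤-trans (+-mono-≤ (Σ-const f a n (λ i i< → h i (m≤n⇒m≤1+n i<))) (h n ≤-refl)) (≤-reflexive (+-comm (n * a) a))

-- All values are bounded by powers Ω ^ p with p ≤ 9, and all costs are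
-- recorded in the form A * val M with a numeral A.

÷-/ : ∀ x y .{{_ : NonZero y}} → x ÷ y ≡ x / y
÷-/ x (suc y) = refl

mod-% : ∀ x y .{{_ : NonZero y}} → x mod y ≡ x % y
mod-% x (suc y) = sym (m%n≡m∸m/n*n x (suc y))

eqN-refl : ∀ x → eqN x x ≡ 1
eqN-refl x rewrite n∸n≡0 x = refl

eqN-≢ : ∀ {x y} → x ≢ y → eqN x y ≡ 0
eqN-≢ {x} {y} x≢y with <-cmp x y
... | tri< x<y _ _ rewrite m≤n⇒m∸n≡0 (<⇒≤ x<y) = trans (+-identityʳ _) (m≤n⇒m∸n≡0 (m<n⇒0<n∸m x<y))
... | tri≈ _ x≡y _ = ⊥-elim (x≢y x≡y)
... | tri> _ _ y<x rewrite m≤n⇒m∸n≡0 (m<n⇒0<n∸m y<x) = refl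

eqN-≤1 : ∀ x y → eqN x y ≤ 1
eqN-≤1 x y with x ≟ y
... | yes refl = ≤-reflexive (eqN-refl x)
... | no x≢y = ≤-trans (≤-reflexive (eqN-≢ x≢y)) z≤n

eqN-0⇒≢ : ∀ {x y} → eqN x y ≡ 0 → x ≢ y
eqN-0⇒≢ {x} e refl with trans (sym (eqN-refl x)) e
... | ()

ltN-< : ∀ {x y} → x < y → ltN x y ≡ 1
ltN-< x<y rewrite m≤n⇒m∸n≡0 (m<n⇒0<n∸m x<y) = refl

ltN-≥ : ∀ {x y} → y ≤ x → ltN x y ≡ 0
ltN-≥ y≤x rewrite m≤n⇒m∸n≡0 y≤x = refl

maxN-≥ˡ : ∀ x y → x ≤ maxN x y
maxN-≥ˡ x y = m≤m+n x (y ∸ x)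

maxN-≥ʳ : ∀ x y → y ≤ maxN x y
maxN-≥ʳ x y = m≤n+m∸n y x

maxN-sel : ∀ x y → maxN x y ≡ x ⊎ maxN x y ≡ y
maxN-sel x y with ≤-total x y
... | inj₁ x≤y = inj₂ (m+[n∸m]≡n x≤y)
... | inj₂ y≤x = inj₁ (trans (cong (x +_) (m≤n⇒m∸n≡0 y≤x)) (+-identityʳ x))

Σ-cong : ∀ {f g} n → (∀ i → i < n → f i ≡ g i) → Σ< f n ≡ Σ< g n
Σ-cong zero    h = refl
Σ-cong (suc n) h = cong₂ _+_ (Σ-cong n (λ i i< → h i (m≤n⇒m≤1+n i<))) (h n ≤-refl)

Σ-mono : ∀ {f g} n → (∀ i → i < n → f i ≤ g i) → Σ< f n ≤ Σ< g n
Σ-mono zero    h = z≤n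
Σ-mono (suc n) h = +-mono-≤ (Σ-mono n (λ i i< → h i (m≤n⇒m≤1+n i<))) (h n ≤-refl)

Σ-+ : ∀ f g n → Σ< (λ i → f i + g i) n ≡ Σ< f n + Σ< g n
Σ-+ f g zero    = refl
Σ-+ f g (suc n) rewrite Σ-+ f g n =
  solve 4 (λ a b c d → (a :+ b) :+ (c :+ d) := (a :+ c) :+ (b :+ d)) refl (Σ< f n) (Σ< g n) (f n) (g n)
  where open +-*-Solver

Σ-*ˡ : ∀ a f n → Σ< (λ i → a * f i) n ≡ a * Σ< f n
Σ-*ˡ a f zero    = sym (*-zeroʳ a)
Σ-*ˡ a f (suc n) rewrite Σ-*ˡ a f n = sym (*-distribˡ-+ a (Σ< f n) (f n))

Σ-0 : ∀ n → Σ< (λ _ → 0) n ≡ 0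
Σ-0 zero    = refl
Σ-0 (suc n) = trans (+-identityʳ _) (Σ-0 n)

Σ-swap : ∀ (f : ℕ → ℕ → ℕ) m n → Σ< (λ i → Σ< (f i) n) m ≡ Σ< (λ j → Σ< (λ i → f i j) m) n
Σ-swap f m zero    = Σ-0 m
Σ-swap f m (suc n) = trans (Σ-+ (λ i → Σ< (f i) n) (λ i → f i n) m) (cong (_+ Σ< (λ i → f i n) m) (Σ-swap f m n))

Σ-split : ∀ f m n → Σ< f (m + n) ≡ Σ< f m + Σ< (λ i → f (m + i)) n
Σ-split f m zero    = trans (cong (Σ< f) (+-identityʳ m)) (sym (+-identityʳ _))
Σ-split f m (suc n) = trans (cong (Σ< f) (+-suc m n)) (trans (cong (_+ f (m + n)) (Σ-split f m n)) (+-assoc (Σ< f m) _ _))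

Σ-term : ∀ f {n i} → i < n → f i ≤ Σ< f n
Σ-term f {suc n} {i} i<1+n with m≤n⇒m<n∨m≡n (≤-pred i<1+n)
... | inj₁ i<n = ≤-trans (Σ-term f i<n) (m≤m+n _ _)
... | inj₂ refl = m≤n+m _ _

Σ-≤ˡ : ∀ f {m n} → m ≤ n → Σ< f m ≤ Σ< f n
Σ-≤ˡ f {m} {n} m≤n = ≤-trans (m≤m+n _ _) (≤-reflexive (trans (sym (Σ-split f m (n ∸ m))) (cong (Σ< f) (m+[n∸m]≡n m≤n))))

Σ-eqN : ∀ x n → Σ< (λ v → eqN x v) n ≤ 1
Σ-eqN x zero    = z≤n
Σ-eqN x (suc n) with x ≟ n
... | no x≢n rewrite eqN-≢ x≢n | +-identityʳ (Σ< (λ v → eqN x v) n) = Σ-eqN x n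
... | yes refl = ≤-reflexive (cong₂ _+_ (trans (Σ-cong x (λ i i< → eqN-≢ (>⇒≢ i<))) (Σ-0 x)) (eqN-refl x))

-- The pigeonhole principle as needed for hashing: fewer collisions than columns leave a column
-- without any.
zero-term : ∀ f m → Σ< f m < m → ∃ λ c → c < m × f c ≡ 0
zero-term f (suc m) lt with f m in eq
... | zero = m , ≤-refl , eq
... | suc y with zero-term f m (≤-trans (s≤s (m≤m+n (Σ< f m) y)) (≤-trans (≤-reflexive (sym (+-suc (Σ< f m) y))) (≤-pred lt)))
...   | c , c<m , z = c , m≤n⇒m≤1+n c<m , z

-- Maximisation with a single accumulator.

-- Best v < N in the form g v * N + v, which a single accumulator can hold.
best : (ℕ → ℕ) → ℕ → ℕ → ℕ
best g N zero    = 0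
best g N (suc i) = maxN (best g N i) (g i * N + i)

argmax : (ℕ → ℕ) → ℕ → ℕ
argmax g N = best g N N mod N

best-≥ : ∀ g N i {v} → v < i → g v * N + v ≤ best g N i
best-≥ g N (suc i) {v} v<1+i with m≤n⇒m<n∨m≡n (≤-pred v<1+i)
... | inj₁ v<i = ≤-trans (best-≥ g N i v<i) (maxN-≥ˡ _ _)
... | inj₂ refl = maxN-≥ʳ (best g N i) _

best-attained : ∀ g N i → 0 < i → ∃ λ v → v < i × best g N i ≡ g v * N + v
best-attained g N (suc zero) _ = 0 , s≤s z≤n , refl
best-attained g N (suc (suc i)) _ with best-attained g N (suc i) (s≤s z≤n) | maxN-sel (best g N (suc i)) (g (suc i) * N + suc i)
... | v , v< , eq | inj₁ e = v , m≤n⇒m≤1+n v< , trans e eq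
... | _           | inj₂ e = suc i , ≤-refl , e

best-≤ : ∀ g N i b → i ≤ N → (∀ v → v < i → g v ≤ b) → best g N i ≤ b * N + N
best-≤ g N zero b _ h = z≤n
best-≤ g N (suc i) b i<N h with maxN-sel (best g N i) (g i * N + i)
... | inj₁ e = ≤-trans (≤-reflexive e) (best-≤ g N i b (<⇒≤ i<N) (λ v v< → h v (m≤n⇒m≤1+n v<)))
... | inj₂ e = ≤-trans (≤-reflexive e) (+-mono-≤ (*-monoˡ-≤ N (h i ≤-refl)) (<⇒≤ i<N))

-- Comparison of `g v * N + v` with `v < N` is lexicographic: a larger gain outweighs every index,
-- and the remainder modulo `N` recovers the index.
argmax-spec : ∀ g N → 0 < N → argmax g N < N × (∀ v → v < N → g v ≤ g (argmax g N))
argmax-spec g N 0<N with best-attained g N N 0<N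
... | a , a<N , eq = subst (_< N) (sym arg) a<N , λ v v<N → subst (λ x → g v ≤ g x) (sym arg) (le v v<N)
  where
  instance _ = >-nonZero 0<N
  arg : argmax g N ≡ a
  arg = trans (mod-% (best g N N) N) (trans (cong (_% N) (trans eq (+-comm (g a * N) a))) (trans ([m+kn]%n≡m%n a (g a) N) (m<n⇒m%n≡m a<N)))
  le : ∀ v → v < N → g v ≤ g a
  le v v<N = ≮⇒≥ λ lt → <-irrefl refl (begin-strict
    g v * N + v ≤⟨ best-≥ g N N v<N ⟩
    best g N N  ≡⟨ eq ⟩
    g a * N + a <⟨ +-monoʳ-< (g a * N) a<N ⟩
    g a * N + N ≡⟨ +-comm (g a * N) N ⟩
    suc (g a) * N ≤⟨ *-monoˡ-≤ N lt ⟩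
    g v * N     ≤⟨ m≤m+n (g v * N) v ⟩
    g v * N + v ∎)
    where open ≤-Reasoning

-- Bitwise exclusive or of numbers.

xorN : ℕ → ℕ → ℕ → ℕ
xorN u v zero    = 0
xorN u v (suc j) = xorN u v j + 2 ^ j * ((u ÷ 2 ^ j + v ÷ 2 ^ j) mod 2)

-- The definition peels off the highest of the `j` bits, as the program does; induction over the
-- operands has to strip the lowest one. This converts one recursion into the other.
xorN-low : ∀ u v j → xorN u v (suc j) ≡ (u + v) % 2 + xorN (u / 2) (v / 2) j * 2
xorN-low u v zero = cong (_+ 0) (trans (mod-% (u ÷ 1 + v ÷ 1) 2) (cong (_% 2) (cong₂ _+_ (n/1≡n u) (n/1≡n v))))
xorN-low u v (suc j) = begin
  xorN u v (suc j) + 2 ^ suc j * ((u ÷ 2 ^ suc j + v ÷ 2 ^ suc j) mod 2)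
    ≡⟨ cong₂ (λ a b → a + 2 ^ suc j * (b mod 2)) (xorN-low u v j) (cong₂ _+_ (shift u) (shift v)) ⟩
  ((u + v) % 2 + x * 2) + (2 * 2 ^ j) * y
    ≡⟨ solve 4 (λ a x p y → (a :+ x :* con 2) :+ (con 2 :* p) :* y := a :+ (x :+ p :* y) :* con 2) refl ((u + v) % 2) x (2 ^ j) y ⟩
  (u + v) % 2 + (x + 2 ^ j * y) * 2 ∎
  where
  open ≡-Reasoning
  open +-*-Solver
  x = xorN (u / 2) (v / 2) j
  y = (u / 2 ÷ 2 ^ j + v / 2 ÷ 2 ^ j) mod 2
  shift : ∀ u → u ÷ 2 ^ suc j ≡ u / 2 ÷ 2 ^ j
  shift u = trans (÷-/ u (2 ^ suc j) ⦃ m^n≢0 2 (suc j) ⦄) (trans (sym (m/n/o≡m/[n*o] u 2 (2 ^ j) ⦃ _ ⦄ ⦃ m^n≢0 2 j ⦄ ⦃ m^n≢0 2 (suc j) ⦄)) (sym (÷-/ (u / 2) (2 ^ j) ⦃ m^n≢0 2 j ⦄)))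

xorN-< : ∀ u v j → xorN u v j < 2 ^ j
xorN-< u v zero = ≤-refl
xorN-< u v (suc j) = begin-strict
  xorN u v (suc j)                     ≡⟨ xorN-low u v j ⟩
  (u + v) % 2 + xorN (u / 2) (v / 2) j * 2 <⟨ +-monoˡ-< _ (m%n<n (u + v) 2) ⟩
  suc (xorN (u / 2) (v / 2) j) * 2     ≤⟨ *-monoˡ-≤ 2 (xorN-< (u / 2) (v / 2) j) ⟩
  2 ^ j * 2                            ≡⟨ *-comm (2 ^ j) 2 ⟩
  2 ^ suc j                            ∎
  where open ≤-Reasoning

bit+2x%2 : ∀ a x → (a % 2 + x * 2) % 2 ≡ a % 2
bit+2x%2 a x = trans ([m+kn]%n≡m%n (a % 2) x 2) (m%n%n≡m%n a 2)

bit+2x/2 : ∀ a x → (a % 2 + x * 2) / 2 ≡ x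
bit+2x/2 a x = trans (+-distrib-/-∣ʳ (a % 2) (Data.Nat.Divisibility.divides x refl))
  (cong₂ _+_ (m<n⇒m/n≡0 (m%n<n a 2)) (m*n/n≡m x 2))

xorN-comm : ∀ u v j → xorN u v j ≡ xorN v u j
xorN-comm u v zero    = refl
xorN-comm u v (suc j) = cong₂ (λ a b → a + 2 ^ j * (b mod 2)) (xorN-comm u v j) (+-comm (u ÷ 2 ^ j) (v ÷ 2 ^ j))

xorN-assoc : ∀ u v x j → xorN (xorN u v j) x j ≡ xorN u (xorN v x j) j
xorN-assoc u v x zero = refl
xorN-assoc u v x (suc j) = begin
  xorN (xorN u v (suc j)) x (suc j) ≡⟨ cong (λ y → xorN y x (suc j)) (xorN-low u v j) ⟩
  xorN a x (suc j) ≡⟨ xorN-low a x j ⟩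
  (a + x) % 2 + xorN (a / 2) (x / 2) j * 2 ≡⟨ cong₂ (λ y z → y + z * 2) par
     (trans (cong (λ y → xorN y (x / 2) j) (bit+2x/2 (u + v) _)) (trans (xorN-assoc (u / 2) (v / 2) (x / 2) j) (cong (λ y → xorN (u / 2) y j) (sym (bit+2x/2 (v + x) _))))) ⟩
  (u + b) % 2 + xorN (u / 2) (b / 2) j * 2 ≡⟨ xorN-low u b j ⟨
  xorN u b (suc j) ≡⟨ cong (λ y → xorN u y (suc j)) (xorN-low v x j) ⟨
  xorN u (xorN v x (suc j)) (suc j) ∎
  where
  open ≡-Reasoning
  a = (u + v) % 2 + xorN (u / 2) (v / 2) j * 2
  b = (v + x) % 2 + xorN (v / 2) (x / 2) j * 2
  par : (a + x) % 2 ≡ (u + b) % 2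
  par = begin
    (a + x) % 2               ≡⟨ %-distribˡ-+ a x 2 ⟩
    (a % 2 + x % 2) % 2       ≡⟨ cong (λ y → (y + x % 2) % 2) (bit+2x%2 (u + v) (xorN (u / 2) (v / 2) j)) ⟩
    ((u + v) % 2 + x % 2) % 2 ≡⟨ %-distribˡ-+ (u + v) x 2 ⟨
    (u + v + x) % 2           ≡⟨ cong (_% 2) (+-assoc u v x) ⟩
    (u + (v + x)) % 2         ≡⟨ %-distribˡ-+ u (v + x) 2 ⟩
    (u % 2 + (v + x) % 2) % 2 ≡⟨ cong (λ y → (u % 2 + y) % 2) (bit+2x%2 (v + x) (xorN (v / 2) (x / 2) j)) ⟨
    (u % 2 + b % 2) % 2       ≡⟨ %-distribˡ-+ u b 2 ⟨
    (u + b) % 2               ∎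

xorN-self : ∀ u j → xorN u u j ≡ 0
xorN-self u zero = refl
xorN-self u (suc j) = trans (xorN-low u u j) (cong₂ (λ a b → a + b * 2)
  (trans (cong (_% 2) (trans (cong (u +_) (sym (+-identityʳ u))) (*-comm 2 u))) (m*n%n≡0 u 2)) (xorN-self (u / 2) j))

xorN-0 : ∀ u j → u < 2 ^ j → xorN u 0 j ≡ u
xorN-0 zero zero _ = refl
xorN-0 (suc u) zero (s≤s ())
xorN-0 u (suc j) u< = trans (xorN-low u 0 j) (trans (cong₂ (λ a b → a % 2 + b * 2) (+-identityʳ u)
  (xorN-0 (u / 2) j (m<n*o⇒m/o<n (≤-trans u< (≤-reflexive (*-comm 2 (2 ^ j))))))) (sym (m≡m%n+[m/n]*n u 2)))

xorN-cancel : ∀ a b g j → xorN (xorN a g j) (xorN b g j) j ≡ xorN a b j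
xorN-cancel a b g j = begin
  xorN (xorN a g j) (xorN b g j) j ≡⟨ cong (λ y → xorN (xorN a g j) y j) (xorN-comm b g j) ⟩
  xorN (xorN a g j) (xorN g b j) j ≡⟨ xorN-assoc a g (xorN g b j) j ⟩
  xorN a (xorN g (xorN g b j) j) j ≡⟨ cong (λ y → xorN a y j) (xorN-assoc g g b j) ⟨
  xorN a (xorN (xorN g g j) b j) j ≡⟨ cong (λ y → xorN a (xorN y b j) j) (xorN-self g j) ⟩
  xorN a (xorN 0 b j) j            ≡⟨ xorN-assoc a 0 b j ⟨
  xorN (xorN a 0 j) b j            ≡⟨ xorN-comm (xorN a 0 j) b j ⟩
  xorN b (xorN a 0 j) j            ≡⟨ xorN-assoc b a 0 j ⟨
  xorN (xorN b a j) 0 j            ≡⟨ xorN-0 (xorN b a j) j (xorN-< b a j) ⟩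
  xorN b a j                       ≡⟨ xorN-comm b a j ⟩
  xorN a b j ∎
  where open ≡-Reasoning

-- Greedy F₂-linear hash maps.

-- The columns of the hash family: h w k is an F₂-linear map from k bits to j
-- bits (on numbers), whose value on the i-th basis vector is chosen greedily
-- with respect to the weights w.
module Hash (j : ℕ) where

  q : ℕ
  q = 2 ^ j

  mutual
    h : (ℕ → ℕ) → ℕ → ℕ → ℕ
    h w zero    z = 0
    h w (suc i) z = if z <ᵇ 2 ^ i then h w i z else xorN (h w i (z ∸ 2 ^ i)) (image w i) j

    -- If basis vector `i` goes to `v`, then `2 ^ i + z` goes to zero exactly when `h w i z` is `v`.
    -- The gain is the weight kept away from zero, so its maximiser minimises the weight sent to
    -- zero.
    gain : (ℕ → ℕ) → ℕ → ℕ → ℕ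
    gain w i v = Σ< (λ z → w (2 ^ i + z) * (1 ∸ eqN (h w i z) v)) (2 ^ i)

    image : (ℕ → ℕ) → ℕ → ℕ
    image w i = argmax (gain w i) q

  <ᵇ-true : ∀ {m n} → m < n → (m <ᵇ n) ≡ true
  <ᵇ-true {m} {n} m<n with m <ᵇ n | <⇒<ᵇ m<n
  ... | true | _ = refl

  <ᵇ-false : ∀ {m n} → n ≤ m → (m <ᵇ n) ≡ false
  <ᵇ-false {m} {n} n≤m with m <ᵇ n in eq
  ... | false = refl
  ... | true = ⊥-elim (<⇒≱ (<ᵇ⇒< m n (subst T (sym eq) tt)) n≤m)

  h-low : ∀ w i {z} → z < 2 ^ i → h w (suc i) z ≡ h w i z
  h-low w i z< rewrite <ᵇ-true z< = refl

  h-high : ∀ w i z → h w (suc i) (2 ^ i + z) ≡ xorN (h w i z) (image w i) j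
  h-high w i z rewrite <ᵇ-false (m≤m+n (2 ^ i) z) | m+n∸m≡n (2 ^ i) z = refl

  image-< : ∀ w i → image w i < q
  image-< w i = proj₁ (argmax-spec (gain w i) q (m^n>0 2 j))

  h-< : ∀ w i z → h w i z < q
  h-< w zero z = m^n>0 2 j
  h-< w (suc i) z with z <ᵇ 2 ^ i
  ... | true  = h-< w i z
  ... | false = xorN-< _ _ j

  h-stable : ∀ w {i k z} → i ≤′ k → z < 2 ^ i → h w k z ≡ h w i z
  h-stable w ≤′-refl z< = refl
  h-stable w {i} (≤′-step {k} i≤k) z< = trans (h-low w k (<-≤-trans z< (^-monoʳ-≤ 2 (≤′⇒≤ i≤k)))) (h-stable w i≤k z<)

  double : ∀ i → 2 ^ i + 2 ^ i ≡ 2 ^ suc i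
  double i = cong (2 ^ i +_) (sym (+-identityʳ (2 ^ i)))

  -- Linearity reduces collisions of pairs to zeros: z is x xor y.
  difference : ∀ k x y → x < 2 ^ k → y < 2 ^ k → ∃ λ z → z < 2 ^ k × (x ≢ y → z ≢ 0) ×
               (∀ w → h w k z ≡ xorN (h w k x) (h w k y) j)
  difference zero zero zero _ _ = 0 , ≤-refl , (λ n → ⊥-elim (n refl)) , λ w → sym (xorN-self 0 j)
  difference zero (suc x) y (s≤s ()) _
  difference zero zero (suc y) _ (s≤s ())
  difference (suc k) x y x< y< = split (high x x<) (high y y<)
    where
    high : ∀ x → x < 2 ^ suc k → x < 2 ^ k ⊎ ∃ λ x′ → x′ < 2 ^ k × x ≡ 2 ^ k + x′
    high x x< with x <? 2 ^ k
    ... | yes l = inj₁ l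
    ... | no ¬l = inj₂ (x ∸ 2 ^ k , +-cancelˡ-< (2 ^ k) _ _ (subst₂ _<_ (sym eq) (sym (double k)) x<) , sym eq)
      where eq = m+[n∸m]≡n (≮⇒≥ ¬l)
    hi< : ∀ {z} → z < 2 ^ k → 2 ^ k + z < 2 ^ suc k
    hi< {z} z< = subst (2 ^ k + z <_) (double k) (+-monoʳ-< (2 ^ k) z<)
    lo< : ∀ {z} → z < 2 ^ k → z < 2 ^ suc k
    lo< z< = ≤-trans z< (≤-trans (m≤m+n _ _) (≤-reflexive (double k)))
    nz : ∀ z → 2 ^ k + z ≢ 0
    nz z e = <⇒≢ (m^n>0 2 k) (sym (m+n≡0⇒m≡0 (2 ^ k) e))
    split : _ → _ → ∃ λ z → z < 2 ^ suc k × (x ≢ y → z ≢ 0) × (∀ w → h w (suc k) z ≡ xorN (h w (suc k) x) (h w (suc k) y) j)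
    split (inj₁ xl) (inj₁ yl) with difference k x y xl yl
    ... | z , z< , ne , lin = z , lo< z< , ne , λ w → trans (h-low w k z<)
          (trans (lin w) (sym (cong₂ (λ a b → xorN a b j) (h-low w k xl) (h-low w k yl))))
    split (inj₂ (x′ , xl , refl)) (inj₂ (y′ , yl , refl)) with difference k x′ y′ xl yl
    ... | z , z< , ne , lin = z , lo< z< , (λ n → ne (n ∘ cong (2 ^ k +_))) , λ w → trans (h-low w k z<)
          (trans (lin w) (trans (sym (xorN-cancel _ _ (image w k) j)) (sym (cong₂ (λ a b → xorN a b j) (h-high w k x′) (h-high w k y′)))))
    split (inj₁ xl) (inj₂ (y′ , yl , refl)) with difference k x y′ xl yl
    ... | z , z< , ne , lin = 2 ^ k + z , hi< z< , (λ _ → nz z) , λ w → trans (h-high w k z)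
          (trans (cong (λ a → xorN a (image w k) j) (lin w)) (trans (xorN-assoc _ _ (image w k) j)
            (sym (cong₂ (λ a b → xorN a b j) (h-low w k xl) (h-high w k y′)))))
    split (inj₂ (x′ , xl , refl)) (inj₁ yl) with difference k x′ y xl yl
    ... | z , z< , ne , lin = 2 ^ k + z , hi< z< , (λ _ → nz z) , λ w → trans (h-high w k z)
          (trans (cong (λ a → xorN a (image w k) j) (trans (lin w) (xorN-comm _ _ j))) (trans (xorN-assoc _ _ (image w k) j)
            (trans (xorN-comm _ _ j) (sym (cong₂ (λ a b → xorN a b j) (h-high w k x′) (h-low w k yl))))))

  -- Averaging over the `q` candidate images: each `z` is killed by at most one of them, and the
  -- chosen image does no worse than the average.
  zeros-≤ : ∀ w i → q * Σ< (λ z → w (2 ^ i + z) * eqN (h w i z) (image w i)) (2 ^ i) ≤ Σ< (λ z → w (2 ^ i + z)) (2 ^ i)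
  zeros-≤ w i = begin
    q * cost (image w i)       ≡⟨ sum-const q ⟨
    Σ< (λ _ → cost (image w i)) q ≤⟨ Σ-mono q (λ v v< → cost-≤ v v<) ⟩
    Σ< cost q                  ≡⟨ Σ-swap (λ v z → W z * eqN (h w i z) v) q (2 ^ i) ⟩
    Σ< (λ z → Σ< (λ v → W z * eqN (h w i z) v) q) (2 ^ i) ≤⟨ Σ-mono (2 ^ i) (λ z _ → ≤-trans (≤-reflexive (Σ-*ˡ (W z) (eqN (h w i z)) q))
        (≤-trans (*-monoʳ-≤ (W z) (Σ-eqN (h w i z) q)) (≤-reflexive (*-identityʳ (W z))))) ⟩
    Σ< W (2 ^ i) ∎
    where
    open ≤-Reasoning
    W : ℕ → ℕ
    W z = w (2 ^ i + z)
    cost : ℕ → ℕ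
    cost v = Σ< (λ z → W z * eqN (h w i z) v) (2 ^ i)
    sum-const : ∀ n → Σ< (λ _ → cost (image w i)) n ≡ n * cost (image w i)
    sum-const zero    = refl
    sum-const (suc n) = trans (cong (_+ cost (image w i)) (sum-const n)) (+-comm (n * cost (image w i)) _)
    total : ∀ v → cost v + gain w i v ≡ Σ< W (2 ^ i)
    total v = trans (sym (Σ-+ _ _ (2 ^ i))) (Σ-cong (2 ^ i) λ z _ →
      trans (sym (*-distribˡ-+ (W z) (eqN (h w i z) v) _)) (trans (cong (W z *_) (m+[n∸m]≡n (eqN-≤1 (h w i z) v))) (*-identityʳ (W z))))
    cost-≤ : ∀ v → v < q → cost (image w i) ≤ cost v
    cost-≤ v v< = +-cancelʳ-≤ (gain w i v) _ _ (≤-trans (+-monoʳ-≤ (cost (image w i)) (proj₂ (argmax-spec (gain w i) q (m^n>0 2 j)) v v<))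
      (≤-reflexive (trans (total (image w i)) (sym (total v)))))

  collision : ∀ {x y} w k z → h w k z ≡ xorN x y j → eqN x y ≤ eqN (h w k z) 0
  collision {x} {y} w k z lin with x ≟ y
  ... | yes refl = ≤-reflexive (trans (eqN-refl x) (sym (trans (cong (λ a → eqN a 0) (trans lin (xorN-self x j))) (eqN-refl 0))))
  ... | no x≢y = ≤-trans (≤-reflexive (eqN-≢ x≢y)) z≤n

  xor-0⇒≡ : ∀ x g → x < q → xorN x g j ≡ 0 → g < q → x ≡ g
  xor-0⇒≡ x g x< e g< = begin
    x                            ≡⟨ xorN-0 x j x< ⟨
    xorN x 0 j                   ≡⟨ cong (λ a → xorN x a j) (xorN-self g j) ⟨
    xorN x (xorN g g j) j        ≡⟨ xorN-assoc x g g j ⟨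
    xorN (xorN x g j) g j        ≡⟨ cong (λ a → xorN a g j) e ⟩
    xorN 0 g j                   ≡⟨ xorN-comm 0 g j ⟩
    xorN g 0 j                   ≡⟨ xorN-0 g j g< ⟩
    g                            ∎
    where open ≡-Reasoning

  -- Summing `zeros-≤` over the position of the leading bit: at most a `1 / q` fraction of the
  -- weight goes to zero, as for a random linear map. Zero itself always goes to zero, hence the
  -- condition `w 0 ≡ 0`.
  column-≤ : ∀ w k → w 0 ≡ 0 → ∀ {i} → i ≤ k → q * Σ< (λ z → w z * eqN (h w k z) 0) (2 ^ i) ≤ Σ< w (2 ^ i)
  column-≤ w k w0 {zero} _ rewrite w0 | *-zeroʳ q = z≤n
  column-≤ w k w0 {suc i} i<k = begin
    q * Σ< f (2 ^ suc i)                        ≡⟨ cong (λ n → q * Σ< f n) (double i) ⟨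
    q * Σ< f (2 ^ i + 2 ^ i)                    ≡⟨ cong (q *_) (Σ-split f (2 ^ i) (2 ^ i)) ⟩
    q * (Σ< f (2 ^ i) + Σ< (λ z → f (2 ^ i + z)) (2 ^ i)) ≡⟨ *-distribˡ-+ q _ _ ⟩
    q * Σ< f (2 ^ i) + q * Σ< (λ z → f (2 ^ i + z)) (2 ^ i)
      ≤⟨ +-mono-≤ (column-≤ w k w0 (<⇒≤ i<k)) (≤-trans (*-monoʳ-≤ q (Σ-mono (2 ^ i) top)) (zeros-≤ w i)) ⟩
    Σ< w (2 ^ i) + Σ< (λ z → w (2 ^ i + z)) (2 ^ i) ≡⟨ Σ-split w (2 ^ i) (2 ^ i) ⟨
    Σ< w (2 ^ i + 2 ^ i)                        ≡⟨ cong (Σ< w) (double i) ⟩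
    Σ< w (2 ^ suc i)                            ∎
    where
    open ≤-Reasoning
    f : ℕ → ℕ
    f z = w z * eqN (h w k z) 0
    top : ∀ z → z < 2 ^ i → f (2 ^ i + z) ≤ w (2 ^ i + z) * eqN (h w i z) (image w i)
    top z z< = *-monoʳ-≤ (w (2 ^ i + z)) (≤-trans (≤-reflexive (cong (λ a → eqN a 0)
        (trans (h-stable w (≤⇒≤′ i<k) (subst (2 ^ i + z <_) (double i) (+-monoʳ-< (2 ^ i) z<))) (h-high w i z)))) flip)
      where
      flip : eqN (xorN (h w i z) (image w i) j) 0 ≤ eqN (h w i z) (image w i)
      flip with xorN (h w i z) (image w i) j ≟ 0
      ... | no n = ≤-trans (≤-reflexive (eqN-≢ n)) z≤n
      ... | yes e = ≤-trans (eqN-≤1 (xorN (h w i z) (image w i) j) 0) (≤-reflexive (sym (trans (cong (eqN (h w i z)) (sym (xor-0⇒≡ _ _ (h-< w i z) e (image-< w i)))) (eqN-refl (h w i z)))))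

  module Columns (k : ℕ) where

    -- A conditional-expectation potential: the weight of `z` doubles with every column that sends
    -- `z` to zero, so a bound on the total `Φ` bounds the number of such columns by its logarithm.
    weight : ℕ → ℕ → ℕ
    weight zero    z = 1 ∸ eqN z 0
    weight (suc c) z = weight c z * (1 + eqN (h (weight c) k z) 0)

    col : ℕ → ℕ → ℕ
    col c = h (weight c) k

    Φ : ℕ → ℕ
    Φ c = Σ< (weight c) (2 ^ k)

    weight-0 : ∀ c → weight c 0 ≡ 0
    weight-0 zero    = refl
    weight-0 (suc c) rewrite weight-0 c = refl

    Φ-step : ∀ c → q * Φ (suc c) ≤ q * Φ c + Φ c
    Φ-step c = begin
      q * Φ (suc c) ≡⟨ cong (q *_) (trans (Σ-cong (2 ^ k) (λ z _ → trans (*-distribˡ-+ (weight c z) 1 _) (cong (_+ weight c z * eqN (col c z) 0) (*-identityʳ (weight c z))))) (Σ-+ _ _ (2 ^ k))) ⟩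
      q * (Φ c + Σ< (λ z → weight c z * eqN (col c z) 0) (2 ^ k)) ≡⟨ *-distribˡ-+ q (Φ c) _ ⟩
      q * Φ c + q * Σ< (λ z → weight c z * eqN (col c z) 0) (2 ^ k) ≤⟨ +-monoʳ-≤ (q * Φ c) (column-≤ (weight c) k (weight-0 c) ≤-refl) ⟩
      q * Φ c + Φ c ∎
      where open ≤-Reasoning

    Φ-mono : ∀ c → Φ c ≤ Φ (suc c)
    Φ-mono c = Σ-mono (2 ^ k) (λ z _ → m≤m*n (weight c z) (suc (eqN (col c z) 0)))

    Φ-mono-≤ : ∀ {a b} → a ≤′ b → Φ a ≤ Φ b
    Φ-mono-≤ ≤′-refl = ≤-refl
    Φ-mono-≤ (≤′-step {b} a≤b) = ≤-trans (Φ-mono-≤ a≤b) (Φ-mono b)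

    -- A linear substitute for growth by the factor `1 + 1 / q` per column, which avoids powers of
    -- fractions; `t = q / 2` turns it into a doubling.
    Φ-run : ∀ c t → q * Φ (t + c) ≤ q * Φ c + t * Φ (t + c)
    Φ-run c zero    = m≤m+n _ _
    Φ-run c (suc t) = begin
      q * Φ (suc t + c)                       ≤⟨ Φ-step (t + c) ⟩
      q * Φ (t + c) + Φ (t + c)               ≤⟨ +-monoˡ-≤ _ (Φ-run c t) ⟩
      (q * Φ c + t * Φ (t + c)) + Φ (t + c)   ≡⟨ trans (+-assoc (q * Φ c) _ _) (cong (q * Φ c +_) (+-comm (t * Φ (t + c)) _)) ⟩
      q * Φ c + suc t * Φ (t + c)             ≤⟨ +-monoʳ-≤ (q * Φ c) (*-monoʳ-≤ (suc t) (Φ-mono (t + c))) ⟩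
      q * Φ c + suc t * Φ (suc t + c)         ∎
      where open ≤-Reasoning

    module Separation (e : ℕ) (0<e : 0 < e) (q≡2e : q ≡ 2 * e) where

      private instance
        e≢0 : NonZero e
        e≢0 = >-nonZero 0<e

      m : ℕ
      m = e * k

      Φ-double : ∀ c → Φ (e + c) ≤ 2 * Φ c
      Φ-double c = *-cancelˡ-≤ e (+-cancelʳ-≤ (e * Φ (e + c)) _ _ (begin
        e * Φ (e + c) + e * Φ (e + c) ≡⟨ solve 2 (λ e x → e :* x :+ e :* x := con 2 :* e :* x) refl e (Φ (e + c)) ⟩
        2 * e * Φ (e + c)             ≡⟨ cong (_* Φ (e + c)) q≡2e ⟨
        q * Φ (e + c)                 ≤⟨ Φ-run c e ⟩
        q * Φ c + e * Φ (e + c)       ≡⟨ cong (λ y → y * Φ c + e * Φ (e + c)) q≡2e ⟩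
        2 * e * Φ c + e * Φ (e + c)   ≡⟨ cong (_+ e * Φ (e + c)) (solve 2 (λ e x → con 2 :* e :* x := e :* (con 2 :* x)) refl e (Φ c)) ⟩
        e * (2 * Φ c) + e * Φ (e + c) ∎))
        where
        open ≤-Reasoning
        open +-*-Solver

      -- The initial total is at most `2 ^ k`, and every round of `e = q / 2` columns at most
      -- doubles it.
      Φ-rounds : ∀ t → Φ (t * e) ≤ 2 ^ (t + k)
      Φ-rounds zero = ≤-trans (Σ-const (weight 0) 1 (2 ^ k) (λ z _ → m∸n≤m 1 (eqN z 0))) (≤-reflexive (*-identityʳ (2 ^ k)))
      Φ-rounds (suc t) = ≤-trans (Φ-double (t * e)) (*-monoʳ-≤ 2 (Φ-rounds t))

      Φ-≤ : ∀ {c} → c ≤ m → Φ c ≤ 2 ^ (k + k)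
      Φ-≤ c≤m = ≤-trans (Φ-mono-≤ (≤⇒≤′ (≤-trans c≤m (≤-reflexive (*-comm e k))))) (Φ-rounds k)

      zeros : ℕ → ℕ → ℕ
      zeros z = Σ< (λ c → eqN (col c z) 0)

      weight-zeros : ∀ {z} → z ≢ 0 → ∀ c → weight c z ≡ 2 ^ zeros z c
      weight-zeros z≢0 zero = cong (1 ∸_) (eqN-≢ z≢0)
      weight-zeros {z} z≢0 (suc c) = trans (cong₂ _*_ (weight-zeros z≢0 c) (bit (eqN (col c z) 0) (eqN-≤1 (col c z) 0)))
        (sym (^-distribˡ-+-* 2 (zeros z c) _))
        where
        bit : ∀ b → b ≤ 1 → 1 + b ≡ 2 ^ b
        bit zero _ = refl
        bit (suc zero) _ = refl
        bit (suc (suc b)) (s≤s ())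

      zeros-≤2k : ∀ {z} → z < 2 ^ k → z ≢ 0 → zeros z m ≤ k + k
      zeros-≤2k {z} z< z≢0 = ≮⇒≥ λ lt → <-irrefl refl (<-≤-trans (^-monoʳ-< 2 (s≤s (s≤s z≤n)) lt)
        (≤-trans (≤-reflexive (sym (weight-zeros z≢0 m))) (≤-trans (Σ-term (weight m) z<) (Φ-≤ ≤-refl))))

      Apart : ℕ × ℕ → Set
      Apart (x , y) = x < 2 ^ k × y < 2 ^ k × x ≢ y

      collisions : List (ℕ × ℕ) → ℕ → ℕ
      collisions []             c = 0
      collisions ((x , y) ∷ ps) c = eqN (col c x) (col c y) + collisions ps c

      collisions-≤ : ∀ {ps} → LAll Apart ps → Σ< (collisions ps) m ≤ length ps * (k + k)
      collisions-≤ []ᵃ = ≤-reflexive (Σ-0 m)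
      collisions-≤ {(x , y) ∷ ps} ((x< , y< , x≢y) ∷ᵃ as) with difference k x y x< y<
      ... | z , z< , z≢0 , lin = ≤-trans (≤-reflexive (Σ-+ _ (collisions ps) m))
        (+-mono-≤ (≤-trans (Σ-mono m (λ c _ → collision (weight c) k z (lin (weight c)))) (zeros-≤2k z< (z≢0 x≢y))) (collisions-≤ as))

      collisions-0 : ∀ ps {c} → collisions ps c ≡ 0 → LAll (λ p → col c (proj₁ p) ≢ col c (proj₂ p)) ps
      collisions-0 [] _ = []ᵃ
      collisions-0 ((x , y) ∷ ps) e = eqN-0⇒≢ (m+n≡0⇒m≡0 _ e) ∷ᵃ collisions-0 ps (m+n≡0⇒n≡0 _ e)

      -- Each pair collides in at most `k + k` of the `e * k` columns, by linearity and `zeros-≤2k`;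
      -- with `4 * length ps < q = 2 * e` there are fewer collisions than columns.
      separating : 0 < k → ∀ {ps} → LAll Apart ps → 4 * length ps < q →
                   ∃ λ c → c < m × LAll (λ p → col c (proj₁ p) ≢ col c (proj₂ p)) ps
      separating 0<k {ps} as 4P<q with zero-term (collisions ps) m (≤-<-trans (collisions-≤ as) few)
        where
        few : length ps * (k + k) < m
        few = begin-strict
          length ps * (k + k) ≡⟨ solve 2 (λ p k → p :* (k :+ k) := con 2 :* p :* k) refl (length ps) k ⟩
          2 * length ps * k   <⟨ *-monoˡ-< k ⦃ >-nonZero 0<k ⦄ {2 * length ps} {e} (*-cancelˡ-< 2 (2 * length ps) e (subst₂ _<_ (*-assoc 2 2 (length ps)) q≡2e 4P<q)) ⟩
          e * k               ∎
          where
          open ≤-Reasoning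
          open +-*-Solver
      ... | c , c<m , z = c , c<m , collisions-0 ps z

-- Programs for logarithms and hashing.

pattern 10F = suc 9F
pattern 11F = suc 10F
pattern 12F = suc 11F

-- The six lists hold weights, hash values, base rows, states of uncovered events, the lifted
-- family, and the final rows.
pattern Wₛ = 0F
pattern Hₛ = 1F
pattern Bₛ = 2F
pattern Uₛ = 3F
pattern Fₛ = 4F
pattern Pₛ = 5F

st : (w h b u f p : Seq ℕ) → Store
st w h b u f p = w ∷ h ∷ b ∷ u ∷ f ∷ p ∷ []

-- Counts up while the power of two is below `n`; `n` rounds suffice to reach the logarithm rounded
-- up, for positive `n`.
lgUpTo : ℕ → ℕ → ℕ
lgUpTo n zero    = 0
lgUpTo n (suc i) = lgUpTo n i + ltN (2 ^ lgUpTo n i) n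

lg : ℕ → ℕ
lg n = lgUpTo n n

lgUpTo-≤ : ∀ n i → lgUpTo n i ≤ i
lgUpTo-≤ n zero    = z≤n
lgUpTo-≤ n (suc i) = ≤-trans (+-mono-≤ (lgUpTo-≤ n i) (m∸n≤m 1 (1 ∸ (n ∸ 2 ^ lgUpTo n i)))) (≤-reflexive (+-comm i 1))

lgUpTo-mono : ∀ n {i k} → i ≤′ k → lgUpTo n i ≤ lgUpTo n k
lgUpTo-mono n ≤′-refl = ≤-refl
lgUpTo-mono n (≤′-step i≤k) = ≤-trans (lgUpTo-mono n i≤k) (m≤m+n _ _)

2^lgUpTo< : ∀ n i → 0 < n → 2 ^ lgUpTo n i < 2 * n
2^lgUpTo< n zero 0<n = *-monoʳ-≤ 2 0<n
2^lgUpTo< n (suc i) 0<n with 2 ^ lgUpTo n i <? n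
... | no ¬lt rewrite ltN-≥ (≮⇒≥ ¬lt) | +-identityʳ (lgUpTo n i) = 2^lgUpTo< n i 0<n
... | yes lt rewrite ltN-< lt | +-comm (lgUpTo n i) 1 = *-monoʳ-< 2 lt

lgUpTo-reach : ∀ n i → n ≤ 2 ^ lgUpTo n i ⊎ lgUpTo n i ≡ i
lgUpTo-reach n zero = inj₂ refl
lgUpTo-reach n (suc i) with 2 ^ lgUpTo n i <? n
... | no ¬lt rewrite ltN-≥ (≮⇒≥ ¬lt) | +-identityʳ (lgUpTo n i) = inj₁ (≮⇒≥ ¬lt)
... | yes lt rewrite ltN-< lt | +-comm (lgUpTo n i) 1 with lgUpTo-reach n i
...   | inj₁ n≤ = ⊥-elim (<⇒≱ lt n≤)
...   | inj₂ eq = inj₂ (cong suc eq)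

n<2^n : ∀ n → n < 2 ^ n
n<2^n zero    = s≤s z≤n
n<2^n (suc n) = ≤-trans (+-mono-≤ (m^n>0 2 n) (n<2^n n)) (≤-reflexive (cong (2 ^ n +_) (sym (+-identityʳ (2 ^ n)))))

≤2^lg : ∀ n → n ≤ 2 ^ lg n
≤2^lg n with lgUpTo-reach n n
... | inj₁ n≤ = n≤
... | inj₂ eq = subst (λ k → n ≤ 2 ^ k) (sym eq) (<⇒≤ (n<2^n n))

2^lg< : ∀ n → 0 < n → 2 ^ lg n < 2 * n
2^lg< n = 2^lgUpTo< n n

lgE : ∀ {n} → Fin n → Exp n
lgE x = fold (var x) (lit 0) (op add (var 1F) (ltE (pow2E (var 1F)) (var (suc (suc x)))))

xorE : ∀ {n} → Fin n → Fin n → Fin n → Exp n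
xorE u v j = fold (var j) (lit 0) (op add (var 1F) (op mul (pow2E (var 0F))
  (modE (op add (op quo (var (suc (suc u))) (pow2E (var 0F))) (op quo (var (suc (suc v))) (pow2E (var 0F)))) (lit 2))))

module _ {n : ℕ} where

  indexE : Fin n → Fin n → Exp n → Exp n
  indexE c K e = op add (op mul (var c) (var K)) e

gainE : ∀ {n} → Exp (10 + n)
gainE = fold (var 2F) (lit 0) (op add (var 1F)
  (op mul (get Wₛ (indexE 6F 8F (op add (var 4F) (var 0F)))) (op sub (lit 1) (eqE (get Hₛ (indexE 6F 8F (var 0F))) (var 2F)))))

imageE : ∀ {n} → Exp (8 + n)
imageE = modE (fold (var 5F) (lit 0) (maxE (var 1F) (op add (op mul gainE (var 7F)) (var 0F)))) (var 5F)

levelS weightS : ∀ {n} → Stmt (7 + n)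
levelS = bind (pow2E (var 0F)) (bind imageE (loop (var 1F)
  (bind (get Hₛ (indexE 4F 6F (var 0F))) (push Hₛ (xorE 0F 2F 10F)))))
weightS = push Wₛ (op mul (get Wₛ (indexE 1F 3F (var 0F))) (op add (lit 1) (eqE (get Hₛ (indexE 1F 3F (var 0F))) (lit 0))))

columnS : ∀ {n} → Stmt (6 + n)
columnS = push Hₛ (lit 0) ⨾ loop (var 4F) levelS ⨾ loop (var 2F) weightS

-- The variables are the number m of columns, K = 2 ^ k, q = 2 ^ j, k and j.
hashS : ∀ {n} → Stmt (5 + n)
hashS = clear Wₛ ⨾ clear Hₛ ⨾ loop (var 1F) (push Wₛ (op sub (lit 1) (eqE (var 0F) (lit 0)))) ⨾ loop (var 0F) columnS

÷-block : ∀ c K {z} → z < K → (c * K + z) ÷ K ≡ c × (c * K + z) mod K ≡ z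
÷-block c K@(suc _) {z} z<K =
  trans (+-distrib-/-∣ˡ z {K} (Data.Nat.Divisibility.divides c refl)) (trans (cong₂ _+_ (m*n/n≡m c K) (m<n⇒m/n≡0 z<K)) (+-identityʳ c)) ,
  trans (mod-% (c * K + z) K) (trans (cong (_% K) (+-comm (c * K) z)) (trans ([m+kn]%n≡m%n z c K) (m<n⇒m%n≡m z<K)))

block-< : ∀ {c z K N} → c < N → z < K → c * K + z < N * K
block-< {c} {z} {K} {N} c<N z<K = <-≤-trans (+-monoʳ-< (c * K) z<K) (≤-trans (≤-reflexive (+-comm (c * K) K)) (*-monoˡ-≤ K c<N))

Σ-2^ : ∀ a k → Σ< (λ i → 2 ^ i * a) k ≤ 2 ^ k * a
Σ-2^ a zero    = z≤n
Σ-2^ a (suc k) = ≤-trans (+-monoˡ-≤ (2 ^ k * a) (Σ-2^ a k)) (≤-reflexive (trans (sym (*-distribʳ-+ a (2 ^ k) (2 ^ k))) (cong (λ x → (2 ^ k + x) * a) (sym (+-identityʳ (2 ^ k))))))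

ext : ∀ {A : Set} → Seq A → (ℕ → A) → ℕ → Seq A
ext s f zero    = s
ext s f (suc n) = ext s f n ▹ f n

size-ext : ∀ {A : Set} (s : Seq A) f n → size# (ext s f n) ≡ size# s + n
size-ext s f zero    = sym (+-identityʳ _)
size-ext s f (suc n) = trans (cong suc (size-ext s f n)) (sym (+-suc _ n))

at-ext : ∀ {A : Set} (z : A) s f n {i} → i < size# s → at z (ext s f n) i ≡ at z s i
at-ext z s f zero    i< = refl
at-ext z s f (suc n) i< = trans (at-init z (ext s f n) (f n) (≤-trans i< (≤-trans (m≤m+n _ n) (≤-reflexive (sym (size-ext s f n)))))) (at-ext z s f n i<)

at-ext-new : ∀ {A : Set} (z : A) s f n {i} → i < n → at z (ext s f n) (size# s + i) ≡ f i
at-ext-new z s f (suc n) {i} i<1+n with m≤n⇒m<n∨m≡n (≤-pred i<1+n)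
... | inj₁ i<n = trans (at-init z (ext s f n) (f n) (subst (size# s + i <_) (sym (size-ext s f n)) (+-monoʳ-< (size# s) i<n))) (at-ext-new z s f n i<n)
... | inj₂ refl = subst (λ k → at z (ext s f n ▹ f n) k ≡ f n) (size-ext s f n) (at-last z (ext s f n) (f n))

-- Tagged rows and their storage.

-- A vector over the alphabet {0, positive}, tagged with a number of ones.
Row : Set
Row = ℕ × (ℕ → ℕ)

Rows : Set
Rows = Seq Row

row : Rows → ℕ → Row
row = at (0 , λ _ → 0)

tag : Rows → ℕ → ℕ
tag R i = proj₁ (row R i)

bit : Rows → ℕ → ℕ → ℕ
bit R i = proj₂ (row R i)

-- A row takes `q + 1` cells with the tag last, since it is pushed after the entries.
flat : ℕ → Rows → Seq ℕ
flat q ε             = ε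
flat q (R ▹ (t , f)) = ext (flat q R) f q ▹ t

size-flat : ∀ q R → size# (flat q R) ≡ size# R * suc q
size-flat q ε             = refl
size-flat q (R ▹ (t , f)) = trans (cong suc (trans (size-ext (flat q R) f q) (trans (cong (_+ q) (size-flat q R)) (+-comm _ q)))) refl

block-end : ∀ {i n q y} → i < n → y ≤ q → i * suc q + y < n * suc q
block-end {i} {n} {q} i<n y≤q = block-< {i} i<n (s≤s y≤q)

at-flat : ∀ q R {i y} → i < size# R → y < q → at 0 (flat q R) (i * suc q + y) ≡ bit R i y
at-flat-tag : ∀ q R {i} → i < size# R → at 0 (flat q R) (i * suc q + q) ≡ tag R i

private
  within-ext : ∀ q R f {i y} → i < size# R → y ≤ q → i * suc q + y < size# (ext (flat q R) f q)
  within-ext q R f i<n y≤q = <-≤-trans (block-end i<n y≤q) (≤-trans (≤-reflexive (sym (size-flat q R))) (≤-trans (m≤m+n _ q) (≤-reflexive (sym (size-ext (flat q R) f q)))))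

at-flat q (R ▹ (t , f)) {i} {y} i<1+n y<q with m≤n⇒m<n∨m≡n (≤-pred i<1+n)
... | inj₁ i<n = trans (at-init 0 (ext (flat q R) f q) t (within-ext q R f i<n (<⇒≤ y<q)))
  (trans (at-ext 0 (flat q R) f q (subst (i * suc q + y <_) (sym (size-flat q R)) (block-end i<n (<⇒≤ y<q))))
    (trans (at-flat q R i<n y<q) (cong (λ x → proj₂ x y) (sym (at-init _ R (t , f) i<n)))))
... | inj₂ refl = trans (at-init 0 (ext (flat q R) f q) t (subst (i * suc q + y <_) (sym (trans (size-ext (flat q R) f q) (cong (_+ q) (size-flat q R)))) (+-monoʳ-< (i * suc q) y<q)))
  (trans (cong (λ k → at 0 (ext (flat q R) f q) (k + y)) (sym (size-flat q R))) (trans (at-ext-new 0 (flat q R) f q y<q) (cong (λ x → proj₂ x y) (sym (at-last _ R (t , f))))))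

at-flat-tag q (R ▹ (t , f)) {i} i<1+n with m≤n⇒m<n∨m≡n (≤-pred i<1+n)
... | inj₁ i<n = trans (at-init 0 (ext (flat q R) f q) t (within-ext q R f i<n ≤-refl))
  (trans (at-ext 0 (flat q R) f q (subst (i * suc q + q <_) (sym (size-flat q R)) (block-end i<n ≤-refl)))
    (trans (at-flat-tag q R i<n) (cong proj₁ (sym (at-init _ R (t , f) i<n)))))
... | inj₂ refl = trans (cong (at 0 (ext (flat q R) f q ▹ t)) (sym (trans (size-ext (flat q R) f q) (cong (_+ q) (size-flat q R)))))
  (trans (at-last 0 (ext (flat q R) f q) t) (cong proj₁ (sym (at-last _ R (t , f)))))

-- Patterns, their load, and splices.

data Cell : Set where
  star one-bit zero-bit : Cell

Pattern : Set
Pattern = ℕ → Cell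

-- Any positive entry counts as a one, so that rows built from tuples may store multiplicities.
Fit : Cell → ℕ → Set
Fit star     _ = ⊤
Fit one-bit  v = v ≢ 0
Fit zero-bit v = v ≡ 0

Fits : ℕ → Pattern → (ℕ → ℕ) → Set
Fits q p f = ∀ y → y < q → Fit (p y) (f y)

weigh : ℕ → ℕ → Cell → ℕ
weigh a b star     = 0
weigh a b one-bit  = a
weigh a b zero-bit = b

-- The load. It is used with both weights 1 when r is large, and otherwise with weight s for ones
-- and r for zeros, which makes both kinds contribute the same total.
mass : ℕ → ℕ → Pattern → ℕ → ℕ
mass a b p = Σ< (λ y → weigh a b (p y))

ones zeros : Pattern → ℕ → ℕ
ones  = mass 1 0
zeros = mass 0 1

mass-split : ∀ a b p n → mass a b p n ≡ a * ones p n + b * zeros p n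
mass-split a b p zero = sym (cong₂ _+_ (*-zeroʳ a) (*-zeroʳ b))
mass-split a b p (suc n) = trans (cong₂ _+_ (mass-split a b p n) (atCell (p n)))
  (solve 6 (λ a b x y u v → (a :* x :+ b :* y) :+ (a :* u :+ b :* v) := a :* (x :+ u) :+ b :* (y :+ v)) refl a b (ones p n) (zeros p n) (weigh 1 0 (p n)) (weigh 0 1 (p n)))
  where
  open +-*-Solver
  atCell : ∀ x → weigh a b x ≡ a * weigh 1 0 x + b * weigh 0 1 x
  atCell star     = sym (cong₂ _+_ (*-zeroʳ a) (*-zeroʳ b))
  atCell one-bit  = sym (trans (cong₂ _+_ (*-identityʳ a) (*-zeroʳ b)) (+-identityʳ a))
  atCell zero-bit = sym (cong₂ _+_ (*-zeroʳ a) (*-identityʳ b))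

before after : ℕ → Pattern → Pattern
before c p y = if y <ᵇ c then p y else star
after  c p y = if y <ᵇ c then star else p y

mass-cut : ∀ a b p c n → mass a b (before c p) n + mass a b (after c p) n ≡ mass a b p n
mass-cut a b p c n = trans (sym (Σ-+ _ _ n)) (Σ-cong n (λ y _ → atCell y))
  where
  atCell : ∀ y → weigh a b (before c p y) + weigh a b (after c p y) ≡ weigh a b (p y)
  atCell y with y <ᵇ c
  ... | true  = +-identityʳ _
  ... | false = refl

mass-before : ∀ a b p c {n} → c ≤ n → mass a b (before c p) n ≡ mass a b p c
mass-before a b p c {n} c≤n = trans (cong (mass a b (before c p)) (sym (m+[n∸m]≡n c≤n))) (trans (Σ-split _ c (n ∸ c))
  (trans (cong₂ _+_ (Σ-cong c inside) (trans (Σ-cong (n ∸ c) outside) (Σ-0 (n ∸ c)))) (+-identityʳ _)))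
  where
  inside : ∀ y → y < c → weigh a b (before c p y) ≡ weigh a b (p y)
  inside y y<c rewrite Hash.<ᵇ-true 0 y<c = refl
  outside : ∀ y → y < n ∸ c → weigh a b (before c p (c + y)) ≡ 0
  outside y _ rewrite Hash.<ᵇ-false 0 (m≤m+n c y) = refl

-- Prefix sums grow by at most `W` per cell, so the last one not above `x` misses it by less than
-- `W`, unless the end is reached.
cut-point : ∀ (f : ℕ → ℕ) W n x → x ≤ Σ< f n → (∀ y → f y ≤ W) → ∃ λ c → c ≤ n × Σ< f c ≤ x × (x < Σ< f c + W ⊎ c ≡ n)
cut-point f W zero x x≤ h = 0 , z≤n , z≤n , inj₂ refl
cut-point f W (suc n) x x≤ h with Σ< f (suc n) ≤? x
... | yes le = suc n , ≤-refl , le , inj₂ refl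
... | no ¬le with x <? Σ< f n
...   | no ¬lt = n , n≤1+n n , ≮⇒≥ ¬lt , inj₁ (<-≤-trans (≰⇒> ¬le) (+-monoʳ-≤ (Σ< f n) (h n)))
...   | yes lt with cut-point f W n x (<⇒≤ lt) h
...     | c , c≤n , s , inj₁ l = c , m≤n⇒m≤1+n c≤n , s , inj₁ l
...     | c , c≤n , s , inj₂ refl = ⊥-elim (<⇒≱ lt s)

splice : ℕ → Row → Row → Row
splice c (t , f) (u , g) = t + u , λ y → ltN y c * f y + (1 ∸ ltN y c) * g y

splice-fits : ∀ {q p x z} c → Fits q (before c p) (proj₂ x) → Fits q (after c p) (proj₂ z) → Fits q p (proj₂ (splice c x z))
splice-fits {p = p} {_ , f} {_ , g} c hf hg y y<q with y <? c
... | yes y<c = subst (Fit (p y)) (trans (sym (+-identityʳ (f y))) (sym (trans (cong (λ b → b * f y + (1 ∸ b) * g y) (ltN-< y<c)) (+-identityʳ _))))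
      (subst (λ b → Fit (if b then p y else star) (f y)) (Hash.<ᵇ-true 0 y<c) (hf y y<q))
... | no y≮c = subst (Fit (p y)) (trans (sym (+-identityʳ (g y))) (sym (cong (λ b → b * f y + (1 ∸ b) * g y) (ltN-≥ (≮⇒≥ y≮c)))))
      (subst (λ b → Fit (if b then star else p y) (g y)) (Hash.<ᵇ-false 0 (≮⇒≥ y≮c)) (hg y y<q))

-- The effect of a loop that runs 0 or 1 times, which is how the programs branch.
pick : ∀ {A : Set} → ℕ → A → A → A
pick zero    x y = x
pick (suc _) x y = y

-- Rows are appended to a list that is still being read; a row once written keeps its index.
record Prefix (R S : Rows) : Set where
  constructor prefix
  field
    longer : size# R ≤ size# S
    agree  : ∀ i → i < size# R → row S i ≡ row R i
open Prefix public

Prefix-refl : ∀ {R} → Prefix R R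
Prefix-refl = prefix ≤-refl (λ _ _ → refl)

Prefix-trans : ∀ {R S T} → Prefix R S → Prefix S T → Prefix R T
Prefix-trans (prefix l a) (prefix l′ a′) = prefix (≤-trans l l′) (λ i i< → trans (a′ i (≤-trans i< l)) (a i i<))

Prefix-ext : ∀ {R} f n → Prefix R (ext R f n)
Prefix-ext {R} f n = prefix (≤-trans (m≤m+n _ n) (≤-reflexive (sym (size-ext R f n)))) (λ i i< → at-ext _ R f n i<)

Prefix-pick : ∀ {R S T} b → Prefix R S → Prefix R T → Prefix R (pick b S T)
Prefix-pick zero    p _ = p
Prefix-pick (suc _) _ p = p

_∈ʳ_ : Row → Rows → Set
x ∈ʳ R = ∃ λ i → i < size# R × row R i ≡ x

∈-prefix : ∀ {x R S} → Prefix R S → x ∈ʳ R → x ∈ʳ S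
∈-prefix (prefix l a) (i , i< , eq) = i , ≤-trans i< l , trans (a i i<) eq

∈-ext : ∀ {R} f n {i} → i < n → f i ∈ʳ ext R f n
∈-ext {R} f n {i} i<n = size# R + i , subst (size# R + i <_) (sym (size-ext R f n)) (+-monoʳ-< (size# R) i<n) , at-ext-new _ R f n i<n

allowed : ℕ → ℕ → ℕ
allowed r t = 1 ∸ (t ∸ r)

-- Splicing the rows of consecutive blocks.

module History (q r : ℕ) (fam : Rows) where

  spliced : Rows → Row → ℕ → Rows
  spliced S x φ = ext S (λ c → splice c x (row fam φ)) (suc q)

  inner : Rows → Row → ℕ → Rows
  inner S x zero    = S
  inner S x (suc φ) = pick (allowed r (proj₁ x + tag fam φ)) (inner S x φ) (spliced (inner S x φ) x φ)

  outer : Rows → ℕ → Rows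
  outer R zero    = R
  outer R (suc ρ) = inner (outer R ρ) (row R ρ) (size# fam)

  -- One round adds one block. The old rows stay in front of the new ones, so that the program can
  -- append to the list that it reads; `outer` runs only over the rows present when the round
  -- begins.
  hist : ℕ → Rows
  hist zero    = ε ▹ (0 , λ _ → 0)
  hist (suc i) = outer (hist i) (size# (hist i))

  inner-prefix : ∀ S x φ → Prefix S (inner S x φ)
  inner-prefix S x zero    = Prefix-refl
  inner-prefix S x (suc φ) = Prefix-pick (allowed r (proj₁ x + tag fam φ)) (inner-prefix S x φ)
    (Prefix-trans (inner-prefix S x φ) (Prefix-ext (λ c → splice c x (row fam φ)) (suc q)))

  inner-mono : ∀ S x {φ ψ} → φ ≤′ ψ → Prefix (inner S x φ) (inner S x ψ)
  inner-mono S x ≤′-refl = Prefix-refl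
  inner-mono S x (≤′-step {ψ} le) = Prefix-trans (inner-mono S x le)
    (Prefix-pick (allowed r (proj₁ x + tag fam ψ)) Prefix-refl (Prefix-ext (λ c → splice c x (row fam ψ)) (suc q)))

  outer-mono : ∀ R {ρ π} → ρ ≤′ π → Prefix (outer R ρ) (outer R π)
  outer-mono R ≤′-refl = Prefix-refl
  outer-mono R (≤′-step {π} le) = Prefix-trans (outer-mono R le) (inner-prefix (outer R π) (row R π) (size# fam))

  outer-prefix : ∀ R ρ → Prefix R (outer R ρ)
  outer-prefix R ρ = outer-mono R (≤⇒≤′ (z≤n {ρ}))

  hist-mono : ∀ {i k} → i ≤′ k → Prefix (hist i) (hist k)
  hist-mono ≤′-refl = Prefix-refl
  hist-mono (≤′-step {k} le) = Prefix-trans (hist-mono le) (outer-prefix (hist k) (size# (hist k)))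

  splice∈ : ∀ {R x z c} → x ∈ʳ R → z ∈ʳ fam → c ≤ q → proj₁ x + proj₁ z ≤ r → splice c x z ∈ʳ outer R (size# R)
  splice∈ {R} {x} {z} {c} (ρ , ρ< , refl) (φ , φ< , refl) c≤q ok =
    ∈-prefix (outer-mono R (≤⇒≤′ ρ<)) (∈-prefix (inner-mono (outer R ρ) (row R ρ) (≤⇒≤′ φ<)) new)
    where
    new : splice c (row R ρ) (row fam φ) ∈ʳ inner (outer R ρ) (row R ρ) (suc φ)
    new rewrite m≤n⇒m∸n≡0 ok = ∈-ext (λ c → splice c (row R ρ) (row fam φ)) (suc q) (s≤s c≤q)

  module Covering (a b L W : ℕ) (0<a : 0 < a) (a≤W : a ≤ W) (b≤W : b ≤ W)
    (fam-covers : ∀ p → mass a b p q < L + W → ∃ λ x → x ∈ʳ fam × proj₁ x ≡ ones p q × Fits q p (proj₂ x)) where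

    weigh≤ : ∀ c → weigh a b c ≤ W
    weigh≤ star     = z≤n
    weigh≤ one-bit  = a≤W
    weigh≤ zero-bit = b≤W

    -- The last block is cut off at the right end: at most `mass ∸ L` remains on the left, and the
    -- right part exceeds `L` by less than the weight `W` of one cell.
    cut : ∀ p → ∃ λ c → c ≤ q × mass a b (before c p) q ≤ mass a b p q ∸ L × mass a b (after c p) q < L + W
    cut p with cut-point (λ y → weigh a b (p y)) W q (mass a b p q ∸ L) (m∸n≤m _ L) (λ y → weigh≤ (p y))
    ... | c , c≤q , s , tight = c , c≤q , subst (_≤ mass a b p q ∸ L) (sym (mass-before a b p c c≤q)) s ,
          +-cancelˡ-< (mass a b p c) _ _ (subst (_< mass a b p c + (L + W)) (trans (sym (mass-cut a b p c q)) (cong (_+ mass a b (after c p) q) (mass-before a b p c c≤q))) (bound tight))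
      where
      bound : _ → mass a b p q < mass a b p c + (L + W)
      bound (inj₁ lt) = ≤-<-trans (m≤n+m∸n (mass a b p q) L) (<-≤-trans (+-monoʳ-< L lt) (≤-reflexive (solve 3 (λ x l w → l :+ (x :+ w) := x :+ (l :+ w)) refl (mass a b p c) L W)))
        where open +-*-Solver
      bound (inj₂ refl) = m<m+n _ (<-≤-trans (<-≤-trans 0<a a≤W) (m≤n+m W L))

    -- Tags equal the exact number of required ones, so no partial row on the way to a pattern with
    -- at most `r` ones is discarded.
    hist-covers : ∀ i p → mass a b p q ≤ i * L → ones p q ≤ r → ∃ λ x → x ∈ʳ hist i × proj₁ x ≡ ones p q × Fits q p (proj₂ x)
    -- Load 0 excludes ones because `0 < a`, and the zero row fits everything else.
    hist-covers zero p le ones≤ = (0 , λ _ → 0) , (0 , s≤s z≤n , refl) , sym no-ones , fits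
      where
      no-ones : ones p q ≡ 0
      no-ones = n≤0⇒n≡0 (≤-trans (m≤n*m (ones p q) a ⦃ >-nonZero 0<a ⦄) (≤-trans (m≤m+n _ (b * zeros p q)) (≤-trans (≤-reflexive (sym (mass-split a b p q))) le)))
      fits : Fits q p (λ _ → 0)
      fits y y<q with p y in eq
      ... | star     = tt
      ... | zero-bit = refl
      ... | one-bit  = ⊥-elim (<⇒≱ (≤-trans (≤-reflexive (cong (weigh 1 0) (sym eq))) (Σ-term (λ y → weigh 1 0 (p y)) y<q)) (≤-reflexive no-ones))
    hist-covers (suc i) p le ones≤ with cut p
    ... | c , c≤q , small , big
      with hist-covers i (before c p) (≤-trans small (≤-trans (∸-monoˡ-≤ L le) (≤-reflexive (m+n∸m≡n L (i * L)))))
             (≤-trans (m≤m+n _ _) (≤-trans (≤-reflexive (mass-cut 1 0 p c q)) ones≤))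
         | fam-covers (after c p) big
    ... | x , x∈ , tx , fx | z , z∈ , tz , fz = splice c x z , splice∈ x∈ z∈ c≤q (≤-trans (≤-reflexive tag≡) ones≤) , tag≡ , splice-fits {q} {p} {x} {z} c fx fz
      where
      tag≡ : proj₁ x + proj₁ z ≡ ones p q
      tag≡ = trans (cong₂ _+_ tx tz) (mass-cut 1 0 p c q)

-- Counting rows by their tags.

sumRows : (ℕ → ℕ) → Rows → ℕ
sumRows F ε             = 0
sumRows F (R ▹ (t , _)) = sumRows F R + F t

countTag : ℕ → Rows → ℕ
countTag a = sumRows (λ t → eqN t a)

Tags≤ : ℕ → Rows → Set
Tags≤ b ε             = ⊤
Tags≤ b (R ▹ (t , _)) = Tags≤ b R × t ≤ b

Tags≤-ext : ∀ {b R} f n → Tags≤ b R → (∀ i → i < n → proj₁ (f i) ≤ b) → Tags≤ b (ext R f n)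
Tags≤-ext f zero    T h = T
Tags≤-ext f (suc n) T h = Tags≤-ext f n T (λ i i< → h i (m≤n⇒m≤1+n i<)) , h n ≤-refl

Tags≤-tag : ∀ {b} R {i} → Tags≤ b R → i < size# R → tag R i ≤ b
Tags≤-tag {b} (R ▹ x) {i} (T , t≤) i<1+n with m≤n⇒m<n∨m≡n (≤-pred i<1+n)
... | inj₁ i<n = subst (_≤ b) (cong proj₁ (sym (at-init _ R x i<n))) (Tags≤-tag R T i<n)
... | inj₂ refl = subst (_≤ b) (cong proj₁ (sym (at-last _ R x))) t≤

sumRows-mono : ∀ {F F′} R → (∀ t → F t ≤ F′ t) → sumRows F R ≤ sumRows F′ R
sumRows-mono ε             h = z≤n
sumRows-mono (R ▹ (t , _)) h = +-mono-≤ (sumRows-mono R h) (h t)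

sumRows-*ˡ : ∀ k F R → sumRows (λ t → k * F t) R ≡ k * sumRows F R
sumRows-*ˡ k F ε             = sym (*-zeroʳ k)
sumRows-*ˡ k F (R ▹ (t , _)) = trans (cong (_+ k * F t) (sumRows-*ˡ k F R)) (sym (*-distribˡ-+ k _ (F t)))

sumRows-Σ : ∀ F R → sumRows F R ≡ Σ< (λ i → F (tag R i)) (size# R)
sumRows-Σ F ε = refl
sumRows-Σ F (R ▹ x) = cong₂ _+_ (trans (sumRows-Σ F R) (Σ-cong (size# R) (λ i i< → cong (F ∘ proj₁) (sym (at-init _ R x i<)))))
  (cong (F ∘ proj₁) (sym (at-last _ R x)))

sumRows-ext : ∀ F R f n → sumRows F (ext R f n) ≡ sumRows F R + Σ< (λ i → F (proj₁ (f i))) n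
sumRows-ext F R f zero    = sym (+-identityʳ _)
sumRows-ext F R f (suc n) = trans (cong (_+ F (proj₁ (f n))) (sumRows-ext F R f n)) (+-assoc (sumRows F R) _ _)

sumRows-swap : ∀ (F : ℕ → ℕ → ℕ) R S → sumRows (λ t → sumRows (F t) S) R ≡ sumRows (λ u → sumRows (λ t → F t u) R) S
sumRows-swap F R S = trans (sumRows-Σ _ R) (trans (Σ-cong (size# R) (λ i _ → sumRows-Σ (F (tag R i)) S))
  (trans (Σ-swap (λ i k → F (tag R i) (tag S k)) (size# R) (size# S))
  (trans (Σ-cong (size# S) (λ k _ → sym (sumRows-Σ (λ t → F t (tag S k)) R))) (sym (sumRows-Σ _ S)))))

group : ∀ {b} F R → Tags≤ b R → sumRows F R ≤ Σ< (λ a → countTag a R * F a) (suc b)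
group {b} F ε T = z≤n
group {b} F (R ▹ (t , f)) (T , t≤) = begin
  sumRows F R + F t ≤⟨ +-mono-≤ (group F R T) (≤-trans (≤-reflexive (sym (trans (cong (_* F t) (eqN-refl t)) (*-identityˡ (F t))))) (Σ-term (λ a → eqN t a * F a) (s≤s t≤))) ⟩
  Σ< (λ a → countTag a R * F a) (suc b) + Σ< (λ a → eqN t a * F a) (suc b) ≡⟨ Σ-+ _ _ (suc b) ⟨
  Σ< (λ a → countTag a R * F a + eqN t a * F a) (suc b) ≡⟨ Σ-cong (suc b) (λ a _ → sym (*-distribʳ-+ (F a) (countTag a R) (eqN t a))) ⟩
  Σ< (λ a → (countTag a R + eqN t a) * F a) (suc b) ∎
  where open ≤-Reasoning

size-sumRows : ∀ R → size# R ≡ sumRows (λ _ → 1) R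
size-sumRows ε       = refl
size-sumRows (R ▹ x) = trans (+-comm 1 (size# R)) (cong (_+ 1) (size-sumRows R))

module Counting (q r : ℕ) (fam : Rows) where

  open History q r fam

  hist-tags : ∀ i → Tags≤ r (hist i)
  hist-tags zero    = tt , z≤n
  hist-tags (suc i) = outer-tags (size# (hist i))
    where
    pick-tags : ∀ {S x} φ → Tags≤ r S → ∀ b → b ≡ allowed r (proj₁ x + tag fam φ) → Tags≤ r (pick b S (spliced S x φ))
    pick-tags φ T zero _ = T
    pick-tags {S} {x} φ T (suc b) eq = Tags≤-ext _ (suc q) T (λ _ _ → ok)
      where
      ok : proj₁ x + tag fam φ ≤ r
      ok = m∸n≡0⇒m≤n (zero-or (proj₁ x + tag fam φ ∸ r) eq)
        where
        zero-or : ∀ d → suc b ≡ 1 ∸ d → d ≡ 0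
        zero-or zero _ = refl
        zero-or (suc d) e with trans e (0∸n≡0 d)
        ... | ()
    inner-tags : ∀ {S x} φ → Tags≤ r S → Tags≤ r (inner S x φ)
    inner-tags zero T = T
    inner-tags {S} {x} (suc φ) T = pick-tags {inner S x φ} {x} φ (inner-tags φ T) _ refl
    outer-tags : ∀ ρ → Tags≤ r (outer (hist i) ρ)
    outer-tags zero    = hist-tags i
    outer-tags (suc ρ) = inner-tags (size# fam) (outer-tags ρ)

  inner-count : ∀ a S x n → countTag a (inner S x n) ≤ countTag a S + Σ< (λ φ → suc q * eqN (proj₁ x + tag fam φ) a) n
  inner-count a S x zero = ≤-reflexive (sym (+-identityʳ _))
  inner-count a S x (suc φ) = ≤-trans (picked (allowed r (proj₁ x + tag fam φ)))
    (≤-trans (+-monoˡ-≤ _ (inner-count a S x φ)) (≤-reflexive (+-assoc (countTag a S) _ _)))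
    where
    picked : ∀ b → countTag a (pick b (inner S x φ) (spliced (inner S x φ) x φ)) ≤ countTag a (inner S x φ) + suc q * eqN (proj₁ x + tag fam φ) a
    picked zero    = m≤m+n _ _
    picked (suc _) = ≤-trans (≤-reflexive (sumRows-ext _ (inner S x φ) _ (suc q)))
      (+-monoʳ-≤ (countTag a (inner S x φ)) (Σ-const (λ c → eqN (proj₁ (splice c x (row fam φ))) a) _ (suc q) (λ _ _ → ≤-refl)))

  outer-count : ∀ a R n → countTag a (outer R n) ≤ countTag a R + Σ< (λ ρ → sumRows (λ u → suc q * eqN (tag R ρ + u) a) fam) n
  outer-count a R zero = ≤-reflexive (sym (+-identityʳ _))
  outer-count a R (suc ρ) = ≤-trans (inner-count a (outer R ρ) (row R ρ) (size# fam))
    (≤-trans (+-mono-≤ (outer-count a R ρ) (≤-reflexive (sym (sumRows-Σ (λ u → suc q * eqN (tag R ρ + u) a) fam)))) (≤-reflexive (+-assoc (countTag a R) _ _)))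

  -- `V i a` counts the rows of tag `a` made from `i` blocks, up to `growth ^ i`. The convolution
  -- inequality `V-conv` will hold with equality for `2 ^ (a * jQ)` and by Vandermonde for
  -- `binom (i * ω) a`.
  module Bound (b X : ℕ) (c : ℕ → ℕ) (V : ℕ → ℕ → ℕ) (fam-tags : Tags≤ b fam)
    (fam-count : ∀ a → countTag a fam ≤ X * c a) (V-base : 1 ≤ V 0 0)
    (V-mono : ∀ i a → V i a ≤ V (suc i) a) (V-conv : ∀ i a a′ → c a * V i a′ ≤ V (suc i) (a + a′)) where

    growth : ℕ
    -- The old rows once, and new rows for `suc q` cut points and `suc b` possible tags of the block
    -- row, each tag with overhead `X`.
    growth = 1 + suc q * (suc b * X)

    hist-count : ∀ i a → countTag a (hist i) ≤ growth ^ i * V i a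
    hist-count zero zero    = ≤-trans V-base (≤-reflexive (sym (+-identityʳ _)))
    hist-count zero (suc a) = ≤-trans (≤-reflexive (eqN-≢ {0} {suc a} (λ ()))) z≤n
    hist-count (suc i) a = begin
      countTag a (outer R (size# R))
        ≤⟨ outer-count a R (size# R) ⟩
      countTag a R + Σ< (λ ρ → sumRows (λ u → suc q * eqN (tag R ρ + u) a) fam) (size# R)
        -- Exchanging the sums groups the new rows by the block row that is spliced on, so that the
        -- induction hypothesis applies to tag `a ∸ u`.
        ≡⟨ cong (countTag a R +_) (trans (sym (sumRows-Σ (λ t → sumRows (λ u → suc q * eqN (t + u) a) fam) R)) (sumRows-swap (λ t u → suc q * eqN (t + u) a) R fam)) ⟩
      countTag a R + sumRows (λ u → sumRows (λ t → suc q * eqN (t + u) a) R) fam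
        ≤⟨ +-mono-≤ (≤-trans (hist-count i a) (*-monoʳ-≤ g (V-mono i a))) (sumRows-mono fam shift≤) ⟩
      g * V (suc i) a + sumRows F fam
        ≤⟨ +-monoʳ-≤ _ (≤-trans (group F fam fam-tags) (Σ-const _ (X * (suc q * (g * V (suc i) a))) (suc b) (λ a′ _ → each a′))) ⟩
      g * V (suc i) a + suc b * (X * (suc q * (g * V (suc i) a)))
        ≡⟨ solve 5 (λ g v b x q → g :* v :+ b :* (x :* (q :* (g :* v))) := ((con 1 :+ q :* (b :* x)) :* g) :* v) refl g (V (suc i) a) (suc b) X (suc q) ⟩
      growth ^ suc i * V (suc i) a ∎
      where
      open ≤-Reasoning
      open +-*-Solver
      R = hist i
      g = growth ^ i
      F : ℕ → ℕ
      F u = ltN u (suc a) * (suc q * (g * V i (a ∸ u)))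
      shift≤ : ∀ u → sumRows (λ t → suc q * eqN (t + u) a) R ≤ F u
      shift≤ u with u <? suc a
      ... | yes u≤a rewrite ltN-< u≤a | +-identityʳ (suc q * (g * V i (a ∸ u))) = ≤-trans (≤-reflexive (sumRows-*ˡ (suc q) _ R))
            (*-monoʳ-≤ (suc q) (≤-trans (sumRows-mono R (λ t → move t)) (hist-count i (a ∸ u))))
        where
        move : ∀ t → eqN (t + u) a ≤ eqN t (a ∸ u)
        move t with t + u ≟ a
        ... | no n = ≤-trans (≤-reflexive (eqN-≢ n)) z≤n
        ... | yes refl = ≤-trans (eqN-≤1 (t + u) (t + u)) (≤-reflexive (sym (trans (cong (eqN t) (m+n∸n≡m t u)) (eqN-refl t))))
      ... | no u≰a rewrite ltN-≥ (≮⇒≥ u≰a) = ≤-reflexive (trans (sumRows-*ˡ (suc q) _ R) (trans (cong (suc q *_) (none-fit R)) (*-zeroʳ (suc q))))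
        where
        none-fit : ∀ R → sumRows (λ t → eqN (t + u) a) R ≡ 0
        none-fit ε = refl
        none-fit (R ▹ (t , _)) = cong₂ _+_ (none-fit R) (eqN-≢ (λ e → u≰a (s≤s (≤-trans (m≤n+m u t) (≤-reflexive e)))))
      each : ∀ a′ → countTag a′ fam * F a′ ≤ X * (suc q * (g * V (suc i) a))
      each a′ with a′ <? suc a
      ... | no n rewrite ltN-≥ (≮⇒≥ n) | *-zeroʳ (countTag a′ fam) = z≤n
      ... | yes le rewrite ltN-< le | +-identityʳ (suc q * (g * V i (a ∸ a′))) = ≤-trans (*-monoˡ-≤ _ (fam-count a′))
        (≤-trans (≤-reflexive (solve 5 (λ x c q g v → (x :* c) :* (q :* (g :* v)) := x :* (q :* (g :* (c :* v)))) refl X (c a′) (suc q) g (V i (a ∸ a′))))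
          (*-monoʳ-≤ X (*-monoʳ-≤ (suc q) (*-monoʳ-≤ g (≤-trans (V-conv i a′ (a ∸ a′)) (≤-reflexive (cong (V (suc i)) (m+[n∸m]≡n (≤-pred le)))))))))

    -- Discarded splices leave only tags up to `r`, hence `suc r` classes.
    hist-size : ∀ i v → (∀ a → a ≤ r → V i a ≤ v) → size# (hist i) ≤ suc r * (growth ^ i * v)
    hist-size i v V≤ = begin
      size# (hist i)                      ≡⟨ size-sumRows (hist i) ⟩
      sumRows (λ _ → 1) (hist i)          ≤⟨ group (λ _ → 1) (hist i) (hist-tags i) ⟩
      Σ< (λ a → countTag a (hist i) * 1) (suc r) ≤⟨ Σ-const _ (growth ^ i * v) (suc r) (λ a a< → ≤-trans (≤-reflexive (*-identityʳ _))
          (≤-trans (hist-count i a) (*-monoʳ-≤ (growth ^ i) (V≤ a (≤-pred a<))))) ⟩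
      suc r * (growth ^ i * v)            ∎
      where open ≤-Reasoning

-- Programs for tuples, lifting, splicing and output.

rowS : ∀ {n} → Slot → Exp n → Exp (1 + n) → Exp n → Stmt n
rowS a q e t = loop q (push a e) ⨾ push a t

tupE : ∀ {n} → Exp (5 + n)
tupE = fold (var 2F) (lit 0) (op add (var 1F) (eqE (modE (op quo (var 3F) (pow2E (op mul (var 0F) (var 5F)))) (var 6F)) (var 2F)))

-- The variables are a, j and 2 ^ j.
tuplesS : ∀ {n} → Stmt (3 + n)
tuplesS = loop (pow2E (op mul (var 0F) (var 1F))) (rowS Bₛ (var 3F) tupE (var 1F))

-- The `a` digits of `t` in base `2 ^ j` name the cells of the ones, possibly with repetition; the
-- entry at `y` counts how often `y` is named.
tuple : ℕ → ℕ → ℕ → Row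
tuple j a t = a , λ y → Σ< (λ i → eqN ((t ÷ 2 ^ (i * j)) mod 2 ^ j) y) a

width : ∀ {n} → Fin n → Exp n
width q = op add (var q) (lit 1)

-- The variables are the number m of columns, q and the width Q of the source rows.
famS : ∀ {n} → Stmt (3 + n)
famS = loop (var 0F) (loop (op quo (len Bₛ) (width 3F)) (rowS Fₛ (var 3F)
  (get Bₛ (op add (op mul (var 1F) (width 5F)) (get Hₛ (op add (op mul (var 2F) (var 4F)) (var 0F)))))
  (get Bₛ (op add (op mul (var 0F) (width 4F)) (var 4F)))))

module Lifting (base : Rows) (g : ℕ → ℕ → ℕ) where

  lifted : ℕ → ℕ → Row
  lifted c ρ = tag base ρ , λ y → bit base ρ (g c y)

  fam : ℕ → Rows
  fam zero    = ε
  fam (suc c) = ext (fam c) (lifted c) (size# base)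

  size-fam : ∀ c → size# (fam c) ≡ c * size# base
  size-fam zero    = refl
  size-fam (suc c) = trans (size-ext (fam c) (lifted c) (size# base)) (trans (cong (_+ size# base) (size-fam c)) (+-comm (c * size# base) _))

tagE : ∀ {n} → Slot → Fin n → Fin n → Exp n
tagE s ρ q = get s (op add (op mul (var ρ) (width q)) (var q))

spliceE : ∀ {n} → Exp (9 + n)
spliceE = op add (op mul (ltE (var 0F) (var 1F)) (get Pₛ (op add (op mul (var 4F) (width 8F)) (var 0F))))
                 (op mul (op sub (lit 1) (ltE (var 0F) (var 1F))) (get Fₛ (op add (op mul (var 3F) (width 8F)) (var 0F))))

-- The variables are the number I of rounds, q and r.
histS : ∀ {n} → Stmt (3 + n)
-- The number of rows is bound before the inner loops because `Pₛ` grows inside them. The loop with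
-- limit 1 minus the excess of the tags over r is the test that discards rows.
histS = rowS Pₛ (var 1F) (lit 0) (lit 0) ⨾ loop (var 0F) (bind (op quo (len Pₛ) (width 2F)) (loop (var 0F) (loop (op quo (len Fₛ) (width 4F))
  (loop (op sub (lit 1) (op sub (op add (tagE Pₛ 1F 5F) (tagE Fₛ 0F 5F)) (var 6F)))
    (loop (width 6F) (rowS Pₛ (var 7F) spliceE (op add (tagE Pₛ 3F 7F) (tagE Fₛ 2F 7F))))))))

-- The variables are m, K, q and n.
emitS : ∀ {n} → Stmt (4 + n)
emitS = loop (var 0F) (loop (op quo (len Pₛ) (width 3F)) (loop (var 5F)
  (out (get Pₛ (op add (op mul (var 1F) (width 5F)) (get Hₛ (op add (op mul (var 2F) (var 4F)) (var 0F))))))))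

module Emission (P : Rows) (g : ℕ → ℕ → ℕ) (n : ℕ) where

  member : ℕ → ℕ → ℕ → Bool
  member c ρ x = isNonZero (bit P ρ (g c x))

  emitRows : Seq Bool → ℕ → ℕ → Seq Bool
  emitRows ω c zero    = ω
  emitRows ω c (suc ρ) = ext (emitRows ω c ρ) (member c ρ) n

  emitted : ℕ → Seq Bool
  emitted zero    = ε
  emitted (suc c) = emitRows (emitted c) c (size# P)

flat-÷ : ∀ q R → size# (flat q R) ÷ (q + 1) ≡ size# R
flat-÷ q R rewrite +-comm q 1 | size-flat q R = m*n/n≡m (size# R) (suc q)

-- Binomial coefficients.

binom : ℕ → ℕ → ℕ
binom n       zero    = 1
binom zero    (suc k) = 0
binom (suc n) (suc k) = binom n k + binom n (suc k)

C≡binom : ∀ n k → n choose k ≡ binom n k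
C≡binom n zero = trans (nCk≡nC[n∸k] {0} {n} z≤n) (nCn≡1 n)
C≡binom zero (suc k) = k>n⇒nCk≡0 {0} {suc k} (s≤s z≤n)
C≡binom (suc n) (suc k) = trans (sym (nCk+nC[k+1]≡[n+1]C[k+1] n k)) (cong₂ _+_ (C≡binom n k) (C≡binom n (suc k)))

binom-mono : ∀ n k → binom n k ≤ binom (suc n) k
binom-mono n zero    = ≤-refl
binom-mono n (suc k) = m≤n+m _ _

binom-mono-+ : ∀ m n k → binom n k ≤ binom (m + n) k
binom-mono-+ zero    n k = ≤-refl
binom-mono-+ (suc m) n k = ≤-trans (binom-mono-+ m n k) (binom-mono (m + n) k)

-- A single term of Vandermonde's identity, by Pascal's rule in the first factor.
binom-* : ∀ m i n k → binom m i * binom n k ≤ binom (m + n) (i + k)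
binom-* m zero n k = ≤-trans (≤-reflexive (*-identityˡ _)) (binom-mono-+ m n k)
binom-* zero (suc i) n k = z≤n
binom-* (suc m) (suc i) n k = ≤-trans (≤-reflexive (*-distribʳ-+ (binom n k) (binom m i) _)) (+-mono-≤ (binom-* m i n k) (binom-* m (suc i) n k))

binom-diag : ∀ a → binom a a ≡ 1
binom-diag zero    = refl
binom-diag (suc a) = cong₂ _+_ (binom-diag a) (trans (cong (λ x → binom a (suc x)) (sym (+-identityʳ a))) (over a 0))
  where
  over : ∀ n k → binom n (suc (n + k)) ≡ 0
  over zero    k = refl
  over (suc n) k = cong₂ _+_ (over n k) (trans (cong (λ x → binom n (suc x)) (sym (+-suc n k))) (over n (suc k)))

binom-≥1 : ∀ a z → 1 ≤ binom (a + z) a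
binom-≥1 zero z    = ≤-refl
binom-≥1 (suc a) z = ≤-trans (binom-≥1 a z) (m≤m+n _ _)

binom-! : ∀ a z → binom (a + z) a * (a ! * z !) ≡ (a + z) !
binom-! zero z = trans (*-identityˡ _) (*-identityˡ (z !))
binom-! (suc a) zero rewrite +-identityʳ a | binom-diag (suc a) = trans (*-identityˡ (suc a ! * 1)) (*-identityʳ (suc a !))
binom-! (suc a) (suc z) = begin
  (binom (a + suc z) a + binom (a + suc z) (suc a)) * (suc a ! * suc z !)
    ≡⟨ cong (λ x → (binom (a + suc z) a + binom x (suc a)) * (suc a ! * suc z !)) (+-suc a z) ⟩
  (binom (a + suc z) a + binom (suc a + z) (suc a)) * ((suc a * a !) * (suc z * z !))
    ≡⟨ solve 6 (λ b c a f z g → (b :+ c) :* ((a :* f) :* (z :* g)) := a :* (b :* (f :* (z :* g))) :+ z :* (c :* ((a :* f) :* g))) refl (binom (a + suc z) a) (binom (suc a + z) (suc a)) (suc a) (a !) (suc z) (z !) ⟩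
  suc a * (binom (a + suc z) a * (a ! * suc z !)) + suc z * (binom (suc a + z) (suc a) * (suc a ! * z !))
    ≡⟨ cong₂ (λ x y → suc a * x + suc z * y) (binom-! a (suc z)) (binom-! (suc a) z) ⟩
  suc a * (a + suc z) ! + suc z * (suc a + z) !
    ≡⟨ cong (λ x → suc a * (a + suc z) ! + suc z * x !) (sym (+-suc a z)) ⟩
  suc a * (a + suc z) ! + suc z * (a + suc z) !
    ≡⟨ *-distribʳ-+ ((a + suc z) !) (suc a) (suc z) ⟨
  (suc a + suc z) * (a + suc z) ! ∎
  where
  open ≡-Reasoning
  open +-*-Solver

-- The additional ones and zeros contribute a second factor, at least 1, to `binom-*`.
binom-≤ : ∀ {a z a′ z′} → a ≤ a′ → z ≤ z′ → binom (a + z) a ≤ binom (a′ + z′) a′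
binom-≤ {a} {z} {a′} {z′} a≤ z≤ = begin
  binom (a + z) a ≡⟨ *-identityʳ _ ⟨
  binom (a + z) a * 1 ≤⟨ *-monoʳ-≤ (binom (a + z) a) (binom-≥1 (a′ ∸ a) (z′ ∸ z)) ⟩
  binom (a + z) a * binom ((a′ ∸ a) + (z′ ∸ z)) (a′ ∸ a) ≤⟨ binom-* (a + z) a _ (a′ ∸ a) ⟩
  binom ((a + z) + ((a′ ∸ a) + (z′ ∸ z))) (a + (a′ ∸ a)) ≡⟨ cong₂ binom
     (trans (solve 4 (λ a z x y → (a :+ z) :+ (x :+ y) := (a :+ x) :+ (z :+ y)) refl a z (a′ ∸ a) (z′ ∸ z)) (cong₂ _+_ (m+[n∸m]≡n a≤) (m+[n∸m]≡n z≤))) (m+[n∸m]≡n a≤) ⟩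
  binom (a′ + z′) a′ ∎
  where
  open ≤-Reasoning
  open +-*-Solver

-- Weighted counting of vectors that meet a requirement.

bitN : ℕ → ℕ → ℕ
bitN v i = (v ÷ 2 ^ i) mod 2

bitN-≤1 : ∀ v i → bitN v i ≤ 1
bitN-≤1 v i = ≤-trans (≤-reflexive (mod-% (v ÷ 2 ^ i) 2)) (≤-pred (m%n<n (v ÷ 2 ^ i) 2))

bitN-top : ∀ Q v → v < 2 ^ Q → bitN v Q ≡ 0
bitN-top Q v v< = cong (_mod 2) (trans (÷-/ v (2 ^ Q) ⦃ m^n≢0 2 Q ⦄) (m<n⇒m/n≡0 ⦃ m^n≢0 2 Q ⦄ v<))

bitN-set : ∀ Q v → v < 2 ^ Q → bitN (2 ^ Q + v) Q ≡ 1
bitN-set Q v v< = cong (_mod 2) (trans (cong (λ x → (x + v) ÷ 2 ^ Q) (sym (*-identityˡ (2 ^ Q)))) (proj₁ (÷-block 1 (2 ^ Q) v<)))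

bitN-low : ∀ Q v i → i < Q → bitN (2 ^ Q + v) i ≡ bitN v i
bitN-low Q v i i<Q = begin
  ((2 ^ Q + v) ÷ 2 ^ i) mod 2  ≡⟨ mod-% ((2 ^ Q + v) ÷ 2 ^ i) 2 ⟩
  ((2 ^ Q + v) ÷ 2 ^ i) % 2    ≡⟨ cong (_% 2) (÷-/ (2 ^ Q + v) (2 ^ i)) ⟩
  ((2 ^ Q + v) / 2 ^ i) % 2    ≡⟨ cong (λ x → ((x + v) / 2 ^ i) % 2) pow ⟩
  ((X * 2 * 2 ^ i + v) / 2 ^ i) % 2 ≡⟨ cong (_% 2) (trans (+-distrib-/-∣ˡ v (Data.Nat.Divisibility.divides (X * 2) refl)) (cong (_+ v / 2 ^ i) (m*n/n≡m (X * 2) (2 ^ i)))) ⟩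
  (X * 2 + v / 2 ^ i) % 2      ≡⟨ cong (_% 2) (+-comm (X * 2) _) ⟩
  (v / 2 ^ i + X * 2) % 2      ≡⟨ [m+kn]%n≡m%n (v / 2 ^ i) X 2 ⟩
  (v / 2 ^ i) % 2              ≡⟨ cong (_% 2) (÷-/ v (2 ^ i)) ⟨
  (v ÷ 2 ^ i) % 2              ≡⟨ mod-% (v ÷ 2 ^ i) 2 ⟨
  (v ÷ 2 ^ i) mod 2            ∎
  where
  open ≡-Reasoning
  instance _ = m^n≢0 2 i
  X = 2 ^ (Q ∸ suc i)
  pow : 2 ^ Q ≡ X * 2 * 2 ^ i
  pow = trans (cong (2 ^_) (sym (m∸n+n≡m i<Q))) (trans (^-distribˡ-+-* 2 (Q ∸ suc i) (suc i)) (sym (*-assoc X 2 (2 ^ i))))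

-- A vector v violates the requirement of ones at x and zeros at y.
violations : (ℕ → ℕ) → (ℕ → ℕ) → ℕ → ℕ → ℕ
violations x y v = Σ< (λ i → x i * (1 ∸ bitN v i) + y i * bitN v i)

meets : ℕ → (ℕ → ℕ) → (ℕ → ℕ) → ℕ → ℕ
meets Q x y v = eqN (violations x y v Q) 0

eqN-+ : ∀ s t → eqN (s + t) 0 ≡ eqN s 0 * eqN t 0
eqN-+ zero t rewrite +-identityʳ (eqN t 0) = refl
eqN-+ (suc s) t = trans (eqN-≢ {suc s + t} {0} (λ ())) (sym (cong (_* eqN t 0) (eqN-≢ {suc s} {0} (λ ()))))

population vacancy : ℕ → ℕ → ℕ
population v = Σ< (bitN v)
vacancy v = Σ< (λ i → 1 ∸ bitN v i)

-- The weight |v|! (Q - |v|)! is that of a Pólya urn: its marginals have the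
-- same form, which makes the total weight of the v meeting a requirement explicit.
module Urn (x y : ℕ → ℕ) (disjoint : ∀ i → (x i ≡ 0 × y i ≡ 0) ⊎ (x i ≡ 1 × y i ≡ 0) ⊎ (x i ≡ 0 × y i ≡ 1)) where

  urn : ℕ → ℕ → ℕ → ℕ → ℕ
  urn Q k l v = ((k + population v Q) ! * (l + vacancy v Q) !) * meets Q x y v

  mass-urn : ℕ → ℕ → ℕ → ℕ
  mass-urn Q k l = Σ< (urn Q k l) (2 ^ Q)

  low : ∀ Q k l v → v < 2 ^ Q → urn (suc Q) k l v ≡ eqN (x Q) 0 * urn Q k (suc l) v
  low Q k l v v< rewrite bitN-top Q v v< | *-zeroʳ (y Q) | *-identityʳ (x Q) | +-identityʳ (x Q) | +-identityʳ (population v Q)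
    | +-comm (vacancy v Q) 1 | +-suc l (vacancy v Q) | eqN-+ (violations x y v Q) (x Q) =
    solve 4 (λ p q e f → (p :* q) :* (e :* f) := f :* ((p :* q) :* e)) refl ((k + population v Q) !) (suc (l + vacancy v Q) !) (meets Q x y v) (eqN (x Q) 0)
    where open +-*-Solver

  lower-bits : ∀ Q v (f : ℕ → ℕ → ℕ) → Σ< (λ i → f i (bitN (2 ^ Q + v) i)) Q ≡ Σ< (λ i → f i (bitN v i)) Q
  lower-bits Q v f = Σ-cong Q (λ i i< → cong (f i) (bitN-low Q v i i<))

  high : ∀ Q k l v → v < 2 ^ Q → urn (suc Q) k l (2 ^ Q + v) ≡ eqN (y Q) 0 * urn Q (suc k) l v
  high Q k l v v< rewrite bitN-set Q v v< | lower-bits Q v (λ _ b → b) | lower-bits Q v (λ _ b → 1 ∸ b)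
    | lower-bits Q v (λ i b → x i * (1 ∸ b) + y i * b) | *-zeroʳ (x Q) | *-identityʳ (y Q) | +-identityʳ (vacancy v Q)
    | +-comm (population v Q) 1 | +-suc k (population v Q) | eqN-+ (violations x y v Q) (y Q) =
    solve 4 (λ p q e f → (p :* q) :* (e :* f) := f :* ((p :* q) :* e)) refl (suc (k + population v Q) !) ((l + vacancy v Q) !) (meets Q x y v) (eqN (y Q) 0)
    where open +-*-Solver

  mass-step : ∀ Q k l → mass-urn (suc Q) k l ≡ eqN (x Q) 0 * mass-urn Q k (suc l) + eqN (y Q) 0 * mass-urn Q (suc k) l
  mass-step Q k l = begin
    Σ< (urn (suc Q) k l) (2 ^ suc Q)     ≡⟨ cong (Σ< (urn (suc Q) k l)) (cong (2 ^ Q +_) (+-identityʳ (2 ^ Q))) ⟩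
    Σ< (urn (suc Q) k l) (2 ^ Q + 2 ^ Q) ≡⟨ Σ-split (urn (suc Q) k l) (2 ^ Q) (2 ^ Q) ⟩
    Σ< (urn (suc Q) k l) (2 ^ Q) + Σ< (λ v → urn (suc Q) k l (2 ^ Q + v)) (2 ^ Q)
      ≡⟨ cong₂ _+_ (trans (Σ-cong (2 ^ Q) (low Q k l)) (Σ-*ˡ (eqN (x Q) 0) (urn Q k (suc l)) (2 ^ Q))) (trans (Σ-cong (2 ^ Q) (high Q k l)) (Σ-*ˡ (eqN (y Q) 0) (urn Q (suc k) l) (2 ^ Q))) ⟩
    eqN (x Q) 0 * mass-urn Q k (suc l) + eqN (y Q) 0 * mass-urn Q (suc k) l ∎
    where open ≡-Reasoning

  -- A Beta integral in disguise: a bias is drawn uniformly, then independent bits with it. For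
  -- `k = l = 0` a fraction `a! z! / (a + z + 1)!` of the weight meets `a` ones and `z` zeros,
  -- whatever `Q` is; no bias has to be tuned to `a` and `z`. The induction splits off the top bit,
  -- which is free or forced.
  mass-formula : ∀ Q k l → let a = Σ< x Q; z = Σ< y Q in
    mass-urn Q k l * (suc (k + l + (a + z))) ! ≡ ((k + a) ! * (l + z) !) * (suc (k + l + Q)) !
  mass-formula zero k l rewrite +-identityʳ k | +-identityʳ l | +-identityʳ (k + l) | *-identityʳ (k ! * l !) = refl
  mass-formula (suc Q) k l = unfold (disjoint Q)
    where
    open ≡-Reasoning
    open +-*-Solver
    a = Σ< x Q
    z = Σ< y Q
    s = k + l + (a + z)
    expand : ∀ {b c} → eqN (x Q) 0 ≡ b → eqN (y Q) 0 ≡ c → mass-urn (suc Q) k l ≡ b * mass-urn Q k (suc l) + c * mass-urn Q (suc k) l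
    expand refl refl = mass-step Q k l
    IH₁ : mass-urn Q k (suc l) * (suc (suc s)) ! ≡ ((k + a) ! * (suc l + z) !) * (suc (k + l + suc Q)) !
    IH₁ = trans (cong (λ t → mass-urn Q k (suc l) * (suc t) !) (sym (solve 4 (λ k l a z → k :+ (con 1 :+ l) :+ (a :+ z) := con 1 :+ (k :+ l :+ (a :+ z))) refl k l a z)))
      (trans (mass-formula Q k (suc l)) (cong (λ t → ((k + a) ! * (suc l + z) !) * (suc t) !) (solve 3 (λ k l q → k :+ (con 1 :+ l) :+ q := k :+ l :+ (con 1 :+ q)) refl k l Q)))
    IH₂ : mass-urn Q (suc k) l * (suc (suc s)) ! ≡ ((suc k + a) ! * (l + z) !) * (suc (k + l + suc Q)) !
    IH₂ = trans (mass-formula Q (suc k) l) (cong (λ t → ((suc k + a) ! * (l + z) !) * (suc t) !) (sym (+-suc (k + l) Q)))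
    unfold : _ → mass-urn (suc Q) k l * (suc (k + l + ((a + x Q) + (z + y Q)))) ! ≡ ((k + (a + x Q)) ! * (l + (z + y Q)) !) * (suc (k + l + suc Q)) !
    unfold (inj₁ (ex , ey)) rewrite expand (cong (λ t → eqN t 0) ex) (cong (λ t → eqN t 0) ey) | ex | ey | +-identityʳ a | +-identityʳ z =
      -- For a free bit, the two induction hypotheses carry the factors `suc (l + z)` and
      -- `suc (k + a)`, whose sum is `suc (suc s)`.
      *-cancelˡ-≡ _ _ (suc (suc s)) (begin
        suc (suc s) * ((1 * mass-urn Q k (suc l) + 1 * mass-urn Q (suc k) l) * suc s !)
          ≡⟨ solve 4 (λ n m₁ m₂ f → n :* ((con 1 :* m₁ :+ con 1 :* m₂) :* f) := m₁ :* (n :* f) :+ m₂ :* (n :* f)) refl (suc (suc s)) (mass-urn Q k (suc l)) (mass-urn Q (suc k) l) (suc s !) ⟩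
        mass-urn Q k (suc l) * (suc (suc s)) ! + mass-urn Q (suc k) l * (suc (suc s)) !
          ≡⟨ cong₂ _+_ IH₁ IH₂ ⟩
        ((k + a) ! * (suc (l + z) * (l + z) !)) * F + ((suc (k + a) * (k + a) !) * (l + z) !) * F
          ≡⟨ solve 5 (λ u v f p q → (u :* ((con 1 :+ p) :* v)) :* f :+ (((con 1 :+ q) :* u) :* v) :* f := (con 1 :+ (con 1 :+ (q :+ p))) :* ((u :* v) :* f)) refl ((k + a) !) ((l + z) !) F (l + z) (k + a) ⟩
        suc (suc ((k + a) + (l + z))) * (((k + a) ! * (l + z) !) * F)
          ≡⟨ cong (λ t → suc (suc t) * (((k + a) ! * (l + z) !) * F)) (solve 4 (λ k l a z → (k :+ a) :+ (l :+ z) := k :+ l :+ (a :+ z)) refl k l a z) ⟩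
        suc (suc s) * (((k + a) ! * (l + z) !) * F) ∎)
      where F = (suc (k + l + suc Q)) !
    unfold (inj₂ (inj₁ (ex , ey))) rewrite expand (cong (λ t → eqN t 0) ex) (cong (λ t → eqN t 0) ey) | ex | ey | +-identityʳ z | +-comm a 1 | +-suc k a | +-identityʳ (mass-urn Q (suc k) l) =
      trans (cong (λ t → mass-urn Q (suc k) l * (suc t) !) (+-suc (k + l) (a + z))) IH₂
    unfold (inj₂ (inj₂ (ex , ey))) rewrite expand (cong (λ t → eqN t 0) ex) (cong (λ t → eqN t 0) ey) | ex | ey | +-identityʳ a | +-comm z 1 | +-suc l z | +-identityʳ (mass-urn Q k (suc l)) | +-identityʳ (mass-urn Q k (suc l)) =
      trans (cong (λ t → mass-urn Q k (suc l) * (suc t) !) (trans (cong (k + l +_) (+-suc a z)) (+-suc (k + l) (a + z)))) IH₁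

!-pos : ∀ n → 0 < n !
!-pos zero    = s≤s z≤n
!-pos (suc n) = *-mono-≤ {1} {suc n} (s≤s z≤n) (!-pos n)

-- Greedy covers of all requirements on Q cells.

module Greedy (Q a b : ℕ) (R₀ : Rows) where

  -- An event below `E` is `x * V + y`: the bits of `x` are the required ones, those of `y` the
  -- required zeros. `1 / D` is the fraction of the urn weight that meets `a` ones and `b` zeros,
  -- the least among active events.
  V E D : ℕ
  V = 2 ^ Q
  E = V * V
  D = suc (a + b) * binom (a + b) a

  xs ys : ℕ → ℕ → ℕ
  xs e = bitN (e ÷ V)
  ys e = bitN (e mod V)

  cov : ℕ → ℕ → ℕ
  cov v e = meets Q (xs e) (ys e) v

  active : ℕ → ℕ
  active e = (1 ∸ (Σ< (xs e) Q ∸ a)) * ((1 ∸ (Σ< (ys e) Q ∸ b)) * eqN (Σ< (λ i → xs e i * ys e i) Q) 0)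

  mutual
    -- Indicator of the active events missed by the first `t` choices.
    u : ℕ → ℕ → ℕ
    u zero    e = active e
    u (suc t) e = u t e * (1 ∸ cov (choice t) e)

    covered : ℕ → ℕ → ℕ
    covered t v = Σ< (λ e → u t e * cov v e) E

    choice : ℕ → ℕ
    choice t = argmax (covered t) V

  -- The quotient of the packed maximum by `V` is the gain; the flag is 1 when it is positive.
  top flag : ℕ → ℕ
  top t = best (covered t) V V
  flag t = 1 ∸ (1 ∸ (top t ÷ V))

  -- Useless choices are not recorded. The program can thus run for a crude number of steps,
  -- computed without binomial coefficients, while the number of rows obeys the sharp bound
  -- `enough`.
  greedy : ℕ → Rows
  greedy zero    = R₀
  greedy (suc t) = pick (flag t) (greedy t) (greedy t ▹ (a , bitN (choice t)))

  U : ℕ → ℕ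
  U t = Σ< (u t) E

  private
    0<V : 0 < V
    0<V = m^n>0 2 Q

    instance
      V≢0 : NonZero V
      V≢0 = m^n≢0 2 Q

  record Active (e : ℕ) : Set where
    field
      x≤ : Σ< (xs e) Q ≤ a
      y≤ : Σ< (ys e) Q ≤ b
      xy : Σ< (λ i → xs e i * ys e i) Q ≡ 0

  1∸≢0 : ∀ {x} → 1 ∸ x ≢ 0 → x ≡ 0
  1∸≢0 {zero} _ = refl
  1∸≢0 {suc x} n = ⊥-elim (n (0∸n≡0 x))

  *≢0 : ∀ x y → x * y ≢ 0 → x ≢ 0 × y ≢ 0
  *≢0 zero y n = ⊥-elim (n refl)
  *≢0 (suc x) zero n = ⊥-elim (n (*-zeroʳ x))
  *≢0 (suc x) (suc y) n = (λ ()) , (λ ())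

  eqN≢0 : ∀ {x y} → eqN x y ≢ 0 → x ≡ y
  eqN≢0 {x} {y} n with x ≟ y
  ... | yes eq = eq
  ... | no x≢y = ⊥-elim (n (eqN-≢ x≢y))

  active-true : ∀ {e} → active e ≢ 0 → Active e
  active-true {e} n = record { x≤ = m∸n≡0⇒m≤n (1∸≢0 (proj₁ outer)) ; y≤ = m∸n≡0⇒m≤n (1∸≢0 (proj₁ inner)) ; xy = eqN≢0 (proj₂ inner) }
    where
    p = 1 ∸ (Σ< (ys e) Q ∸ b)
    d = eqN (Σ< (λ i → xs e i * ys e i) Q) 0
    outer = *≢0 (1 ∸ (Σ< (xs e) Q ∸ a)) (p * d) n
    inner = *≢0 p d (proj₂ outer)

  true-active : ∀ {e} → Active e → active e ≡ 1
  true-active A rewrite m≤n⇒m∸n≡0 (Active.x≤ A) | m≤n⇒m∸n≡0 (Active.y≤ A) | Active.xy A = refl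

  u-active : ∀ t e → u t e ≢ 0 → Active e
  u-active zero    e n = active-true n
  u-active (suc t) e n = u-active t e (proj₁ (*≢0 (u t e) (1 ∸ cov (choice t) e) n))

  bitN-beyond : ∀ {v i} → v < V → Q ≤ i → bitN v i ≡ 0
  bitN-beyond {v} {i} v< Q≤i = bitN-top i v (<-≤-trans v< (^-monoʳ-≤ 2 Q≤i))

  ÷V< : ∀ {e} → e < E → e ÷ V < V
  ÷V< {e} e< = ≤-<-trans (≤-reflexive (÷-/ e V)) (m<n*o⇒m/o<n e<)

  modV< : ∀ e → e mod V < V
  modV< e = ≤-<-trans (≤-reflexive (mod-% e V)) (m%n<n e V)

  disjoint : ∀ {e} → e < E → Active e → ∀ i → (xs e i ≡ 0 × ys e i ≡ 0) ⊎ (xs e i ≡ 1 × ys e i ≡ 0) ⊎ (xs e i ≡ 0 × ys e i ≡ 1)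
  disjoint {e} e< A i with i <? Q
  ... | no n = inj₁ (bitN-beyond (÷V< e<) (≮⇒≥ n) , bitN-beyond (modV< e) (≮⇒≥ n))
  ... | yes i<Q = cases (xs e i) (ys e i) (bitN-≤1 (e ÷ V) i) (bitN-≤1 (e mod V) i)
      (n≤0⇒n≡0 (≤-trans (Σ-term (λ i → xs e i * ys e i) i<Q) (≤-reflexive (Active.xy A))))
    where
    cases : ∀ x y → x ≤ 1 → y ≤ 1 → x * y ≡ 0 → (x ≡ 0 × y ≡ 0) ⊎ (x ≡ 1 × y ≡ 0) ⊎ (x ≡ 0 × y ≡ 1)
    cases zero zero _ _ _ = inj₁ (refl , refl)
    cases zero (suc zero) _ _ _ = inj₂ (inj₂ (refl , refl))
    cases zero (suc (suc _)) _ (s≤s ()) _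
    cases (suc zero) zero _ _ _ = inj₂ (inj₁ (refl , refl))
    cases (suc zero) (suc _) _ _ ()
    cases (suc (suc _)) _ (s≤s ()) _ _

  wt : ℕ → ℕ
  wt v = population v Q ! * vacancy v Q !

  total-weight : Σ< wt V ≡ (suc Q) !
  total-weight = begin
    Σ< wt V                    ≡⟨ Σ-cong V (λ v _ → sym (trans (cong (wt v *_) (cong (λ z → eqN z 0) (Σ-0 Q))) (*-identityʳ (wt v)))) ⟩
    Urn.mass-urn (λ _ → 0) (λ _ → 0) free Q 0 0 ≡⟨ *-identityʳ _ ⟨
    Urn.mass-urn (λ _ → 0) (λ _ → 0) free Q 0 0 * 1 ≡⟨ cong (λ z → Urn.mass-urn (λ _ → 0) (λ _ → 0) free Q 0 0 * (suc (z + z)) !) (Σ-0 Q) ⟨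
    _ ≡⟨ Urn.mass-formula (λ _ → 0) (λ _ → 0) free Q 0 0 ⟩
    _ ≡⟨ cong (λ z → (z ! * z !) * (suc Q) !) (Σ-0 Q) ⟩
    1 * (suc Q) !              ≡⟨ *-identityˡ ((suc Q) !) ⟩
    (suc Q) !                  ∎
    where
    open ≡-Reasoning
    free : ∀ (i : ℕ) → (0 ≡ 0 × 0 ≡ 0) ⊎ (0 ≡ 1 × 0 ≡ 0) ⊎ (0 ≡ 0 × 0 ≡ 1)
    free _ = inj₁ (refl , refl)

  urn-average : ∀ {e} → e < E → Active e → (suc Q) ! ≤ D * Σ< (λ v → wt v * cov v e) V
  urn-average {e} e< A = ≤-trans (≤-reflexive (sym exact)) (≤-trans (≤-reflexive (*-comm M _)) (*-monoˡ-≤ M D≥))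
    where
    open Urn (xs e) (ys e) (disjoint e< A)
    a′ = Σ< (xs e) Q
    z′ = Σ< (ys e) Q
    M = Σ< (λ v → wt v * cov v e) V
    D≥ : suc (a′ + z′) * binom (a′ + z′) a′ ≤ D
    D≥ = *-mono-≤ (s≤s (+-mono-≤ (Active.x≤ A) (Active.y≤ A))) (binom-≤ (Active.x≤ A) (Active.y≤ A))
    f = a′ ! * z′ !
    exact : M * (suc (a′ + z′) * binom (a′ + z′) a′) ≡ (suc Q) !
    exact = *-cancelˡ-≡ _ _ f ⦃ >-nonZero (*-mono-≤ (!-pos a′) (!-pos z′)) ⦄ (begin
      f * (M * (suc (a′ + z′) * binom (a′ + z′) a′)) ≡⟨ solve 4 (λ f m s b → f :* (m :* (s :* b)) := m :* (s :* (b :* f))) refl f M (suc (a′ + z′)) (binom (a′ + z′) a′) ⟩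
      M * (suc (a′ + z′) * (binom (a′ + z′) a′ * f)) ≡⟨ cong (λ t → M * (suc (a′ + z′) * t)) (binom-! a′ z′) ⟩
      M * (suc (a′ + z′)) ! ≡⟨ mass-formula Q 0 0 ⟩
      f * (suc Q) ! ∎)
      where
      open ≡-Reasoning
      open +-*-Solver

  gain≤ : ∀ t v → v < V → covered t v ≤ covered t (choice t)
  gain≤ t v v< = proj₂ (argmax-spec (covered t) V 0<V) v v<

  -- Every uncovered event is met by at least a `1 / D` fraction of the urn weight, whose total is
  -- `(suc Q) !`; exchanging the sums, some vector, and hence the best one, covers a `1 / D`
  -- fraction of the uncovered events.
  average : ∀ t → U t ≤ D * covered t (choice t)
  average t = *-cancelʳ-≤ (U t) (D * g) ((suc Q) !) ⦃ >-nonZero (!-pos (suc Q)) ⦄ (begin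
    U t * (suc Q) ! ≡⟨ *-comm (U t) _ ⟩
    (suc Q) ! * U t ≡⟨ Σ-*ˡ ((suc Q) !) (u t) E ⟨
    Σ< (λ e → (suc Q) ! * u t e) E ≤⟨ Σ-mono E each ⟩
    Σ< (λ e → D * Σ< (λ v → u t e * (wt v * cov v e)) V) E ≡⟨ Σ-*ˡ D _ E ⟩
    D * Σ< (λ e → Σ< (λ v → u t e * (wt v * cov v e)) V) E ≡⟨ cong (D *_) (Σ-swap (λ e v → u t e * (wt v * cov v e)) E V) ⟩
    D * Σ< (λ v → Σ< (λ e → u t e * (wt v * cov v e)) E) V ≤⟨ *-monoʳ-≤ D (Σ-mono V (λ v v< → ≤-trans (≤-reflexive (trans (Σ-cong E (λ e _ → exchange (u t e) (wt v) (cov v e))) (Σ-*ˡ (wt v) (λ e → u t e * cov v e) E)))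
         (≤-trans (*-monoʳ-≤ (wt v) (gain≤ t v v<)) (≤-reflexive (*-comm (wt v) g))))) ⟩
    D * Σ< (λ v → g * wt v) V ≡⟨ cong (D *_) (trans (Σ-*ˡ g wt V) (cong (g *_) total-weight)) ⟩
    D * (g * (suc Q) !) ≡⟨ *-assoc D g _ ⟨
    D * g * (suc Q) ! ∎)
    where
    open ≤-Reasoning
    g = covered t (choice t)
    exchange : ∀ x y z → x * (y * z) ≡ y * (x * z)
    exchange x y z = trans (sym (*-assoc x y z)) (trans (cong (_* z) (*-comm x y)) (*-assoc y x z))
    each : ∀ e → e < E → (suc Q) ! * u t e ≤ D * Σ< (λ v → u t e * (wt v * cov v e)) V
    each e e< with u t e ≟ 0
    ... | yes z rewrite z = ≤-trans (≤-reflexive (*-zeroʳ ((suc Q) !))) z≤n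
    ... | no n = ≤-trans (*-monoˡ-≤ (u t e) (urn-average e< (u-active t e n)))
      (≤-reflexive (trans (*-assoc D _ (u t e)) (cong (D *_) (trans (*-comm _ (u t e)) (sym (Σ-*ˡ (u t e) (λ v → wt v * cov v e) V))))))

  U-step : ∀ t → U (suc t) + covered t (choice t) ≡ U t
  U-step t = trans (sym (Σ-+ _ _ E)) (Σ-cong E (λ e _ → trans (sym (*-distribˡ-+ (u t e) _ _))
    (trans (cong (u t e *_) (m∸n+n≡m (eqN-≤1 (violations (xs e) (ys e) (choice t) Q) 0))) (*-identityʳ (u t e)))))

  U-mono : ∀ s t → U (s + t) ≤ U t
  U-mono zero    t = ≤-refl
  U-mono (suc s) t = ≤-trans (≤-trans (m≤m+n _ _) (≤-reflexive (U-step (s + t)))) (U-mono s t)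

  -- As for the hash maps, a linear substitute for decay by `1 - 1 / D` per step; `s = D` gives a
  -- halving.
  U-run : ∀ s t → D * U (s + t) + s * U (s + t) ≤ D * U t
  U-run zero    t = ≤-reflexive (+-identityʳ _)
  U-run (suc s) t = begin
    D * U′ + suc s * U′                     ≤⟨ +-monoʳ-≤ (D * U′) (*-monoʳ-≤ (suc s) (U-mono 1 (s + t))) ⟩
    D * U′ + (U₀ + s * U₀)                  ≤⟨ +-monoʳ-≤ (D * U′) (+-monoˡ-≤ (s * U₀) (average (s + t))) ⟩
    D * U′ + (D * g + s * U₀)               ≡⟨ +-assoc (D * U′) (D * g) (s * U₀) ⟨
    D * U′ + D * g + s * U₀                 ≡⟨ cong (_+ s * U₀) (trans (sym (*-distribˡ-+ D U′ g)) (cong (D *_) (U-step (s + t)))) ⟩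
    D * U₀ + s * U₀                         ≤⟨ U-run s t ⟩
    D * U t                                 ∎
    where
    open ≤-Reasoning
    U′ = U (suc s + t)
    U₀ = U (s + t)
    g = covered (s + t) (choice (s + t))

  0<D : 0 < D
  0<D = *-mono-≤ (s≤s (z≤n {a + b})) (binom-≥1 a b)

  U-half : ∀ t → 2 * U (D + t) ≤ U t
  U-half t = *-cancelˡ-≤ D ⦃ >-nonZero 0<D ⦄ (≤-trans (≤-reflexive (trans (cong (λ z → D * (U (D + t) + z)) (+-identityʳ _)) (*-distribˡ-+ D _ _))) (U-run D t))

  U-halves : ∀ c → 2 ^ c * U (c * D) ≤ E
  U-halves zero = ≤-trans (≤-reflexive (*-identityˡ _)) (≤-trans (Σ-const active 1 E (λ e _ → active≤1 e)) (≤-reflexive (*-identityʳ E)))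
    where
    active≤1 : ∀ e → active e ≤ 1
    active≤1 e = *-mono-≤ {_} {1} (m∸n≤m 1 (Σ< (xs e) Q ∸ a)) (*-mono-≤ {_} {1} (m∸n≤m 1 (Σ< (ys e) Q ∸ b)) (eqN-≤1 (Σ< (λ i → xs e i * ys e i) Q) 0))
  U-halves (suc c) = ≤-trans (≤-reflexive (trans (cong (_* U (suc c * D)) (*-comm 2 (2 ^ c))) (*-assoc (2 ^ c) 2 _))) (≤-trans (*-monoʳ-≤ (2 ^ c) (U-half (c * D))) (U-halves c))

  -- There are at most `2 ^ (Q + Q)` active events, so `suc (Q + Q)` halvings of `D` steps each
  -- leave none.
  enough : ℕ
  enough = suc (Q + Q) * D

  U-end : ∀ {t} → enough ≤ t → U t ≡ 0
  U-end {t} le = n≤0⇒n≡0 (≤-trans (≤-reflexive (cong U (sym (m∸n+n≡m le)))) (≤-trans (U-mono (t ∸ enough) enough) (≤-pred (≰⇒> absurd))))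
    where
    absurd : ¬ (1 ≤ U enough)
    absurd 1≤ = <⇒≱ (^-monoʳ-< 2 (s≤s (s≤s z≤n)) (n<1+n (Q + Q)))
      (≤-trans (≤-reflexive (sym (*-identityʳ (2 ^ suc (Q + Q))))) (≤-trans (*-monoʳ-≤ (2 ^ suc (Q + Q)) 1≤) (≤-trans (U-halves (suc (Q + Q))) (≤-reflexive (sym (^-distribˡ-+-* 2 Q Q))))))

  top-÷ : ∀ t → top t ÷ V ≡ covered t (choice t) × choice t < V
  top-÷ t with best-attained (covered t) V V 0<V
  ... | v , v< , eq = trans (cong (_÷ V) eq) (trans (proj₁ (÷-block (covered t v) V v<)) (cong (covered t) (sym ch))) , subst (_< V) (sym ch) v<
    where
    ch : choice t ≡ v
    ch = trans (cong (_mod V) eq) (proj₂ (÷-block (covered t v) V v<))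

  flag-≤1 : ∀ t → flag t ≤ 1
  flag-≤1 t = m∸n≤m 1 (1 ∸ (top t ÷ V))

  flag-0 : ∀ t → covered t (choice t) ≡ 0 → flag t ≡ 0
  flag-0 t z rewrite trans (proj₁ (top-÷ t)) z = refl

  flag-1 : ∀ t → covered t (choice t) ≢ 0 → flag t ≡ 1
  flag-1 t n with covered t (choice t) | proj₁ (top-÷ t)
  ... | zero  | _ = ⊥-elim (n refl)
  ... | suc g | e rewrite e = cong (1 ∸_) (0∸n≡0 g)

  idle : ∀ t → enough ≤ t → covered t (choice t) ≡ 0
  idle t le = n≤0⇒n≡0 (≤-trans (≤-trans (m≤n+m _ (U (suc t))) (≤-reflexive (U-step t))) (≤-reflexive (U-end le)))

  greedy-size : ∀ t → size# (greedy t) ≤ size# R₀ + enough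
  greedy-size t = ≤-trans (count t) (+-monoʳ-≤ (size# R₀) (m⊓n≤n t enough))
    where
    picked : ∀ R x b → size# (pick b R (R ▹ x)) ≤ suc (size# R)
    picked R x zero    = n≤1+n _
    picked R x (suc b) = ≤-refl
    count : ∀ t → size# (greedy t) ≤ size# R₀ + t ⊓ enough
    count zero = ≤-reflexive (sym (+-identityʳ _))
    count (suc t) with suc t ≤? enough
    ... | yes le rewrite m≤n⇒m⊓n≡m le = ≤-trans (picked (greedy t) _ (flag t)) (≤-trans (s≤s (≤-trans (count t) (+-monoʳ-≤ (size# R₀) (m⊓n≤m t enough)))) (≤-reflexive (sym (+-suc (size# R₀) t))))
    ... | no ¬le rewrite m≥n⇒m⊓n≡n (<⇒≤ (≰⇒> ¬le)) | flag-0 t (idle t (≤-pred (≰⇒> ¬le))) = ≤-trans (count t) (+-monoʳ-≤ (size# R₀) (m⊓n≤n t enough))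

  greedy-prefix : ∀ {s t} → s ≤′ t → Prefix (greedy s) (greedy t)
  greedy-prefix ≤′-refl = Prefix-refl
  greedy-prefix (≤′-step {t} le) = Prefix-trans (greedy-prefix le) (Prefix-pick (flag t) Prefix-refl (Prefix-ext {greedy t} (λ _ → a , bitN (choice t)) 1))

  greedy-tags : ∀ {B} t → a ≤ B → Tags≤ B R₀ → Tags≤ B (greedy t)
  greedy-tags zero    a≤ T = T
  greedy-tags {B} (suc t) a≤ T with flag t
  ... | zero  = greedy-tags t a≤ T
  ... | suc _ = greedy-tags t a≤ T , a≤

  greedy-count : ∀ t c → c ≢ a → countTag c (greedy t) ≡ countTag c R₀
  greedy-count zero    c n = refl
  greedy-count (suc t) c n with flag t
  ... | zero  = greedy-count t c n
  ... | suc _ = trans (cong₂ _+_ (greedy-count t c n) (eqN-≢ (n ∘ sym))) (+-identityʳ _)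

  -- The event is traced back to the step at which it was covered; that step had a positive gain, so
  -- its choice was recorded.
  greedy-covers : ∀ {t e} → enough ≤ t → e < E → Active e →
    ∃ λ v → v < V × (a , bitN v) ∈ʳ greedy t × cov v e ≢ 0
  greedy-covers {t} {e} le e< A = search t (n≤0⇒n≡0 (≤-trans (Σ-term (u t) e<) (≤-reflexive (U-end le))))
    where
    search : ∀ t → u t e ≡ 0 → ∃ λ v → v < V × (a , bitN v) ∈ʳ greedy t × cov v e ≢ 0
    search zero z with trans (sym (true-active A)) z
    ... | ()
    search (suc t) z with u t e ≟ 0
    ... | yes z′ with search t z′
    ...   | v , v< , v∈ , c = v , v< , ∈-prefix (greedy-prefix {t} {suc t} (≤′-step ≤′-refl)) v∈ , c
    search (suc t) z | no n = choice t , proj₂ (top-÷ t) , newest , hit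
      where
      hit : cov (choice t) e ≢ 0
      hit c = n (trans (sym (*-identityʳ (u t e))) (trans (cong (λ k → u t e * (1 ∸ k)) (sym c)) z))
      some : covered t (choice t) ≢ 0
      some c = (λ z′ → [ n , hit ]′ (m*n≡0⇒m≡0∨n≡0 (u t e) z′)) (n≤0⇒n≡0 (≤-trans (Σ-term (λ e → u t e * cov (choice t) e) e<) (≤-reflexive c)))
      newest : (a , bitN (choice t)) ∈ʳ greedy (suc t)
      newest rewrite flag-1 t some = size# (greedy t) , ≤-refl , at-last _ (greedy t) (a , bitN (choice t))

-- The program of the greedy cover.

bitE : ∀ {n} → Exp n → Exp n → Exp n
bitE v i = modE (op quo v (pow2E i)) (lit 2)

-- Fragments for an event e = x * V + y; the arguments give the variables of e, V, Q.
xE yE : ∀ {n} → Fin n → Fin n → Exp n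
xE e V = op quo (var e) (var V)
yE e V = modE (var e) (var V)

meetsE : ∀ {n} → Fin n → Fin n → Fin n → Fin n → Exp n
meetsE v e V Q = eqE (fold (var Q) (lit 0) (op add (var 1F) (op add
  (op mul (bitE (xE (suc (suc e)) (suc (suc V))) (var 0F)) (op sub (lit 1) (bitE (var (suc (suc v))) (var 0F))))
  (op mul (bitE (yE (suc (suc e)) (suc (suc V))) (var 0F)) (bitE (var (suc (suc v))) (var 0F)))))) (lit 0)

sumE : ∀ {n} → Fin n → Exp (2 + n) → Exp n
sumE Q e = fold (var Q) (lit 0) (op add (var 1F) e)

-- The variables are e, a, b, Q, V.
activeE : ∀ {n} → Exp (5 + n)
activeE = op mul (op sub (lit 1) (op sub (sumE 3F (bitE (xE 2F 6F) (var 0F))) (var 1F)))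
  (op mul (op sub (lit 1) (op sub (sumE 3F (bitE (yE 2F 6F) (var 0F))) (var 2F)))
    (eqE (sumE 3F (op mul (bitE (xE 2F 6F) (var 0F)) (bitE (yE 2F 6F) (var 0F)))) (lit 0)))

-- The variables are t, a, b, Q, V, E, T.
topE : ∀ {n} → Exp (7 + n)
topE = fold (var 4F) (lit 0) (maxE (var 1F) (op add (op mul
  (fold (var 7F) (lit 0) (op add (var 1F) (op mul (get Uₛ (op add (op mul (var 4F) (var 9F)) (var 0F))) (meetsE 2F 0F 8F 7F))))
  (var 6F)) (var 0F)))

-- The variables are a, b, Q, V = 2 ^ Q, E = V * V and the number T of steps.
greedyS : ∀ {n} → Stmt (6 + n)
greedyS = clear Uₛ ⨾ loop (var 4F) (push Uₛ activeE′) ⨾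
  loop (var 5F) (bind topE (
    loop (op sub (lit 1) (op sub (lit 1) (op quo (var 0F) (var 5F))))
      (rowS Bₛ (var 5F) (bitE (modE (var 2F) (var 7F)) (var 0F)) (var 3F)) ⨾
    bind (modE (var 0F) (var 5F)) (loop (var 7F)
      (push Uₛ (op mul (get Uₛ (op add (op mul (var 3F) (var 8F)) (var 0F))) (op sub (lit 1) (meetsE 1F 0F 7F 6F)))))))
  where activeE′ = activeE

-- Requirements as lists of positions.

Disjoint : List ℕ → List ℕ → Set
Disjoint os zs = LAll (λ o → LAll (o ≢_) zs) os

Bounded# : ℕ → List ℕ → Set
Bounded# q = LAll (_< q)

Hits : (ℕ → ℕ) → List ℕ → List ℕ → Set
Hits f os zs = LAll (λ o → f o ≢ 0) os × LAll (λ z → f z ≡ 0) zs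

occurs : List ℕ → ℕ → ℕ
occurs []       y = 0
occurs (o ∷ os) y = eqN o y + occurs os y

occurs-in : ∀ {os} → LAll (λ o → occurs os o ≢ 0) os
occurs-in {[]} = []ᵃ
occurs-in {o ∷ os} = (λ e → one≢0 (trans (sym (eqN-refl o)) (m+n≡0⇒m≡0 _ e))) ∷ᵃ LAll.map (λ {x} n e → n (m+n≡0⇒n≡0 (eqN o x) e)) occurs-in
  where
  one≢0 : 1 ≢ 0
  one≢0 ()

occurs-out : ∀ os {z} → LAll (_≢ z) os → occurs os z ≡ 0
occurs-out [] []ᵃ = refl
occurs-out (o ∷ os) (n ∷ᵃ ns) = cong₂ _+_ (eqN-≢ n) (occurs-out os ns)

Disjoint-swap : ∀ {os zs} → Disjoint os zs → LAll (λ z → LAll (_≢ z) os) zs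
Disjoint-swap {zs = []} _ = []ᵃ
Disjoint-swap {zs = z ∷ zs} d = LAll.map (λ { (n ∷ᵃ _) → n }) d ∷ᵃ Disjoint-swap (LAll.map (λ { (_ ∷ᵃ ns) → ns }) d)

occurs-hits : ∀ os zs → Disjoint os zs → Hits (occurs os) os zs
occurs-hits os zs d = occurs-in , LAll.map (occurs-out os) (Disjoint-swap d)

Hits-cong : ∀ {q f g os zs} → Bounded# q os → Bounded# q zs → (∀ y → y < q → f y ≡ g y) → Hits f os zs → Hits g os zs
Hits-cong {q} {f} {g} bo bz eq (ho , hz) = go bo ho , gz bz hz
  where
  go : ∀ {os} → Bounded# q os → LAll (λ o → f o ≢ 0) os → LAll (λ o → g o ≢ 0) os
  go []ᵃ []ᵃ = []ᵃ
  go (b ∷ᵃ bs) (n ∷ᵃ ns) = (λ e → n (trans (eq _ b) e)) ∷ᵃ go bs ns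
  gz : ∀ {zs} → Bounded# q zs → LAll (λ z → f z ≡ 0) zs → LAll (λ z → g z ≡ 0) zs
  gz []ᵃ []ᵃ = []ᵃ
  gz (b ∷ᵃ bs) (n ∷ᵃ ns) = trans (sym (eq _ b)) n ∷ᵃ gz bs ns

encode : ℕ → List ℕ → ℕ
encode j []       = 0
encode j (o ∷ os) = encode j os * 2 ^ j + o

encode-< : ∀ j {os} → Bounded# (2 ^ j) os → encode j os < 2 ^ (length os * j)
encode-< j []ᵃ = ≤-refl
encode-< j {o ∷ os} (o< ∷ᵃ bs) = <-≤-trans (block-< (encode-< j bs) o<) (≤-reflexive (trans (*-comm (2 ^ (length os * j)) (2 ^ j)) (sym (^-distribˡ-+-* 2 j (length os * j)))))

tuple-occurs : ∀ j os → Bounded# (2 ^ j) os → ∀ y → proj₂ (tuple j (length os) (encode j os)) y ≡ occurs os y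
tuple-occurs j os bs y = sums os bs
  where
  instance _ = m^n≢0 2 j
  digit : ℕ → ℕ → ℕ
  digit t i = eqN ((t ÷ 2 ^ (i * j)) mod 2 ^ j) y
  shift : ∀ t o i → o < 2 ^ j → (t * 2 ^ j + o) ÷ 2 ^ (suc i * j) ≡ t ÷ 2 ^ (i * j)
  shift t o i o< = begin
    (t * 2 ^ j + o) ÷ 2 ^ (j + i * j)  ≡⟨ ÷-/ (t * 2 ^ j + o) (2 ^ (j + i * j)) ⦃ m^n≢0 2 (j + i * j) ⦄ ⟩
    _/_ (t * 2 ^ j + o) (2 ^ (j + i * j)) ⦃ m^n≢0 2 (j + i * j) ⦄  ≡⟨ /-congʳ ⦃ m^n≢0 2 (j + i * j) ⦄ ⦃ nz ⦄ (^-distribˡ-+-* 2 j (i * j)) ⟩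
    _/_ (t * 2 ^ j + o) (2 ^ j * 2 ^ (i * j)) ⦃ nz ⦄ ≡⟨ m/n/o≡m/[n*o] (t * 2 ^ j + o) (2 ^ j) (2 ^ (i * j)) ⦃ _ ⦄ ⦃ m^n≢0 2 (i * j) ⦄ ⦃ nz ⦄ ⟨
    _/_ ((t * 2 ^ j + o) / 2 ^ j) (2 ^ (i * j)) ⦃ m^n≢0 2 (i * j) ⦄ ≡⟨ ÷-/ ((t * 2 ^ j + o) / 2 ^ j) (2 ^ (i * j)) ⦃ m^n≢0 2 (i * j) ⦄ ⟨
    ((t * 2 ^ j + o) / 2 ^ j) ÷ 2 ^ (i * j) ≡⟨ cong (_÷ 2 ^ (i * j)) (trans (sym (÷-/ (t * 2 ^ j + o) (2 ^ j))) (proj₁ (÷-block t (2 ^ j) o<))) ⟩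
    t ÷ 2 ^ (i * j) ∎
    where
    open ≡-Reasoning
    nz : NonZero (2 ^ j * 2 ^ (i * j))
    nz = m*n≢0 (2 ^ j) (2 ^ (i * j)) ⦃ m^n≢0 2 j ⦄ ⦃ m^n≢0 2 (i * j) ⦄
  front : ∀ (f : ℕ → ℕ) n → Σ< f (suc n) ≡ f 0 + Σ< (f ∘ suc) n
  front f zero    = +-comm 0 (f 0)
  front f (suc n) = trans (cong (_+ f (suc n)) (front f n)) (+-assoc (f 0) _ _)
  sums : ∀ os → Bounded# (2 ^ j) os → Σ< (digit (encode j os)) (length os) ≡ occurs os y
  sums [] []ᵃ = refl
  sums (o ∷ os) (o< ∷ᵃ bs) = trans (front (digit (encode j (o ∷ os))) (length os)) (cong₂ _+_
    (trans (cong (λ t → eqN (t mod 2 ^ j) y) (n/1≡n (encode j os * 2 ^ j + o))) (cong (λ t → eqN t y) (proj₂ (÷-block (encode j os) (2 ^ j) o<))))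
    (trans (Σ-cong (length os) (λ i _ → cong (λ t → eqN (t mod 2 ^ j) y) (shift (encode j os) o i o<))) (sums os bs)))

number : (ℕ → ℕ) → ℕ → ℕ
number f zero    = 0
number f (suc Q) = f Q * 2 ^ Q + number f Q

number-< : ∀ f Q → (∀ i → f i ≤ 1) → number f Q < 2 ^ Q
number-< f zero    h = ≤-refl
number-< f (suc Q) h = <-≤-trans (+-mono-≤-< (≤-trans (*-monoˡ-≤ (2 ^ Q) (h Q)) (≤-reflexive (*-identityˡ (2 ^ Q)))) (number-< f Q h)) (≤-reflexive (cong (2 ^ Q +_) (sym (+-identityʳ (2 ^ Q)))))

bitN-number : ∀ f Q → (∀ i → f i ≤ 1) → ∀ i → i < Q → bitN (number f Q) i ≡ f i
bitN-number f (suc Q) h i i<1+Q with f Q in eq | h Q | m≤n⇒m<n∨m≡n (≤-pred i<1+Q)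
... | zero  | _ | inj₁ i<Q = bitN-number f Q h i i<Q
... | zero  | _ | inj₂ refl = trans (bitN-top Q (number f Q) (number-< f Q h)) (sym eq)
... | suc zero | _ | inj₁ i<Q rewrite *-identityˡ (2 ^ Q) = trans (bitN-low Q (number f Q) i i<Q) (bitN-number f Q h i i<Q)
... | suc zero | _ | inj₂ refl rewrite *-identityˡ (2 ^ Q) = trans (bitN-set Q (number f Q) (number-< f Q h)) (sym eq)
... | suc (suc _) | s≤s () | _

-- Hashing may send several positions to one cell; the indicator forgets multiplicities, and list
-- lengths still bound its sum.
indicator : List ℕ → ℕ → ℕ
indicator os y = 1 ∸ (1 ∸ occurs os y)

indicator-≤1 : ∀ os y → indicator os y ≤ 1
indicator-≤1 os y = m∸n≤m 1 (1 ∸ occurs os y)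

indicator-≤ : ∀ os y → indicator os y ≤ occurs os y
indicator-≤ os y with occurs os y
... | zero  = z≤n
... | suc k = ≤-trans (m∸n≤m 1 (0 ∸ k)) (s≤s z≤n)

occurs-count : ∀ os n → Σ< (occurs os) n ≤ length os
occurs-count [] n = ≤-reflexive (Σ-0 n)
occurs-count (o ∷ os) n = ≤-trans (≤-reflexive (Σ-+ (eqN o) (occurs os) n)) (+-mono-≤ (Σ-eqN o n) (occurs-count os n))

indicator-count : ∀ os n → Σ< (indicator os) n ≤ length os
indicator-count os n = ≤-trans (Σ-mono n (λ y _ → indicator-≤ os y)) (occurs-count os n)

module DenseBase (Q a b : ℕ) (R : Rows) where

  open Greedy Q a b R

  covers : ∀ {t} → enough ≤ t → ∀ os zs → length os ≤ a → length zs ≤ b → Bounded# Q os → Bounded# Q zs → Disjoint os zs →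
    ∃ λ x → x ∈ʳ greedy t × proj₁ x ≡ a × Hits (proj₂ x) os zs
  covers {t} le os zs os≤ zs≤ bo bz dis with greedy-covers {t} {e} le e< act
    where
    X = number (indicator os) Q
    Y = number (indicator zs) Q
    X< = number-< (indicator os) Q (indicator-≤1 os)
    Y< = number-< (indicator zs) Q (indicator-≤1 zs)
    e = X * 2 ^ Q + Y
    e< : e < E
    e< = block-< X< Y<
    xs≡ : ∀ i → i < Q → xs e i ≡ indicator os i
    xs≡ i i< = trans (cong (λ v → bitN v i) (proj₁ (÷-block X (2 ^ Q) Y<))) (bitN-number (indicator os) Q (indicator-≤1 os) i i<)
    ys≡ : ∀ i → i < Q → ys e i ≡ indicator zs i
    ys≡ i i< = trans (cong (λ v → bitN v i) (proj₂ (÷-block X (2 ^ Q) Y<))) (bitN-number (indicator zs) Q (indicator-≤1 zs) i i<)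
    apart : ∀ i → indicator os i * indicator zs i ≡ 0
    apart i with occurs os i ≟ 0
    ... | yes o rewrite o = refl
    ... | no n = trans (cong (λ k → indicator os i * (1 ∸ (1 ∸ k))) (occurs-out zs (LAll.map (λ p → p ∘ sym) (found os dis n)))) (*-zeroʳ (indicator os i))
      where
      found : ∀ os → Disjoint os zs → occurs os i ≢ 0 → LAll (i ≢_) zs
      found [] []ᵃ n = ⊥-elim (n refl)
      found (o ∷ os) (d ∷ᵃ ds) n with o ≟ i
      ... | yes refl = d
      ... | no o≢i = found os ds (λ z → n (cong₂ _+_ (eqN-≢ o≢i) z))
    act : Active e
    act = record
      { x≤ = ≤-trans (≤-reflexive (Σ-cong Q xs≡)) (≤-trans (indicator-count os Q) os≤)
      ; y≤ = ≤-trans (≤-reflexive (Σ-cong Q ys≡)) (≤-trans (indicator-count zs Q) zs≤)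
      ; xy = trans (Σ-cong Q (λ i i< → trans (cong₂ _*_ (xs≡ i i<) (ys≡ i i<)) (apart i))) (Σ-0 Q) }
  ... | v , v< , v∈ , hit = (a , bitN v) , v∈ , refl , all-ones bo occurs-in , all-zeros bz occurs-in
    where
    X = number (indicator os) Q
    Y = number (indicator zs) Q
    Y< = number-< (indicator zs) Q (indicator-≤1 zs)
    e = X * 2 ^ Q + Y
    none-violated : violations (xs e) (ys e) v Q ≡ 0
    none-violated = eqN≢0 hit
    at-bit : ∀ i → i < Q → xs e i * (1 ∸ bitN v i) + ys e i * bitN v i ≡ 0
    at-bit i i< = n≤0⇒n≡0 (≤-trans (Σ-term (λ i → xs e i * (1 ∸ bitN v i) + ys e i * bitN v i) i<) (≤-reflexive none-violated))
    set : ∀ {k} → k ≢ 0 → 1 ∸ (1 ∸ k) ≡ 1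
    set {zero} n = ⊥-elim (n refl)
    set {suc k} _ = cong (1 ∸_) (0∸n≡0 k)
    all-ones : ∀ {os′} → Bounded# Q os′ → LAll (λ o → occurs os o ≢ 0) os′ → LAll (λ o → bitN v o ≢ 0) os′
    all-ones []ᵃ []ᵃ = []ᵃ
    all-ones {o ∷ _} (o< ∷ᵃ bs) (n ∷ᵃ ns) = (λ z → contradiction (trans (sym (cong₂ _*_ (trans (trans (cong (λ v → bitN v o) (proj₁ (÷-block X (2 ^ Q) Y<))) (bitN-number (indicator os) Q (indicator-≤1 os) o o<)) (set n)) (cong (1 ∸_) z))) (m+n≡0⇒m≡0 _ (at-bit o o<))) (λ ()))
      ∷ᵃ all-ones bs ns
    all-zeros : ∀ {zs′} → Bounded# Q zs′ → LAll (λ z → occurs zs z ≢ 0) zs′ → LAll (λ z → bitN v z ≡ 0) zs′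
    all-zeros []ᵃ []ᵃ = []ᵃ
    all-zeros {z ∷ _} (z< ∷ᵃ bs) (n ∷ᵃ ns) = trans (sym (*-identityˡ _)) (trans (cong (_* bitN v z) (sym (trans (trans (cong (λ v → bitN v z) (proj₂ (÷-block X (2 ^ Q) Y<))) (bitN-number (indicator zs) Q (indicator-≤1 zs) z z<)) (set n)))) (m+n≡0⇒n≡0 (xs e z * (1 ∸ bitN v z)) (at-bit z z<)))
      ∷ᵃ all-zeros bs ns

positions : (Cell → ℕ) → Pattern → ℕ → List ℕ
positions F p zero    = []
positions F p (suc n) with F (p n)
... | zero  = positions F p n
... | suc _ = n ∷ positions F p n

positions-length : ∀ (F : Cell → ℕ) → (∀ c → F c ≤ 1) → ∀ p n → length (positions F p n) ≡ Σ< (F ∘ p) n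
positions-length F h p zero = refl
positions-length F h p (suc n) with F (p n) | h (p n)
... | zero  | _ = trans (positions-length F h p n) (sym (+-identityʳ _))
... | suc zero | _ = trans (cong suc (positions-length F h p n)) (+-comm 1 _)
... | suc (suc _) | s≤s ()

positions-all : ∀ (F : Cell → ℕ) p n → LAll (λ y → y < n × F (p y) ≢ 0) (positions F p n)
positions-all F p zero = []ᵃ
positions-all F p (suc n) with F (p n) in eq
... | zero  = LAll.map (λ (y< , ne) → m≤n⇒m≤1+n y< , ne) (positions-all F p n)
... | suc _ = (≤-refl , λ z → case trans (sym eq) z of λ ()) ∷ᵃ LAll.map (λ (y< , ne) → m≤n⇒m≤1+n y< , ne) (positions-all F p n)

positions-complete : ∀ (F : Cell → ℕ) p n {P : ℕ → Set} → LAll P (positions F p n) → ∀ y → y < n → F (p y) ≢ 0 → P y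
positions-complete F p (suc n) ps y y<1+n ne with F (p n) in eq | m≤n⇒m<n∨m≡n (≤-pred y<1+n)
... | zero  | inj₁ y<n = positions-complete F p n ps y y<n ne
... | zero  | inj₂ refl = ⊥-elim (ne eq)
positions-complete F p (suc n) (px ∷ᵃ ps) y y<1+n ne | suc _ | inj₁ y<n = positions-complete F p n ps y y<n ne
positions-complete F p (suc n) (px ∷ᵃ ps) y y<1+n ne | suc _ | inj₂ refl = px

pairs : List ℕ → List ℕ → List (ℕ × ℕ)
pairs []       zs = []
pairs (o ∷ os) zs = List.map (o ,_) zs ++ pairs os zs

length-pairs : ∀ os zs → length (pairs os zs) ≡ length os * length zs
length-pairs []       zs = refl
length-pairs (o ∷ os) zs = trans (length-++ (List.map (o ,_) zs)) (cong₂ _+_ (Data.List.Properties.length-map (o ,_) zs) (length-pairs os zs))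

pairs-all : ∀ {P : ℕ × ℕ → Set} os zs → LAll (λ o → LAll (λ z → P (o , z)) zs) os → LAll P (pairs os zs)
pairs-all [] zs []ᵃ = []ᵃ
pairs-all {P} (o ∷ os) zs (h ∷ᵃ hs) = Data.List.Relation.Unary.All.Properties.++⁺ (Data.List.Relation.Unary.All.Properties.map⁺ h) (pairs-all os zs hs)

all-pairs : ∀ {P : ℕ × ℕ → Set} os zs → LAll P (pairs os zs) → LAll (λ o → LAll (λ z → P (o , z)) zs) os
all-pairs [] zs _ = []ᵃ
all-pairs {P} (o ∷ os) zs h = Data.List.Relation.Unary.All.Properties.map⁻ (Data.List.Relation.Unary.All.Properties.++⁻ˡ (List.map (o ,_) zs) h) ∷ᵃ all-pairs os zs (Data.List.Relation.Unary.All.Properties.++⁻ʳ (List.map (o ,_) zs) h)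

map-all : ∀ {P : ℕ → Set} (f : ℕ → ℕ) {xs} → LAll (P ∘ f) xs → LAll P (List.map f xs)
map-all f = Data.List.Relation.Unary.All.Properties.map⁺

all-map : ∀ {P : ℕ → Set} (f : ℕ → ℕ) {xs} → LAll P (List.map f xs) → LAll (P ∘ f) xs
all-map f = Data.List.Relation.Unary.All.Properties.map⁻

-- Only pairs of a one and a zero have to be kept apart; collisions among ones or among zeros are
-- harmless. This is why `r * s` cells suffice up to a constant.
separate : ∀ j k e → 0 < e → 2 ^ j ≡ 2 * e → 0 < k → ∀ os zs → Bounded# (2 ^ k) os → Bounded# (2 ^ k) zs → Disjoint os zs → 4 * (length os * length zs) < 2 ^ j →
  ∃ λ c → c < e * k × Disjoint (List.map (Hash.Columns.col j k c) os) (List.map (Hash.Columns.col j k c) zs)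
separate j k e 0<e q≡ 0<k os zs bo bz dis few with Hash.Columns.Separation.separating j k e 0<e q≡ 0<k
    (pairs-all os zs (apart os bo dis)) (≤-<-trans (≤-reflexive (cong (4 *_) (length-pairs os zs))) few)
  where
  apart₁ : ∀ {o} zs → o < 2 ^ k → Bounded# (2 ^ k) zs → LAll (o ≢_) zs → LAll (λ z → Hash.Columns.Separation.Apart j k e 0<e q≡ (o , z)) zs
  apart₁ [] o< []ᵃ []ᵃ = []ᵃ
  apart₁ (z ∷ zs) o< (z< ∷ᵃ bz) (n ∷ᵃ ns) = (o< , z< , n) ∷ᵃ apart₁ zs o< bz ns
  apart : ∀ os → Bounded# (2 ^ k) os → Disjoint os zs → LAll (λ o → LAll (λ z → Hash.Columns.Separation.Apart j k e 0<e q≡ (o , z)) zs) os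
  apart [] []ᵃ []ᵃ = []ᵃ
  apart (o ∷ os) (o< ∷ᵃ bo) (d ∷ᵃ ds) = apart₁ zs o< bz d ∷ᵃ apart os bo ds
... | c , c< , sep = c , c< , map-all _ (LAll.map (λ h → map-all _ h) (all-pairs os zs sep))

-- Covers of all requirements on the cells.

record Covers (q r s : ℕ) (R : Rows) : Set where
  field
    cover : ∀ os zs → length os ≡ r → length zs ≡ s → Bounded# q os → Bounded# q zs → Disjoint os zs →
            ∃ λ x → x ∈ʳ R × Hits (proj₂ x) os zs

tuples-cover : ∀ j r s R → Covers (2 ^ j) r s (ext R (tuple j r) (2 ^ (r * j)))
tuples-cover j r s R = record { cover = λ { os zs refl _ bo bz dis → tuple j (length os) (encode j os) , ∈-ext (tuple j (length os)) _ (encode-< j bo) ,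
  Hits-cong bo bz (λ y _ → sym (tuple-occurs j os bo y)) (occurs-hits os zs dis) } }

patternOf : List ℕ → List ℕ → Pattern
patternOf os zs y with occurs os y | occurs zs y
... | suc _ | _     = one-bit
... | zero  | suc _ = zero-bit
... | zero  | zero  = star

patternOf-ones : ∀ os zs n → ones (patternOf os zs) n ≤ length os
patternOf-ones os zs n = ≤-trans (Σ-mono n (λ y _ → each y)) (occurs-count os n)
  where
  each : ∀ y → weigh 1 0 (patternOf os zs y) ≤ occurs os y
  each y with occurs os y | occurs zs y
  ... | suc _ | _     = s≤s z≤n
  ... | zero  | suc _ = z≤n
  ... | zero  | zero  = z≤n

patternOf-zeros : ∀ os zs n → zeros (patternOf os zs) n ≤ length zs
patternOf-zeros os zs n = ≤-trans (Σ-mono n (λ y _ → each y)) (occurs-count zs n)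
  where
  each : ∀ y → weigh 0 1 (patternOf os zs y) ≤ occurs zs y
  each y with occurs os y | occurs zs y
  ... | suc _ | _     = z≤n
  ... | zero  | suc _ = s≤s z≤n
  ... | zero  | zero  = z≤n

patternOf-hits : ∀ {q f} os zs → Bounded# q os → Bounded# q zs → Disjoint os zs → Fits q (patternOf os zs) f → Hits f os zs
patternOf-hits {q} {f} os zs bo bz dis fits = on bo occurs-in , off bz (LAll.zip (occurs-in , LAll.map (occurs-out os) (Disjoint-swap dis)))
  where
  one-at : ∀ y → occurs os y ≢ 0 → patternOf os zs y ≡ one-bit
  one-at y n with occurs os y | occurs zs y
  ... | suc _ | _ = refl
  ... | zero  | _ = ⊥-elim (n refl)
  zero-at : ∀ y → occurs zs y ≢ 0 → occurs os y ≡ 0 → patternOf os zs y ≡ zero-bit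
  zero-at y n z with occurs os y | occurs zs y
  ... | suc _ | _ = ⊥-elim (case z of λ ())
  ... | zero  | suc _ = refl
  ... | zero  | zero = ⊥-elim (n refl)
  on : ∀ {os′} → Bounded# q os′ → LAll (λ o → occurs os o ≢ 0) os′ → LAll (λ o → f o ≢ 0) os′
  on []ᵃ []ᵃ = []ᵃ
  on {o ∷ _} (o< ∷ᵃ bs) (n ∷ᵃ ns) = subst (λ c → Fit c (f o)) (one-at o n) (fits o o<) ∷ᵃ on bs ns
  off : ∀ {zs′} → Bounded# q zs′ → LAll (λ z → occurs zs z ≢ 0 × occurs os z ≡ 0) zs′ → LAll (λ z → f z ≡ 0) zs′
  off []ᵃ []ᵃ = []ᵃ
  off {z ∷ _} (z< ∷ᵃ bs) ((n , e) ∷ᵃ ns) = subst (λ c → Fit c (f z)) (zero-at z n e) (fits z z<) ∷ᵃ off bs ns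

-- Entries may be multiplicities; a bound on them is needed for machine words.
AllBits : ℕ → Rows → Set
AllBits B ε             = ⊤
AllBits B (R ▹ (_ , f)) = AllBits B R × (∀ y → f y ≤ B)

AllBits-ext : ∀ {B R} f n → AllBits B R → (∀ i y → i < n → proj₂ (f i) y ≤ B) → AllBits B (ext R f n)
AllBits-ext f zero    T h = T
AllBits-ext f (suc n) T h = AllBits-ext f n T (λ i y i< → h i y (m≤n⇒m≤1+n i<)) , λ y → h n y ≤-refl

AllBits-pick : ∀ {B R S} b → AllBits B R → AllBits B S → AllBits B (pick b R S)
AllBits-pick zero    x y = x
AllBits-pick (suc _) x y = y

AllBits-bit : ∀ {B} R i y → AllBits B R → bit R i y ≤ B
AllBits-bit ε i y T = z≤n
AllBits-bit {B} (R ▹ (t , f)) i y (T , h) with i ≡ᵇ size# R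
... | true  = h y
... | false = AllBits-bit R i y T

Tags≤-any : ∀ {b} R i → Tags≤ b R → tag R i ≤ b
Tags≤-any ε i T = z≤n
Tags≤-any (R ▹ (t , f)) i (T , t≤) with i ≡ᵇ size# R
... | true  = t≤
... | false = Tags≤-any R i T

Tags≤-weaken : ∀ {b c} R → b ≤ c → Tags≤ b R → Tags≤ c R
Tags≤-weaken ε             le T = tt
Tags≤-weaken (R ▹ (t , f)) le (T , t≤) = Tags≤-weaken R le T , ≤-trans t≤ le

tuple-bits : ∀ j a t y → proj₂ (tuple j a t) y ≤ a
tuple-bits j a t y = ≤-trans (Σ-const _ 1 a (λ i _ → eqN-≤1 ((t ÷ 2 ^ (i * j)) mod 2 ^ j) y)) (≤-reflexive (*-identityʳ a))

-- Base families for a single block.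

-- Base families over 2 ^ j cells, with ω the largest number of ones in a block.
sparseRows : ℕ → ℕ → Rows
sparseRows j zero    = ε
sparseRows j (suc a) = ext (sparseRows j a) (tuple j a) (2 ^ (a * j))

-- A bound on `enough` uniform in the number of ones: `2 ^ ω` stands for the binomial coefficient,
-- which the program never computes.
steps : ℕ → ℕ → ℕ
steps ω Q = (ω + 1) * (2 ^ ω * ((Q + Q) + 1))

-- One greedy cover for each number of ones below the argument, against as many zeros as load `ω`
-- permits.
denseRows : ℕ → ℕ → ℕ → Rows
denseRows ω Q zero    = ε
denseRows ω Q (suc a) = Greedy.greedy Q a (ω ∸ a) (denseRows ω Q a) (steps ω Q)

sparse-prefix : ∀ j {a b} → a ≤′ b → Prefix (sparseRows j a) (sparseRows j b)
sparse-prefix j ≤′-refl = Prefix-refl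
sparse-prefix j (≤′-step {b} le) = Prefix-trans (sparse-prefix j le) (Prefix-ext (tuple j b) _)

dense-prefix : ∀ ω Q {a b} → a ≤′ b → Prefix (denseRows ω Q a) (denseRows ω Q b)
dense-prefix ω Q ≤′-refl = Prefix-refl
dense-prefix ω Q (≤′-step {b} le) = Prefix-trans (dense-prefix ω Q le) (Greedy.greedy-prefix Q b (ω ∸ b) (denseRows ω Q b) {0} {steps ω Q} (≤⇒≤′ z≤n))

sparse-bits : ∀ j ω a → a ≤ suc ω → AllBits ω (sparseRows j a)
sparse-bits j ω zero    _ = tt
sparse-bits j ω (suc a) (s≤s a≤) = AllBits-ext (tuple j a) _ (sparse-bits j ω a (m≤n⇒m≤1+n a≤)) (λ t y _ → ≤-trans (tuple-bits j a t y) a≤)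

sparse-tags : ∀ j ω a → a ≤ suc ω → Tags≤ ω (sparseRows j a)
sparse-tags j ω zero    _ = tt
sparse-tags j ω (suc a) (s≤s a≤) = Tags≤-ext (tuple j a) _ (sparse-tags j ω a (m≤n⇒m≤1+n a≤)) (λ _ _ → a≤)

greedy-bits : ∀ Q a b R t → AllBits 1 R → AllBits 1 (Greedy.greedy Q a b R t)
greedy-bits Q a b R zero    T = T
greedy-bits Q a b R (suc t) T = AllBits-pick (Greedy.flag Q a b R t) (greedy-bits Q a b R t T) (greedy-bits Q a b R t T , bitN-≤1 (Greedy.choice Q a b R t))

dense-bits : ∀ ω Q a → AllBits 1 (denseRows ω Q a)
dense-bits ω Q zero    = tt
dense-bits ω Q (suc a) = greedy-bits Q a (ω ∸ a) (denseRows ω Q a) (steps ω Q) (dense-bits ω Q a)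

dense-tags : ∀ ω Q a → a ≤ suc ω → Tags≤ ω (denseRows ω Q a)
dense-tags ω Q zero    _ = tt
dense-tags ω Q (suc a) (s≤s a≤) = Greedy.greedy-tags Q a (ω ∸ a) (denseRows ω Q a) (steps ω Q) a≤ (dense-tags ω Q a (m≤n⇒m≤1+n a≤))

dense-size : ∀ ω Q a → size# (denseRows ω Q a) ≤ a * steps ω Q
dense-size ω Q zero    = z≤n
dense-size ω Q (suc a) = ≤-trans (grow (steps ω Q)) (≤-trans (+-monoˡ-≤ (steps ω Q) (dense-size ω Q a)) (≤-reflexive (+-comm (a * steps ω Q) _)))
  where
  open Greedy Q a (ω ∸ a) (denseRows ω Q a)
  grow : ∀ t → size# (greedy t) ≤ size# (denseRows ω Q a) + t
  grow zero = ≤-reflexive (sym (+-identityʳ _))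
  grow (suc t) with flag t
  ... | zero  = ≤-trans (grow t) (+-monoʳ-≤ _ (n≤1+n t))
  ... | suc _ = ≤-trans (s≤s (grow t)) (≤-reflexive (sym (+-suc _ t)))

binom≤2^ : ∀ n k → binom n k ≤ 2 ^ n
binom≤2^ n       zero    = m^n>0 2 n
binom≤2^ zero    (suc k) = z≤n
binom≤2^ (suc n) (suc k) = ≤-trans (+-mono-≤ (binom≤2^ n k) (binom≤2^ n (suc k))) (≤-reflexive (cong (2 ^ n +_) (sym (+-identityʳ (2 ^ n)))))

enough-steps : ∀ ω Q a R → a ≤ ω → Greedy.enough Q a (ω ∸ a) R ≤ steps ω Q
enough-steps ω Q a R a≤ = ≤-trans (≤-reflexive (cong (λ x → suc (Q + Q) * (suc x * binom x a)) (m+[n∸m]≡n a≤)))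
  (≤-trans (*-monoʳ-≤ (suc (Q + Q)) (*-monoʳ-≤ (suc ω) (binom≤2^ ω a)))
    (≤-reflexive (solve 3 (λ q w p → (con 1 :+ q) :* ((con 1 :+ w) :* p) := (w :+ con 1) :* (p :* (q :+ con 1))) refl (Q + Q) ω (2 ^ ω))))
  where open +-*-Solver

-- The tag has to be exactly the number of ones, because splices add tags and compare the sum with
-- r.
BaseCovers : (ℕ → ℕ → Set) → ℕ → Rows → Set
BaseCovers Cond Q R = ∀ os zs → Cond (length os) (length zs) → Bounded# Q os → Bounded# Q zs → Disjoint os zs →
  ∃ λ x → x ∈ʳ R × proj₁ x ≡ length os × Hits (proj₂ x) os zs

sparse-covers : ∀ (Cond : ℕ → ℕ → Set) j ω → (∀ {a z} → Cond a z → a ≤ ω) → BaseCovers Cond (2 ^ j) (sparseRows j (suc ω))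
sparse-covers Cond j ω small os zs c bo bz dis = tuple j (length os) (encode j os) ,
  ∈-prefix (sparse-prefix j (≤⇒≤′ (s≤s (small c)))) (∈-ext (tuple j (length os)) _ (encode-< j bo)) , refl ,
  Hits-cong bo bz (λ y _ → sym (tuple-occurs j os bo y)) (occurs-hits os zs dis)

dense-covers : ∀ (Cond : ℕ → ℕ → Set) Q ω → (∀ {a z} → Cond a z → a + z ≤ ω) → BaseCovers Cond Q (denseRows ω Q (suc ω))
dense-covers Cond Q ω small os zs c bo bz dis = proj₁ covered ,
  ∈-prefix (dense-prefix ω Q (≤⇒≤′ (s≤s a≤))) (proj₁ (proj₂ covered)) , proj₂ (proj₂ covered)
  where
  a≤ : length os ≤ ω
  a≤ = ≤-trans (m≤m+n (length os) (length zs)) (small c)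
  z≤ : length zs ≤ ω ∸ length os
  z≤ = ≤-trans (≤-reflexive (sym (m+n∸m≡n (length os) (length zs)))) (∸-monoˡ-≤ (length os) (small c))
  covered : ∃ λ x → x ∈ʳ denseRows ω Q (suc (length os)) × proj₁ x ≡ length os × Hits (proj₂ x) os zs
  covered = DenseBase.covers Q (length os) (ω ∸ length os) (denseRows ω Q (length os)) {steps ω Q}
    (enough-steps ω Q (length os) (denseRows ω Q (length os)) a≤) os zs ≤-refl z≤ bo bz dis

-- Lifting base families along the inner hash maps.

columnsOf : ℕ → ℕ → ℕ → ℕ
columnsOf j k t = Hash.Columns.col j k (t ÷ 2 ^ k) (t mod 2 ^ k)

columnsOf-at : ∀ j k c {y} → y < 2 ^ k → columnsOf j k (c * 2 ^ k + y) ≡ Hash.Columns.col j k c y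
columnsOf-at j k c y< = cong₂ (Hash.Columns.col j k) (proj₁ (÷-block c (2 ^ k) y<)) (proj₂ (÷-block c (2 ^ k) y<))

fam∈ : ∀ base g m {c ρ} → c < m → ρ < size# base → Lifting.lifted base g c ρ ∈ʳ Lifting.fam base g m
fam∈ base g (suc m) {c} c<1+m ρ< with m≤n⇒m<n∨m≡n (≤-pred c<1+m)
... | inj₁ c<m = ∈-prefix (Prefix-ext (Lifting.lifted base g m) (size# base)) (fam∈ base g m c<m ρ<)
... | inj₂ refl = ∈-ext (Lifting.lifted base g m) (size# base) ρ<

fam-bits : ∀ {B} base g m → AllBits B base → AllBits B (Lifting.fam base g m)
fam-bits base g zero    T = tt
fam-bits base g (suc m) T = AllBits-ext _ (size# base) (fam-bits base g m T) (λ ρ y _ → AllBits-bit base ρ _ T)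

fam-tags : ∀ {b} base g m → Tags≤ b base → Tags≤ b (Lifting.fam base g m)
fam-tags base g zero    T = tt
fam-tags base g (suc m) T = Tags≤-ext _ (size# base) (fam-tags base g m T) (λ ρ _ → Tags≤-any base ρ T)

fam-count : ∀ base g m a → countTag a (Lifting.fam base g m) ≡ m * countTag a base
fam-count base g zero    a = refl
fam-count base g (suc m) a = trans (sumRows-ext _ (Lifting.fam base g m) (Lifting.lifted base g m) (size# base))
  (trans (cong₂ _+_ (fam-count base g m a) (sym (sumRows-Σ _ base))) (+-comm (m * countTag a base) _))

-- One column separates the ones of the pattern from its zeros, and a base row for the images is
-- pulled back along it. Images of ones may coincide; the tag counts them with multiplicity and so
-- remains the number of ones of the pattern.
fam-covers : ∀ (Cond : ℕ → ℕ → Set) j jQ e base → 0 < e → 2 ^ jQ ≡ 2 * e → 0 < j → BaseCovers Cond (2 ^ jQ) base →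
  (∀ {a z} → Cond a z → 4 * (a * z) < 2 ^ jQ) → ∀ p → Cond (ones p (2 ^ j)) (zeros p (2 ^ j)) →
  ∃ λ x → x ∈ʳ Lifting.fam base (λ c y → columnsOf jQ j (c * 2 ^ j + y)) (e * j) × proj₁ x ≡ ones p (2 ^ j) × Fits (2 ^ j) p (proj₂ x)
fam-covers Cond j jQ e base 0<e Q≡ 0<j covers few p cond = found
  where
  q = 2 ^ j
  one# zero# : Cell → ℕ
  one#  = weigh 1 0
  zero# = weigh 0 1
  one≤ : ∀ c → one# c ≤ 1
  one≤ star = z≤n
  one≤ one-bit = ≤-refl
  one≤ zero-bit = z≤n
  zero≤ : ∀ c → zero# c ≤ 1
  zero≤ star = z≤n
  zero≤ one-bit = z≤n
  zero≤ zero-bit = ≤-refl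
  os zs : List ℕ
  os = positions one# p q
  zs = positions zero# p q
  os-length : length os ≡ ones p q
  os-length = positions-length one# one≤ p q
  zs-length : length zs ≡ zeros p q
  zs-length = positions-length zero# zero≤ p q
  cond′ : Cond (length os) (length zs)
  cond′ = subst₂ Cond (sym os-length) (sym zs-length) cond
  differ : ∀ {o z} → one# (p o) ≢ 0 → zero# (p z) ≢ 0 → o ≢ z
  differ {o} n n′ refl with p o
  ... | star = n refl
  ... | one-bit = n′ refl
  ... | zero-bit = n refl
  dis : Disjoint os zs
  dis = LAll.map (λ (_ , n) → LAll.map (λ (_ , n′) → differ n n′) (positions-all zero# p q)) (positions-all one# p q)
  separated : ∃ λ c → c < e * j × Disjoint (List.map (Hash.Columns.col jQ j c) os) (List.map (Hash.Columns.col jQ j c) zs)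
  separated = separate jQ j e 0<e Q≡ 0<j os zs (LAll.map proj₁ (positions-all one# p q)) (LAll.map proj₁ (positions-all zero# p q)) dis (few cond′)
  conclude : ∀ c → c < e * j → let cs = List.map (Hash.Columns.col jQ j c) in
    (∃ λ x → x ∈ʳ base × proj₁ x ≡ length (cs os) × Hits (proj₂ x) (cs os) (cs zs)) →
    ∃ λ x → x ∈ʳ Lifting.fam base (λ c y → columnsOf jQ j (c * q + y)) (e * j) × proj₁ x ≡ ones p q × Fits q p (proj₂ x)
  conclude c c< (x , (ρ , ρ< , refl) , t , (ho , hz)) = Lifting.lifted base g c ρ , fam∈ base g (e * j) c< ρ< ,
        trans t (trans (Data.List.Properties.length-map col os) os-length) , fits
    where
    col : ℕ → ℕ
    col = Hash.Columns.col jQ j c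
    g : ℕ → ℕ → ℕ
    g c y = columnsOf jQ j (c * q + y)
    fits : Fits q p (λ y → bit base ρ (g c y))
    fits y y<q with p y in eq
    ... | star = tt
    ... | one-bit = subst (λ z → bit base ρ z ≢ 0) (sym (columnsOf-at jQ j c y<q))
          (positions-complete one# p q (all-map col ho) y y<q (λ e → case trans (sym (cong one# eq)) e of λ ()))
    ... | zero-bit = trans (cong (bit base ρ) (columnsOf-at jQ j c y<q))
          (positions-complete zero# p q (all-map col hz) y y<q (λ e → case trans (sym (cong zero# eq)) e of λ ()))
  c : ℕ
  c = proj₁ separated
  col : ℕ → ℕ
  col = Hash.Columns.col jQ j c
  col< : ∀ y → col y < 2 ^ jQ
  col< y = Hash.h-< jQ (Hash.Columns.weight jQ j c) j y
  found = conclude c (proj₁ (proj₂ separated)) (covers (List.map col os) (List.map col zs)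
    (subst₂ Cond (sym (Data.List.Properties.length-map col os)) (sym (Data.List.Properties.length-map col zs)) cond′)
    (map-all col (LAll.universal col< os)) (map-all col (LAll.universal col< zs)) (proj₂ (proj₂ separated)))

hist-bits : ∀ {B q r} F → AllBits B F → ∀ i → AllBits B (History.hist q r F i)
hist-bits {B} {q} {r} F T = go
  where
  open History q r F
  spliceB : ∀ {x z c} → (∀ y → proj₂ x y ≤ B) → (∀ y → proj₂ z y ≤ B) → ∀ y → proj₂ (splice c x z) y ≤ B
  spliceB {c = c} hx hz y with y <? c
  ... | yes y<c rewrite ltN-< y<c = ≤-trans (≤-reflexive (trans (+-identityʳ _) (+-identityʳ _))) (hx y)
  ... | no y≮c rewrite ltN-≥ (≮⇒≥ y≮c) = ≤-trans (≤-reflexive (+-identityʳ _)) (hz y)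
  innerB : ∀ {S x} φ → AllBits B S → (∀ y → proj₂ x y ≤ B) → AllBits B (inner S x φ)
  innerB zero    T′ h = T′
  innerB {S} {x} (suc φ) T′ h = AllBits-pick (allowed r (proj₁ x + tag F φ)) (innerB φ T′ h)
    (AllBits-ext _ (suc q) (innerB φ T′ h) (λ c y _ → spliceB {x} {row F φ} {c} h (λ y → AllBits-bit F φ y T) y))
  outerB : ∀ {R} ρ → AllBits B R → AllBits B (outer R ρ)
  outerB zero    T′ = T′
  outerB {R} (suc ρ) T′ = innerB (size# F) (outerB ρ T′) (λ y → AllBits-bit R ρ y T′)
  go : ∀ i → AllBits B (hist i)
  go zero    = tt , λ _ → z≤n
  go (suc i) = outerB (size# (hist i)) (go i)

-- The cover obtained from blocks of load less than L + W, over 2 ^ j cells.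
hist-cover : ∀ {j r s} a b L W I F → 0 < a → a ≤ W → b ≤ W → a * r + b * s ≤ I * L →
  (∀ p → mass a b p (2 ^ j) < L + W → ∃ λ x → x ∈ʳ F × proj₁ x ≡ ones p (2 ^ j) × Fits (2 ^ j) p (proj₂ x)) →
  Covers (2 ^ j) r s (History.hist (2 ^ j) r F I)
hist-cover {j} {r} a b L W I F 0<a a≤ b≤ total covers = record { cover = λ os zs os≡ zs≡ bo bz dis →
  let p = patternOf os zs
      ones≤ = ≤-trans (patternOf-ones os zs (2 ^ j)) (≤-reflexive os≡)
      zeros≤ = ≤-trans (patternOf-zeros os zs (2 ^ j)) (≤-reflexive zs≡)
      x , x∈ , _ , fits = hist-covers I p (≤-trans (≤-reflexive (mass-split a b p (2 ^ j)))
         (≤-trans (+-mono-≤ (*-monoʳ-≤ a ones≤) (*-monoʳ-≤ b zeros≤)) total)) ones≤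
  in x , x∈ , patternOf-hits os zs bo bz dis fits }
  where
  open History.Covering (2 ^ j) r F a b L W 0<a a≤ b≤ covers

tab-cong : ∀ {A : Set} {f g : ℕ → A} n → (∀ i → i < n → f i ≡ g i) → tab f n ≡ tab g n
tab-cong zero    h = refl
tab-cong (suc n) h = cong₂ _▹_ (tab-cong n (λ i i< → h i (m≤n⇒m≤1+n i<))) (h n ≤-refl)

tab-at : ∀ s → tab (at 0 s) (size# s) ≡ s
tab-at ε       = refl
tab-at (s ▹ x) = cong₂ _▹_ (trans (tab-cong (size# s) (λ i i< → at-init 0 s x i<)) (tab-at s)) (at-last 0 s x)

at-flat-≤ : ∀ {B} q R → AllBits B R → Tags≤ B R → ∀ i → at 0 (flat q R) i ≤ B
at-flat-≤ q ε _ _ i = z≤n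
at-flat-≤ {B} q (R ▹ (t , f)) (T , h) (U , t≤) i with i ≡ᵇ size# (ext (flat q R) f q)
... | true  = t≤
... | false = inside q
  where
  inside : ∀ n → at 0 (ext (flat q R) f n) i ≤ B
  inside zero = at-flat-≤ q R T U i
  inside (suc n) with i ≡ᵇ size# (ext (flat q R) f n)
  ... | true  = h n
  ... | false = inside n

-- The complete program.

suc# : ∀ {n} → Exp n → Exp n
suc# e = op add e (lit 1)

-- The variables are q, j, p, ℓ, d, n, r and s, preceded by the locally bound ones.
smallE : Exp 8
smallE = op sub (lit 1) (op sub (var (# 6)) (op mul (var (# 3)) (var (# 3))))

smallS : Stmt 9
smallS = bind (var (# 1)) (bind (var (# 3)) (bind (var (# 9)) (tuplesS ⨾ loop (len Bₛ) (push Pₛ (get Bₛ (var (# 0)))))))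

denseS sparseS : Stmt 22
denseS = bind (op mul (suc# (var (# 10))) (op mul (pow2E (var (# 10))) (suc# (op add (var (# 4)) (var (# 4))))))
  (bind (op mul (pow2E (var (# 5))) (pow2E (var (# 5)))) (bind (pow2E (var (# 6))) (bind (var (# 7)) (bind (op sub (var (# 14)) (var (# 5))) (bind (var (# 6)) greedyS)))))
sparseS = bind (var (# 4)) (bind (var (# 7)) (bind (var (# 3)) tuplesS))

baseS : Stmt 21
baseS = loop (var (# 10)) denseS ⨾ loop (op sub (lit 1) (var (# 10))) sparseS

roundsE : Exp 22
-- This evaluates to `I`: the flag `dn` selects between the rounds of the dense and of the sparse
-- case.
roundsE = suc# (op add (op mul (var (# 11)) (op quo (var (# 18)) (var (# 10)))) (op mul (op sub (lit 1) (var (# 11))) (op quo (op add (var (# 20)) (var (# 20))) (var (# 10)))))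

blocksS : Stmt 20
blocksS = hashS ⨾ loop (suc# (var (# 8))) baseS ⨾ famS ⨾ bind (var (# 18)) (bind (var (# 2)) (bind roundsE histS))

parametersS : Stmt 15
parametersS = bind (var (# 1)) (bind (var (# 9)) (bind (var (# 2)) (bind (var (# 10)) (bind (op mul (op quo (var (# 1)) (lit 2)) (var (# 2))) blocksS))))

largeS : Stmt 9
-- The bound values are g, dn, ω, x, jQ and Q, in this order.
largeS = bind (op quo (var (# 4)) (lit 12)) (bind (op sub (lit 1) (op sub (pow2E (op mul (lit 10) (var (# 0)))) (var (# 8))))
  (bind (op add (op mul (var (# 0)) (pow2E (op mul (lit 3) (var (# 1))))) (op mul (op sub (lit 1) (var (# 0))) (var (# 6))))
  (bind (suc# (op mul (lit 4) (op mul (op mul (suc# (var (# 0))) (suc# (var (# 0)))) (suc# (op quo (var (# 11)) (var (# 10)))))))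
  (bind (lgE (# 0)) (bind (pow2E (var (# 0))) parametersS)))))

finalS : Stmt 8
-- After k, the values j, k, q, `2 ^ k` and the number of columns are bound again in the order that
-- `hashS` expects.
finalS = bind (lgE (# 5)) (bind (var (# 2)) (bind (var (# 1)) (bind (var (# 3)) (bind (pow2E (var (# 1))) (bind (op mul (op quo (var (# 1)) (lit 2)) (var (# 2)))
  (hashS ⨾ bind (var (# 11)) (bind (var (# 3)) (bind (var (# 3)) (bind (var (# 3)) emitS)))))))))

mainS : Stmt 3
mainS = bind (op add (var (# 1)) (var (# 2))) (bind (lgE (# 0)) (bind (suc# (op mul (lit 4) (op mul (var (# 3)) (var (# 4)))))
  (bind (lgE (# 0)) (bind (pow2E (var (# 0))) ((loop smallE smallS ⨾ loop (op sub (lit 1) smallE) largeS) ⨾ finalS)))))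

-- Cost derivations with bounded values.

module Bounded (w Ω : ℕ) (32≤Ω : 32 ≤ Ω) (Ω^9<B : Ω ^ 9 < 2 ^ w) where

  open Machine w

  1≤Ω : 1 ≤ Ω
  1≤Ω = ≤-trans (s≤s z≤n) 32≤Ω

  Ω-nonZero : NonZero Ω
  Ω-nonZero = >-nonZero 1≤Ω

  Ω^-mono : ∀ {p q} → p ≤ q → Ω ^ p ≤ Ω ^ q
  Ω^-mono = ^-monoʳ-≤ Ω ⦃ Ω-nonZero ⦄

  <B : ∀ {v p} → v ≤ Ω ^ p → T (p ≤ᵇ 9) → v < B
  <B {p = p} v≤ p≤9 = ≤-<-trans (≤-trans v≤ (Ω^-mono (≤ᵇ⇒≤ p 9 p≤9))) Ω^9<B

  small : ∀ {v} → v ≤ Ω → v ≤ Ω ^ 1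
  small v≤ = ≤-trans v≤ (≤-reflexive (sym (*-identityʳ Ω)))

  unsmall : ∀ {v} → v ≤ Ω ^ 1 → v ≤ Ω
  unsmall v≤ = ≤-trans v≤ (≤-reflexive (*-identityʳ Ω))

  room : ∀ {L} → L ≤ Ω → (2 + L) * 16 < B
  room {L} L≤ = <B {p = 3} (≤-trans (*-monoˡ-≤ 16 (+-mono-≤ {2} {Ω} (≤-trans (m≤m+n 2 30) 32≤Ω) L≤))
    (≤-trans (≤-reflexive (trans (*-distribʳ-+ 16 Ω Ω) (trans (sym (*-distribˡ-+ Ω 16 16)) (*-comm Ω 32))))
      (≤-trans (*-monoˡ-≤ Ω 32≤Ω) (≤-trans (*-monoʳ-≤ Ω (small ≤-refl)) (Ω^-mono {2} {3} (n≤1+n 2)))))) tt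

  Good : ∀ {n} → Vec ℕ n → Set
  Good = All (_≤ Ω)

  within : ∀ {n} {ρ : Vec ℕ n} → Good ρ → ∀ x → lookup ρ x ≤ Ω
  within (v≤ ∷ _) zero    = v≤
  within (_ ∷ G)  (suc x) = within G x

  -- The exponent `p` tracks the size of the value as a power of `Ω`. For numerals, side conditions
  -- such as `p ≤ 9` hold by computation.
  record Ev {n} {ρ : Vec ℕ n} (G : Good ρ) (σ : Store) (e : Exp n) (v A : ℕ) (M : Pos) (p : ℕ) : Set where
    constructor ev
    field
      runE : Eval σ ρ e v (A * val M)
      bnd  : v ≤ Ω ^ p
  open Ev public

  record Ex {n} {ρ : Vec ℕ n} (G : Good ρ) (s : Stmt n) (σ : Store) (ω : Seq Bool) (σ′ : Store) (ω′ : Seq Bool) (A : ℕ) (M : Pos) : Set where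
    constructor ex
    field
      runS : Exec ρ s σ ω σ′ ω′ (A * val M)
  open Ex public

  lits : ∀ a (M : Pos) → a ≤ a * val M
  lits a M = ≤-trans (≤-reflexive (sym (*-identityʳ a))) (*-monoʳ-≤ a (pos M))

  lift₂ : ∀ {x y a} A C (M : Pos) → x ≤ A * val M → y ≤ C * val M → x + (y + a) ≤ (A + (C + a)) * val M
  lift₂ {x} {y} {a} A C M hx hy = ≤-trans (+-mono-≤ hx (≤-trans (+-mono-≤ hy (lits a M)) (≤-reflexive (sym (*-distribʳ-+ (val M) C a)))))
    (≤-reflexive (sym (*-distribʳ-+ (val M) A (C + a))))

  lift₁ : ∀ {x a} A (M : Pos) → x ≤ A * val M → x + a ≤ (A + a) * val M
  lift₁ {x} {a} A M hx = ≤-trans (+-mono-≤ hx (lits a M)) (≤-reflexive (sym (*-distribʳ-+ (val M) A a)))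

  module _ {n} {ρ : Vec ℕ n} {G : Good ρ} {σ : Store} where

    V : ∀ x {M} → Ev G σ (var x) (lookup ρ x) 2 M 1
    V x {M} = ev (slack (var x (<B {p = 1} (small (within G x)) tt)) (lits 2 M)) (small (within G x))

    Lᵉ : ∀ v {M} {v≤32 : T (v ≤ᵇ 32)} → Ev G σ (lit v) v 1 M 1
    Lᵉ v {M} {v≤32} = ev (slack (lit v (<B {p = 1} v≤ tt)) (lits 1 M)) v≤
      where
      v≤ : v ≤ Ω ^ 1
      v≤ = small (≤-trans (≤ᵇ⇒≤ v 32 v≤32) 32≤Ω)

    L₁ : ∀ {M} → Ev G σ (lit 1) 1 1 M 0
    L₁ {M} = ev (slack (lit 1 (<B {p = 0} ≤-refl tt)) (lits 1 M)) ≤-refl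

    opᵉ : ∀ o {e f x y A C M p q} → Ev G σ e x A M p → Ev G σ f y C M q → ∀ s → ⟦ o ⟧ x y ≤ Ω ^ s → T (s ≤ᵇ 9) →
          Ev G σ (op o e f) (⟦ o ⟧ x y) (A + (C + 1)) M s
    opᵉ o {A = A} {C} {M} (ev d _) (ev d′ _) s v≤ s≤9 = ev (slack (op o d d′ (<B {p = s} v≤ s≤9)) (lift₂ A C M ≤-refl ≤-refl)) v≤

    infixl 6 _+ᵉ_ _∸ᵉ_
    infixl 7 _*ᵉ_ _÷ᵉ_

    _+ᵉ_ : ∀ {e f x y A C M p q} → Ev G σ e x A M p → Ev G σ f y C M q → {_ : T (suc (p ⊔ q) ≤ᵇ 9)} →
           Ev G σ (op add e f) (x + y) (A + (C + 1)) M (suc (p ⊔ q))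
    _+ᵉ_ {x = x} {y} {p = p} {q} d d′ {s≤9} = opᵉ add d d′ (suc (p ⊔ q)) bound s≤9
      where
      bound : x + y ≤ Ω ^ suc (p ⊔ q)
      bound = ≤-trans (+-mono-≤ (≤-trans (bnd d) (Ω^-mono (m≤m⊔n p q))) (≤-trans (bnd d′) (Ω^-mono (m≤n⊔m p q))))
        (≤-trans (≤-reflexive (cong (Ω ^ (p ⊔ q) +_) (sym (+-identityʳ _)))) (*-monoˡ-≤ (Ω ^ (p ⊔ q)) (≤-trans (m≤m+n 2 30) 32≤Ω)))

    _*ᵉ_ : ∀ {e f x y A C M p q} → Ev G σ e x A M p → Ev G σ f y C M q → {_ : T ((p + q) ≤ᵇ 9)} →
           Ev G σ (op mul e f) (x * y) (A + (C + 1)) M (p + q)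
    _*ᵉ_ {x = x} {y} {p = p} {q} d d′ {s≤9} = opᵉ mul d d′ (p + q)
      (≤-trans (*-mono-≤ (bnd d) (bnd d′)) (≤-reflexive (sym (^-distribˡ-+-* Ω p q)))) s≤9

    _∸ᵉ_ : ∀ {e f x y A C M p q} → Ev G σ e x A M p → Ev G σ f y C M q → {_ : T (p ≤ᵇ 9)} →
           Ev G σ (op sub e f) (x ∸ y) (A + (C + 1)) M p
    _∸ᵉ_ {x = x} {y} {p = p} d d′ {s≤9} = opᵉ sub d d′ p (≤-trans (m∸n≤m x y) (bnd d)) s≤9

    _÷ᵉ_ : ∀ {e f x y A C M p q} → Ev G σ e x A M p → Ev G σ f y C M q → {_ : T (p ≤ᵇ 9)} →
           Ev G σ (op quo e f) (x ÷ y) (A + (C + 1)) M p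
    _÷ᵉ_ {x = x} {y} {p = p} d d′ {s≤9} = opᵉ quo d d′ p (≤-trans (÷-≤ x y) (bnd d)) s≤9

    modᵉ : ∀ {e f x y A C M p q} → Ev G σ e x A M p → Ev G σ f y C M q → {s≤9 : T (p ≤ᵇ 9)} →
           Ev G σ (modE e f) (x mod y) (A + (((A + (C + 1)) + (C + 1)) + 1)) M p
    modᵉ {x = x} {y} {p = p} d d′ {s≤9} = _∸ᵉ_ d (opᵉ mul (_÷ᵉ_ d d′ {s≤9}) d′ p (≤-trans (÷*-≤ x y) (bnd d)) s≤9) {s≤9}

    eqᵉ : ∀ {e f x y A C M p q} → Ev G σ e x A M p → Ev G σ f y C M q → {_ : T (p ≤ᵇ 9)} {_ : T (q ≤ᵇ 9)} →
          Ev G σ (eqE e f) (eqN x y) ((1 + ((A + (C + 1)) + 1)) + ((1 + ((C + (A + 1)) + 1)) + 1)) M 0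
    eqᵉ d d′ {s} {t} = (L₁ ∸ᵉ _∸ᵉ_ d d′ {s}) *ᵉ (L₁ ∸ᵉ _∸ᵉ_ d′ d {t})

    ltᵉ : ∀ {e f x y A C M p q} → Ev G σ e x A M p → Ev G σ f y C M q → {_ : T (q ≤ᵇ 9)} →
          Ev G σ (ltE e f) (ltN x y) (1 + ((1 + ((C + (A + 1)) + 1)) + 1)) M 0
    ltᵉ d d′ {s} = L₁ ∸ᵉ (L₁ ∸ᵉ _∸ᵉ_ d′ d {s})

    maxᵉ : ∀ {e f x y A C M p q} → Ev G σ e x A M p → Ev G σ f y C M q → {_ : T (q ≤ᵇ 9)} {_ : T (suc (p ⊔ q) ≤ᵇ 9)} →
          Ev G σ (maxE e f) (maxN x y) (A + ((C + (A + 1)) + 1)) M (suc (p ⊔ q))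
    maxᵉ d d′ {s} {t} = _+ᵉ_ d (_∸ᵉ_ d′ d {s}) {t}

    lowerᵉ : ∀ {e v A M p} → v ≤ Ω → Ev G σ e v A M p → Ev G σ e v A M 1
    lowerᵉ v≤ (ev d _) = ev d (small v≤)

    castᵉ : ∀ {e u v A M p} → u ≡ v → Ev G σ e u A M p → Ev G σ e v A M p
    castᵉ refl d = d

    raiseᵉ : ∀ {e v A M M′ p} → val M ≤ val M′ → Ev G σ e v A M p → Ev G σ e v A M′ p
    raiseᵉ {A = A} M≤ (ev d v≤) = ev (slack d (*-monoʳ-≤ A M≤)) v≤

    getᵉ : ∀ a {e i A M p} → Ev G σ e i A M p → i < size# (lookup σ a) → at 0 (lookup σ a) i ≤ Ω → size# (lookup σ a) ≤ Ω →
           Ev G σ (get a e) (at 0 (lookup σ a) i) (A + 5) M 1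
    getᵉ a {A = A} {M} (ev d _) i< v≤ s≤ = ev (slack (get a d i< (<B {p = 1} (small v≤) tt) (room s≤)) (lift₁ A M ≤-refl)) (small v≤)

    lenᵉ : ∀ a {M} → size# (lookup σ a) ≤ Ω → Ev G σ (len a) (size# (lookup σ a)) 2 M 1
    lenᵉ a {M} s≤ = ev (slack (len a (<B {p = 1} (small s≤) tt)) (lits 2 M)) (small s≤)

    foldᵉ : ∀ {e f b N A C D M M′ p q} (acc : ℕ → ℕ) (N≤ : N ≤ Ω) (acc≤ : ∀ i → i ≤ N → acc i ≤ Ω) →
            Ev G σ e N A M p → Ev G σ f (acc 0) C M q →
            (∀ i (i<N : i < N) → ∃ λ q → Ev (≤-trans (<⇒≤ i<N) N≤ ∷ acc≤ i (<⇒≤ i<N) ∷ G) σ b (acc (suc i)) D M′ q) →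
            N * val M′ ≤ val M → Ev G σ (fold e f b) (acc N) (A + (C + (D + 13))) M 1
    foldᵉ {N = N} {A} {C} {D} {M} {M′} acc N≤ acc≤ (ev d _) (ev d′ _) ds NM = ev
      (slack (fold acc (λ _ → D * val M′) d d′ (λ i i<N → runE (proj₂ (ds i i<N))) (<B {p = 1} (small (acc≤ N ≤-refl)) tt)) cost) (small (acc≤ N ≤-refl))
      where
      loop≤ : Σ< (λ i → (D * val M′ + 2) + 6) N ≤ (D + 8) * val M
      loop≤ = ≤-trans (Σ-const _ ((D + 8) * val M′) N (λ _ _ → ≤-trans (≤-reflexive (+-assoc (D * val M′) 2 6)) (lift₁ D M′ ≤-refl)))
        (≤-trans (≤-reflexive (trans (sym (*-assoc N (D + 8) (val M′))) (trans (cong (_* val M′) (*-comm N (D + 8))) (*-assoc (D + 8) N (val M′))))) (*-monoʳ-≤ (D + 8) NM))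
      cost : A * val M + (C * val M + (1 + ((Σ< (λ i → (D * val M′ + 2) + 6) N + 2) + 2))) ≤ (A + (C + (D + 13))) * val M
      cost = lift₂′
        where
        rest : 1 + ((Σ< (λ i → (D * val M′ + 2) + 6) N + 2) + 2) ≤ (D + 13) * val M
        rest = ≤-trans (≤-reflexive (trans (cong suc (+-assoc _ 2 2)) (sym (+-suc _ 4)))) (≤-trans (lift₁ (D + 8) M loop≤) (≤-reflexive (cong (_* val M) (+-assoc D 8 5))))
        lift₂′ : _
        lift₂′ = ≤-trans (+-monoʳ-≤ (A * val M) (≤-trans (+-monoʳ-≤ (C * val M) rest) (≤-reflexive (sym (*-distribʳ-+ (val M) C (D + 13))))))
          (≤-reflexive (sym (*-distribʳ-+ (val M) A (C + (D + 13)))))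

  pow2ᵉ : ∀ {n} {ρ : Vec ℕ n} {G : Good ρ} {σ e x A p} → x ≤ Ω → 2 ^ x ≤ Ω → Ev G σ e x A (succ x) p →
          Ev G σ (pow2E e) (2 ^ x) (A + 19) (succ x) 1
  pow2ᵉ {σ = σ} {x = x} x≤ 2^x≤ d = foldᵉ {C = 1} {D = 5} {M′ = one} (2 ^_) x≤ (λ i i≤x → ≤-trans (^-monoʳ-≤ 2 i≤x) 2^x≤) d L₁
     (λ i i<x → 2 , castᵉ (cong (2 ^ i +_) (sym (+-identityʳ (2 ^ i)))) (V (suc zero) +ᵉ V (suc zero)))
     (≤-trans (≤-reflexive (*-identityʳ x)) (n≤1+n x))

  module _ {n} {ρ : Vec ℕ n} {G : Good ρ} where

    pushᵉ : ∀ a {σ ω e v A M p} → Ev G σ e v A M p → size# (lookup σ a) ≤ Ω → Ex G (push a e) σ ω (σ [ a ]≔ (lookup σ a ▹ v)) ω (A + 7) M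
    pushᵉ a {A = A} {M} (ev d _) s≤ = ex (slack (push a d (room s≤)) (lift₁ A M ≤-refl))

    clearᵉ : ∀ a {σ ω M} → Ex G (clear a) σ ω (σ [ a ]≔ ε) ω 1 M
    clearᵉ a {M = M} = ex (slack (clear a) (lits 1 M))

    outᵉ : ∀ {σ ω e v A M p} → Ev G σ e v A M p → Ex G (out e) σ ω σ (ω ▹ isNonZero v) (A + 1) M
    outᵉ {A = A} {M} (ev d _) = ex (slack (out d) (lift₁ A M ≤-refl))

    infixr 4 _⨾ᵉ_
    _⨾ᵉ_ : ∀ {s t σ ω σ₁ ω₁ σ₂ ω₂ A C M} → Ex G s σ ω σ₁ ω₁ A M → Ex G t σ₁ ω₁ σ₂ ω₂ C M → Ex G (s ⨾ t) σ ω σ₂ ω₂ (A + C) M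
    _⨾ᵉ_ {A = A} {C} {M} (ex d) (ex d′) = ex (slack (d ⨾ d′) (≤-reflexive (sym (*-distribʳ-+ (val M) A C))))

    bindᵉ : ∀ {e s v σ ω σ₁ ω₁ A C M p} (v≤ : v ≤ Ω) → Ev G σ e v A M p → Ex (v≤ ∷ G) s σ ω σ₁ ω₁ C M → Ex G (bind e s) σ ω σ₁ ω₁ (A + C) M
    bindᵉ {A = A} {C} {M} _ (ev d _) (ex d′) = ex (slack (bind d d′) (≤-reflexive (sym (*-distribʳ-+ (val M) A C))))

    raise : ∀ {s σ ω σ₁ ω₁ A M M′} → val M ≤ val M′ → Ex G s σ ω σ₁ ω₁ A M → Ex G s σ ω σ₁ ω₁ A M′
    raise {A = A} M≤ (ex d) = ex (slack d (*-monoʳ-≤ A M≤))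

    loopΣ : ∀ {e s N A C M p} (N≤ : N ≤ Ω) (τ : ℕ → Store) (ω : ℕ → Seq Bool) (M′ : ℕ → Pos) → Ev G (τ 0) e N A M p →
            (∀ i (i<N : i < N) → Ex (≤-trans (<⇒≤ i<N) N≤ ∷ G) s (τ i) (ω i) (τ (suc i)) (ω (suc i)) C (M′ i)) →
            Σ< (λ i → val (M′ i)) N ≤ val M → Ex G (loop e s) (τ 0) (ω 0) (τ N) (ω N) (A + (C + 9)) M
    loopΣ {N = N} {A} {C} {M} N≤ τ ω M′ (ev d _) ds NM = ex (slack (loop τ ω (λ i → C * val (M′ i)) d (λ i i<N → runS (ds i i<N))) cost)
      where
      sum≤ : ∀ n → Σ< (λ i → C * val (M′ i) + 6) n ≤ (C + 6) * Σ< (λ i → val (M′ i)) n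
      sum≤ zero    = z≤n
      sum≤ (suc n) = ≤-trans (+-mono-≤ (sum≤ n) (lift₁ C (M′ n) ≤-refl)) (≤-reflexive (sym (*-distribˡ-+ (C + 6) (Σ< (λ i → val (M′ i)) n) (val (M′ n)))))
      cost : A * val M + (1 + (Σ< (λ i → C * val (M′ i) + 6) N + 2)) ≤ (A + (C + 9)) * val M
      cost = ≤-trans (+-monoʳ-≤ (A * val M) (≤-trans (≤-reflexive (sym (+-suc _ 2)))
          (≤-trans (lift₁ (C + 6) M (≤-trans (sum≤ N) (*-monoʳ-≤ (C + 6) NM))) (≤-reflexive (cong (_* val M) (+-assoc C 6 3))))))
        (≤-reflexive (sym (*-distribʳ-+ (val M) A (C + 9))))

    loopᵉ : ∀ {e s N A C M M′ p} (N≤ : N ≤ Ω) (τ : ℕ → Store) (ω : ℕ → Seq Bool) → Ev G (τ 0) e N A M p →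
            (∀ i (i<N : i < N) → Ex (≤-trans (<⇒≤ i<N) N≤ ∷ G) s (τ i) (ω i) (τ (suc i)) (ω (suc i)) C M′) →
            N * val M′ ≤ val M → Ex G (loop e s) (τ 0) (ω 0) (τ N) (ω N) (A + (C + 9)) M
    loopᵉ {N = N} {M′ = M′} N≤ τ ω d ds NM = loopΣ N≤ τ ω (λ _ → M′) d ds (≤-trans (Σ-const _ (val M′) N (λ _ _ → ≤-refl)) NM)

  -- The exact numeral of a composite cost is inferred; here it is rounded up to a readable one, by
  -- computation.
  relaxᵉ : ∀ {n} {ρ : Vec ℕ n} {G : Good ρ} {σ e v A A′ M p} {_ : T (A ≤ᵇ A′)} → Ev G σ e v A M p → Ev G σ e v A′ M p
  relaxᵉ {A = A} {A′} {M} {_} {A≤} (ev d v≤) = ev (Machine.slack d (*-monoˡ-≤ (val M) (≤ᵇ⇒≤ A A′ A≤))) v≤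

  relaxˢ : ∀ {n} {ρ : Vec ℕ n} {G : Good ρ} {s σ ω σ′ ω′ A A′ M} {_ : T (A ≤ᵇ A′)} → Ex G s σ ω σ′ ω′ A M → Ex G s σ ω σ′ ω′ A′ M
  relaxˢ {A = A} {A′} {M} {A≤} (ex d) = ex (Machine.slack d (*-monoˡ-≤ (val M) (≤ᵇ⇒≤ A A′ A≤)))

  castˢ : ∀ {n} {ρ : Vec ℕ n} {G : Good ρ} {s σ ω σ′ ω′ σ₂ σ₂′ A M} → σ ≡ σ₂ → σ′ ≡ σ₂′ →
          Ex G s σ ω σ′ ω′ A M → Ex G s σ₂ ω σ₂′ ω′ A M
  castˢ refl refl d = d

  getTab : ∀ {n} {ρ : Vec ℕ n} {G : Good ρ} {σ} a {e i A M p} {f : ℕ → ℕ} {N} → lookup σ a ≡ tab f N →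
           Ev G σ e i A M p → i < N → f i ≤ Ω → N ≤ Ω → Ev G σ (get a e) (f i) (A + 5) M 1
  getTab a {i = i} {f = f} {N} eq d i<N f≤ N≤ = castᵉ val≡
    (getᵉ a d (subst (i <_) (sym len≡) i<N) (≤-trans (≤-reflexive val≡) f≤) (≤-trans (≤-reflexive len≡) N≤))
    where
    len≡ = trans (cong size# eq) (size-tab f N)
    val≡ = trans (cong (λ s → at 0 s i) eq) (at-tab 0 f N i<N)

  lgᵉ : ∀ {n} {ρ : Vec ℕ n} {G : Good ρ} {σ} x → 0 < lookup ρ x → 2 * lookup ρ x ≤ Ω →
        Ev G σ (lgE x) (lg (lookup ρ x)) 50 (succ (lookup ρ x) ⊗ succ (lg (lookup ρ x))) 1
  lgᵉ {ρ = ρ} {G} x 0<X 2X≤ = relaxᵉ $ foldᵉ {M′ = succ (lg X)} (lgUpTo X) (within G x) (λ i i≤X → ≤-trans (lgUpTo-≤ X i) (≤-trans i≤X (within G x)))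
      (V x) (Lᵉ 0) (λ i i<X → 2 , (V 1F +ᵉ ltᵉ (raiseᵉ (s≤s (lgUpTo-mono X (≤⇒≤′ (<⇒≤ i<X)))) (pow2ᵉ (≤-trans (lgUpTo-≤ X i) (≤-trans (<⇒≤ i<X) (within G x)))
        (≤-trans (<⇒≤ (2^lgUpTo< X i 0<X)) 2X≤) (V 1F))) (V (suc (suc x)))))
      (*-monoˡ-≤ (suc (lg X)) (n≤1+n X))
    where X = lookup ρ x

  xorᵉ : ∀ {n} {ρ : Vec ℕ n} {G : Good ρ} {σ} u v j → 2 ^ lookup ρ j ≤ Ω →
         Ev G σ (xorE u v j) (xorN (lookup ρ u) (lookup ρ v) (lookup ρ j)) 200 (succ (lookup ρ j) ⊗ succ (lookup ρ j)) 1
  xorᵉ {ρ = ρ} {G} {σ} u v j 2^j≤ = relaxᵉ d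
    where
    X = lookup ρ j
    acc = xorN (lookup ρ u) (lookup ρ v)
    acc≤ : ∀ i → i ≤ X → acc i ≤ Ω
    acc≤ i i≤X = ≤-trans (<⇒≤ (xorN-< (lookup ρ u) (lookup ρ v) i)) (≤-trans (^-monoʳ-≤ 2 i≤X) 2^j≤)
    body : ∀ i (i<X : i < X) → _
    body i i<X = _ , (V 1F +ᵉ (pow *ᵉ modᵉ ((V (suc (suc u)) ÷ᵉ pow) +ᵉ (V (suc (suc v)) ÷ᵉ pow)) (Lᵉ 2)))
      where
      pow : Ev (≤-trans (<⇒≤ i<X) (within G j) ∷ acc≤ i (<⇒≤ i<X) ∷ G) σ (pow2E (var 0F)) (2 ^ i) 21 (succ X) 1
      pow = raiseᵉ (s≤s (<⇒≤ i<X)) (pow2ᵉ (≤-trans (<⇒≤ i<X) (within G j)) (≤-trans (^-monoʳ-≤ 2 (<⇒≤ i<X)) 2^j≤) (V 0F))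
    d : Ev G σ (xorE u v j) (acc X) _ (succ X ⊗ succ X) 1
    d = foldᵉ acc (within G j) acc≤ (V j) (Lᵉ 0) body (*-monoˡ-≤ (suc X) (n≤1+n X))

  -- Derivation for the hash maps.

  module HashDerivation {n} (ρ : Vec ℕ n) (G : Good ρ) (k j m : ℕ)
    -- `space` is the length of the list of weights, which has one block more than there are
    -- columns; `heavy` bounds the packed maximum in the search for an image.
    (space : suc m * (2 ^ k) ≤ Ω) (heavy : suc (2 ^ (k + k)) * (2 ^ j) ≤ Ω)
    (Φ≤ : ∀ c → c ≤ m → Hash.Columns.Φ j k c ≤ 2 ^ (k + k)) where

    private
      K q : ℕ
      K = 2 ^ k
      q = 2 ^ j

    open Hash j hiding (q)
    open Columns k

    private
      0<K : 0 < K
      0<K = m^n>0 2 k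

      K≤ : K ≤ Ω
      K≤ = ≤-trans (m≤m+n K (m * K)) space

      Φ<Ω : 2 ^ (k + k) ≤ Ω
      Φ<Ω = ≤-trans (n≤1+n _) (≤-trans (m≤m*n (suc (2 ^ (k + k))) q ⦃ m^n≢0 2 j ⦄) heavy)

      q≤ : q ≤ Ω
      q≤ = ≤-trans (m≤m+n q _) heavy

      m≤ : m ≤ Ω
      m≤ = ≤-trans (n≤1+n m) (≤-trans (m≤m*n (suc m) K ⦃ m^n≢0 2 k ⦄) space)

      k≤ : k ≤ Ω
      k≤ = ≤-trans (<⇒≤ (n<2^n k)) K≤

      j≤ : j ≤ Ω
      j≤ = ≤-trans (<⇒≤ (n<2^n j)) q≤

    hashEnv : Good (m ∷ K ∷ q ∷ k ∷ j ∷ ρ)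
    hashEnv = m≤ ∷ K≤ ∷ q≤ ∷ k≤ ∷ j≤ ∷ G

    -- All columns and all weights stay in the lists: entry `c * K + z` belongs to `z` in column
    -- `c`.
    weights columns : ℕ → ℕ
    weights t = weight (t ÷ K) (t mod K)
    columns t = col (t ÷ K) (t mod K)

    weights-at : ∀ c {z} → z < K → weights (c * K + z) ≡ weight c z
    weights-at c z< = cong₂ weight (proj₁ (÷-block c K z<)) (proj₂ (÷-block c K z<))

    columns-at : ∀ c {z} → z < K → columns (c * K + z) ≡ col c z
    columns-at c z< = cong₂ col (proj₁ (÷-block c K z<)) (proj₂ (÷-block c K z<))

    unit : Pos
    unit = two^ j ⊗ (succ j ⊗ succ j)

    hashCost : Pos
    hashCost = succ m ⊗ (two^ k ⊗ unit)

    private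
      j²≤unit : suc j * suc j ≤ val unit
      j²≤unit = m≤n*m (suc j * suc j) q ⦃ m^n≢0 2 j ⦄

      q≤unit : q ≤ val unit
      q≤unit = m≤m*n q (suc j * suc j)

      weight≤ : ∀ c z → c ≤ m → z < K → weight c z ≤ Ω
      weight≤ c z c≤ z< = ≤-trans (Σ-term (weight c) z<) (≤-trans (Φ≤ c c≤) Φ<Ω)

      col≤ : ∀ c z → col c z ≤ Ω
      col≤ c z = ≤-trans (<⇒≤ (h-< (weight c) k z)) q≤

      module _ (b u f p : Seq ℕ) (ω : Seq Bool) where

        hst : ℕ → ℕ → Store
        hst x y = st (tab weights x) (tab columns y) b u f p

        initial-weights : Ex hashEnv (loop (var 1F) (push Wₛ (op sub (lit 1) (eqE (var 0F) (lit 0))))) (hst 0 0) ω (hst (1 * K) 0) ω 50 hashCost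
        initial-weights = castˢ refl (cong (λ x → hst x 0) (sym (+-identityʳ K))) $ relaxˢ $ loopᵉ {M′ = one} K≤ (λ z → hst z 0) (λ _ → ω) (V 1F)
          (λ z z< → castˢ refl (cong (λ v → st (tab weights z ▹ v) ε b u f p) (trans (sym (weights-at 0 z<)) refl))
            (pushᵉ Wₛ (Lᵉ 1 ∸ᵉ eqᵉ (V 0F) (Lᵉ 0)) (≤-trans (≤-reflexive (size-tab weights z)) (≤-trans (<⇒≤ z<) K≤))))
          (≤-trans (≤-reflexive (*-identityʳ K)) (≤-trans (m≤m*n K (val unit) ⦃ >-nonZero (pos unit) ⦄) (m≤m+n (K * val unit) _)))

        ▹-tab : ∀ (f : ℕ → ℕ) {x y v} → v ≡ f x → suc x ≡ y → tab f x ▹ v ≡ tab f y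
        ▹-tab f refl refl = refl

        W≤ : ∀ {c} → c ≤ m → suc c * K ≤ Ω
        W≤ c≤ = ≤-trans (*-monoˡ-≤ K (s≤s c≤)) space

        module Column (c : ℕ) (c<m : c < m) where

          wt : ℕ → ℕ
          wt = weight c

          C : Good (c ∷ m ∷ K ∷ q ∷ k ∷ j ∷ ρ)
          C = ≤-trans (<⇒≤ c<m) m≤ ∷ hashEnv

          cK≤ : ∀ {z} → z ≤ K → c * K + z ≤ Ω
          cK≤ {z} z≤ = ≤-trans (+-monoʳ-≤ (c * K) z≤) (≤-trans (≤-reflexive (+-comm (c * K) K)) (W≤ (<⇒≤ c<m)))

          update-weights : Ex C (loop (var 2F) weightS) (hst (suc c * K) (suc c * K)) ω (hst (suc (suc c) * K) (suc c * K)) ω 120 (two^ k ⊗ unit)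
          update-weights = castˢ (cong (λ x → hst x (suc c * K)) (+-identityʳ _)) (cong (λ x → hst x (suc c * K)) (+-comm (suc c * K) K)) $
            relaxˢ $ loopᵉ {M′ = one} K≤ (λ z → hst (suc c * K + z) (suc c * K)) (λ _ → ω) (V 2F)
            (λ z z< → castˢ refl (cong (λ s → st s (tab columns (suc c * K)) b u f p)
                (▹-tab weights (sym (weights-at (suc c) z<)) (sym (+-suc (suc c * K) z))))
              (pushᵉ Wₛ
                (castᵉ (weights-at c z<) (getTab Wₛ refl ((V 1F *ᵉ V 3F) +ᵉ V 0F)
                    (<-≤-trans (block-< {c} ≤-refl z<) (m≤m+n (suc c * K) z))
                    (≤-trans (≤-reflexive (weights-at c z<)) (weight≤ c z (<⇒≤ c<m) z<)) (len≤ z (<⇒≤ z<)))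
                  *ᵉ (L₁ +ᵉ eqᵉ (castᵉ (columns-at c z<) (getTab Hₛ refl ((V 1F *ᵉ V 3F) +ᵉ V 0F) (block-< {c} ≤-refl z<)
                    (≤-trans (≤-reflexive (columns-at c z<)) (col≤ c z)) (W≤ (<⇒≤ c<m)))) (Lᵉ 0)))
                (≤-trans (≤-reflexive (size-tab weights (suc c * K + z))) (len≤ z (<⇒≤ z<)))))
            (*-monoʳ-≤ K (pos unit))
            where
            len≤ : ∀ z → z ≤ K → suc c * K + z ≤ Ω
            len≤ z z≤ = ≤-trans (+-monoʳ-≤ (suc c * K) z≤) (≤-trans (≤-reflexive (+-comm (suc c * K) K)) (W≤ c<m))

          module Level (i : ℕ) (i<k : i < k) (i≤Ω : i ≤ Ω) where

            H# : ℕ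
            H# = c * K + 2 ^ i

            2^i≤K : 2 ^ i ≤ K
            2^i≤K = ^-monoʳ-≤ 2 (<⇒≤ i<k)

            2^i≤ : 2 ^ i ≤ Ω
            2^i≤ = ≤-trans 2^i≤K K≤

            high< : ∀ {z} → z < 2 ^ i → 2 ^ i + z < K
            high< {z} z< = <-≤-trans (+-monoʳ-< (2 ^ i) z<) (≤-trans (≤-reflexive (double i)) (^-monoʳ-≤ 2 i<k))

            entry : ∀ {z} → z < 2 ^ i → columns (c * K + z) ≡ h wt i z
            entry z< = trans (columns-at c (<-≤-trans z< 2^i≤K)) (h-stable wt (≤⇒≤′ (<⇒≤ i<k)) z<)

            L : Good (i ∷ c ∷ m ∷ K ∷ q ∷ k ∷ j ∷ ρ)
            L = i≤Ω ∷ C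

            LP : Good (2 ^ i ∷ i ∷ c ∷ m ∷ K ∷ q ∷ k ∷ j ∷ ρ)
            LP = 2^i≤ ∷ L

            σ₀ : Store
            σ₀ = hst (suc c * K) H#

            term : ℕ → ℕ → ℕ
            term v z = wt (2 ^ i + z) * (1 ∸ eqN (h wt i z) v)

            partial≤ : ∀ v y → y ≤ 2 ^ i → Σ< (term v) y ≤ 2 ^ (k + k)
            partial≤ v y y≤ = begin
              Σ< (term v) y                   ≤⟨ Σ-≤ˡ (term v) y≤ ⟩
              Σ< (term v) (2 ^ i)             ≤⟨ Σ-mono (2 ^ i) (λ z _ → ≤-trans (*-monoʳ-≤ (wt (2 ^ i + z)) (m∸n≤m 1 (eqN (h wt i z) v))) (≤-reflexive (*-identityʳ _))) ⟩
              Σ< (λ z → wt (2 ^ i + z)) (2 ^ i) ≤⟨ m≤n+m _ (Σ< wt (2 ^ i)) ⟩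
              Σ< wt (2 ^ i) + Σ< (λ z → wt (2 ^ i + z)) (2 ^ i) ≡⟨ Σ-split wt (2 ^ i) (2 ^ i) ⟨
              Σ< wt (2 ^ i + 2 ^ i)           ≡⟨ cong (Σ< wt) (double i) ⟩
              Σ< wt (2 ^ suc i)               ≤⟨ Σ-≤ˡ wt (^-monoʳ-≤ 2 i<k) ⟩
              Φ c                             ≤⟨ Φ≤ c (<⇒≤ c<m) ⟩
              2 ^ (k + k)                     ∎
              where open ≤-Reasoning

            gainᵉ : ∀ v a (v≤ : v ≤ Ω) (a≤ : a ≤ Ω) → Ev (v≤ ∷ a≤ ∷ LP) σ₀ gainE (gain wt i v) 100 (two^ i) 1
            gainᵉ v a v≤ a≤ = relaxᵉ $ foldᵉ {M = two^ i} {M′ = one} (Σ< (term v)) 2^i≤ (λ y y≤ → ≤-trans (partial≤ v y y≤) Φ<Ω) (V 2F) (Lᵉ 0)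
              (λ z z< → _ , (V 1F +ᵉ
                (castᵉ (weights-at c (high< z<)) (getTab Wₛ refl ((V 6F *ᵉ V 8F) +ᵉ (V 4F +ᵉ V 0F)) (block-< {c} ≤-refl (high< z<))
                   (≤-trans (≤-reflexive (weights-at c (high< z<))) (weight≤ c _ (<⇒≤ c<m) (high< z<))) (W≤ (<⇒≤ c<m)))
                 *ᵉ (L₁ ∸ᵉ eqᵉ (castᵉ (entry z<) (getTab Hₛ refl ((V 6F *ᵉ V 8F) +ᵉ V 0F) (+-monoʳ-< (c * K) z<)
                   (≤-trans (≤-reflexive (entry z<)) (≤-trans (<⇒≤ (h-< wt i z)) q≤)) (cK≤ 2^i≤K))) (V 2F)))))
              (≤-reflexive (*-identityʳ _))

            imageᵉ : Ev LP σ₀ imageE (image wt i) 800 (two^ i ⊗ unit) 1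
            imageᵉ = relaxᵉ $ modᵉ (foldᵉ {M = two^ i ⊗ unit} {M′ = two^ i} (best (gain wt i) q) q≤ best≤ (V 5F) (Lᵉ 0)
                (λ v v< → _ , maxᵉ (V 1F) ((gainᵉ v _ _ _ *ᵉ V 7F) +ᵉ V 0F))
                (≤-trans (≤-reflexive (*-comm q (2 ^ i))) (*-monoʳ-≤ (2 ^ i) q≤unit)))
              (V 5F)
              where
              best≤ : ∀ v → v ≤ q → best (gain wt i) q v ≤ Ω
              best≤ v v≤ = ≤-trans (best-≤ (gain wt i) q v (2 ^ (k + k)) v≤ (λ x _ → partial≤ x (2 ^ i) ≤-refl)) (≤-trans (≤-reflexive (+-comm (2 ^ (k + k) * q) q)) heavy)

            image≤ : image wt i ≤ Ω
            image≤ = ≤-trans (<⇒≤ (image-< wt i)) q≤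

            new : ∀ {z} → z < 2 ^ i → xorN (h wt i z) (image wt i) j ≡ columns (H# + z)
            new {z} z< = sym (trans (cong columns (+-assoc (c * K) (2 ^ i) z)) (trans (columns-at c (high< z<))
              (trans (h-stable wt (≤⇒≤′ i<k) (subst (2 ^ i + z <_) (double i) (+-monoʳ-< (2 ^ i) z<))) (h-high wt i z))))

            levelᵉ : Ex L levelS σ₀ ω (hst (suc c * K) (c * K + 2 ^ suc i)) ω 1200 (two^ i ⊗ unit)
            levelᵉ = castˢ refl (cong (hst (suc c * K)) (trans (+-assoc (c * K) (2 ^ i) (2 ^ i)) (cong (c * K +_) (double i)))) $ relaxˢ $
              bindᵉ 2^i≤ (raiseᵉ (≤-trans (n<2^n i) (m≤m*n (2 ^ i) (val unit) ⦃ >-nonZero (pos unit) ⦄)) (pow2ᵉ i≤Ω 2^i≤ (V 0F)))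
              (bindᵉ image≤ imageᵉ
              (castˢ (cong (hst (suc c * K)) (+-identityʳ H#)) refl $ loopᵉ {M′ = succ j ⊗ succ j} 2^i≤ (λ z → hst (suc c * K) (H# + z)) (λ _ → ω) (V 1F)
                (λ z z< → bindᵉ (≤-trans (<⇒≤ (h-< wt i z)) q≤)
                    (castᵉ (entry z<) (getTab Hₛ refl ((V 4F *ᵉ V 6F) +ᵉ V 0F)
                      (≤-trans (+-monoʳ-< (c * K) z<) (m≤m+n H# z))
                      (≤-trans (≤-reflexive (entry z<)) (≤-trans (<⇒≤ (h-< wt i z)) q≤)) (H≤ z (<⇒≤ z<))))
                  (castˢ refl (cong (λ s → st (tab weights (suc c * K)) s b u f p) (▹-tab columns (new z<) (sym (+-suc H# z))))
                    (pushᵉ Hₛ (xorᵉ 0F 2F 10F q≤) (≤-trans (≤-reflexive (size-tab columns (H# + z))) (H≤ z (<⇒≤ z<))))))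
                (*-monoʳ-≤ (2 ^ i) j²≤unit)))
              where
              H≤ : ∀ z → z ≤ 2 ^ i → H# + z ≤ Ω
              H≤ z z≤ = ≤-trans (≤-reflexive (+-assoc (c * K) (2 ^ i) z)) (cK≤ (≤-trans (+-monoʳ-≤ (2 ^ i) z≤) (≤-trans (≤-reflexive (double i)) (^-monoʳ-≤ 2 i<k))))

          columnᵉ : Ex C columnS (hst (suc c * K) (c * K)) ω (hst (suc (suc c) * K) (suc c * K)) ω 1400 (two^ k ⊗ unit)
          columnᵉ = relaxˢ $ castˢ refl (cong (λ s → st (tab weights (suc c * K)) s b u f p)
                (▹-tab columns {y = c * K + 2 ^ 0} (sym (trans (cong columns (sym (+-identityʳ (c * K)))) (trans (columns-at c 0<K) (h-stable wt {0} {k} (≤⇒≤′ z≤n) ≤-refl)))) (+-comm 1 (c * K))))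
              (pushᵉ Hₛ {M = two^ k ⊗ unit} (Lᵉ 0) (≤-trans (≤-reflexive (size-tab columns (c * K))) (≤-trans (m≤m+n _ K) (cK≤ ≤-refl)))) ⨾ᵉ
            castˢ refl (cong (hst (suc c * K)) (+-comm (c * K) K))
              -- Level `i` costs `2 ^ i` units; the geometric sum keeps a column at `2 ^ k` units,
              -- without a further factor `k`.
              (loopΣ k≤ (λ i → hst (suc c * K) (c * K + 2 ^ i)) (λ _ → ω) (λ i → two^ i ⊗ unit) (V 4F)
                (λ i i<k → Level.levelᵉ i i<k _) (Σ-2^ (val unit) k)) ⨾ᵉ
            update-weights

    hashᵉ : ∀ {w₀ h₀ b u f p ω} → Ex hashEnv hashS (st w₀ h₀ b u f p) ω (st (tab weights (suc m * K)) (tab columns (m * K)) b u f p) ω 1500 hashCost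
    hashᵉ {b = b} {u} {f} {p} {ω} = relaxˢ $ clearᵉ Wₛ ⨾ᵉ clearᵉ Hₛ ⨾ᵉ initial-weights b u f p ω ⨾ᵉ
      loopᵉ {M′ = two^ k ⊗ unit} m≤ (λ c → hst b u f p ω (suc c * K) (c * K)) (λ _ → ω) (V 0F)
        (λ c c<m → Column.columnᵉ b u f p ω c c<m) (*-monoˡ-≤ (val (two^ k ⊗ unit)) (n≤1+n m))

  -- Derivations for rows, tuples and lifted families.

  rowᵉ : ∀ {n} {ρ : Vec ℕ n} {G : Good ρ} a {κ : Seq ℕ → Store} {q R ω qe e te t A C D M M′ p p′ p″} {f : ℕ → ℕ}
    (look : ∀ s → lookup (κ s) a ≡ s) (upd : ∀ s v → (κ s) [ a ]≔ (lookup (κ s) a ▹ v) ≡ κ (s ▹ v)) (q≤ : q ≤ Ω) →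
    suc (size# R) * suc q ≤ Ω → Ev G (κ (flat q R)) qe q A M p →
    (∀ y (y<q : y < q) → Ev (≤-trans (<⇒≤ y<q) q≤ ∷ G) (κ (ext (flat q R) f y)) e (f y) C M′ p′) →
    Ev G (κ (ext (flat q R) f q)) te t D M p″ → q * val M′ ≤ val M →
    Ex G (rowS a qe e te) (κ (flat q R)) ω (κ (flat q (R ▹ (t , f)))) ω ((A + ((C + 7) + 9)) + (D + 7)) M
  rowᵉ a {κ} {q} {R} {ω} {t = t} {f = f} look upd q≤ space dq de dt qM =
    loopᵉ q≤ (λ y → κ (ext (flat q R) f y)) (λ _ → ω) dq
      (λ y y<q → castˢ refl (upd (ext (flat q R) f y) (f y)) (pushᵉ a (de y y<q) (len≤ y (<⇒≤ y<q)))) qM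
    ⨾ᵉ castˢ refl (upd (ext (flat q R) f q) t) (pushᵉ a dt (len≤ q ≤-refl))
    where
    len≤ : ∀ y → y ≤ q → size# (lookup (κ (ext (flat q R) f y)) a) ≤ Ω
    len≤ y y≤ = ≤-trans (≤-reflexive (trans (cong size# (look _)) (trans (size-ext (flat q R) f y) (cong (_+ y) (size-flat q R)))))
      (≤-trans (≤-trans (+-monoʳ-≤ (size# R * suc q) (≤-trans y≤ (n≤1+n q))) (≤-reflexive (+-comm _ (suc q)))) space)

  widthᵉ : ∀ {n} {ρ : Vec ℕ n} {G : Good ρ} {σ M} q → Ev G σ (width q) (lookup ρ q + 1) 4 M 2
  widthᵉ q = V q +ᵉ Lᵉ 1

  cellᵉ : ∀ {n} {ρ : Vec ℕ n} {G : Good ρ} {σ M i e y A p} q {iA pi} → Ev G σ i (y) iA M pi → {_ : T (suc ((pi + 2) ⊔ p) ≤ᵇ 9)} {_ : T (pi + 2 ≤ᵇ 9)} →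
    ∀ {z} → Ev G σ e z A M p → Ev G σ (op add (op mul i (width q)) e) (y * suc (lookup ρ q) + z) ((iA + (4 + 1)) + (A + 1)) M (suc ((pi + 2) ⊔ p))
  cellᵉ {ρ = ρ} {y = y} q {iA} {pi} di {s} {s′} {z} de = castᵉ (cong (λ x → y * x + z) (+-comm (lookup ρ q) 1)) (_+ᵉ_ (_*ᵉ_ di (widthᵉ q) {s′}) de {s})

  -- Complete rows remain readable while the entries of a further row are pushed onto the same list.
  Extends : ℕ → Rows → Seq ℕ → Set
  Extends q R s = size# (flat q R) ≤ size# s × (∀ i → i < size# (flat q R) → at 0 s i ≡ at 0 (flat q R) i)

  Extends-refl : ∀ {q R} → Extends q R (flat q R)
  Extends-refl = ≤-refl , λ _ _ → refl

  Extends-ext : ∀ {q R} f y → Extends q R (ext (flat q R) f y)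
  Extends-ext {q} {R} f y = ≤-trans (m≤m+n _ y) (≤-reflexive (sym (size-ext (flat q R) f y))) , λ i i< → at-ext 0 (flat q R) f y i<

  getCell : ∀ {n} {ρ : Vec ℕ n} {G : Good ρ} {σ} a {e q R i y A M p s} → lookup σ a ≡ s → Extends q R s →
    Ev G σ e (i * suc q + y) A M p → i < size# R → y < q → bit R i y ≤ Ω → size# s ≤ Ω → Ev G σ (get a e) (bit R i y) (A + 5) M 1
  getCell a {q = q} {R} {i} {y} refl (longer , agree) d i< y< v≤ s≤ = castᵉ eq (getᵉ a d (<-≤-trans idx longer) (≤-trans (≤-reflexive eq) v≤) s≤)
    where
    idx : i * suc q + y < size# (flat q R)
    idx = subst (i * suc q + y <_) (sym (size-flat q R)) (block-end i< (<⇒≤ y<))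
    eq = trans (agree _ idx) (at-flat q R i< y<)

  getTag : ∀ {n} {ρ : Vec ℕ n} {G : Good ρ} {σ} a {e q R i A M p s} → lookup σ a ≡ s → Extends q R s →
    Ev G σ e (i * suc q + q) A M p → i < size# R → tag R i ≤ Ω → size# s ≤ Ω → Ev G σ (get a e) (tag R i) (A + 5) M 1
  getTag a {q = q} {R} {i} refl (longer , agree) d i< v≤ s≤ = castᵉ eq (getᵉ a d (<-≤-trans idx longer) (≤-trans (≤-reflexive eq) v≤) s≤)
    where
    idx : i * suc q + q < size# (flat q R)
    idx = subst (i * suc q + q <_) (sym (size-flat q R)) (block-end i< ≤-refl)
    eq = trans (agree _ idx) (at-flat-tag q R i<)

  countRows : ∀ {n} {ρ : Vec ℕ n} {G : Good ρ} {σ} a {R M} q → lookup σ a ≡ flat (lookup ρ q) R → size# R * suc (lookup ρ q) ≤ Ω →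
    Ev G σ (op quo (len a) (width q)) (size# R) 7 M 1
  countRows {ρ = ρ} a {R} q eq s≤ = castᵉ (trans (cong (λ s → size# s ÷ (lookup ρ q + 1)) eq) (flat-÷ (lookup ρ q) R))
    (lenᵉ a (≤-trans (≤-reflexive (trans (cong size# eq) (size-flat (lookup ρ q) R))) s≤) ÷ᵉ widthᵉ q)

  rows≤ : ∀ {m q R} → m * suc q ≤ Ω → size# R ≤ m → size# (flat q R) ≤ Ω
  rows≤ {q = q} {R} s≤ le = ≤-trans (≤-reflexive (size-flat q R)) (≤-trans (*-monoˡ-≤ (suc q) le) s≤)

  tuplesᵉ : ∀ {n} {ρ : Vec ℕ n} (G : Good ρ) {a j wl hl ul fl pl ω R} (a≤ : a ≤ Ω) (j≤ : j ≤ Ω) (Q≤ : 2 ^ j ≤ Ω) →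
    2 ^ (a * j) ≤ Ω → (size# R + 2 ^ (a * j)) * suc (2 ^ j) ≤ Ω →
    Ex (a≤ ∷ j≤ ∷ Q≤ ∷ G) tuplesS (st wl hl (flat (2 ^ j) R) ul fl pl) ω
       (st wl hl (flat (2 ^ j) (ext R (tuple j a) (2 ^ (a * j)))) ul fl pl) ω 400 (two^ (a * j) ⊗ (two^ j ⊗ (succ a ⊗ succ (a * j))))
  tuplesᵉ {ρ = ρ} G {a} {j} {wl} {hl} {ul} {fl} {pl} {ω} {R} a≤ j≤ Q≤ X≤ space = relaxˢ $
    loopᵉ {M′ = two^ j ⊗ (succ a ⊗ succ (a * j))} X≤ (λ t → κ (flat Q (ext R (tuple j a) t))) (λ _ → ω)
      (raiseᵉ (≤-trans (n<2^n (a * j)) (m≤m*n X (val (two^ j ⊗ (succ a ⊗ succ (a * j)))) ⦃ >-nonZero (pos (two^ j ⊗ (succ a ⊗ succ (a * j)))) ⦄))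
        (pow2ᵉ (≤-trans (<⇒≤ (n<2^n (a * j))) X≤) X≤ (V 0F *ᵉ V 1F)))
      (λ t t< → rowᵉ Bₛ {κ} {Q} {ext R (tuple j a) t} {M′ = succ a ⊗ succ (a * j)} (λ _ → refl) (λ _ _ → refl) Q≤
        (≤-trans (*-monoˡ-≤ (suc Q) (≤-trans (≤-reflexive (trans (cong suc (size-ext R (tuple j a) t)) (sym (+-suc (size# R) t)))) (+-monoʳ-≤ (size# R) t<))) space)
        (V 3F) (λ y y<Q → entry t (≤-trans (<⇒≤ t<) X≤) y (≤-trans (<⇒≤ y<Q) Q≤)) (V 1F) ≤-refl)
      ≤-refl
    where
    Q = 2 ^ j
    X = 2 ^ (a * j)
    κ : Seq ℕ → Store
    κ s = st wl hl s ul fl pl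
    ij≤ : ∀ {i} → i < a → i * j ≤ a * j
    ij≤ i<a = *-monoˡ-≤ j (<⇒≤ i<a)
    entry : ∀ t (t≤ : t ≤ Ω) y (y≤ : y ≤ Ω) {σ} → Ev (y≤ ∷ t≤ ∷ a≤ ∷ j≤ ∷ Q≤ ∷ G) σ tupE (proj₂ (tuple j a t) y) 300 (succ a ⊗ succ (a * j)) 1
    entry t t≤ y y≤ = relaxᵉ $ foldᵉ {M′ = succ (a * j)} (Σ< (λ i → eqN ((t ÷ 2 ^ (i * j)) mod Q) y)) a≤
      (λ i i≤a → ≤-trans (≤-trans (Σ-const _ 1 i (λ i _ → eqN-≤1 ((t ÷ 2 ^ (i * j)) mod Q) y)) (≤-reflexive (*-identityʳ i))) (≤-trans i≤a a≤))
      (V 2F) (Lᵉ 0)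
      (λ i i<a → _ , (V 1F +ᵉ eqᵉ (modᵉ (V 3F ÷ᵉ raiseᵉ (s≤s (ij≤ i<a)) (pow2ᵉ (≤-trans (<⇒≤ (n<2^n (i * j))) (2^ij≤ i<a)) (2^ij≤ i<a) (V 0F *ᵉ V 5F))) (V 6F)) (V 2F)))
      (*-monoˡ-≤ (suc (a * j)) (n≤1+n a))
      where
      2^ij≤ : ∀ {i} → i < a → 2 ^ (i * j) ≤ Ω
      2^ij≤ i<a = ≤-trans (^-monoʳ-≤ 2 (ij≤ i<a)) X≤

  Bits≤ : Rows → Set
  Bits≤ R = ∀ i y → bit R i y ≤ Ω

  famᵉ : ∀ {n} {ρ : Vec ℕ n} (G : Good ρ) {m q Q wl ul pl ω R g} (m≤ : m ≤ Ω) (q≤ : q ≤ Ω) (Q≤ : Q ≤ Ω) → m * q ≤ Ω →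
    Bits≤ R → (∀ i → tag R i ≤ Ω) → (∀ c y → c < m → y < q → g (c * q + y) < Q) → size# R * suc Q ≤ Ω → (m * size# R) * suc q ≤ Ω →
    Ex (m≤ ∷ q≤ ∷ Q≤ ∷ G) famS (st wl (tab g (m * q)) (flat Q R) ul ε pl) ω
       (st wl (tab g (m * q)) (flat Q R) ul (flat q (Lifting.fam R (λ c y → g (c * q + y)) m)) pl) ω 200 (succ m ⊗ (succ (size# R) ⊗ succ q))
  famᵉ {ρ = ρ} G {m} {q} {Q} {wl} {ul} {pl} {ω} {R} {g} m≤ q≤ Q≤ mq≤ bits tags g< sR sF = relaxˢ $
    loopᵉ {M′ = succ (size# R) ⊗ succ q} m≤ (λ c → κ (flat q (fam c))) (λ _ → ω) (V 0F)
      (λ c c<m → loopᵉ {M′ = succ q} nR≤ (λ i → κ (flat q (ext (fam c) (lifted c) i))) (λ _ → ω) (countRows Bₛ 3F refl sR)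
        (λ i i< → rowᵉ Fₛ {κ} {q} {ext (fam c) (lifted c) i} {M′ = one} (λ _ → refl) (λ _ _ → refl) q≤ (space c c<m i i<) (V 3F)
          (λ y y<q → getCell Bₛ {R = R} refl Extends-refl
            (cellᵉ 5F (V 1F) (getTab Hₛ refl ((V 2F *ᵉ V 4F) +ᵉ V 0F) (block-< c<m y<q) (≤-trans (<⇒≤ (g< c y c<m y<q)) Q≤) mq≤))
            i< (g< c y c<m y<q) (bits i _) sR′)
          (getTag Bₛ {R = R} refl Extends-refl (cellᵉ 4F (V 0F) (V 4F)) i< (tags i) sR′)
          (≤-trans (≤-reflexive (*-identityʳ q)) (n≤1+n q)))
        (*-monoˡ-≤ (suc q) (n≤1+n (size# R))))
      (*-monoˡ-≤ (suc (size# R) * suc q) (n≤1+n m))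
    where
    open Lifting R (λ c y → g (c * q + y))
    κ : Seq ℕ → Store
    κ s = st wl (tab g (m * q)) (flat Q R) ul s pl
    sR′ : size# (flat Q R) ≤ Ω
    sR′ = ≤-trans (≤-reflexive (size-flat Q R)) sR
    nR≤ : size# R ≤ Ω
    nR≤ = ≤-trans (m≤m*n (size# R) (suc Q)) sR
    space : ∀ c → c < m → ∀ i → i < size# R → suc (size# (ext (fam c) (lifted c) i)) * suc q ≤ Ω
    space c c<m i i< = ≤-trans (*-monoˡ-≤ (suc q) (begin
      suc (size# (ext (fam c) (lifted c) i)) ≡⟨ cong suc (trans (size-ext (fam c) (lifted c) i) (cong (_+ i) (size-fam c))) ⟩
      suc (c * size# R + i)                  ≡⟨ +-suc (c * size# R) i ⟨
      c * size# R + suc i                    ≤⟨ +-monoʳ-≤ (c * size# R) i< ⟩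
      c * size# R + size# R                  ≡⟨ +-comm (c * size# R) (size# R) ⟩
      suc c * size# R                        ≤⟨ *-monoˡ-≤ (size# R) c<m ⟩
      m * size# R                            ∎)) sF
      where open ≤-Reasoning

  Extends-prefix : ∀ {q R S s} → Prefix R S → Extends q S s → ∀ {n} {ρ : Vec ℕ n} {G : Good ρ} {σ} a {e i y A M p} → lookup σ a ≡ s →
    Ev G σ e (i * suc q + y) A M p → i < size# R → y < q → bit R i y ≤ Ω → size# s ≤ Ω → Ev G σ (get a e) (bit R i y) (A + 5) M 1
  Extends-prefix {q} {R} {S} (prefix longer agree) es a {i = i} {y} eq d i< y< v≤ s≤ =
    castᵉ same (getCell a {R = S} eq es d (<-≤-trans i< longer) y< (≤-trans (≤-reflexive same) v≤) s≤)
    where same = cong (λ x → proj₂ x y) (agree i i<)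

  tag-prefix : ∀ {q R S s} → Prefix R S → Extends q S s → ∀ {n} {ρ : Vec ℕ n} {G : Good ρ} {σ} a {e i A M p} → lookup σ a ≡ s →
    Ev G σ e (i * suc q + q) A M p → i < size# R → tag R i ≤ Ω → size# s ≤ Ω → Ev G σ (get a e) (tag R i) (A + 5) M 1
  tag-prefix {q} {R} {S} (prefix longer agree) es a {i = i} eq d i< v≤ s≤ =
    castᵉ same (getTag a {R = S} eq es d (<-≤-trans i< longer) (≤-trans (≤-reflexive same) v≤) s≤)
    where same = cong proj₁ (agree i i<)

  -- Derivation for the splices.

  module HistoryDerivation {n} {ρ : Vec ℕ n} (G : Good ρ) {I q r : ℕ} (I≤ : I ≤ Ω) (q≤ : suc q ≤ Ω) (r≤ : r ≤ Ω) (F : Rows) {wl hl bl ul : Seq ℕ} {ω : Seq Bool}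
    (bits : Bits≤ F) (tags : ∀ i → tag F i ≤ Ω) (sF : size# F * suc q ≤ Ω)
    (hbits : ∀ i → i ≤ I → Bits≤ (History.hist q r F i)) (htags : ∀ i ρ → i ≤ I → ρ < size# (History.hist q r F i) → tag (History.hist q r F i) ρ ≤ Ω)
    (sH : size# (History.hist q r F I) * suc q ≤ Ω) where

    open History q r F

    private
      κ : Seq ℕ → Store
      κ s = st wl hl bl ul (flat q F) s

      q≤′ : q ≤ Ω
      q≤′ = ≤-trans (n≤1+n q) q≤

      E : Good (I ∷ q ∷ r ∷ ρ)
      E = I≤ ∷ q≤′ ∷ r≤ ∷ G

      nF≤ : size# F ≤ Ω
      nF≤ = ≤-trans (m≤m*n (size# F) (suc q)) sF

      sF′ : size# (flat q F) ≤ Ω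
      sF′ = ≤-trans (≤-reflexive (size-flat q F)) sF

      NH = size# (hist I)

      nH≤ : NH ≤ Ω
      nH≤ = ≤-trans (m≤m*n NH (suc q)) sH

      fits : ∀ {S} → Prefix S (hist I) → size# S * suc q ≤ Ω
      fits P = ≤-trans (*-monoˡ-≤ (suc q) (longer P)) sH

    spliceRowᵉ : ∀ i (i< : i < I) ρ′ (ρ< : ρ′ < size# (hist i)) φ (φ< : φ < size# F) c (c≤ : c ≤ q) S → Prefix (hist i) S → suc (size# S) * suc q ≤ Ω →
      ∀ {b} (b≤ : b ≤ Ω) (c≤Ω : c ≤ Ω) {φ≤ ρ≤ N≤ i≤} → Ex {ρ = c ∷ b ∷ φ ∷ ρ′ ∷ size# (hist i) ∷ i ∷ I ∷ q ∷ r ∷ ρ} (c≤Ω ∷ b≤ ∷ φ≤ ∷ ρ≤ ∷ N≤ ∷ i≤ ∷ E) (rowS Pₛ (var 7F) spliceE (op add (tagE Pₛ 3F 7F) (tagE Fₛ 2F 7F)))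
        (κ (flat q S)) ω (κ (flat q (S ▹ splice c (row (hist i) ρ′) (row F φ)))) ω 200 (succ q)
    spliceRowᵉ i i< ρ′ ρ< φ φ< c c≤ S P space b≤ c≤Ω = relaxˢ $ rowᵉ Pₛ {κ} {q} {S} {M′ = one} (λ _ → refl) (λ _ _ → refl) q≤′ space (V 7F)
      (λ y y<q → (ltᵉ (V 0F) (V 1F) *ᵉ Extends-prefix P (Extends-ext f y) Pₛ refl (cellᵉ 8F (V 4F) (V 0F)) ρ< y<q (hbits i (<⇒≤ i<) ρ′ y) (sP y (<⇒≤ y<q)))
        +ᵉ ((L₁ ∸ᵉ ltᵉ (V 0F) (V 1F)) *ᵉ getCell Fₛ {R = F} refl Extends-refl (cellᵉ 8F (V 3F) (V 0F)) φ< y<q (bits φ y) sF′))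
      (tag-prefix P (Extends-ext f q) Pₛ refl (cellᵉ 7F (V 3F) (V 7F)) ρ< (htags i ρ′ (<⇒≤ i<) ρ<) (sP q ≤-refl)
        +ᵉ getTag Fₛ {R = F} refl Extends-refl (cellᵉ 7F (V 2F) (V 7F)) φ< (tags φ) sF′)
      (≤-trans (≤-reflexive (*-identityʳ q)) (n≤1+n q))
      where
      f : ℕ → ℕ
      f = proj₂ (splice c (row (hist i) ρ′) (row F φ))
      sP : ∀ y → y ≤ q → size# (ext (flat q S) f y) ≤ Ω
      sP y y≤ = ≤-trans (≤-reflexive (trans (size-ext (flat q S) f y) (cong (_+ y) (size-flat q S))))
        (≤-trans (≤-trans (+-monoʳ-≤ (size# S * suc q) (≤-trans y≤ (n≤1+n q))) (≤-reflexive (+-comm _ (suc q)))) space)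

    histCost : Pos
    histCost = succ I ⊗ (succ NH ⊗ (succ (size# F) ⊗ (succ q ⊗ succ q)))

    private
      hist-I : ∀ {i} → i ≤ I → Prefix (hist i) (hist I)
      hist-I le = hist-mono (≤⇒≤′ le)

      outer-I : ∀ {i ρ′} → i < I → ρ′ ≤ size# (hist i) → Prefix (outer (hist i) ρ′) (hist I)
      outer-I {i} i< ρ≤ = Prefix-trans (outer-mono (hist i) (≤⇒≤′ ρ≤)) (hist-I i<)

      inner-I : ∀ {i ρ′ φ} → i < I → ρ′ < size# (hist i) → φ ≤ size# F → Prefix (inner (outer (hist i) ρ′) (row (hist i) ρ′) φ) (hist I)
      inner-I {i} {ρ′} i< ρ< φ≤ = Prefix-trans (inner-mono (outer (hist i) ρ′) (row (hist i) ρ′) (≤⇒≤′ φ≤)) (outer-I i< ρ<)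

      inner-above : ∀ i ρ′ φ → Prefix (hist i) (inner (outer (hist i) ρ′) (row (hist i) ρ′) φ)
      inner-above i ρ′ φ = Prefix-trans (outer-prefix (hist i) ρ′) (inner-prefix (outer (hist i) ρ′) (row (hist i) ρ′) φ)

    blockS : Stmt (8 + n)
    blockS = loop (width 6F) (rowS Pₛ (var 7F) spliceE (op add (tagE Pₛ 3F 7F) (tagE Fₛ 2F 7F)))

    guardS : Stmt (7 + n)
    guardS = loop (op sub (lit 1) (op sub (op add (tagE Pₛ 1F 5F) (tagE Fₛ 0F 5F)) (var 6F))) (loop (width 6F) (rowS Pₛ (var 7F) spliceE (op add (tagE Pₛ 3F 7F) (tagE Fₛ 2F 7F))))

    -- The guard loop runs `b ≤ 1` times. Describing its intermediate stores with `pick` makes the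
    -- final one the definition of `inner`.
    guardᵉ : ∀ i (i< : i < I) ρ′ (ρ< : ρ′ < size# (hist i)) φ (φ< : φ < size# F) {φ≤ ρ≤ N≤ i≤} →
      Ex {ρ = φ ∷ ρ′ ∷ size# (hist i) ∷ i ∷ I ∷ q ∷ r ∷ ρ} (φ≤ ∷ ρ≤ ∷ N≤ ∷ i≤ ∷ E) guardS
        (κ (flat q (inner (outer (hist i) ρ′) (row (hist i) ρ′) φ))) ω (κ (flat q (inner (outer (hist i) ρ′) (row (hist i) ρ′) (suc φ)))) ω 400 (succ q ⊗ succ q)
    guardᵉ i i< ρ′ ρ< φ φ< {φ≤} {ρ≤} {N≤} {i≤} = castˢ refl (sym (pick-κ b)) $ relaxˢ $ loopᵉ {M′ = succ q ⊗ succ q} b≤Ω (λ x → pick x (κ (flat q S)) (κ (flat q S′))) (λ _ → ω)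
      (Lᵉ 1 ∸ᵉ ((tag-prefix (inner-above i ρ′ φ) Extends-refl Pₛ refl (cellᵉ 5F (V 1F) (V 5F)) ρ< (htags i ρ′ (<⇒≤ i<) ρ<) (rows≤ {R = S} (fits (inner-I i< ρ< (<⇒≤ φ<))) ≤-refl)
         +ᵉ getTag Fₛ {R = F} refl Extends-refl (cellᵉ 5F (V 0F) (V 5F)) φ< (tags φ) sF′) ∸ᵉ V 6F))
      body
      (≤-trans (*-monoˡ-≤ (suc q * suc q) (m∸n≤m 1 (proj₁ x + tag F φ ∸ r))) (≤-reflexive (*-identityˡ (suc q * suc q))))
      where
      x = row (hist i) ρ′
      S = inner (outer (hist i) ρ′) x φ
      S′ = spliced S x φ
      b = allowed r (proj₁ x + tag F φ)
      pick-κ : ∀ y → κ (flat q (pick y S S′)) ≡ pick y (κ (flat q S)) (κ (flat q S′))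
      pick-κ zero    = refl
      pick-κ (suc _) = refl
      pick-pos : ∀ b → 0 < b → pick b S S′ ≡ S′
      pick-pos (suc _) _ = refl
      b≤1 : b ≤ 1
      b≤1 = m∸n≤m 1 (proj₁ x + tag F φ ∸ r)
      b≤Ω : b ≤ Ω
      b≤Ω = ≤-trans b≤1 1≤Ω
      body : ∀ y (y<b : y < b) → Ex {ρ = y ∷ φ ∷ ρ′ ∷ size# (hist i) ∷ i ∷ I ∷ q ∷ r ∷ ρ} (≤-trans (<⇒≤ y<b) b≤Ω ∷ φ≤ ∷ ρ≤ ∷ N≤ ∷ i≤ ∷ E) blockS (pick y (κ (flat q S)) (κ (flat q S′))) ω (pick (suc y) (κ (flat q S)) (κ (flat q S′))) ω 250 (succ q ⊗ succ q)
      body zero y<b = relaxˢ $ castˢ refl (cong (λ z → κ (flat q (ext S (λ c → splice c x (row F φ)) z))) (+-comm q 1)) $ loopᵉ {M′ = succ q} (≤-trans (≤-reflexive (+-comm q 1)) q≤) (λ c → κ (flat q (ext S (λ c → splice c x (row F φ)) c))) (λ _ → ω) (widthᵉ 6F)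
        (λ c c< → spliceRowᵉ i i< ρ′ ρ< φ φ< c (≤-pred (≤-trans c< (≤-reflexive (+-comm q 1)))) (ext S (λ c → splice c x (row F φ)) c)
          (Prefix-trans (inner-above i ρ′ φ) (Prefix-ext _ c)) (grow c (≤-trans c< (≤-reflexive (+-comm q 1)))) _ _)
        (≤-reflexive (cong (_* suc q) (+-comm q 1)))
        where
        next-S : inner (outer (hist i) ρ′) x (suc φ) ≡ S′
        next-S = pick-pos b y<b
        grow : ∀ c → c < suc q → suc (size# (ext S (λ c → splice c x (row F φ)) c)) * suc q ≤ Ω
        grow c c< = ≤-trans (*-monoˡ-≤ (suc q) (≤-trans (≤-reflexive (cong suc (size-ext S _ c))) (≤-trans (≤-reflexive (sym (+-suc (size# S) c)))
          (≤-trans (+-monoʳ-≤ (size# S) c<) (≤-reflexive (sym (size-ext S (λ c → splice c x (row F φ)) (suc q))))))))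
          (fits (subst (λ R → Prefix R (hist I)) next-S (inner-I i< ρ< φ<)))
      body (suc y) y<b = ⊥-elim (<⇒≱ y<b (≤-trans b≤1 (s≤s z≤n)))

    histᵉ : Ex E histS (κ ε) ω (κ (flat q (hist I))) ω 500 histCost
    histᵉ = relaxˢ $
      raise (≤-trans (m≤m*n (suc q) (suc q)) (≤-trans (m≤n*m (suc q * suc q) (suc (size# F))) (≤-trans (m≤n*m (suc (size# F) * (suc q * suc q)) (suc NH)) (m≤n*m _ (suc I)))))
        (rowᵉ Pₛ {κ} {q} {ε} {M = succ q} {M′ = one} {f = λ _ → 0} (λ _ → refl) (λ _ _ → refl) q≤′ (≤-trans (≤-reflexive (*-identityˡ (suc q))) q≤) (V 1F) (λ _ _ → Lᵉ 0) (Lᵉ 0) (≤-trans (≤-reflexive (*-identityʳ q)) (n≤1+n q)))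
      ⨾ᵉ loopᵉ {M′ = succ NH ⊗ (succ (size# F) ⊗ (succ q ⊗ succ q))} I≤ (λ i → κ (flat q (hist i))) (λ _ → ω) (V 0F)
        (λ i i< → bindᵉ (N≤ i (<⇒≤ i<)) (countRows Pₛ {R = hist i} 2F refl (fits (hist-I (<⇒≤ i<))))
          (loopᵉ {M′ = succ (size# F) ⊗ (succ q ⊗ succ q)} (N≤ i (<⇒≤ i<)) (λ ρ′ → κ (flat q (outer (hist i) ρ′))) (λ _ → ω) (V 0F)
            (λ ρ′ ρ< → loopᵉ {M′ = succ q ⊗ succ q} nF≤ (λ φ → κ (flat q (inner (outer (hist i) ρ′) (row (hist i) ρ′) φ))) (λ _ → ω) (countRows Fₛ {R = F} 4F refl sF)
              (λ φ φ< → guardᵉ i i< ρ′ ρ< φ φ<)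
              (*-monoˡ-≤ (suc q * suc q) (n≤1+n (size# F))))
            (*-monoˡ-≤ _ (≤-trans (longer (hist-I (<⇒≤ i<))) (n≤1+n NH)))))
        (*-monoˡ-≤ _ (n≤1+n I))
      where
      N≤ : ∀ i → i ≤ I → size# (hist i) ≤ Ω
      N≤ i i≤ = ≤-trans (longer (hist-I i≤)) nH≤

  -- Derivation for the output.

  emitᵉ : ∀ {n} {ρ : Vec ℕ n} (G : Good ρ) {m K q x : ℕ} {wl bl ul fl : Seq ℕ} {P : Rows} {g : ℕ → ℕ} (m≤ : m ≤ Ω) (K≤ : K ≤ Ω) (q≤ : q ≤ Ω) (x≤ : x ≤ Ω) → x ≤ K → m * K ≤ Ω →
    Bits≤ P → (∀ c y → c < m → y < K → g (c * K + y) < q) → size# P * suc q ≤ Ω →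
    Ex (m≤ ∷ K≤ ∷ q≤ ∷ x≤ ∷ G) emitS (st wl (tab g (m * K)) bl ul fl (flat q P)) ε
       (st wl (tab g (m * K)) bl ul fl (flat q P)) (Emission.emitted P (λ c y → g (c * K + y)) x m) 100 (succ m ⊗ (succ (size# P) ⊗ succ x))
  emitᵉ {ρ = ρ} G {m} {K} {q} {x} {wl} {bl} {ul} {fl} {P} {g} m≤ K≤ q≤ x≤ x≤K mK≤ bits g< sP = relaxˢ $
    loopᵉ {M′ = succ (size# P) ⊗ succ x} m≤ (λ _ → σ) emitted (V 0F)
      (λ c c<m → loopᵉ {M′ = succ x} nP≤ (λ _ → σ) (emitRows (emitted c) c) (countRows Pₛ {R = P} 3F refl sP)
        (λ i i< → loopᵉ {M′ = one} x≤ (λ _ → σ) (ext (emitRows (emitted c) c i) (member c i)) (V 5F)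
          (λ y y< → outᵉ (getCell Pₛ {R = P} refl Extends-refl
            (cellᵉ 5F (V 1F) (getTab Hₛ refl ((V 2F *ᵉ V 4F) +ᵉ V 0F) (block-< c<m (<-≤-trans y< x≤K)) (≤-trans (<⇒≤ (g< c y c<m (<-≤-trans y< x≤K))) q≤) mK≤))
            i< (g< c y c<m (<-≤-trans y< x≤K)) (bits i _) sP′))
          (≤-trans (≤-reflexive (*-identityʳ x)) (n≤1+n x)))
        (*-monoˡ-≤ (suc x) (n≤1+n (size# P))))
      (*-monoˡ-≤ (suc (size# P) * suc x) (n≤1+n m))
    where
    open Emission P (λ c y → g (c * K + y)) x
    σ = st wl (tab g (m * K)) bl ul fl (flat q P)
    sP′ : size# (flat q P) ≤ Ω
    sP′ = ≤-trans (≤-reflexive (size-flat q P)) sP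
    nP≤ : size# P ≤ Ω
    nP≤ = ≤-trans (m≤m*n (size# P) (suc q)) sP

  -- Derivation for the greedy cover.

  bitᵉ : ∀ {n} {ρ : Vec ℕ n} {G : Good ρ} {σ e f v i A C p p′} Q → i ≤ Q → Q ≤ Ω → 2 ^ Q ≤ Ω → {_ : T (p ≤ᵇ 9)} →
    Ev G σ e v A (succ Q) p → (∀ {M} → Ev G σ f i C M p′) → Ev G σ (bitE e f) (bitN v i) _ (succ Q) p
  bitᵉ {p = p} Q i≤ Q≤ 2^Q≤ {p≤} d di = modᵉ (_÷ᵉ_ d (raiseᵉ (s≤s i≤) (pow2ᵉ (≤-trans i≤ Q≤) (≤-trans (^-monoʳ-≤ 2 i≤) 2^Q≤) di)) {p≤}) (Lᵉ 2) {p≤}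

  unary : ∀ {n} {ρ : Vec ℕ n} {G : Good ρ} {σ e v A M p} → v ≤ 1 → Ev G σ e v A M p → Ev G σ e v A M 1
  unary v≤ = lowerᵉ (≤-trans v≤ 1≤Ω)

  xᵉ : ∀ {n} {ρ : Vec ℕ n} {G : Good ρ} {σ M} e V′ → Ev G σ (xE e V′) (lookup ρ e ÷ lookup ρ V′) 5 M 1
  xᵉ e V′ = V e ÷ᵉ V V′

  yᵉ : ∀ {n} {ρ : Vec ℕ n} {G : Good ρ} {σ M} e V′ → Ev G σ (yE e V′) (lookup ρ e mod lookup ρ V′) 11 M 1
  yᵉ e V′ = modᵉ (V e) (V V′)

  sum≤ : ∀ (f : ℕ → ℕ) {Q} → (∀ i → f i ≤ 2) → 2 * Q ≤ Ω → ∀ i → i ≤ Q → Σ< f i ≤ Ω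
  sum≤ f {Q} h 2Q≤ i i≤ = ≤-trans (Σ-const f 2 i (λ x _ → h x)) (≤-trans (≤-trans (*-monoˡ-≤ 2 i≤) (≤-reflexive (*-comm Q 2))) 2Q≤)

  *≤1 : ∀ {x y} → x ≤ 1 → y ≤ 1 → x * y ≤ 1
  *≤1 x≤ y≤ = *-mono-≤ x≤ y≤

  sumᵉ : ∀ {n} {ρ : Vec ℕ n} {G : Good ρ} {σ} Q {e A} (f : ℕ → ℕ) (f≤ : ∀ i → f i ≤ 2) (2Q≤ : 2 * lookup ρ Q ≤ Ω) →
    (∀ i (i< : i < lookup ρ Q) → Ev (≤-trans (<⇒≤ i<) (within G Q) ∷ sum≤ f f≤ 2Q≤ i (<⇒≤ i<) ∷ G) σ e (f i) A (succ (lookup ρ Q)) 1) →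
    Ev G σ (sumE Q e) (Σ< f (lookup ρ Q)) (2 + (1 + ((2 + (A + 1)) + 13))) (succ (lookup ρ Q) ⊗ succ (lookup ρ Q)) 1
  sumᵉ {ρ = ρ} {G} Q f f≤ 2Q≤ d = foldᵉ {M′ = succ (lookup ρ Q)} (Σ< f) (within G Q) (sum≤ f f≤ 2Q≤) (V Q) (Lᵉ 0)
    (λ i i< → _ , (V 1F +ᵉ d i i<)) (*-monoˡ-≤ (suc (lookup ρ Q)) (n≤1+n (lookup ρ Q)))

  meetsᵉ : ∀ {n} {ρ : Vec ℕ n} {G : Good ρ} {σ} v e V′ Q → 2 ^ lookup ρ Q ≤ Ω → 2 * lookup ρ Q ≤ Ω →
    Ev G σ (meetsE v e V′ Q) (meets (lookup ρ Q) (bitN (lookup ρ e ÷ lookup ρ V′)) (bitN (lookup ρ e mod lookup ρ V′)) (lookup ρ v)) 1200 (succ (lookup ρ Q) ⊗ succ (lookup ρ Q)) 0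
  meetsᵉ {ρ = ρ} {G} {σ} v e V′ Q 2^Q≤ 2Q≤ = relaxᵉ $ eqᵉ (sumᵉ Q f f≤ 2Q≤ body) (Lᵉ 0)
    where
    x = lookup ρ e ÷ lookup ρ V′
    y = lookup ρ e mod lookup ρ V′
    f : ℕ → ℕ
    f i = bitN x i * (1 ∸ bitN (lookup ρ v) i) + bitN y i * bitN (lookup ρ v) i
    f≤ : ∀ i → f i ≤ 2
    f≤ i = +-mono-≤ (*≤1 (bitN-≤1 x i) (m∸n≤m 1 (bitN (lookup ρ v) i))) (*≤1 (bitN-≤1 y i) (bitN-≤1 (lookup ρ v) i))
    body : ∀ i (i< : i < lookup ρ Q) → Ev (≤-trans (<⇒≤ i<) (within G Q) ∷ sum≤ f f≤ 2Q≤ i (<⇒≤ i<) ∷ G) σ _ (f i) _ (succ (lookup ρ Q)) 1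
    body i i< = lowerᵉ (≤-trans (f≤ i) (≤-trans (m≤m+n 2 30) 32≤Ω))
      ((b (xᵉ (suc (suc e)) (suc (suc V′))) *ᵉ (L₁ ∸ᵉ b (V (suc (suc v))))) +ᵉ (b (yᵉ (suc (suc e)) (suc (suc V′))) *ᵉ b (V (suc (suc v)))))
      where
      G′ : Good (i ∷ Σ< f i ∷ ρ)
      G′ = ≤-trans (<⇒≤ i<) (within G Q) ∷ sum≤ f f≤ 2Q≤ i (<⇒≤ i<) ∷ G
      b : ∀ {c z A} → Ev {ρ = i ∷ Σ< f i ∷ ρ} G′ σ c z A (succ (lookup ρ Q)) 1 → Ev {ρ = i ∷ Σ< f i ∷ ρ} G′ σ (bitE c (var 0F)) (bitN z i) _ (succ (lookup ρ Q)) 1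
      b d = bitᵉ (lookup ρ Q) (<⇒≤ i<) (within G Q) 2^Q≤ d (V 0F)

  activeᵉ : ∀ {n} {ρ : Vec ℕ n} {G : Good ρ} {σ e a b Q} {e≤ a≤ b≤} {Q≤ : Q ≤ Ω} {V≤ : 2 ^ Q ≤ Ω} R → 2 * Q ≤ Ω →
    Ev (e≤ ∷ a≤ ∷ b≤ ∷ Q≤ ∷ V≤ ∷ G) σ activeE (Greedy.active Q a b R e) 600 (succ Q ⊗ succ Q) 1
  activeᵉ {ρ = ρ} {G = G} {σ} {e} {a} {b} {Q} {e≤} {a≤} {b≤} {Q≤} {V≤} R 2Q≤ = relaxᵉ $ unary
      (*≤1 (m∸n≤m 1 (Σ< x Q ∸ a)) (*≤1 (m∸n≤m 1 (Σ< y Q ∸ b)) (eqN-≤1 (Σ< (λ i → x i * y i) Q) 0)))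
      ((L₁ ∸ᵉ (sumᵉ 3F x (λ i → up (bitN-≤1 (e ÷ 2 ^ Q) i)) 2Q≤ (λ i i< → c i i< (xᵉ 2F 6F)) ∸ᵉ V 1F))
      *ᵉ ((L₁ ∸ᵉ (sumᵉ 3F y (λ i → up (bitN-≤1 (e mod 2 ^ Q) i)) 2Q≤ (λ i i< → c i i< (yᵉ 2F 6F)) ∸ᵉ V 2F))
      *ᵉ eqᵉ (sumᵉ 3F (λ i → x i * y i) (λ i → up (*≤1 (bitN-≤1 (e ÷ 2 ^ Q) i) (bitN-≤1 (e mod 2 ^ Q) i))) 2Q≤
           (λ i i< → unary (*≤1 (bitN-≤1 (e ÷ 2 ^ Q) i) (bitN-≤1 (e mod 2 ^ Q) i)) (c i i< (xᵉ 2F 6F) *ᵉ c i i< (yᵉ 2F 6F)))) (Lᵉ 0)))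
    where
    x = bitN (e ÷ 2 ^ Q)
    y = bitN (e mod 2 ^ Q)
    up : ∀ {k} → k ≤ 1 → k ≤ 2
    up k≤ = ≤-trans k≤ (n≤1+n 1)
    c : ∀ i (i< : i < Q) {s : ℕ} {s≤ : s ≤ Ω} {f z A} → Ev {ρ = i ∷ s ∷ e ∷ a ∷ b ∷ Q ∷ 2 ^ Q ∷ ρ} (≤-trans (<⇒≤ i<) Q≤ ∷ s≤ ∷ e≤ ∷ a≤ ∷ b≤ ∷ Q≤ ∷ V≤ ∷ G) σ f z A (succ Q) 1 →
        Ev (≤-trans (<⇒≤ i<) Q≤ ∷ s≤ ∷ e≤ ∷ a≤ ∷ b≤ ∷ Q≤ ∷ V≤ ∷ G) σ (bitE f (var 0F)) (bitN z i) _ (succ Q) 1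
    c i i< d = bitᵉ Q (<⇒≤ i<) Q≤ V≤ d (V 0F)

  module GreedyDerivation {n} {ρ : Vec ℕ n} (G : Good ρ) (a b Q T : ℕ) (R : Rows) {wl hl fl pl : Seq ℕ} {ω : Seq Bool}
    (a≤ : a ≤ Ω) (b≤ : b ≤ Ω) (Q≤ : Q ≤ Ω) (V≤ : (2 ^ Q) ≤ Ω) (E≤ : ((2 ^ Q) * (2 ^ Q)) ≤ Ω) (T≤ : T ≤ Ω) (2Q≤ : 2 * Q ≤ Ω)
    (history≤ : suc T * ((2 ^ Q) * (2 ^ Q)) ≤ Ω) (best≤ : suc ((2 ^ Q) * (2 ^ Q)) * (2 ^ Q) ≤ Ω) (space : (size# R + T) * suc Q ≤ Ω) where

    private
      V# E# : ℕ
      V# = 2 ^ Q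
      E# = V# * V#

    open Greedy Q a b R hiding (V)

    private
      0<E : 0 < E
      0<E = *-mono-≤ (m^n>0 2 Q) (m^n>0 2 Q)

      -- The list of uncovered events is never overwritten: every step appends a new block of length
      -- `E`.
      history : ℕ → ℕ
      history i = u (i ÷ E) (i mod E)

      history-at : ∀ t {e} → e < E → history (t * E + e) ≡ u t e
      history-at t e< = cong₂ u (proj₁ (÷-block t E e<)) (proj₂ (÷-block t E e<))

      u≤1 : ∀ t e → u t e ≤ 1
      u≤1 zero e = *≤1 (m∸n≤m 1 (Σ< (xs e) Q ∸ a)) (*≤1 (m∸n≤m 1 (Σ< (ys e) Q ∸ b)) (eqN-≤1 (Σ< (λ i → xs e i * ys e i) Q) 0))
      u≤1 (suc t) e = *≤1 (u≤1 t e) (m∸n≤m 1 (cov (choice t) e))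

      σ# : ℕ → Rows → Store
      σ# x S = st wl hl (flat Q S) (tab history x) fl pl

      E₀ : Good (a ∷ b ∷ Q ∷ 2 ^ Q ∷ E ∷ T ∷ ρ)
      E₀ = a≤ ∷ b≤ ∷ Q≤ ∷ V≤ ∷ E≤ ∷ T≤ ∷ G

      QQ unit : Pos
      QQ = succ Q ⊗ succ Q
      unit = two^ Q ⊗ ((E ⁺ 0<E) ⊗ QQ)

      Q≤unit : succ Q .val ≤ val unit
      Q≤unit = ≤-trans (m≤m*n (suc Q) (suc Q)) (≤-trans (m≤n*m _ E ⦃ >-nonZero 0<E ⦄) (m≤n*m _ (2 ^ Q) ⦃ m^n≢0 2 Q ⦄))

      ▹-tab : ∀ (f : ℕ → ℕ) {x y v} → v ≡ f x → suc x ≡ y → tab f x ▹ v ≡ tab f y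
      ▹-tab f refl refl = refl

      greedy-size-≤ : ∀ t → size# (greedy t) ≤ size# R + t
      greedy-size-≤ zero = ≤-reflexive (sym (+-identityʳ _))
      greedy-size-≤ (suc t) with flag t
      ... | zero = ≤-trans (greedy-size-≤ t) (+-monoʳ-≤ (size# R) (n≤1+n t))
      ... | suc _ = ≤-trans (s≤s (greedy-size-≤ t)) (≤-reflexive (sym (+-suc (size# R) t)))

    greedyCost : Pos
    greedyCost = succ T ⊗ unit

    private
      module Step (t : ℕ) (t< : t < T) (t≤Ω : t ≤ Ω) where

        Eₜ : Good (t ∷ a ∷ b ∷ Q ∷ 2 ^ Q ∷ E ∷ T ∷ ρ)
        Eₜ = t≤Ω ∷ E₀

        u≤ : suc t * E ≤ Ω
        u≤ = ≤-trans (*-monoˡ-≤ E (<⇒≤ (s≤s t<))) history≤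

        σ₀ = σ# (suc t * E) (greedy t)

        covered≤ : ∀ v x → x ≤ E → Σ< (λ e → u t e * cov v e) x ≤ E
        covered≤ v x x≤ = ≤-trans (Σ-const _ 1 x (λ e _ → *≤1 (u≤1 t e) (eqN-≤1 (violations (xs e) (ys e) v Q) 0))) (≤-trans (≤-reflexive (*-identityʳ x)) x≤)

        coveredᵉ : ∀ v c (v≤ : v ≤ Ω) (c≤ : c ≤ Ω) → Ev (v≤ ∷ c≤ ∷ Eₜ) σ₀ (fold (var 7F) (lit 0) (op add (var 1F) (op mul (get Uₛ (op add (op mul (var 4F) (var 9F)) (var 0F))) (meetsE 2F 0F 8F 7F))))
          (covered t v) 1400 ((E ⁺ 0<E) ⊗ QQ) 1
        coveredᵉ v c v≤ c≤ = relaxᵉ $ foldᵉ {M′ = QQ} (Σ< (λ e → u t e * cov v e)) E≤ (λ x x≤ → ≤-trans (covered≤ v x x≤) E≤) (V 7F) (Lᵉ 0)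
          (λ e e< → _ , (V 1F +ᵉ (castᵉ (history-at t e<) (getTab Uₛ refl ((V 4F *ᵉ V 9F) +ᵉ V 0F) (block-< {t} ≤-refl e<)
              (≤-trans (≤-reflexive (history-at t e<)) (≤-trans (u≤1 t e) 1≤Ω)) u≤) *ᵉ meetsᵉ 2F 0F 8F 7F V≤ 2Q≤)))
          ≤-refl

        topᵉ : Ev Eₜ σ₀ topE (top t) 1500 unit 1
        topᵉ = relaxᵉ $ foldᵉ {M = unit} {M′ = (E ⁺ 0<E) ⊗ QQ} (best (covered t) (2 ^ Q)) V≤ top≤ (V 4F) (Lᵉ 0)
          (λ v v< → _ , maxᵉ (V 1F) ((coveredᵉ v _ _ _ *ᵉ V 6F) +ᵉ V 0F)) ≤-refl
          where
          top≤ : ∀ v → v ≤ 2 ^ Q → best (covered t) (2 ^ Q) v ≤ Ω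
          top≤ v v≤ = ≤-trans (best-≤ (covered t) (2 ^ Q) v E v≤ (λ x _ → covered≤ x E ≤-refl)) (≤-trans (≤-reflexive (+-comm (E * 2 ^ Q) (2 ^ Q))) best≤)

        flag≤Ω : flag t ≤ Ω
        flag≤Ω = ≤-trans (flag-≤1 t) 1≤Ω

        recordᵉ : ∀ {top≤} → Ex {ρ = top t ∷ t ∷ a ∷ b ∷ Q ∷ 2 ^ Q ∷ E ∷ T ∷ ρ} (top≤ ∷ Eₜ)
          (loop (op sub (lit 1) (op sub (lit 1) (op quo (var 0F) (var 5F)))) (rowS Bₛ (var 5F) (bitE (modE (var 2F) (var 7F)) (var 0F)) (var 3F)))
          σ₀ ω (σ# (suc t * E) (greedy (suc t))) ω 300 unit
        recordᵉ {top≤} = castˢ refl (sym (pick-σ (flag t))) $ relaxˢ $ loopᵉ {M′ = QQ} flag≤Ω (λ x → pick x σ₀ (σ# (suc t * E) (greedy t ▹ (a , bitN (choice t))))) (λ _ → ω)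
          (Lᵉ 1 ∸ᵉ (Lᵉ 1 ∸ᵉ (V 0F ÷ᵉ V 5F))) body
          (≤-trans (*-monoˡ-≤ (val QQ) (flag-≤1 t)) (≤-trans (≤-reflexive (*-identityˡ (val QQ))) (≤-trans (m≤n*m _ E ⦃ >-nonZero 0<E ⦄) (m≤n*m _ (2 ^ Q) ⦃ m^n≢0 2 Q ⦄))))
          where
          pick-σ : ∀ x → σ# (suc t * E) (pick x (greedy t) (greedy t ▹ (a , bitN (choice t)))) ≡ pick x σ₀ (σ# (suc t * E) (greedy t ▹ (a , bitN (choice t))))
          pick-σ zero    = refl
          pick-σ (suc _) = refl
          body : ∀ x (x< : x < flag t) → Ex {ρ = x ∷ top t ∷ t ∷ a ∷ b ∷ Q ∷ 2 ^ Q ∷ E ∷ T ∷ ρ} (≤-trans (<⇒≤ x<) flag≤Ω ∷ top≤ ∷ Eₜ)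
            (rowS Bₛ (var 5F) (bitE (modE (var 2F) (var 7F)) (var 0F)) (var 3F)) (pick x σ₀ (σ# (suc t * E) (greedy t ▹ (a , bitN (choice t))))) ω
            (pick (suc x) σ₀ (σ# (suc t * E) (greedy t ▹ (a , bitN (choice t))))) ω 200 QQ
          body zero x< = relaxˢ $ rowᵉ Bₛ {λ s → st wl hl s (tab history (suc t * E)) fl pl} {Q} {greedy t} {M′ = succ Q} (λ _ → refl) (λ _ _ → refl) Q≤
            (≤-trans (*-monoˡ-≤ (suc Q) (≤-trans (s≤s (greedy-size-≤ t)) (≤-trans (≤-reflexive (sym (+-suc (size# R) t))) (+-monoʳ-≤ (size# R) t<)))) space)
            (V 5F) (λ y y< → bitᵉ Q (<⇒≤ y<) Q≤ V≤ (modᵉ (V 2F) (V 7F)) (V 0F)) (V 3F) (*-monoˡ-≤ (suc Q) (n≤1+n Q))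
          body (suc x) x< = ⊥-elim (<⇒≱ x< (≤-trans (flag-≤1 t) (s≤s z≤n)))

        updateᵉ : ∀ {top≤ c≤} → Ex {ρ = choice t ∷ top t ∷ t ∷ a ∷ b ∷ Q ∷ 2 ^ Q ∷ E ∷ T ∷ ρ} (c≤ ∷ top≤ ∷ Eₜ)
          (loop (var 7F) (push Uₛ (op mul (get Uₛ (op add (op mul (var 3F) (var 8F)) (var 0F))) (op sub (lit 1) (meetsE 1F 0F 7F 6F)))))
          (σ# (suc t * E) (greedy (suc t))) ω (σ# (suc (suc t) * E) (greedy (suc t))) ω 1500 unit
        updateᵉ = castˢ (cong (λ x → σ# x (greedy (suc t))) (+-identityʳ _)) (cong (λ x → σ# x (greedy (suc t))) (+-comm (suc t * E) E)) $ relaxˢ $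
          loopᵉ {M′ = QQ} E≤ (λ e → σ# (suc t * E + e) (greedy (suc t))) (λ _ → ω) (V 7F)
          (λ e e< → castˢ refl (cong (λ s → st wl hl (flat Q (greedy (suc t))) s fl pl) (▹-tab history (sym (history-at (suc t) e<)) (sym (+-suc (suc t * E) e))))
            (pushᵉ Uₛ (castᵉ (history-at t e<) (getTab Uₛ refl ((V 3F *ᵉ V 8F) +ᵉ V 0F) (<-≤-trans (block-< {t} ≤-refl e<) (m≤m+n (suc t * E) e))
                (≤-trans (≤-reflexive (history-at t e<)) (≤-trans (u≤1 t e) 1≤Ω)) (len≤ e (<⇒≤ e<)))
              *ᵉ (L₁ ∸ᵉ meetsᵉ 1F 0F 7F 6F V≤ 2Q≤))
              (≤-trans (≤-reflexive (size-tab history (suc t * E + e))) (len≤ e (<⇒≤ e<)))))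
          (m≤n*m _ (2 ^ Q) ⦃ m^n≢0 2 Q ⦄)
          where
          len≤ : ∀ e → e ≤ E → suc t * E + e ≤ Ω
          len≤ e e≤ = ≤-trans (+-monoʳ-≤ (suc t * E) e≤) (≤-trans (≤-reflexive (+-comm (suc t * E) E)) (≤-trans (*-monoˡ-≤ E (s≤s t<)) history≤))

    greedyᵉ : ∀ {ul} → Ex E₀ greedyS (st wl hl (flat Q R) ul fl pl) ω (st wl hl (flat Q (greedy T)) (tab history (suc T * E)) fl pl) ω 4000 greedyCost
    greedyᵉ = relaxˢ $ clearᵉ Uₛ ⨾ᵉ
      castˢ refl (cong (λ x → σ# x R) (sym (+-identityʳ E))) (loopᵉ {M′ = QQ} E≤ (λ e → σ# e R) (λ _ → ω) (V 4F)
        (λ e e< → castˢ refl (cong (λ s → st wl hl (flat Q R) s fl pl) (▹-tab history (sym (history-at 0 e<)) refl))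
          (pushᵉ Uₛ (activeᵉ R 2Q≤) (≤-trans (≤-reflexive (size-tab history e)) (≤-trans (<⇒≤ e<) E≤))))
        (≤-trans (m≤n*m _ (2 ^ Q) ⦃ m^n≢0 2 Q ⦄) (m≤n*m (val unit) (suc T)))) ⨾ᵉ
      loopᵉ {M′ = unit} T≤ (λ t → σ# (suc t * E) (greedy t)) (λ _ → ω) (V 5F)
        (λ t t< → bindᵉ (unsmall (bnd (Step.topᵉ t t< (≤-trans (<⇒≤ t<) T≤)))) (Step.topᵉ t t< _) (Step.recordᵉ t t< _ ⨾ᵉ
          bindᵉ (≤-trans (<⇒≤ (proj₂ (top-÷ t))) V≤) (raiseᵉ {M = one} (pos unit) (modᵉ (V 0F) (V 5F))) (Step.updateᵉ t t< _)))
        (*-monoˡ-≤ (val unit) (n≤1+n T))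

  skipᵉ : ∀ {n} {ρ : Vec ℕ n} {G : Good ρ} {e s σ ω A M p} → Ev G σ e 0 A M p → Ex G (loop e s) σ ω σ ω (A + 9) M
  skipᵉ {σ = σ} {ω} d = loopᵉ {C = 0} {M′ = one} z≤n (λ _ → σ) (λ _ → ω) d (λ i ()) z≤n

  onceᵉ : ∀ {n} {ρ : Vec ℕ n} {G : Good ρ} {e s σ σ′ ω A C M p} → Ev G σ e 1 A M p →
    (∀ (z≤ : 0 ≤ Ω) → Ex (z≤ ∷ G) s σ ω σ′ ω C M) → Ex G (loop e s) σ ω σ′ ω (A + (C + 9)) M
  onceᵉ {s = s} {σ} {σ′} {ω} {C = C} {M} d b = loopᵉ {M′ = M} 1≤Ω (λ i → pick i σ σ′) (λ _ → ω) d body (≤-reflexive (*-identityˡ (val M)))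
    where
    body : ∀ i (i< : i < 1) → Ex (≤-trans (<⇒≤ i<) 1≤Ω ∷ _) s (pick i σ σ′) ω (pick (suc i) σ σ′) ω C M
    body zero i< = b _
    body (suc i) (s≤s ())

  regood : ∀ {n} {ρ : Vec ℕ n} {G G′ : Good ρ} {s σ ω σ′ ω′ A M} → Ex G s σ ω σ′ ω′ A M → Ex G′ s σ ω σ′ ω′ A M
  regood (ex d) = ex d

  -- Derivations for the rows on q cells.

  module Prepare (r s n d ℓ p j Z : ℕ) (Z≤Ω : Z ≤ Ω) (1≤Z : 1 ≤ Z) (q≤ : (2 ^ j) ≤ Z) (j≤ : j ≤ Ω) (p≤ : p ≤ Ω) (ℓ≤ : ℓ ≤ Ω) (d≤ : d ≤ Ω) (n≤ : n ≤ Ω) (r≤ : r ≤ Ω) (s≤ : s ≤ Ω) where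

    private
      q : ℕ
      q = 2 ^ j

    M# : Pos
    M# = Z ⁺ 1≤Z

    ≤Ω : ∀ {x} → x ≤ Z → x ≤ Ω
    ≤Ω h = ≤-trans h Z≤Ω

    E₈ : Good (q ∷ j ∷ p ∷ ℓ ∷ d ∷ n ∷ r ∷ s ∷ [])
    E₈ = ≤Ω q≤ ∷ j≤ ∷ p≤ ∷ ℓ≤ ∷ d≤ ∷ n≤ ∷ r≤ ∷ s≤ ∷ []

    smallRows : Rows
    smallRows = ext ε (tuple j r) (2 ^ (r * j))

    smallᵉ : 2 ^ (r * j) * suc q ≤ Z → 2 ^ (r * j) * (q * (suc r * suc (r * j))) ≤ Z → ∀ {z≤ : 0 ≤ Ω} {ω} →
      Ex (z≤ ∷ E₈) smallS none ω (st ε ε (flat q smallRows) ε ε (flat q smallRows)) ω 1000 M#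
    smallᵉ space cost {z≤} {ω} = relaxˢ $ bindᵉ (≤Ω q≤) (V (# 1)) (bindᵉ j≤ (V (# 3)) (bindᵉ r≤ (V (# 9))
      (raise cost (tuplesᵉ (z≤ ∷ E₈) {R = ε} r≤ j≤ (≤Ω q≤) (≤Ω (≤-trans (m≤m*n (2 ^ (r * j)) (suc q)) space)) (≤Ω space))
       ⨾ᵉ castˢ refl (cong (st ε ε F ε ε) (tab-at F)) (loopᵉ {M′ = one} (≤Ω L≤) (λ i → st ε ε F ε ε (tab (at 0 F) i)) (λ _ → ω) (lenᵉ Bₛ (≤Ω L≤))
         (λ i i< → pushᵉ Pₛ (getᵉ Bₛ (V (# 0)) i< (≤-trans (at-flat-≤ q smallRows bits tags i) r≤) (≤Ω L≤)) (≤-trans (≤-reflexive (size-tab (at 0 F) i)) (≤Ω (≤-trans (<⇒≤ i<) L≤))))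
         (≤-trans (≤-reflexive (*-identityʳ _)) L≤)))))
      where
      F = flat q smallRows
      L≤ : size# F ≤ Z
      L≤ = ≤-trans (≤-reflexive (trans (size-flat q smallRows) (cong (_* suc q) (size-ext ε (tuple j r) (2 ^ (r * j)))))) space
      bits : AllBits r smallRows
      bits = AllBits-ext (tuple j r) _ tt (λ t y _ → tuple-bits j r t y)
      tags : Tags≤ r smallRows
      tags = Tags≤-ext (tuple j r) _ tt (λ _ _ → ≤-refl)

    -- One number `Z` bounds every quantity of the construction; it serves as space bound and as
    -- cost factor at once.
    module Large (g dn ω x jQ : ℕ)
      (g≡ : ℓ ÷ 12 ≡ g) (dn≡ : 1 ∸ (2 ^ (10 * g) ∸ r) ≡ dn) (ω≡ : dn * 2 ^ (3 * g) + (1 ∸ dn) * ℓ ≡ ω)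
      (x≡ : 4 * ((ω + 1) * (ω + 1) * (s ÷ r + 1)) + 1 ≡ x) (jQ≡ : lg x ≡ jQ)
      (2^10g≤ : 2 ^ (10 * g) ≤ Z) (ω≤ : suc ω ≤ Z) (2x≤ : 2 * x ≤ Z) (lgx≤ : suc x * suc jQ ≤ Z)
      (hashSpace : suc (((2 ^ jQ) ÷ 2) * j) * q ≤ Z) (hashHeavy : suc (2 ^ (j + j)) * (2 ^ jQ) ≤ Z) (hashTime : suc (((2 ^ jQ) ÷ 2) * j) * (q * ((2 ^ jQ) * (suc jQ * suc jQ))) ≤ Z)
      (Φ≤ : ∀ c → c ≤ (((2 ^ jQ) ÷ 2) * j) → Hash.Columns.Φ jQ j c ≤ 2 ^ (j + j)) where

      private
        Q V# m₁ T₁ : ℕ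
        Q = 2 ^ jQ
        V# = 2 ^ Q
        m₁ = (Q ÷ 2) * j
        T₁ = steps ω Q

      base fam : Rows
      base = pick dn (sparseRows jQ (suc ω)) (denseRows ω Q (suc ω))
      fam  = Lifting.fam base (λ c y → columnsOf jQ j (c * q + y)) m₁

      I : ℕ
      I = dn * (d ÷ ω) + (1 ∸ dn) * ((r + r) ÷ ω) + 1

      hist : Rows
      hist = History.hist q r fam I

      module _ (flag : (dn ≡ 0 × suc ω * (2 ^ (ω * jQ) * (Q * (suc ω * suc (ω * jQ)))) ≤ Z) ⊎
                       (dn ≡ 1 × 2 * Q ≤ Z × (suc ω * T₁) * suc Q ≤ Z × suc T₁ * (V# * V#) ≤ Z × suc (V# * V#) * V# ≤ Z × suc ω * (suc T₁ * (V# * ((V# * V#) * (suc Q * suc Q)))) ≤ Z))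
        (baseSpace : size# base * suc Q ≤ Z) (famSpace : (m₁ * size# base) * suc q ≤ Z) (famTime : suc m₁ * (suc (size# base) * suc q) ≤ Z)
        (I≤ : I ≤ Z) (q+1≤ : suc q ≤ Z) (histSpace : size# hist * suc q ≤ Z) (histTime : suc I * (suc (size# hist) * (suc (size# fam) * (suc q * suc q))) ≤ Z) where

        private
          d≤1 : dn ≤ 1
          d≤1 = ≤-trans (≤-reflexive (sym dn≡)) (m∸n≤m 1 (2 ^ (10 * g) ∸ r))
          Q≤ : Q ≤ Z
          Q≤ = ≤-trans (m≤m+n Q _) hashHeavy
          jQ≤ : jQ ≤ Z
          jQ≤ = ≤-trans (<⇒≤ (n<2^n jQ)) Q≤
          g≤ : g ≤ Z
          g≤ = ≤-trans (m≤n*m g 10) (≤-trans (<⇒≤ (n<2^n (10 * g))) 2^10g≤)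
          2^3g≤ : 2 ^ (3 * g) ≤ Z
          2^3g≤ = ≤-trans (^-monoʳ-≤ 2 (*-monoˡ-≤ g (m≤m+n 3 7))) 2^10g≤
          ω≤Z : ω ≤ Z
          ω≤Z = ≤-trans (n≤1+n ω) ω≤
          x≤ : x ≤ Z
          x≤ = ≤-trans (m≤m+n x _) 2x≤
          m₁≤ : m₁ ≤ Z
          m₁≤ = ≤-trans (n≤1+n m₁) (≤-trans (m≤m*n (suc m₁) q ⦃ m^n≢0 2 j ⦄) hashSpace)
          0<x : 0 < x
          0<x = subst (0 <_) x≡ (≤-trans (s≤s z≤n) (≤-reflexive (+-comm 1 (4 * ((ω + 1) * (ω + 1) * (s ÷ r + 1))))))

        module _ {z≤ : 0 ≤ Ω} where

          E₁₅ : Good (Q ∷ jQ ∷ x ∷ ω ∷ dn ∷ g ∷ 0 ∷ q ∷ j ∷ p ∷ ℓ ∷ d ∷ n ∷ r ∷ s ∷ [])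
          E₁₅ = ≤Ω Q≤ ∷ ≤Ω jQ≤ ∷ ≤Ω x≤ ∷ ≤Ω ω≤Z ∷ ≤-trans d≤1 1≤Ω ∷ ≤Ω g≤ ∷ z≤ ∷ E₈

          E₂₀ : Good (m₁ ∷ q ∷ Q ∷ j ∷ jQ ∷ Q ∷ jQ ∷ x ∷ ω ∷ dn ∷ g ∷ 0 ∷ q ∷ j ∷ p ∷ ℓ ∷ d ∷ n ∷ r ∷ s ∷ [])
          E₂₀ = ≤Ω m₁≤ ∷ ≤Ω q≤ ∷ ≤Ω Q≤ ∷ j≤ ∷ ≤Ω jQ≤ ∷ E₁₅

          module Inner = HashDerivation (Q ∷ jQ ∷ x ∷ ω ∷ dn ∷ g ∷ 0 ∷ q ∷ j ∷ p ∷ ℓ ∷ d ∷ n ∷ r ∷ s ∷ []) E₁₅ j jQ m₁ (≤Ω hashSpace) (≤Ω hashHeavy) Φ≤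

          σ₂₀ : Seq ℕ → Seq ℕ → Seq ℕ → Seq ℕ → Store
          σ₂₀ b u f p = st (tab Inner.weights (suc m₁ * q)) (tab (columnsOf jQ j) (m₁ * q)) b u f p

          baseᵉ : ∀ {ω′} → ∃ λ u → Ex E₂₀ (loop (suc# (var (# 8))) baseS) (σ₂₀ ε ε ε ε) ω′ (σ₂₀ (flat Q base) u ε ε) ω′ 6000 M#
          baseᵉ {ω′} = choose flag
            where
            sω≤ : suc ω ≤ Ω
            sω≤ = ≤Ω ω≤
            sω≤′ : ω + 1 ≤ Ω
            sω≤′ = ≤-trans (≤-reflexive (+-comm ω 1)) sω≤
            choose : _ → ∃ λ u → Ex E₂₀ (loop (suc# (var (# 8))) baseS) (σ₂₀ ε ε ε ε) ω′ (σ₂₀ (flat Q base) u ε ε) ω′ 6000 M#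
            choose (inj₁ (dn≡0 , time)) = ε , (castˢ refl (cong (λ R → σ₂₀ (flat Q R) ε ε ε) same) $ relaxˢ $
              loopᵉ {M′ = N′} sω≤′ (λ a → σ₂₀ (flat Q (sparseRows jQ a)) ε ε ε) (λ _ → ω′) (V (# 8) +ᵉ Lᵉ 1) body
                (≤-trans (≤-reflexive (cong (_* val N′) (+-comm ω 1))) time))
              where
              N′ : Pos
              N′ = two^ (ω * jQ) ⊗ (two^ jQ ⊗ (succ ω ⊗ succ (ω * jQ)))
              same : sparseRows jQ (ω + 1) ≡ base
              same = trans (cong (sparseRows jQ) (+-comm ω 1)) (cong (λ t → pick t (sparseRows jQ (suc ω)) (denseRows ω Q (suc ω))) (sym dn≡0))
              body : ∀ a (a< : a < ω + 1) → Ex (≤-trans (<⇒≤ a<) sω≤′ ∷ E₂₀) baseS (σ₂₀ (flat Q (sparseRows jQ a)) ε ε ε) ω′ (σ₂₀ (flat Q (sparseRows jQ (suc a))) ε ε ε) ω′ 500 N′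
              body a a< = relaxˢ $ skipᵉ (castᵉ dn≡0 (V (# 10))) ⨾ᵉ onceᵉ (castᵉ (cong (1 ∸_) dn≡0) (Lᵉ 1 ∸ᵉ V (# 10)))
                (λ z≤′ → bindᵉ (≤Ω Q≤) (V (# 4)) (bindᵉ (≤Ω jQ≤) (V (# 7)) (bindᵉ (≤-trans (<⇒≤ a<) sω≤′) (V (# 3))
                  (raise bound (tuplesᵉ (z≤′ ∷ ≤-trans (<⇒≤ a<) sω≤′ ∷ E₂₀) {R = sparseRows jQ a} (≤-trans (<⇒≤ a<) sω≤′) (≤Ω jQ≤) (≤Ω Q≤) pow≤ (≤-trans (*-monoˡ-≤ (suc Q) room≤) (≤Ω baseSpace)))))))
                where
                a≤ : a ≤ ω
                a≤ = ≤-pred (≤-trans a< (≤-reflexive (+-comm ω 1)))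
                room≤ : size# (sparseRows jQ a) + 2 ^ (a * jQ) ≤ size# base
                room≤ = ≤-trans (≤-reflexive (sym (size-ext (sparseRows jQ a) (tuple jQ a) (2 ^ (a * jQ)))))
                  (≤-trans (longer (sparse-prefix jQ (≤⇒≤′ (s≤s a≤)))) (≤-reflexive (cong size# (trans (cong (sparseRows jQ) (+-comm 1 ω)) same))))
                pow≤ : 2 ^ (a * jQ) ≤ Ω
                pow≤ = ≤-trans (m≤n+m _ (size# (sparseRows jQ a))) (≤-trans room≤ (≤Ω (≤-trans (m≤m*n (size# base) (suc Q)) baseSpace)))
                bound : 2 ^ (a * jQ) * (2 ^ jQ * (suc a * suc (a * jQ))) ≤ val N′
                bound = *-mono-≤ (^-monoʳ-≤ 2 (*-monoˡ-≤ jQ a≤)) (*-monoʳ-≤ (2 ^ jQ) (*-mono-≤ (s≤s a≤) (s≤s (*-monoˡ-≤ jQ a≤))))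
            choose (inj₂ (dn≡1 , 2Q≤ , space , hist≤ , best≤ , time)) = u (ω + 1) , (castˢ refl (cong (λ R → σ₂₀ (flat Q R) (u (ω + 1)) ε ε) same) $ relaxˢ $
              loopᵉ {M′ = N′} sω≤′ (λ a → σ₂₀ (flat Q (denseRows ω Q a)) (u a) ε ε) (λ _ → ω′) (V (# 8) +ᵉ Lᵉ 1) body
                (≤-trans (≤-reflexive (cong (_* val N′) (+-comm ω 1))) time))
              where
              0<VV : 0 < V# * V#
              0<VV = *-mono-≤ (m^n>0 2 Q) (m^n>0 2 Q)
              N′ : Pos
              N′ = succ T₁ ⊗ (two^ Q ⊗ (((V# * V#) ⁺ 0<VV) ⊗ (succ Q ⊗ succ Q)))
              u : ℕ → Seq ℕ
              u zero    = ε
              u (suc a) = tab (λ i → Greedy.u Q a (ω ∸ a) (denseRows ω Q a) (i ÷ (V# * V#)) (i mod (V# * V#))) (suc T₁ * (V# * V#))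
              same : denseRows ω Q (ω + 1) ≡ base
              same = trans (cong (denseRows ω Q) (+-comm ω 1)) (cong (λ t → pick t (sparseRows jQ (suc ω)) (denseRows ω Q (suc ω))) (sym dn≡1))
              VV≤ : V# * V# ≤ Ω
              VV≤ = ≤Ω (≤-trans (m≤m+n (V# * V#) _) hist≤)
              V≤ : V# ≤ Ω
              V≤ = ≤-trans (m≤m*n V# V# ⦃ m^n≢0 2 Q ⦄) VV≤
              T≤ : T₁ ≤ Ω
              T≤ = ≤Ω (≤-trans (≤-trans (n≤1+n T₁) (m≤m*n (suc T₁) (V# * V#) ⦃ >-nonZero 0<VV ⦄)) hist≤)
              2^ω≤ : 2 ^ ω ≤ Ω
              2^ω≤ = ≤-trans (≤-trans (m≤m*n (2 ^ ω) ((Q + Q) + 1) ⦃ >-nonZero (≤-trans (s≤s z≤n) (≤-reflexive (+-comm 1 (Q + Q)))) ⦄) (m≤n*m _ (ω + 1) ⦃ >-nonZero (≤-trans (s≤s z≤n) (≤-reflexive (+-comm 1 ω))) ⦄)) T≤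
              Z″ : ∀ {x} → suc x ≤ V# → suc x ≤ val N′
              Z″ {x} h = ≤-trans h (≤-trans (m≤m*n V# ((V# * V#) * (suc Q * suc Q)) ⦃ >-nonZero (pos (((V# * V#) ⁺ 0<VV) ⊗ (succ Q ⊗ succ Q))) ⦄) (m≤n*m _ (suc T₁)))
              powω : suc ω ≤ val N′
              powω = ≤-trans (≤-trans (n<2^n ω) (≤-trans (≤-trans (m≤m*n (2 ^ ω) ((Q + Q) + 1) ⦃ >-nonZero (≤-trans (s≤s z≤n) (≤-reflexive (+-comm 1 (Q + Q)))) ⦄) (m≤n*m _ (ω + 1) ⦃ >-nonZero (≤-trans (s≤s z≤n) (≤-reflexive (+-comm 1 ω))) ⦄)) (n≤1+n T₁)))
                (m≤m*n (suc T₁) _ ⦃ >-nonZero (pos (two^ Q ⊗ (((V# * V#) ⁺ 0<VV) ⊗ (succ Q ⊗ succ Q)))) ⦄)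
              body : ∀ a (a< : a < ω + 1) → Ex (≤-trans (<⇒≤ a<) sω≤′ ∷ E₂₀) baseS (σ₂₀ (flat Q (denseRows ω Q a)) (u a) ε ε) ω′ (σ₂₀ (flat Q (denseRows ω Q (suc a))) (u (suc a)) ε ε) ω′ 5000 N′
              body a a< = relaxˢ $ onceᵉ (castᵉ dn≡1 (V (# 10)))
                (λ z≤′ → bindᵉ T≤ ((V (# 10) +ᵉ Lᵉ 1) *ᵉ (raiseᵉ powω (pow2ᵉ (≤Ω ω≤Z) 2^ω≤ (V (# 10))) *ᵉ ((V (# 4) +ᵉ V (# 4)) +ᵉ Lᵉ 1)))
                  (bindᵉ VV≤ (powQ (V (# 5)) *ᵉ powQ (V (# 5))) (bindᵉ V≤ (powQ (V (# 6))) (bindᵉ (≤Ω Q≤) (V (# 7)) (bindᵉ (≤-trans (m∸n≤m ω a) (≤Ω ω≤Z)) (V (# 14) ∸ᵉ V (# 5)) (bindᵉ (≤-trans (<⇒≤ a<) sω≤′) (V (# 6))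
                    (GreedyDerivation.greedyᵉ (z≤′ ∷ ≤-trans (<⇒≤ a<) sω≤′ ∷ E₂₀) a (ω ∸ a) Q T₁ (denseRows ω Q a) (≤-trans (<⇒≤ a<) sω≤′) (≤-trans (m∸n≤m ω a) (≤Ω ω≤Z)) (≤Ω Q≤) V≤ VV≤ T≤ (≤Ω 2Q≤) (≤Ω hist≤) (≤Ω best≤) room≤)))))))
                ⨾ᵉ skipᵉ (castᵉ (cong (1 ∸_) dn≡1) (Lᵉ 1 ∸ᵉ V (# 10)))
                where
                a≤ : a ≤ ω
                a≤ = ≤-pred (≤-trans a< (≤-reflexive (+-comm ω 1)))
                room≤ : (size# (denseRows ω Q a) + T₁) * suc Q ≤ Ω
                room≤ = ≤Ω (≤-trans (*-monoˡ-≤ (suc Q) (≤-trans (+-monoˡ-≤ T₁ (dense-size ω Q a)) (≤-trans (≤-reflexive (+-comm (a * T₁) T₁)) (*-monoˡ-≤ T₁ (s≤s a≤))))) space)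
                powQ : ∀ {n} {ρ : Vec ℕ n} {G : Good ρ} {σ e A p} → (∀ {M} → Ev G σ e Q A M p) → Ev G σ (pow2E e) (2 ^ Q) _ N′ 1
                powQ d = raiseᵉ (Z″ (n<2^n Q)) (pow2ᵉ (≤Ω Q≤) V≤ d)

          base-bits : AllBits (suc ω) base
          base-bits = AllBits-pick dn (weaken (sparseRows jQ (suc ω)) (n≤1+n ω) (sparse-bits jQ ω (suc ω) ≤-refl)) (weaken (denseRows ω Q (suc ω)) (s≤s z≤n) (dense-bits ω Q (suc ω)))
            where
            weaken : ∀ {b c} R → b ≤ c → AllBits b R → AllBits c R
            weaken ε             le T₁ = tt
            weaken (R ▹ (t , f)) le (T₁ , h) = weaken R le T₁ , λ y → ≤-trans (h y) le

          base-tags : Tags≤ ω base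
          base-tags = choose dn
            where
            choose : ∀ t → Tags≤ ω (pick t (sparseRows jQ (suc ω)) (denseRows ω Q (suc ω)))
            choose zero    = sparse-tags jQ ω (suc ω) ≤-refl
            choose (suc _) = dense-tags ω Q (suc ω) ≤-refl

          blocksᵉ : ∀ {ω′} → ∃ λ u → Ex E₂₀ blocksS none ω′ (σ₂₀ (flat Q base) u (flat q fam) (flat q hist)) ω′ 9000 M#
          blocksᵉ {ω′} with baseᵉ {ω′}
          ... | u , dbase = u , (relaxˢ $ raise hashTime (regood Inner.hashᵉ) ⨾ᵉ dbase ⨾ᵉ
                raise famTime (famᵉ E₁₇ (≤Ω m₁≤) (≤Ω q≤) (≤Ω Q≤) (≤Ω (≤-trans (m≤n+m (m₁ * q) q) hashSpace))
                  (λ i y → ≤-trans (AllBits-bit base i y base-bits) (≤Ω ω≤)) (λ i → ≤-trans (Tags≤-any base i base-tags) (≤Ω ω≤Z)) g< (≤Ω baseSpace) (≤Ω famSpace)) ⨾ᵉ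
                bindᵉ r≤ (V (# 18)) (bindᵉ (≤Ω q≤) (V (# 2)) (bindᵉ (≤Ω I≤) I-ev
                  (raise histTime (regood (HistoryDerivation.histᵉ E₂₀ (≤Ω I≤) (≤Ω q+1≤) r≤ fam
                    (λ i y → ≤-trans (AllBits-bit fam i y (fam-bits base _ m₁ base-bits)) (≤Ω ω≤)) (λ i → ≤-trans (Tags≤-any fam i (fam-tags base _ m₁ base-tags)) (≤Ω ω≤Z))
                    (≤-trans (≤-reflexive (cong (_* suc q) (Lifting.size-fam base _ m₁))) (≤Ω famSpace))
                    (λ i _ ρ y → ≤-trans (AllBits-bit (History.hist q r fam i) ρ y (hist-bits fam (fam-bits base _ m₁ base-bits) i)) (≤Ω ω≤))
                    (λ i ρ _ _ → ≤-trans (Tags≤-any (History.hist q r fam i) ρ (Counting.hist-tags q r fam i)) r≤) (≤Ω histSpace)))))))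
            where
            E₁₇ : Good (j ∷ jQ ∷ Q ∷ jQ ∷ x ∷ ω ∷ dn ∷ g ∷ 0 ∷ q ∷ j ∷ p ∷ ℓ ∷ d ∷ n ∷ r ∷ s ∷ [])
            E₁₇ = j≤ ∷ ≤Ω jQ≤ ∷ E₁₅
            g< : ∀ c y → c < m₁ → y < q → columnsOf jQ j (c * q + y) < Q
            g< c y _ y< = subst (_< Q) (sym (columnsOf-at jQ j c y<)) (Hash.h-< jQ (Hash.Columns.weight jQ j c) j y)
            I-ev : Ev {ρ = q ∷ r ∷ m₁ ∷ q ∷ Q ∷ j ∷ jQ ∷ Q ∷ jQ ∷ x ∷ ω ∷ dn ∷ g ∷ 0 ∷ q ∷ j ∷ p ∷ ℓ ∷ d ∷ n ∷ r ∷ s ∷ []} (≤Ω q≤ ∷ r≤ ∷ E₂₀)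
              (σ₂₀ (flat Q base) u (flat q fam) ε) roundsE I _ M# _
            I-ev = ((V (# 11) *ᵉ (V (# 18) ÷ᵉ V (# 10))) +ᵉ ((Lᵉ 1 ∸ᵉ V (# 11)) *ᵉ ((V (# 20) +ᵉ V (# 20)) ÷ᵉ V (# 10)))) +ᵉ Lᵉ 1

          parametersᵉ : ∀ {ω′} → ∃ λ u → Ex E₁₅ parametersS none ω′ (σ₂₀ (flat Q base) u (flat q fam) (flat q hist)) ω′ 9100 M#
          parametersᵉ {ω′} = proj₁ (blocksᵉ {ω′}) , (relaxˢ $
            bindᵉ (≤Ω jQ≤) (V (# 1)) $ bindᵉ j≤ (V (# 9)) $ bindᵉ (≤Ω Q≤) (V (# 2)) $ bindᵉ (≤Ω q≤) (V (# 10)) $ bindᵉ (≤Ω m₁≤) ((V (# 1) ÷ᵉ Lᵉ 2) *ᵉ V (# 2)) $ proj₂ (blocksᵉ {ω′}))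

          largeᵉ : ∀ {ω′} → ∃ λ u → Ex (z≤ ∷ E₈) largeS none ω′ (σ₂₀ (flat Q base) u (flat q fam) (flat q hist)) ω′ 10000 M#
          largeᵉ {ω′} = proj₁ (parametersᵉ {ω′}) , (relaxˢ $
            bindᵉ (≤Ω g≤) g-ev $ bindᵉ (≤-trans d≤1 1≤Ω) dn-ev $ bindᵉ (≤Ω ω≤Z) ω-ev $ bindᵉ (≤Ω x≤) x-ev $ bindᵉ (≤Ω jQ≤) jQ-ev $ bindᵉ (≤Ω Q≤) Q-ev $ proj₂ (parametersᵉ {ω′}))
            where
            E₁₀ : Good (g ∷ 0 ∷ q ∷ j ∷ p ∷ ℓ ∷ d ∷ n ∷ r ∷ s ∷ [])
            E₁₀ = ≤Ω g≤ ∷ z≤ ∷ E₈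
            E₁₁ : Good (dn ∷ g ∷ 0 ∷ q ∷ j ∷ p ∷ ℓ ∷ d ∷ n ∷ r ∷ s ∷ [])
            E₁₁ = ≤-trans d≤1 1≤Ω ∷ E₁₀
            E₁₂ : Good (ω ∷ dn ∷ g ∷ 0 ∷ q ∷ j ∷ p ∷ ℓ ∷ d ∷ n ∷ r ∷ s ∷ [])
            E₁₂ = ≤Ω ω≤Z ∷ E₁₁
            E₁₃ : Good (x ∷ ω ∷ dn ∷ g ∷ 0 ∷ q ∷ j ∷ p ∷ ℓ ∷ d ∷ n ∷ r ∷ s ∷ [])
            E₁₃ = ≤Ω x≤ ∷ E₁₂
            E₁₄ : Good (jQ ∷ x ∷ ω ∷ dn ∷ g ∷ 0 ∷ q ∷ j ∷ p ∷ ℓ ∷ d ∷ n ∷ r ∷ s ∷ [])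
            E₁₄ = ≤Ω jQ≤ ∷ E₁₃
            lgx≤′ : suc x * suc (lg x) ≤ Z
            lgx≤′ = subst (λ t → suc x * suc t ≤ Z) (sym jQ≡) lgx≤
            g-ev : Ev {ρ = 0 ∷ q ∷ j ∷ p ∷ ℓ ∷ d ∷ n ∷ r ∷ s ∷ []} (z≤ ∷ E₈) none (op quo (var (# 4)) (lit 12)) g 4 M# 1
            g-ev = castᵉ g≡ (V (# 4) ÷ᵉ Lᵉ 12)
            dn-ev : Ev E₁₀ none (op sub (lit 1) (op sub (pow2E (op mul (lit 10) (var (# 0)))) (var (# 8)))) dn 28 M# 1
            dn-ev = relaxᵉ $ castᵉ dn≡ (Lᵉ 1 ∸ᵉ (raiseᵉ (≤-trans (n<2^n (10 * g)) 2^10g≤) (pow2ᵉ (≤-trans (<⇒≤ (n<2^n (10 * g))) (≤Ω 2^10g≤)) (≤Ω 2^10g≤) (Lᵉ 10 *ᵉ V (# 0))) ∸ᵉ V (# 8)))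
            ω-ev : Ev E₁₁ none (op add (op mul (var (# 0)) (pow2E (op mul (lit 3) (var (# 1))))) (op mul (op sub (lit 1) (var (# 0))) (var (# 6)))) ω 60 M# _
            ω-ev = relaxᵉ $ castᵉ ω≡ ((V (# 0) *ᵉ raiseᵉ (≤-trans (n<2^n (3 * g)) 2^3g≤) (pow2ᵉ (≤-trans (<⇒≤ (n<2^n (3 * g))) (≤Ω 2^3g≤)) (≤Ω 2^3g≤) (Lᵉ 3 *ᵉ V (# 1)))) +ᵉ ((Lᵉ 1 ∸ᵉ V (# 0)) *ᵉ V (# 6)))
            x-ev : Ev E₁₂ none (suc# (op mul (lit 4) (op mul (op mul (suc# (var (# 0))) (suc# (var (# 0)))) (suc# (op quo (var (# 11)) (var (# 10))))))) x 60 M# _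
            x-ev = relaxᵉ $ castᵉ x≡ ((Lᵉ 4 *ᵉ (((V (# 0) +ᵉ Lᵉ 1) *ᵉ (V (# 0) +ᵉ Lᵉ 1)) *ᵉ ((V (# 11) ÷ᵉ V (# 10)) +ᵉ Lᵉ 1))) +ᵉ Lᵉ 1)
            jQ-ev : Ev E₁₃ none (lgE (# 0)) jQ 50 M# 1
            jQ-ev = raiseᵉ lgx≤′ (castᵉ jQ≡ (lgᵉ (# 0) 0<x (≤Ω 2x≤)))
            Q-ev : Ev E₁₄ none (pow2E (var (# 0))) Q 30 M# 1
            Q-ev = relaxᵉ $ raiseᵉ (≤-trans (n<2^n jQ) Q≤) (pow2ᵉ (≤Ω jQ≤) (≤Ω Q≤) (V (# 0)))

  -- Derivation for the outer hashing.

  module Final (r s n d ℓ p j k : ℕ)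
    (q≤ : (2 ^ j) ≤ Ω) (j≤ : j ≤ Ω) (p≤ : p ≤ Ω) (ℓ≤ : ℓ ≤ Ω) (d≤ : d ≤ Ω) (n≤ : n ≤ Ω) (r≤ : r ≤ Ω) (s≤ : s ≤ Ω)
    (0<n : 0 < n) (k≡ : lg n ≡ k) (2n≤ : 2 * n ≤ Ω) (space : suc (((2 ^ j) ÷ 2) * k) * (2 ^ k) ≤ Ω) (heavy : suc (2 ^ (k + k)) * (2 ^ j) ≤ Ω)
    (Φ≤ : ∀ c → c ≤ (((2 ^ j) ÷ 2) * k) → Hash.Columns.Φ j k c ≤ 2 ^ (k + k)) (P : Rows) (bits : Bits≤ P) (rowSpace : size# P * suc (2 ^ j) ≤ Ω)
    (Y : Pos) (time₁ : suc n * suc k ≤ val Y) (time₂ : suc (((2 ^ j) ÷ 2) * k) * ((2 ^ k) * ((2 ^ j) * (suc j * suc j))) ≤ val Y) (time₃ : suc (((2 ^ j) ÷ 2) * k) * (suc (size# P) * suc n) ≤ val Y) where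

    private
      q K m : ℕ
      q = 2 ^ j
      K = 2 ^ k
      m = (q ÷ 2) * k

    private
      m≤ : m ≤ Ω
      m≤ = ≤-trans (n≤1+n m) (≤-trans (m≤m*n (suc m) K ⦃ m^n≢0 2 k ⦄) space)
      K≤ : K ≤ Ω
      K≤ = ≤-trans (m≤m+n K (m * K)) space
      k≤ : k ≤ Ω
      k≤ = ≤-trans (<⇒≤ (n<2^n k)) K≤

      E₉ : Good (k ∷ q ∷ j ∷ p ∷ ℓ ∷ d ∷ n ∷ r ∷ s ∷ [])
      E₉ = k≤ ∷ q≤ ∷ j≤ ∷ p≤ ∷ ℓ≤ ∷ d≤ ∷ n≤ ∷ r≤ ∷ s≤ ∷ []

      module Outer = HashDerivation (k ∷ q ∷ j ∷ p ∷ ℓ ∷ d ∷ n ∷ r ∷ s ∷ []) E₉ k j m space heavy Φ≤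

      n≤K : n ≤ K
      n≤K = subst (λ t → n ≤ 2 ^ t) k≡ (≤2^lg n)

    finalᵉ : ∀ {w₀ h₀ b u f} → Ex (q≤ ∷ j≤ ∷ p≤ ∷ ℓ≤ ∷ d≤ ∷ n≤ ∷ r≤ ∷ s≤ ∷ []) finalS (st w₀ h₀ b u f (flat q P)) ε
      (st (tab Outer.weights (suc m * K)) (tab (columnsOf j k) (m * K)) b u f (flat q P)) (Emission.emitted P (λ c y → columnsOf j k (c * K + y)) n m) 2000 Y
    finalᵉ = relaxˢ $ bindᵉ k≤ (raiseᵉ (subst (λ t → suc n * suc t ≤ val Y) (sym k≡) time₁) (castᵉ k≡ (lgᵉ (# 5) 0<n 2n≤)))
      (bindᵉ j≤ (V (# 2)) (bindᵉ k≤ (V (# 1)) (bindᵉ q≤ (V (# 3)) (bindᵉ K≤ (raiseᵉ (≤-trans (s≤s (m≤n*m k (suc n))) (≤-trans (suc≤ n k) time₁)) (pow2ᵉ k≤ K≤ (V (# 1))))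
      (bindᵉ m≤ ((V (# 1) ÷ᵉ Lᵉ 2) *ᵉ V (# 2))
        (raise time₂ (regood Outer.hashᵉ) ⨾ᵉ bindᵉ n≤ (V (# 11)) (bindᵉ q≤ (V (# 3)) (bindᵉ K≤ (V (# 3)) (bindᵉ m≤ (V (# 3))
          (raise time₃ (emitᵉ (m≤ ∷ K≤ ∷ q≤ ∷ k≤ ∷ j≤ ∷ E₉) m≤ K≤ q≤ n≤ n≤K (≤-trans (m≤n+m (m * K) K) space) bits g< rowSpace)))))))))))
      where
      suc≤ : ∀ n k → suc (suc n * k) ≤ suc n * suc k
      suc≤ n k = ≤-trans (+-monoˡ-≤ (suc n * k) (s≤s (z≤n {n}))) (≤-reflexive (sym (*-suc (suc n) k)))
      g< : ∀ c y → c < m → y < K → columnsOf j k (c * K + y) < q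
      g< c y _ y< = subst (_< q) (sym (columnsOf-at j k c y<)) (Hash.h-< j (Hash.Columns.weight j k c) k y)

-- The parameters of the construction.

record Params (r s : ℕ) : Set where
  field
    d ℓ p j g dn ω x jQ : ℕ
    d≡  : r + s ≡ d
    ℓ≡  : lg d ≡ ℓ
    -- Just above `4 * (r * s)`, the bound under which `separating` applies to all pairs of a one
    -- and a zero.
    p≡  : 4 * (r * s) + 1 ≡ p
    j≡  : lg p ≡ j
    -- The unit of exponents: `2 ^ g` is the twelfth root of d up to constants.
    g≡  : ℓ ÷ 12 ≡ g
    -- 1 exactly in the dense case `2 ^ (10 * g) ≤ r`.
    dn≡ : 1 ∸ (2 ^ (10 * g) ∸ r) ≡ dn
    -- The number of ones that a block may contain: `2 ^ (3 * g)` if dense, where zeros count as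
    -- well, and `ℓ` if sparse.
    ω≡  : dn * 2 ^ (3 * g) + (1 ∸ dn) * ℓ ≡ ω
    -- In both cases a block has at most `ω + 1` ones and `(ω + 1) * (s ÷ r + 1)` zeros, so `x`
    -- exceeds four times the number of pairs to separate.
    x≡  : 4 * ((ω + 1) * (ω + 1) * (s ÷ r + 1)) + 1 ≡ x
    jQ≡ : lg x ≡ jQ

params : ∀ r s → Params r s
params r s = record { d≡ = refl ; ℓ≡ = refl ; p≡ = refl ; j≡ = refl ; g≡ = refl ; dn≡ = refl ; ω≡ = refl ; x≡ = refl ; jQ≡ = refl }

total : List ℕ → ℕ
total = List.foldr _+_ 0

part : ∀ xs i → List.lookup xs i ≤ total xs
part (x ∷ xs) zero    = m≤m+n x _
part (x ∷ xs) (suc i) = ≤-trans (part xs i) (m≤n+m _ x)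

half : ∀ j → 0 < j → 0 < 2 ^ (j ∸ 1) × 2 ^ j ≡ 2 * 2 ^ (j ∸ 1) × 2 ^ j ÷ 2 ≡ 2 ^ (j ∸ 1)
half (suc j) _ = m^n>0 2 j , refl , trans (cong (_÷ 2) (*-comm 2 (2 ^ j))) (m*n/n≡m (2 ^ j) 2)

lg-pos : ∀ n → 1 < n → 0 < lg n
lg-pos n 1<n with lg n | ≤2^lg n
... | zero  | n≤1 = ⊥-elim (<⇒≱ 1<n n≤1)
... | suc _ | _   = s≤s z≤n

-- The rows of the construction and their budget.

module Family# {r s : ℕ} (P : Params r s) where

  open Params P public

  q Q m₁ T# V# I : ℕ
  q  = 2 ^ j
  Q  = 2 ^ jQ
  m₁ = (Q ÷ 2) * j
  T# = steps ω Q
  V# = 2 ^ Q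
  I  = dn * (d ÷ ω) + (1 ∸ dn) * ((r + r) ÷ ω) + 1

  base fam hist smallRows rows : Rows
  base = pick dn (sparseRows jQ (suc ω)) (denseRows ω Q (suc ω))
  fam  = Lifting.fam base (λ c y → columnsOf jQ j (c * q + y)) m₁
  hist = History.hist q r fam I
  smallRows = ext ε (tuple j r) (2 ^ (r * j))

  small : ℕ
  small = 1 ∸ (r ∸ ℓ * ℓ)

  rows = pick small hist smallRows

  -- Only the regime at hand enters the budget: in the others, the powers `2 ^ Q` of the greedy
  -- search or `2 ^ (r * j)` of the plain tuples would be ruinous.
  sparsePart densePart largePart smallPart commonPart : List ℕ
  sparsePart = suc ω * (2 ^ (ω * jQ) * (Q * (suc ω * suc (ω * jQ)))) ∷ []
  densePart = 2 * Q ∷ (suc ω * T#) * suc Q ∷ suc T# * (V# * V#) ∷ suc (V# * V#) * V# ∷ suc ω * (suc T# * (V# * ((V# * V#) * (suc Q * suc Q)))) ∷ []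
  largePart = 2 ^ (10 * g) ∷ suc ω ∷ 2 * x ∷ suc x * suc jQ ∷ suc m₁ * q ∷ suc (2 ^ (j + j)) * Q ∷ suc m₁ * (q * (Q * (suc jQ * suc jQ)))
    ∷ size# base * suc Q ∷ (m₁ * size# base) * suc q ∷ suc m₁ * (suc (size# base) * suc q) ∷ I ∷ suc q ∷ size# hist * suc q
    ∷ suc I * (suc (size# hist) * (suc (size# fam) * (suc q * suc q))) ∷ total (pick dn sparsePart densePart) ∷ []
  smallPart = 2 ^ (r * j) * suc q ∷ 2 ^ (r * j) * (q * (suc r * suc (r * j))) ∷ []
  commonPart = 2 * d ∷ suc d * suc ℓ ∷ 2 * p ∷ suc p * suc j ∷ q ∷ size# rows * suc q ∷ 1 ∷ []

  -- The sum of all bounds that do not involve n, so that each single one follows from `part`; the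
  -- entry 1 makes it positive.
  budget : ℕ
  budget = total (total commonPart ∷ total (pick small largePart smallPart) ∷ [])

  common≤ : ∀ i → List.lookup commonPart i ≤ budget
  common≤ i = ≤-trans (part commonPart i) (m≤m+n _ _)

  0<x : 1 < x
  0<x = subst (1 <_) x≡ (≤-trans (s≤s (*-mono-≤ {1} {4} (s≤s z≤n) (*-mono-≤ {1} (*-mono-≤ {1} (m≤n+m 1 ω) (m≤n+m 1 ω)) (m≤n+m 1 (s ÷ r))))) (≤-reflexive (+-comm 1 _)))

  Q-half = half jQ (subst (0 <_) jQ≡ (lg-pos x 0<x))

  x≤Q : x ≤ Q
  x≤Q = ≤-trans (≤2^lg x) (≤-reflexive (cong (2 ^_) jQ≡))

  4rs<q : 4 * (r * s) < q
  4rs<q = <-≤-trans (subst (4 * (r * s) <_) p≡ (m<m+n (4 * (r * s)) (s≤s z≤n))) (≤-trans (≤2^lg p) (≤-reflexive (cong (2 ^_) j≡)))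

  module _ (0<r : 0 < r) (r<s : r < s) where

    0<s : 0 < s
    0<s = <-trans 0<r r<s

    1<p : 1 < p
    1<p = subst (1 <_) p≡ (≤-trans (s≤s (*-mono-≤ {1} {4} (s≤s z≤n) (*-mono-≤ 0<r 0<s))) (≤-reflexive (+-comm 1 _)))

    0<j : 0 < j
    0<j = subst (0 <_) j≡ (lg-pos p 1<p)

    0<d : 1 < d
    0<d = subst (1 <_) d≡ (+-mono-≤ 0<r 0<s)

    0<ℓ : 0 < ℓ
    0<ℓ = subst (0 <_) ℓ≡ (lg-pos d 0<d)

    bit-cases : ∀ t → t ≤ 1 → t ≡ 0 ⊎ t ≡ 1
    bit-cases zero _ = inj₁ refl
    bit-cases (suc zero) _ = inj₂ refl
    bit-cases (suc (suc _)) (s≤s ())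

    dn-cases : dn ≡ 0 ⊎ dn ≡ 1
    dn-cases = bit-cases dn (≤-trans (≤-reflexive (sym dn≡)) (m∸n≤m 1 (2 ^ (10 * g) ∸ r)))

    small-cases : small ≡ 0 ⊎ small ≡ 1
    small-cases = bit-cases small (m∸n≤m 1 (r ∸ ℓ * ℓ))

    X : ℕ
    X = (ω + 1) * (ω + 1) * (s ÷ r + 1)

    4X<Q : 4 * X < Q
    4X<Q = <-≤-trans (subst (4 * X <_) x≡ (m<m+n (4 * X) (s≤s z≤n))) x≤Q

    round-up : ∀ w → 0 < w → ∀ y → y ≤ (y ÷ w + 1) * w
    round-up (suc w) _ y = ≤-trans (≤-reflexive (m≡m%n+[m/n]*n y (suc w))) (≤-trans (+-monoˡ-≤ _ (<⇒≤ (m%n<n y (suc w))))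
      (≤-reflexive (cong (_* suc w) (+-comm 1 (y / suc w)))))

    -- The load is the number of constrained cells. With `L = ω` and `W = 1` a block has at most `ω`
    -- of them, and `d ÷ ω + 1` blocks suffice.
    dense-case : dn ≡ 1 → Covers q r s hist
    dense-case dn≡1 = hist-cover {j} 1 1 ω 1 I fam (s≤s z≤n) ≤-refl ≤-refl
          (≤-trans (≤-reflexive (trans (cong₂ _+_ (*-identityˡ r) (*-identityˡ s)) d≡)) (≤-trans (round-up ω 0<ω d) (*-monoˡ-≤ ω (≤-reflexive (cong (_+ 1) (sym I≡))))))
          (λ p′ m< → subst (λ e → ∃ λ x → x ∈ʳ Lifting.fam base (λ c y → columnsOf jQ j (c * q + y)) (e * j) × proj₁ x ≡ ones p′ q × Fits q p′ (proj₂ x)) (sym (proj₂ (proj₂ Q-half)))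
            (fam-covers Cond j jQ (2 ^ (jQ ∸ 1)) base (proj₁ Q-half) (proj₁ (proj₂ Q-half)) 0<j
              (subst (BaseCovers Cond Q) (cong (λ t → pick t (sparseRows jQ (suc ω)) (denseRows ω Q (suc ω))) (sym dn≡1)) (dense-covers Cond Q ω (λ {a} {z} c → c)))
              (λ {a} {z} → few {a} {z}) p′ (≤-pred (<-≤-trans (≤-<-trans (≤-reflexive (sym (trans (mass-split 1 1 p′ q) (cong₂ _+_ (*-identityˡ (ones p′ q)) (*-identityˡ (zeros p′ q)))))) m<) (≤-reflexive (+-comm ω 1))))))
      where
      Cond : ℕ → ℕ → Set
      Cond a z = a + z ≤ ω
      0<ω : 0 < ω
      0<ω = subst (0 <_) (trans (sym (trans (cong₂ (λ a b → a * 2 ^ (3 * g) + b * ℓ) dn≡1 (cong (1 ∸_) dn≡1)) (trans (+-identityʳ _) (*-identityˡ _)))) ω≡) (m^n>0 2 (3 * g))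
      I≡ : dn * (d ÷ ω) + (1 ∸ dn) * ((r + r) ÷ ω) ≡ d ÷ ω
      I≡ = trans (cong₂ (λ a b → a * (d ÷ ω) + b * ((r + r) ÷ ω)) dn≡1 (cong (1 ∸_) dn≡1)) (trans (+-identityʳ _) (*-identityˡ _))
      few : ∀ {a z} → Cond a z → 4 * (a * z) < Q
      few {a} {z} c = ≤-<-trans (*-monoʳ-≤ 4 (≤-trans (*-mono-≤ (≤-trans (m≤m+n a z) (≤-trans c (m≤m+n ω 1))) (≤-trans (m≤n+m z a) (≤-trans c (m≤m+n ω 1))))
        (m≤m*n _ (s ÷ r + 1) ⦃ >-nonZero (≤-trans (s≤s z≤n) (≤-reflexive (+-comm 1 (s ÷ r)))) ⦄))) 4X<Q

    -- Weight s for ones and r for zeros gives total load `2 * r * s`. A block of load below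
    -- `(ω + 1) * s` has at most `ω` ones and `(ω + 1) * s / r` zeros, and `(r + r) ÷ ω + 1` rounds
    -- of load `ω * s` suffice.
    sparse-case : dn ≡ 0 → Covers q r s hist
    sparse-case dn≡0 = hist-cover {j} s r (ω * s) s I fam 0<s ≤-refl (<⇒≤ r<s) enough-rounds
          (λ p′ m< → subst (λ e → ∃ λ x → x ∈ʳ Lifting.fam base (λ c y → columnsOf jQ j (c * q + y)) (e * j) × proj₁ x ≡ ones p′ q × Fits q p′ (proj₂ x)) (sym (proj₂ (proj₂ Q-half)))
            (fam-covers Cond j jQ (2 ^ (jQ ∸ 1)) base (proj₁ Q-half) (proj₁ (proj₂ Q-half)) 0<j
              (subst (BaseCovers Cond Q) (cong (λ t → pick t (sparseRows jQ (suc ω)) (denseRows ω Q (suc ω))) (sym dn≡0)) (sparse-covers Cond jQ ω (λ {a} {z} → proj₁-small {a} {z})))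
              (λ {a} {z} → few {a} {z}) p′ (≤-<-trans (≤-reflexive (sym (mass-split s r p′ q))) m<)))
      where
      instance _ = >-nonZero 0<s
      Cond : ℕ → ℕ → Set
      Cond a z = s * a + r * z < ω * s + s
      ω≡ℓ : ω ≡ ℓ
      ω≡ℓ = trans (sym ω≡) (trans (cong₂ (λ a b → a * 2 ^ (3 * g) + b * ℓ) dn≡0 (cong (1 ∸_) dn≡0)) (*-identityˡ ℓ))
      I≡ : dn * (d ÷ ω) + (1 ∸ dn) * ((r + r) ÷ ω) ≡ (r + r) ÷ ω
      I≡ = trans (cong₂ (λ a b → a * (d ÷ ω) + b * ((r + r) ÷ ω)) dn≡0 (cong (1 ∸_) dn≡0)) (*-identityˡ _)
      proj₁-small : ∀ {a z} → Cond a z → a ≤ ω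
      proj₁-small {a} {z} c = ≤-pred (*-cancelˡ-< s a (suc ω) (≤-<-trans (m≤m+n (s * a) (r * z)) (<-≤-trans c (≤-reflexive (solve 2 (λ s w → w :* s :+ s := s :* (con 1 :+ w)) refl s ω)))))
        where open +-*-Solver
      z-small : ∀ {a z} → Cond a z → z ≤ (ω + 1) * (s ÷ r + 1)
      z-small {a} {z} c = <⇒≤ (*-cancelˡ-< r z _ (<-≤-trans (≤-<-trans (m≤n+m (r * z) (s * a)) c)
        (≤-trans (≤-reflexive (solve 2 (λ s w → w :* s :+ s := (w :+ con 1) :* s) refl s ω)) (≤-trans (*-monoʳ-≤ (ω + 1) (round-up r 0<r s))
          (≤-reflexive (solve 3 (λ w y r → w :* (y :* r) := r :* (w :* y)) refl (ω + 1) (s ÷ r + 1) r))))))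
        where open +-*-Solver
      few : ∀ {a z} → Cond a z → 4 * (a * z) < Q
      few {a} {z} c = ≤-<-trans (*-monoʳ-≤ 4 (≤-trans (*-mono-≤ (≤-trans (proj₁-small {a} {z} c) (m≤m+n ω 1)) (z-small {a} {z} c)) (≤-reflexive (sym (*-assoc (ω + 1) (ω + 1) _))))) 4X<Q
      enough-rounds : s * r + r * s ≤ I * (ω * s)
      enough-rounds = ≤-trans (≤-reflexive (solve 2 (λ s r → s :* r :+ r :* s := (r :+ r) :* s) refl s r))
        (≤-trans (*-monoˡ-≤ s (round-up ω (subst (0 <_) (sym ω≡ℓ) 0<ℓ) (r + r))) (≤-trans (≤-reflexive (*-assoc ((r + r) ÷ ω + 1) ω s)) (*-monoˡ-≤ (ω * s) (≤-reflexive (cong (_+ 1) (sym I≡))))))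
        where open +-*-Solver

    rows-cover : Covers q r s rows
    rows-cover = [ (λ e → subst (λ t → Covers q r s (pick t hist smallRows)) (sym e) ([ sparse-case , dense-case ]′ dn-cases)) ,
                   (λ e → subst (λ t → Covers q r s (pick t hist smallRows)) (sym e) (tuples-cover j r s ε)) ]′ small-cases

-- From covers on the cells to cover-free families.

ins outs : ∀ {m} → Subset m → (Fin m → ℕ) → List ℕ
ins  []          f = []
ins  (true ∷ J)  f = f zero ∷ ins J (f ∘ suc)
ins  (false ∷ J) f = ins J (f ∘ suc)
outs []          f = []
outs (true ∷ J)  f = outs J (f ∘ suc)
outs (false ∷ J) f = f zero ∷ outs J (f ∘ suc)

length-ins : ∀ {m} (J : Subset m) f → length (ins J f) ≡ Subset.∣ J ∣
length-ins []          f = refl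
length-ins (true ∷ J)  f = cong suc (length-ins J (f ∘ suc))
length-ins (false ∷ J) f = length-ins J (f ∘ suc)

length-outs : ∀ {m} (J : Subset m) f → Subset.∣ J ∣ + length (outs J f) ≡ m
length-outs []          f = refl
length-outs (true ∷ J)  f = cong suc (length-outs J (f ∘ suc))
length-outs (false ∷ J) f = trans (+-suc _ _) (cong suc (length-outs J (f ∘ suc)))

ins-all : ∀ {m} {P : ℕ → Set} (J : Subset m) f → (∀ j → j ∈ˢ J → P (f j)) → LAll P (ins J f)
ins-all []          f h = []ᵃ
ins-all (true ∷ J)  f h = h zero _[_]=_.here ∷ᵃ ins-all J (f ∘ suc) (λ j j∈ → h (suc j) (_[_]=_.there j∈))
ins-all (false ∷ J) f h = ins-all J (f ∘ suc) (λ j j∈ → h (suc j) (_[_]=_.there j∈))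

outs-all : ∀ {m} {P : ℕ → Set} (J : Subset m) f → (∀ j → j ∉ˢ J → P (f j)) → LAll P (outs J f)
outs-all []          f h = []ᵃ
outs-all (true ∷ J)  f h = outs-all J (f ∘ suc) (λ j j∉ → h (suc j) (λ { (_[_]=_.there j∈) → j∉ j∈ }))
outs-all (false ∷ J) f h = h zero (λ ()) ∷ᵃ outs-all J (f ∘ suc) (λ j j∉ → h (suc j) (λ { (_[_]=_.there j∈) → j∉ j∈ }))

all-ins : ∀ {m} {P : ℕ → Set} (J : Subset m) f → LAll P (ins J f) → ∀ j → j ∈ˢ J → P (f j)
all-ins (true ∷ J)  f (h ∷ᵃ hs) zero    _ = h
all-ins (true ∷ J)  f (h ∷ᵃ hs) (suc j) (_[_]=_.there j∈) = all-ins J (f ∘ suc) hs j j∈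
all-ins (false ∷ J) f hs        (suc j) (_[_]=_.there j∈) = all-ins J (f ∘ suc) hs j j∈

all-outs : ∀ {m} {P : ℕ → Set} (J : Subset m) f → LAll P (outs J f) → ∀ j → j ∉ˢ J → P (f j)
all-outs (false ∷ J) f (h ∷ᵃ hs) zero    _ = h
all-outs (true ∷ J)  f hs        zero    j∉ = ⊥-elim (j∉ _[_]=_.here)
all-outs (false ∷ J) f (h ∷ᵃ hs) (suc j) j∉ = all-outs J (f ∘ suc) hs j (λ j∈ → j∉ (_[_]=_.there j∈))
all-outs (true ∷ J)  f hs        (suc j) j∉ = all-outs J (f ∘ suc) hs j (λ j∈ → j∉ (_[_]=_.there j∈))

increasing⇒injective : ∀ {d n} (i : Fin d → Fin n) → StrictlyIncreasing i → ∀ {j k} → j ≢ k → toℕ (i j) ≢ toℕ (i k)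
increasing⇒injective i inc {j} {k} j≢k eq with <-cmp (toℕ j) (toℕ k)
... | tri< lt _ _ = <⇒≢ (inc lt) eq
... | tri≈ _ e _  = j≢k (toℕ-injective e)
... | tri> _ _ gt = <⇒≢ (inc gt) (sym eq)

-- The output as a list of vectors.

module Listing (P : Rows) (g : ℕ → ℕ → ℕ) (n : ℕ) where

  open Emission P g n

  rowVec : ℕ → ℕ → Vec Bool n
  rowVec c ρ = tabulate (member c ρ ∘ toℕ)

  listRows : Family n → ℕ → ℕ → Family n
  listRows F c zero    = F
  listRows F c (suc ρ) = listRows F c ρ ∷ʳ rowVec c ρ

  listing : ℕ → Family n
  listing zero    = []
  listing (suc c) = listRows (listing c) c (size# P)

  concatMap-∷ʳ : ∀ (F : Family n) v → concatMap toList (F ∷ʳ v) ≡ concatMap toList F ++ toList v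
  concatMap-∷ʳ [] v = Data.List.Properties.++-identityʳ (toList v)
  concatMap-∷ʳ (u ∷ F) v = trans (cong (toList u ++_) (concatMap-∷ʳ F v)) (sym (++-assoc (toList u) (concatMap toList F) (toList v)))

  toList-ext : ∀ (ω : Seq Bool) f n → toList# (ext ω f n) ≡ toList# ω ++ applyUpTo f n
  toList-ext ω f zero    = sym (Data.List.Properties.++-identityʳ _)
  toList-ext ω f (suc n) = trans (cong (_∷ʳ f n) (toList-ext ω f n)) (trans (++-assoc (toList# ω) (applyUpTo f n) _) (cong (toList# ω ++_) (Data.List.Properties.applyUpTo-∷ʳ f n)))

  toList-tabulate : ∀ (f : ℕ → Bool) n → toList (tabulate {n = n} (f ∘ toℕ)) ≡ applyUpTo f n
  toList-tabulate f zero    = refl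
  toList-tabulate f (suc n) = cong (f 0 ∷_) (toList-tabulate (f ∘ suc) n)

  emitRows-list : ∀ ω F c ρ → toList# ω ≡ concatMap toList F → toList# (emitRows ω c ρ) ≡ concatMap toList (listRows F c ρ)
  emitRows-list ω F c zero    eq = eq
  emitRows-list ω F c (suc ρ) eq = trans (toList-ext (emitRows ω c ρ) (member c ρ) n)
    (trans (cong₂ _++_ (emitRows-list ω F c ρ eq) (sym (toList-tabulate (member c ρ) n))) (sym (concatMap-∷ʳ (listRows F c ρ) (rowVec c ρ))))

  emitted-list : ∀ m → toList# (emitted m) ≡ concatMap toList (listing m)
  emitted-list zero    = refl
  emitted-list (suc c) = emitRows-list (emitted c) (listing c) c (size# P) (emitted-list c)

  length-listRows : ∀ F c ρ → length (listRows F c ρ) ≡ length F + ρ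
  length-listRows F c zero    = sym (+-identityʳ _)
  length-listRows F c (suc ρ) = trans (length-++ (listRows F c ρ)) (trans (+-comm _ 1) (trans (cong suc (length-listRows F c ρ)) (sym (+-suc _ ρ))))

  length-listing : ∀ m → length (listing m) ≡ m * size# P
  length-listing zero    = refl
  length-listing (suc c) = trans (length-listRows (listing c) c (size# P)) (trans (cong (_+ size# P) (length-listing c)) (+-comm (c * size# P) _))

  listRows-⊆ : ∀ {v F} c ρ → v ∈ F → v ∈ listRows F c ρ
  listRows-⊆ c zero    v∈ = v∈
  listRows-⊆ c (suc ρ) v∈ = ∈-++⁺ˡ (listRows-⊆ c ρ v∈)

  ∈-listRows : ∀ F c {ρ k} → ρ < k → rowVec c ρ ∈ listRows F c k
  ∈-listRows F c {ρ} {suc k} ρ<1+k with m≤n⇒m<n∨m≡n (≤-pred ρ<1+k)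
  ... | inj₁ ρ<k = ∈-++⁺ˡ (∈-listRows F c ρ<k)
  ... | inj₂ refl = ∈-++⁺ʳ (listRows F c k) (here refl)

  ∈-listing : ∀ {m c ρ} → c < m → ρ < size# P → rowVec c ρ ∈ listing m
  ∈-listing {suc m} {c} c<1+m ρ< with m≤n⇒m<n∨m≡n (≤-pred c<1+m)
  ... | inj₁ c<m = listRows-⊆ m (size# P) (∈-listing c<m ρ<)
  ... | inj₂ refl = ∈-listRows (listing m) m ρ<

isNonZero-≢0 : ∀ {v} → v ≢ 0 → isNonZero v ≡ true
isNonZero-≢0 {zero}  n = ⊥-elim (n refl)
isNonZero-≢0 {suc v} _ = refl

-- For a separating column the cells of the ones avoid those of the zeros. Repeated cells are no
-- obstacle, since `Covers` is about lists of r and s cells that need not be distinct.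
listing-CFF : ∀ {r s} j k n e P → 0 < e → 2 ^ j ≡ 2 * e → 0 < k → n ≤ 2 ^ k → 4 * (r * s) < 2 ^ j → Covers (2 ^ j) r s P →
  IsCFF n r s (Listing.listing P (λ c y → columnsOf j k (c * 2 ^ k + y)) n (e * k))
listing-CFF {r} {s} j k n e P 0<e q≡ 0<k n≤ few covers i inc J ∣J∣≡r = rowVec c ρ , ∈-listing (proj₁ (proj₂ separated)) ρ< , hit , miss
  where
  f : Fin (r + s) → ℕ
  f = toℕ ∘ i
  os = ins J f
  zs = outs J f
  os≡ : length os ≡ r
  os≡ = trans (length-ins J f) ∣J∣≡r
  zs≡ : length zs ≡ s
  zs≡ = +-cancelˡ-≡ r _ _ (trans (cong (_+ length zs) (sym ∣J∣≡r)) (length-outs J f))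
  f< : ∀ x → f x < 2 ^ k
  f< x = <-≤-trans (toℕ<n (i x)) n≤
  dis : Disjoint os zs
  dis = ins-all J f (λ x x∈ → outs-all J f (λ y y∉ → increasing⇒injective i inc (λ { refl → y∉ x∈ })))
  separated : ∃ λ c → c < e * k × Disjoint (List.map (Hash.Columns.col j k c) os) (List.map (Hash.Columns.col j k c) zs)
  separated = separate j k e 0<e q≡ 0<k os zs (ins-all J f (λ x _ → f< x)) (outs-all J f (λ x _ → f< x)) dis
    (subst (λ t → 4 * t < 2 ^ j) (sym (cong₂ _*_ os≡ zs≡)) few)
  c : ℕ
  c = proj₁ separated
  col : ℕ → ℕ
  col = Hash.Columns.col j k c
  col< : ∀ y → col y < 2 ^ j
  col< y = Hash.h-< j (Hash.Columns.weight j k c) k y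
  covered : ∃ λ x → x ∈ʳ P × Hits (proj₂ x) (List.map col os) (List.map col zs)
  covered = Covers.cover covers (List.map col os) (List.map col zs) (trans (Data.List.Properties.length-map col os) os≡) (trans (Data.List.Properties.length-map col zs) zs≡)
    (map-all col (LAll.universal col< os)) (map-all col (LAll.universal col< zs)) (proj₂ (proj₂ separated))
  ρ : ℕ
  ρ = proj₁ (proj₁ (proj₂ covered))
  ρ< : ρ < size# P
  ρ< = proj₁ (proj₂ (proj₁ (proj₂ covered)))
  hits : Hits (bit P ρ) (List.map col os) (List.map col zs)
  hits = subst (λ x → Hits (proj₂ x) (List.map col os) (List.map col zs)) (sym (proj₂ (proj₂ (proj₁ (proj₂ covered))))) (proj₂ (proj₂ covered))
  g : ℕ → ℕ → ℕ
  g c y = columnsOf j k (c * 2 ^ k + y)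
  open Listing P g n
  open Emission P g n
  value : ∀ x → lookup (rowVec c ρ) (i x) ≡ isNonZero (bit P ρ (col (f x)))
  value x = trans (lookup∘tabulate (member c ρ ∘ toℕ) (i x)) (cong (λ y → isNonZero (bit P ρ y)) (columnsOf-at j k c (f< x)))
  hit : ∀ x → x ∈ˢ J → lookup (rowVec c ρ) (i x) ≡ true
  hit x x∈ = trans (value x) (isNonZero-≢0 (all-ins {P = λ y → bit P ρ (col y) ≢ 0} J f (all-map {P = λ y → bit P ρ y ≢ 0} col (proj₁ hits)) x x∈))
  miss : ∀ x → x ∉ˢ J → lookup (rowVec c ρ) (i x) ≡ false
  miss x x∉ = trans (value x) (cong isNonZero (all-outs {P = λ y → bit P ρ (col y) ≡ 0} J f (all-map {P = λ y → bit P ρ y ≡ 0} col (proj₂ hits)) x x∉))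

Φ-bound : ∀ j k → 0 < j → ∀ c → c ≤ (2 ^ j ÷ 2) * k → Hash.Columns.Φ j k c ≤ 2 ^ (k + k)
Φ-bound j k 0<j c c≤ = Hash.Columns.Separation.Φ-≤ j k (2 ^ (j ∸ 1)) (proj₁ (half j 0<j)) (proj₁ (proj₂ (half j 0<j)))
  (≤-trans c≤ (≤-reflexive (cong (_* k) (proj₂ (proj₂ (half j 0<j))))))

-- Running the program within its bounds.

module Core {r s : ℕ} (P : Params r s) (0<r : 0 < r) (r<s : r < s) (n : ℕ) (r<n : r < n) (s<n : s < n) where

  open Family# P

  k K m : ℕ
  k = lg n
  K = 2 ^ k
  m = (q ÷ 2) * k

  Y : Pos
  Y = (budget + (suc n * suc k + (suc m * (K * (q * (suc j * suc j))) + suc m * (suc (size# rows) * suc n)))) ⁺ ≤-trans (s≤s z≤n) (≤-trans (m≤m+n (suc n * suc k) _) (m≤n+m _ budget))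

  Z# : Pos
  Z# = budget ⁺ common≤ (# 6)

  family : Family n
  family = Listing.listing rows (λ c y → columnsOf j k (c * K + y)) n m

  0<n : 1 < n
  0<n = ≤-trans (s≤s 0<r) r<n

  family-CFF : IsCFF n r s family
  family-CFF = subst (λ e → IsCFF n r s (Listing.listing rows (λ c y → columnsOf j k (c * K + y)) n (e * k))) (sym (proj₂ (proj₂ (half j (0<j 0<r r<s)))))
    (listing-CFF j k n (2 ^ (j ∸ 1)) rows (proj₁ (half j (0<j 0<r r<s))) (proj₁ (proj₂ (half j (0<j 0<r r<s)))) (lg-pos n 0<n) (≤2^lg n) 4rs<q (rows-cover 0<r r<s))

  family-size : length family ≡ m * size# rows
  family-size = Listing.length-listing rows (λ c y → columnsOf j k (c * K + y)) n m

  module Timed (w Ω : ℕ) (32≤Ω : 32 ≤ Ω) (Ω^9<B : Ω ^ 9 < 2 ^ w) (Z≤Ω : budget ≤ Ω) (2n≤ : 2 * n ≤ Ω) (space : suc m * K ≤ Ω) (heavy : suc (2 ^ (k + k)) * q ≤ Ω) where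

    open Bounded w Ω 32≤Ω Ω^9<B hiding (small)

    n≤ : n ≤ Ω
    n≤ = ≤-trans (m≤m+n n _) 2n≤
    r≤ : r ≤ Ω
    r≤ = ≤-trans (<⇒≤ r<n) n≤
    s≤ : s ≤ Ω
    s≤ = ≤-trans (<⇒≤ s<n) n≤
    2d≤ : 2 * d ≤ Ω
    2d≤ = ≤-trans (common≤ (# 0)) Z≤Ω
    d≤ : d ≤ Ω
    d≤ = ≤-trans (m≤m+n d _) 2d≤
    2p≤ : 2 * p ≤ Ω
    2p≤ = ≤-trans (common≤ (# 2)) Z≤Ω
    p≤ : p ≤ Ω
    p≤ = ≤-trans (m≤m+n p _) 2p≤
    q≤ : q ≤ Ω
    q≤ = ≤-trans (common≤ (# 4)) Z≤Ω
    j≤ : j ≤ Ω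
    j≤ = ≤-trans (<⇒≤ (n<2^n j)) q≤
    ℓ≤ : ℓ ≤ Ω
    ℓ≤ = ≤-trans (≤-trans (n≤1+n ℓ) (m≤n*m (suc ℓ) (suc d))) (≤-trans (common≤ (# 1)) Z≤Ω)

    E₈ : Good (q ∷ j ∷ p ∷ ℓ ∷ d ∷ n ∷ r ∷ s ∷ [])
    E₈ = Prepare.E₈ r s n d ℓ p j budget Z≤Ω (common≤ (# 6)) (common≤ (# 4)) j≤ p≤ ℓ≤ d≤ n≤ r≤ s≤

    Result : Stmt 8 → ℕ → Rows → Set
    Result S A R = ∃ λ w₀ → ∃ λ h₀ → ∃ λ b → ∃ λ u → ∃ λ f → Ex E₈ S none ε (st w₀ h₀ b u f (flat q R)) ε A Z#

    prepS : Stmt 8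
    prepS = loop smallE smallS ⨾ loop (op sub (lit 1) smallE) largeS

    small-ev : ∀ {σ} → Ev E₈ σ smallE small 11 Z# 1
    small-ev = relaxᵉ (Lᵉ 1 ∸ᵉ (V (# 6) ∸ᵉ (V (# 3) *ᵉ V (# 3))))

    regime : ∀ {b} → small ≡ b → total (pick b largePart smallPart) ≤ budget
    regime refl = part (total commonPart ∷ total (pick small largePart smallPart) ∷ []) (# 1)

    small-result : small ≡ 1 → Result prepS 11100 smallRows
    small-result e = ε , ε , _ , ε , ε , relaxˢ (onceᵉ (castᵉ e small-ev) (λ z≤ → Prepare.smallᵉ r s n d ℓ p j budget Z≤Ω (common≤ (# 6)) (common≤ (# 4)) j≤ p≤ ℓ≤ d≤ n≤ r≤ s≤ (≤-trans (part smallPart (# 0)) (regime e)) (≤-trans (part smallPart (# 1)) (regime e)))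
      ⨾ᵉ skipᵉ (castᵉ (cong (1 ∸_) e) (Lᵉ 1 ∸ᵉ small-ev)))

    large-result : small ≡ 0 → Result prepS 11100 hist
    large-result e = _ , _ , _ , proj₁ derived , _ , relaxˢ (skipᵉ (castᵉ e small-ev) ⨾ᵉ onceᵉ (castᵉ (cong (1 ∸_) e) (Lᵉ 1 ∸ᵉ small-ev)) (λ z≤ → regood (proj₂ derived)))
      where
      b : ∀ i → List.lookup largePart i ≤ budget
      b i = ≤-trans (part largePart i) (regime e)
      flagged : ∀ {t} → dn ≡ t → total (pick t sparsePart densePart) ≤ budget
      flagged refl = b (# 14)
      flag : _ ⊎ _
      flag = [ (λ z → inj₁ (z , ≤-trans (part sparsePart (# 0)) (flagged z))) ,
               (λ o → inj₂ (o , ≤-trans (part densePart (# 0)) (flagged o) , ≤-trans (part densePart (# 1)) (flagged o) , ≤-trans (part densePart (# 2)) (flagged o)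
                          , ≤-trans (part densePart (# 3)) (flagged o) , ≤-trans (part densePart (# 4)) (flagged o))) ]′ (dn-cases 0<r r<s)
      derived : ∃ λ u → Ex {ρ = 0 ∷ q ∷ j ∷ p ∷ ℓ ∷ d ∷ n ∷ r ∷ s ∷ []} (z≤n ∷ E₈) largeS none ε _ ε 10000 Z#
      derived = (Prepare.Large.largeᵉ r s n d ℓ p j budget Z≤Ω (common≤ (# 6)) (common≤ (# 4)) j≤ p≤ ℓ≤ d≤ n≤ r≤ s≤ g dn ω x jQ g≡ dn≡ ω≡ x≡ jQ≡ (b (# 0)) (b (# 1)) (b (# 2)) (b (# 3)) (b (# 4)) (b (# 5)) (b (# 6)) (Φ-bound jQ j (subst (0 <_) jQ≡ (lg-pos x 0<x)))) flag (b (# 7)) (b (# 8)) (b (# 9)) (b (# 10)) (b (# 11)) (b (# 12)) (b (# 13)) {z≤n}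

    prepared : Result prepS 11100 rows
    prepared = [ (λ e → subst (λ t → Result prepS 11100 (pick t hist smallRows)) (sym e) (large-result e)) ,
                 (λ e → subst (λ t → Result prepS 11100 (pick t hist smallRows)) (sym e) (small-result e)) ]′ (small-cases 0<r r<s)

    small-bits : ∀ i y → bit smallRows i y ≤ Ω
    small-bits i y = ≤-trans (AllBits-bit smallRows i y (AllBits-ext (tuple j r) (2 ^ (r * j)) tt (λ t y _ → tuple-bits j r t y))) r≤

    large-bits : small ≡ 0 → ∀ i y → bit hist i y ≤ Ω
    large-bits e i y = ≤-trans (AllBits-bit hist i y (hist-bits fam (fam-bits base _ m₁ base-bits#) I)) (≤-trans (≤-trans (part largePart (# 1)) (regime e)) Z≤Ω)
      where
      weaken : ∀ {b c} R → b ≤ c → AllBits b R → AllBits c R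
      weaken ε             le T = tt
      weaken (R ▹ (t , f)) le (T , h) = weaken R le T , λ y → ≤-trans (h y) le
      base-bits# : AllBits (suc ω) base
      base-bits# = AllBits-pick dn (weaken (sparseRows jQ (suc ω)) (n≤1+n ω) (sparse-bits jQ ω (suc ω) ≤-refl)) (weaken (denseRows ω Q (suc ω)) (s≤s z≤n) (dense-bits ω Q (suc ω)))

    rows-bits : ∀ i y → bit rows i y ≤ Ω
    rows-bits = [ (λ e → subst (λ t → ∀ i y → bit (pick t hist smallRows) i y ≤ Ω) (sym e) (large-bits e)) ,
                  (λ e → subst (λ t → ∀ i y → bit (pick t hist smallRows) i y ≤ Ω) (sym e) small-bits) ]′ (small-cases 0<r r<s)

    E₃ : Good (n ∷ r ∷ s ∷ [])
    E₃ = n≤ ∷ r≤ ∷ s≤ ∷ []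

    E₄ : Good (d ∷ n ∷ r ∷ s ∷ [])
    E₄ = d≤ ∷ E₃

    E₅ : Good (ℓ ∷ d ∷ n ∷ r ∷ s ∷ [])
    E₅ = ℓ≤ ∷ E₄

    E₆ : Good (p ∷ ℓ ∷ d ∷ n ∷ r ∷ s ∷ [])
    E₆ = p≤ ∷ E₅

    E₇ : Good (j ∷ p ∷ ℓ ∷ d ∷ n ∷ r ∷ s ∷ [])
    E₇ = j≤ ∷ E₆

    budget≤Y : budget ≤ val Y
    budget≤Y = m≤m+n budget _

    d-ev : Ev E₃ none (op add (var (# 1)) (var (# 2))) d 5 Y 2
    d-ev = castᵉ d≡ (V (# 1) +ᵉ V (# 2))

    ℓ-ev : Ev E₄ none (lgE (# 0)) ℓ 50 Y 1
    ℓ-ev = raiseᵉ (≤-trans (subst (λ t → suc d * suc t ≤ budget) (sym ℓ≡) (common≤ (# 1))) budget≤Y) (castᵉ ℓ≡ (lgᵉ (# 0) (<-trans (s≤s z≤n) (0<d 0<r r<s)) 2d≤))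

    p-ev : Ev E₅ none (suc# (op mul (lit 4) (op mul (var (# 3)) (var (# 4))))) p 20 Y 4
    p-ev = relaxᵉ (castᵉ p≡ ((Lᵉ 4 *ᵉ (V (# 3) *ᵉ V (# 4))) +ᵉ Lᵉ 1))

    j-ev : Ev E₆ none (lgE (# 0)) j 50 Y 1
    j-ev = raiseᵉ (≤-trans (subst (λ t → suc p * suc t ≤ budget) (sym j≡) (common≤ (# 3))) budget≤Y) (castᵉ j≡ (lgᵉ (# 0) (<-trans (s≤s z≤n) (1<p 0<r r<s)) 2p≤))

    q-ev : Ev E₇ none (pow2E (var (# 0))) q 30 Y 1
    q-ev = relaxᵉ (raiseᵉ (≤-trans (≤-trans (n<2^n j) (common≤ (# 4))) budget≤Y) (pow2ᵉ j≤ q≤ (V (# 0))))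

    emitted : Seq Bool
    emitted = Emission.emitted rows (λ c y → columnsOf j k (c * K + y)) n m

    w₀ h₀ b₀ u₀ f₀ : Seq ℕ
    w₀ = proj₁ prepared
    h₀ = proj₁ (proj₂ prepared)
    b₀ = proj₁ (proj₂ (proj₂ prepared))
    u₀ = proj₁ (proj₂ (proj₂ (proj₂ prepared)))
    f₀ = proj₁ (proj₂ (proj₂ (proj₂ (proj₂ prepared))))

    prepᵉ : Ex E₈ prepS none ε (st w₀ h₀ b₀ u₀ f₀ (flat q rows)) ε 11100 Y
    prepᵉ = raise {M = Z#} {M′ = Y} budget≤Y (proj₂ (proj₂ (proj₂ (proj₂ (proj₂ prepared)))))

    time₁ : suc n * suc k ≤ val Y
    time₁ = ≤-trans (m≤m+n (suc n * suc k) _) (m≤n+m _ budget)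

    time₂ : suc m * (K * (q * (suc j * suc j))) ≤ val Y
    time₂ = ≤-trans (≤-trans (m≤m+n _ (suc m * (suc (size# rows) * suc n))) (m≤n+m _ (suc n * suc k))) (m≤n+m _ budget)

    time₃ : suc m * (suc (size# rows) * suc n) ≤ val Y
    time₃ = ≤-trans (≤-trans (m≤n+m _ (suc m * (K * (q * (suc j * suc j))))) (m≤n+m _ (suc n * suc k))) (m≤n+m _ budget)

    finishᵉ : ∃ λ σ → Ex (q≤ ∷ j≤ ∷ p≤ ∷ ℓ≤ ∷ d≤ ∷ n≤ ∷ r≤ ∷ s≤ ∷ []) finalS (st w₀ h₀ b₀ u₀ f₀ (flat q rows)) ε σ emitted 2000 Y
    finishᵉ = _ , Final.finalᵉ r s n d ℓ p j k q≤ j≤ p≤ ℓ≤ d≤ n≤ r≤ s≤ (<-trans (s≤s z≤n) 0<n) refl 2n≤ space heavy (Φ-bound j k (0<j 0<r r<s)) rows rows-bits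
        (≤-trans (common≤ (# 5)) Z≤Ω) Y time₁ time₂ time₃ {w₀} {h₀} {b₀} {u₀} {f₀}

    bodyᵉ : ∃ λ σ → Ex E₈ (prepS ⨾ finalS) none ε σ emitted 13100 Y
    bodyᵉ = proj₁ finishᵉ , relaxˢ (prepᵉ ⨾ᵉ regood (proj₂ finishᵉ))

    mainᵉ : ∃ λ σ → Ex E₃ mainS none ε σ emitted 14000 Y
    mainᵉ = proj₁ bodyᵉ , relaxˢ (bindᵉ d≤ d-ev (bindᵉ ℓ≤ ℓ-ev (bindᵉ p≤ p-ev (bindᵉ j≤ j-ev (bindᵉ q≤ q-ev (regood (proj₂ bodyᵉ)))))))

    run : ∃ λ t → t ≤ 4 + 14000 * val Y × Run w (compile mainS) (initial w n r s) t (List.concatMap toList family)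
    run = proj₁ ran , proj₁ (proj₂ ran) , subst (Run w (compile mainS) (initial w n r s) (proj₁ ran)) (Listing.emitted-list rows (λ c y → columnsOf j k (c * K + y)) n m) (proj₂ (proj₂ ran))
      where
      <B′ : ∀ {x} → x ≤ Ω → x < 2 ^ w
      <B′ x≤ = <B {p = 1} (small′ x≤) tt
        where
        small′ : ∀ {x} → x ≤ Ω → x ≤ Ω ^ 1
        small′ x≤ = ≤-trans x≤ (≤-reflexive (sym (*-identityʳ Ω)))
      ran : ∃ λ t → t ≤ 4 + 14000 * val Y × Run w (compile mainS) (initial w n r s) t (toList# emitted)
      ran = run-compile w (<B′ 32≤Ω) (<B′ n≤) (<B′ r≤) (<B′ s≤) (runS (proj₂ mainᵉ))

-- A calculus of orders of magnitude.

module Orders (D : ℕ) (2≤D : 2 ≤ D) where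

  instance
    D≢0 : NonZero D
    D≢0 = >-nonZero (≤-trans (s≤s z≤n) 2≤D)

  D^-mono : ∀ {a b} → a ≤ b → D ^ a ≤ D ^ b
  D^-mono = ^-monoʳ-≤ D

  -- A power of `D` times a scale `S`. Exponents are numerals found by unification; a sum costs one
  -- more factor `D`, as `2 ≤ D`. It is applied with `D = 2 ^ ℓ` for factors polynomial in d and
  -- with `D = ℓ` for polylogarithmic ones.
  record Order (S x c : ℕ) : Set where
    constructor ord
    field ord≤ : x ≤ D ^ c * S
  open Order public

  module _ {S : ℕ} (1≤S : 1 ≤ S) where

    free : ∀ {x c} → Order 1 x c → Order S x c
    free {x} {c} (ord h) = ord (≤-trans h (*-monoʳ-≤ (D ^ c) 1≤S))

    infixl 6 _⊕_
    _⊕_ : ∀ {x y a b} → Order S x a → Order S y b → Order S (x + y) (suc (a ⊔ b))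
    _⊕_ {x} {y} {a} {b} (ord hx) (ord hy) = ord (≤-trans (+-mono-≤ (≤-trans hx (*-monoˡ-≤ S (D^-mono (m≤m⊔n a b)))) (≤-trans hy (*-monoˡ-≤ S (D^-mono (m≤n⊔m a b)))))
      (≤-trans (≤-reflexive (cong (D ^ (a ⊔ b) * S +_) (sym (+-identityʳ _)))) (≤-trans (*-monoˡ-≤ (D ^ (a ⊔ b) * S) 2≤D) (≤-reflexive (sym (*-assoc D _ S))))))

    up : ∀ {x a b} → {_ : T (a ≤ᵇ b)} → Order S x a → Order S x b
    up {x} {a} {b} {t} (ord h) = ord (≤-trans h (*-monoˡ-≤ S (D^-mono (≤ᵇ⇒≤ a b t))))

  times : ∀ {S S′ x y a b} → Order S x a → Order S′ y b → Order (S * S′) (x * y) (a + b)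
  times {S} {S′} {x} {y} {a} {b} (ord hx) (ord hy) = ord (≤-trans (*-mono-≤ hx hy) (≤-reflexive (trans
    (solve 4 (λ p s q t → (p :* s) :* (q :* t) := (p :* q) :* (s :* t)) refl (D ^ a) S (D ^ b) S′) (cong (_* (S * S′)) (sym (^-distribˡ-+-* D a b))))))
    where open +-*-Solver

  infixl 7 _⊛_
  _⊛_ : ∀ {S x y a b} → Order 1 x a → Order S y b → Order S (x * y) (a + b)
  _⊛_ {S} {x} {y} {a} {b} hx hy = subst (λ t → Order t (x * y) (a + b)) (*-identityˡ S) (times hx hy)

  one-order : Order 1 1 0
  one-order = ord ≤-refl

  num : ∀ c → Order 1 (2 ^ c) c
  num c = ord (≤-trans (^-monoˡ-≤ c 2≤D) (≤-reflexive (sym (*-identityʳ (D ^ c)))))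

  below : ∀ {S x y c} → x ≤ y → Order S y c → Order S x c
  below le (ord h) = ord (≤-trans le h)

  sucᵒ : ∀ {S x c} → 1 ≤ S → Order S x c → Order S (suc x) (suc (0 ⊔ c))
  sucᵒ {S} {x} {c} 1≤S h = _⊕_ 1≤S {1} {x} {0} {c} (free 1≤S {1} {0} one-order) h

  1≤1 : 1 ≤ 1
  1≤1 = ≤-refl

  comm : ∀ {S c} x y → Order S (x * y) c → Order S (y * x) c
  comm {S} {c} x y = subst (λ t → Order S t c) (*-comm x y)

-- The cost as a power of d times a scale.

module Asymptotics {r s : ℕ} (P : Params r s) (0<r : 0 < r) (r<s : r < s) where

  open Family# P

  D : ℕ
  D = 2 ^ ℓ

  1≤ℓ : 1 ≤ ℓ
  1≤ℓ = 0<ℓ 0<r r<s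

  2≤D : 2 ≤ D
  2≤D = ^-monoʳ-≤ 2 1≤ℓ

  d≤D : d ≤ D
  d≤D = ≤-trans (≤2^lg d) (≤-reflexive (cong (2 ^_) ℓ≡))

  D<2d : D < 2 * d
  D<2d = subst (λ t → 2 ^ t < 2 * d) ℓ≡ (2^lg< d (<-trans (s≤s z≤n) (0<d 0<r r<s)))

  r≤d : r ≤ d
  r≤d = ≤-trans (m≤m+n r s) (≤-reflexive d≡)

  s≤d : s ≤ d
  s≤d = ≤-trans (m≤n+m s r) (≤-reflexive d≡)

  q≤2p : q ≤ 2 * p
  q≤2p = <⇒≤ (subst (λ t → 2 ^ t < 2 * p) j≡ (2^lg< p (<-trans (s≤s z≤n) (1<p 0<r r<s))))

  1≤q : 1 ≤ q
  1≤q = m^n>0 2 j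

  -- `Λ` bounds the logarithm of the binomial coefficient. Its square pays for the denominator of N
  -- under any exponent up to 2, and 460000 covers the constants of the program.
  T₀ Λ T-total : ℕ
  T₀ = budget + (q * q) * (suc j * suc j)
  Λ = r * ℓ
  T-total = 460000 * (T₀ * (Λ * Λ))

  D^≡ : ∀ c → D ^ c ≡ 2 ^ (ℓ * c)
  D^≡ c = ^-*-assoc 2 ℓ c

  2^-cancel : ∀ {a b} → 2 ^ a ≤ 2 ^ b → a ≤ b
  2^-cancel le = ≮⇒≥ λ lt → <⇒≱ (^-monoʳ-< 2 (s≤s (s≤s z≤n)) lt) le

  module Powers where

    open Orders D 2≤D public

    D-order : Order 1 D 1
    D-order = ord (≤-reflexive (trans (sym (*-identityʳ D)) (sym (*-identityʳ (D * 1)))))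

    d-order : Order 1 d 1
    d-order = below d≤D D-order

    r-order : Order 1 r 1
    r-order = below r≤d d-order

    s-order : Order 1 s 1
    s-order = below s≤d d-order

    ℓ-order : Order 1 ℓ 1
    ℓ-order = below (<⇒≤ (n<2^n ℓ)) D-order

    p-order : Order 1 p 5
    p-order = subst (λ t → Order 1 t 5) p≡ (_⊕_ 1≤1 (num 2 ⊛ (r-order ⊛ s-order)) one-order)

    q-order : Order 1 q 6
    q-order = below q≤2p (num 1 ⊛ p-order)

    j-order : Order 1 j 6
    j-order = below (<⇒≤ (n<2^n j)) q-order

    j≤6ℓ : j ≤ ℓ * 6
    j≤6ℓ = 2^-cancel (≤-trans (ord≤ q-order) (≤-reflexive (trans (*-identityʳ _) (D^≡ 6))))

    common-order : Order 1 (total (2 * d ∷ suc d * suc ℓ ∷ 2 * p ∷ suc p * suc j ∷ q ∷ [])) 17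
    common-order = up 1≤1 (_⊕_ 1≤1 (num 1 ⊛ d-order) (_⊕_ 1≤1 (sucᵒ 1≤1 d-order ⊛ sucᵒ 1≤1 ℓ-order) (_⊕_ 1≤1 (num 1 ⊛ p-order) (_⊕_ 1≤1 (sucᵒ 1≤1 p-order ⊛ sucᵒ 1≤1 j-order) (_⊕_ 1≤1 q-order (ord {c = 0} z≤n))))))

    module Blocks (ω≤ : ω ≤ D) where

      ω-order : Order 1 ω 1
      ω-order = below ω≤ D-order

      s/r-order : Order 1 (s ÷ r + 1) 2
      s/r-order = _⊕_ 1≤1 (below (÷-≤ s r) s-order) one-order

      x-order : Order 1 x 9
      x-order = subst (λ t → Order 1 t 9) x≡ (_⊕_ 1≤1 (num 2 ⊛ ((_⊕_ 1≤1 ω-order one-order ⊛ _⊕_ 1≤1 ω-order one-order) ⊛ s/r-order)) one-order)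

      Q-order : Order 1 Q 10
      Q-order = below (<⇒≤ (subst (λ t → 2 ^ t < 2 * x) jQ≡ (2^lg< x (<-trans (s≤s z≤n) 0<x)))) (num 1 ⊛ x-order)

      jQ-order : Order 1 jQ 10
      jQ-order = below (<⇒≤ (n<2^n jQ)) Q-order

      m₁-order : Order 1 m₁ 16
      m₁-order = below (÷-≤ Q 2) Q-order ⊛ j-order

      g-order : Order 1 (2 ^ (10 * g)) 1
      g-order = below (^-monoʳ-≤ 2 (≤-trans (*-monoˡ-≤ g (m≤m+n 10 2)) (≤-trans (≤-reflexive (*-comm 12 g)) (≤-trans (≤-reflexive (cong (_* 12) (sym g≡))) (÷*-≤ ℓ 12))))) D-order

      I-order : Order 1 I 4
      I-order = _⊕_ 1≤1 (_⊕_ 1≤1 (dn≤ ⊛ below (÷-≤ d ω) d-order) (below (m∸n≤m 1 dn) one-order ⊛ below (÷-≤ (r + r) ω) (_⊕_ 1≤1 r-order r-order))) one-order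
        where
        dn≤ : Order 1 dn 0
        dn≤ = below (≤-trans (≤-reflexive (sym dn≡)) (m∸n≤m 1 (2 ^ (10 * g) ∸ r))) one-order

      sq-order : Order 1 (suc q) 7
      sq-order = sucᵒ 1≤1 q-order

      -- `S₁` is the scale of the base family, `S₂` that of the spliced rows. Splicing multiplies
      -- the sizes of `hist` and `fam`, and nothing costs more than this product up to powers of d.
      module Whole (S₁ S₂ : ℕ) (1≤S₁ : 1 ≤ S₁) (1≤S₂ : 1 ≤ S₂) (large : small ≡ 0)
        (base-order : Order S₁ (size# base) 30) (flag-order : Order S₁ (total (pick dn sparsePart densePart)) 100)
        (hist-order : Order S₂ (size# hist) 3) where

        S : ℕ
        S = S₁ * S₂

        1≤S : 1 ≤ S
        1≤S = *-mono-≤ 1≤S₁ 1≤S₂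

        lift₁ : ∀ {y c} → Order S₁ y c → Order S y c
        lift₁ {y} {c} (ord h) = ord (≤-trans h (*-monoʳ-≤ (D ^ c) (m≤m*n S₁ S₂ ⦃ >-nonZero 1≤S₂ ⦄)))

        lift₂ : ∀ {y c} → Order S₂ y c → Order S y c
        lift₂ {y} {c} (ord h) = ord (≤-trans h (*-monoʳ-≤ (D ^ c) (m≤n*m S₂ S₁ ⦃ >-nonZero 1≤S₁ ⦄)))

        fam-order : Order S₁ (size# fam) 46
        fam-order = subst (λ t → Order S₁ t 46) (sym (Lifting.size-fam base _ m₁)) (m₁-order ⊛ base-order)

        large-order : Order S (total largePart) 145
        large-order = up 1≤S (fr g-order ⊞ (fr (sucᵒ 1≤1 ω-order) ⊞ (fr (num 1 ⊛ x-order) ⊞ (fr (sucᵒ 1≤1 x-order ⊛ sucᵒ 1≤1 jQ-order)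
          ⊞ (fr (sucᵒ 1≤1 m₁-order ⊛ q-order) ⊞ (fr (sucᵒ 1≤1 qq-order ⊛ Q-order) ⊞ (fr (sucᵒ 1≤1 m₁-order ⊛ (q-order ⊛ (Q-order ⊛ (sucᵒ 1≤1 jQ-order ⊛ sucᵒ 1≤1 jQ-order))))
          ⊞ (lift₁ (comm (suc Q) (size# base) (sucᵒ 1≤1 Q-order ⊛ base-order)) ⊞ (lift₁ (comm (suc q) (m₁ * size# base) (sq-order ⊛ (m₁-order ⊛ base-order))) ⊞ (lift₁ (sucᵒ 1≤1 m₁-order ⊛ comm (suc q) (suc (size# base)) (sq-order ⊛ sucᵒ 1≤S₁ base-order))
          ⊞ (fr I-order ⊞ (fr sq-order ⊞ (lift₂ (comm (suc q) (size# hist) (sq-order ⊛ hist-order)) ⊞ (hist-time ⊞ (lift₁ flag-order ⊞ nil)))))))))))))))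
          where
          infixr 6 _⊞_
          _⊞_ : ∀ {x y a b} → Order S x a → Order S y b → Order S (x + y) (suc (a ⊔ b))
          _⊞_ = _⊕_ 1≤S
          fr : ∀ {x c} → Order 1 x c → Order S x c
          fr {x} {c} = free 1≤S {x} {c}
          nil : Order S 0 0
          nil = ord z≤n
          qq-order : Order 1 (2 ^ (j + j)) 12
          qq-order = subst (λ t → Order 1 t 12) (sym (^-distribˡ-+-* 2 j j)) (q-order ⊛ q-order)
          hist-time : Order S (suc I * (suc (size# hist) * (suc (size# fam) * (suc q * suc q)))) 70
          hist-time = sucᵒ 1≤1 I-order ⊛ subst (λ t → Order t (suc (size# hist) * (suc (size# fam) * (suc q * suc q))) 65) (*-comm S₂ S₁)
            (times (sucᵒ 1≤S₂ hist-order) (comm (suc q * suc q) (suc (size# fam)) ((sq-order ⊛ sq-order) ⊛ sucᵒ 1≤S₁ fam-order)))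

        T₀-order : Order S T₀ 160
        T₀-order = up 1≤S (_⊕_ 1≤S
            (_⊕_ 1≤S common′ (_⊕_ 1≤S (subst (λ t → Order S (total (pick t largePart smallPart)) 145) (sym large) large-order) (ord {c = 0} z≤n)))
            (free 1≤S {_} {26} ((q-order ⊛ q-order) ⊛ (sucᵒ 1≤1 j-order ⊛ sucᵒ 1≤1 j-order))))
          where
          rows-order : Order S (size# rows * suc q) 10
          rows-order = subst (λ t → Order S (size# (pick t hist smallRows) * suc q) 10) (sym large)
            (lift₂ (subst (λ t → Order S₂ t 10) (*-comm (suc q) (size# hist)) (sq-order ⊛ hist-order)))
          regroup : total commonPart ≡ total (2 * d ∷ suc d * suc ℓ ∷ 2 * p ∷ suc p * suc j ∷ q ∷ []) + (size# rows * suc q + 1)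
          regroup = solve 6 (λ a b c e f h → a :+ (b :+ (c :+ (e :+ (f :+ (h :+ (con 1 :+ con 0)))))) := (a :+ (b :+ (c :+ (e :+ (f :+ con 0))))) :+ (h :+ con 1)) refl
            (2 * d) (suc d * suc ℓ) (2 * p) (suc p * suc j) q (size# rows * suc q)
            where open +-*-Solver
          common′ : Order S (total commonPart) 18
          common′ = subst (λ t → Order S t 18) (sym regroup) (_⊕_ 1≤S (free 1≤S {_} {17} common-order) (_⊕_ 1≤S rows-order (free 1≤S {1} {0} one-order)))

        T-order : Order S T-total 183
        T-order = factor ⊛ comm (Λ * Λ) T₀ (( (r-order ⊛ ℓ-order) ⊛ (r-order ⊛ ℓ-order)) ⊛ T₀-order)
          where
          factor : Order 1 460000 19
          factor = below (≤ᵇ⇒≤ 460000 (2 ^ 19) tt) (num 19)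

-- Estimates of binomial coefficients.

binom-ratio : ∀ a z → binom (a + suc z) a * suc z ≡ binom (a + suc z) (suc a) * suc a
binom-ratio a z = *-cancelʳ-≡ _ _ (a ! * z !) ⦃ a !* z !≢0 ⦄ (begin
  binom (a + suc z) a * suc z * (a ! * z !)       ≡⟨ solve 4 (λ b z f g → b :* z :* (f :* g) := b :* (f :* (z :* g))) refl (binom (a + suc z) a) (suc z) (a !) (z !) ⟩
  binom (a + suc z) a * (a ! * suc z !)           ≡⟨ binom-! a (suc z) ⟩
  (a + suc z) !                                   ≡⟨ cong _! (+-suc a z) ⟩
  (suc a + z) !                                   ≡⟨ binom-! (suc a) z ⟨
  binom (suc a + z) (suc a) * (suc a ! * z !)     ≡⟨ cong (λ n → binom n (suc a) * (suc a ! * z !)) (sym (+-suc a z)) ⟩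
  binom (a + suc z) (suc a) * (suc a ! * z !)     ≡⟨ solve 4 (λ b z f g → b :* ((z :* f) :* g) := b :* z :* (f :* g)) refl (binom (a + suc z) (suc a)) (suc a) (a !) (z !) ⟩
  binom (a + suc z) (suc a) * suc a * (a ! * z !) ∎)
  where
  open ≡-Reasoning
  open +-*-Solver

-- By `binom-ratio` the quotient of neighbours is `suc z / suc a`, at least 1 below the middle.
binom-rise : ∀ n a → suc a + a ≤ n → binom n a ≤ binom n (suc a)
binom-rise n a le = subst (λ t → binom t a ≤ binom t (suc a)) n≡ (*-cancelʳ-≤ _ _ (suc z) (≤-trans (≤-reflexive (binom-ratio a z)) (*-monoʳ-≤ (binom (a + suc z) (suc a)) (s≤s a≤z))))
  where
  z = n ∸ suc a
  n≡ : a + suc z ≡ n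
  n≡ = trans (+-suc a z) (m+[n∸m]≡n (≤-trans (m≤m+n (suc a) a) le))
  a≤z : a ≤ z
  a≤z = m+n≤o⇒m≤o∸n a (≤-trans (≤-reflexive (+-comm a (suc a))) le)

binom-peak : ∀ n {a b} → a ≤′ b → b + b ≤ n → binom n a ≤ binom n b
binom-peak n ≤′-refl         le = ≤-refl
binom-peak n (≤′-step {b} h) le = ≤-trans (binom-peak n h (≤-trans (n≤1+n _) le′)) (binom-rise n b le′)
  where
  le′ : suc b + b ≤ n
  le′ = ≤-trans (+-monoʳ-≤ (suc b) (n≤1+n b)) le

-- Up to the middle, the two summands of Pascal's rule are ordered by `binom-rise`, so one more
-- element at most doubles the coefficient.
binom-doubling : ∀ t d a → a + a ≤ d → binom (t + d) a ≤ 2 ^ t * binom d a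
binom-doubling zero    d a le = ≤-reflexive (sym (+-identityʳ _))
binom-doubling (suc t) d a le = ≤-trans (double a le) (≤-trans (*-monoʳ-≤ 2 (binom-doubling t d a le)) (≤-reflexive (sym (*-assoc 2 (2 ^ t) _))))
  where
  double : ∀ a → a + a ≤ d → binom (suc (t + d)) a ≤ 2 * binom (t + d) a
  double zero    _  = s≤s z≤n
  double (suc a) le = +-mono-≤ (binom-rise (t + d) a (≤-trans (≤-trans (+-monoʳ-≤ (suc a) (n≤1+n a)) le) (m≤n+m d t))) (≤-reflexive (sym (+-identityʳ _)))

binom-1 : ∀ n → binom n 1 ≡ n
binom-1 zero    = refl
binom-1 (suc n) = cong suc (binom-1 n)

-- One element is chosen from each of `k` groups of `m`.
^≤binom : ∀ m k → m ^ k ≤ binom (k * m) k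
^≤binom m zero    = ≤-refl
^≤binom m (suc k) = ≤-trans (*-mono-≤ (≤-reflexive (sym (binom-1 m))) (^≤binom m k)) (binom-* m 1 (k * m) k)

binom≤^ : ∀ n k → binom n k ≤ n ^ k
binom≤^ n       zero    = ≤-refl
binom≤^ zero    (suc k) = z≤n
binom≤^ (suc n) (suc k) = ≤-trans (+-mono-≤ (binom≤^ n k) (binom≤^ n (suc k))) (*-monoʳ-≤ (suc n) (^-monoˡ-≤ k (n≤1+n n)))

≤binom : ∀ a z → suc a + suc z ≤ binom (suc a + suc z) (suc a)
≤binom zero    z = s≤s (≤-reflexive (sym (binom-1 (suc z))))
≤binom (suc a) z = ≤-trans (≤-reflexive (+-comm 1 _)) (+-mono-≤ (≤binom a z)
  (≤-trans (binom-≥1 (suc (suc a)) z) (≤-reflexive (cong (λ n → binom n (suc (suc a))) (sym (cong suc (+-suc a z)))))))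

÷-≥ : ∀ {w} → 0 < w → ∀ {b y} → b * w ≤ y → b ≤ y ÷ w
÷-≥ {w} 0<w {b} {y} le = ≤-trans (≤-reflexive (sym (m*n/n≡m b w))) (≤-trans (/-monoˡ-≤ w le) (≤-reflexive (sym (÷-/ y w))))
  where instance _ = >-nonZero 0<w

÷-bound : ∀ {w} → 0 < w → ∀ {b y} → y ≤ b * w → y ÷ w ≤ b
÷-bound {w} 0<w {b} {y} le = *-cancelʳ-≤ _ _ w ⦃ >-nonZero 0<w ⦄ (≤-trans (÷*-≤ y w) le)

1∸-zero : ∀ {a b} → 1 ∸ (a ∸ b) ≡ 0 → b < a
1∸-zero {a} {b} e = ≰⇒> λ a≤b → case trans (sym e) (cong (1 ∸_) (m≤n⇒m∸n≡0 a≤b)) of λ ()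

1∸-one : ∀ {a b} → 1 ∸ (a ∸ b) ≡ 1 → a ≤ b
1∸-one {a} {b} e = ≮⇒≥ λ b<a → case trans (sym e) (m≤n⇒m∸n≡0 (m<n⇒0<n∸m b<a)) of λ ()

sparse-size : ∀ j ω a → a ≤ suc ω → size# (sparseRows j a) ≤ a * 2 ^ (ω * j)
sparse-size j ω zero    _ = z≤n
sparse-size j ω (suc a) (s≤s a≤) = ≤-trans (≤-reflexive (size-ext (sparseRows j a) (tuple j a) _))
  (≤-trans (+-mono-≤ (sparse-size j ω a (m≤n⇒m≤1+n a≤)) (^-monoʳ-≤ 2 (*-monoˡ-≤ j a≤))) (≤-reflexive (+-comm (a * 2 ^ (ω * j)) _)))

sparse-count : ∀ j b a → countTag b (sparseRows j a) ≤ a * 2 ^ (b * j)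
sparse-count j b zero    = z≤n
sparse-count j b (suc a) = ≤-trans (≤-reflexive (sumRows-ext _ (sparseRows j a) (tuple j a) (2 ^ (a * j))))
  (≤-trans (+-mono-≤ (sparse-count j b a) new) (≤-reflexive (+-comm (a * 2 ^ (b * j)) _)))
  where
  new : Σ< (λ _ → eqN a b) (2 ^ (a * j)) ≤ 2 ^ (b * j)
  new = case a ≟ b of λ
    { (yes refl) → ≤-trans (Σ-const _ 1 (2 ^ (a * j)) (λ _ _ → eqN-≤1 a a)) (≤-reflexive (*-identityʳ _))
    ; (no a≢b)   → ≤-trans (Σ-const _ 0 (2 ^ (a * j)) (λ _ _ → ≤-reflexive (eqN-≢ a≢b))) (≤-trans (≤-reflexive (*-zeroʳ (2 ^ (a * j)))) z≤n) }

greedy-new : ∀ Q a b R₀ t c → countTag c (Greedy.greedy Q a b R₀ t) + size# R₀ ≤ countTag c R₀ + size# (Greedy.greedy Q a b R₀ t)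
greedy-new Q a b R₀ zero    c = ≤-refl
greedy-new Q a b R₀ (suc t) c with Greedy.flag Q a b R₀ t
... | zero  = greedy-new Q a b R₀ t c
... | suc _ = begin
  countTag c G + eqN a c + size# R₀ ≤⟨ +-monoˡ-≤ (size# R₀) (+-monoʳ-≤ (countTag c G) (eqN-≤1 a c)) ⟩
  countTag c G + 1 + size# R₀       ≡⟨ cong (_+ size# R₀) (+-comm (countTag c G) 1) ⟩
  suc (countTag c G + size# R₀)     ≤⟨ s≤s (greedy-new Q a b R₀ t c) ⟩
  suc (countTag c R₀ + size# G)     ≡⟨ +-suc (countTag c R₀) (size# G) ⟨
  countTag c R₀ + suc (size# G)     ∎
  where
  open ≤-Reasoning
  G = Greedy.greedy Q a b R₀ t

-- Rows of tag `b` come from a single greedy cover, and its sharp size `enough` provides the factor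
-- `binom ω b` instead of `2 ^ ω`; Vandermonde needs precisely this.
dense-count : ∀ ω Q b a → a ≤ suc ω → countTag b (denseRows ω Q a) ≤ a * (suc (Q + Q) * (suc ω * binom ω b))
dense-count ω Q b zero    _ = z≤n
dense-count ω Q b (suc a) (s≤s a≤) = ≤-trans added (≤-trans (+-monoˡ-≤ _ (dense-count ω Q b a (m≤n⇒m≤1+n a≤))) (≤-reflexive (+-comm (a * _) _)))
  where
  R = denseRows ω Q a
  added : countTag b (denseRows ω Q (suc a)) ≤ countTag b R + suc (Q + Q) * (suc ω * binom ω b)
  added = case b ≟ a of λ
    { (no b≢a)   → ≤-trans (≤-reflexive (Greedy.greedy-count Q a (ω ∸ a) R (steps ω Q) b b≢a)) (m≤m+n _ _)
    ; (yes refl) → +-cancelʳ-≤ (size# R) _ _ (≤-trans (greedy-new Q a (ω ∸ a) R (steps ω Q) a)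
        (≤-trans (+-monoʳ-≤ (countTag a R) (≤-trans (Greedy.greedy-size Q a (ω ∸ a) R (steps ω Q))
            (≤-reflexive (cong (λ x → size# R + suc (Q + Q) * (suc x * binom x a)) (m+[n∸m]≡n a≤)))))
          (≤-reflexive (solve 3 (λ c s e → c :+ (s :+ e) := c :+ e :+ s) refl (countTag a R) (size# R) (suc (Q + Q) * (suc ω * binom ω a)))))) }
    where open +-*-Solver

-- The number of spliced rows in the two large cases.

module Cases {r s : ℕ} (P : Params r s) (0<r : 0 < r) (r<s : r < s) where

  open Family# P
  open Asymptotics P 0<r r<s

  C m : ℕ
  C = binom d r
  m = d ÷ r

  base-at : ∀ {t} → dn ≡ t → base ≡ pick t (sparseRows jQ (suc ω)) (denseRows ω Q (suc ω))
  base-at = cong (λ t → pick t (sparseRows jQ (suc ω)) (denseRows ω Q (suc ω)))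

  module Sparse (large : small ≡ 0) (dn≡0 : dn ≡ 0) where

    open Powers

    ω≡ℓ : ω ≡ ℓ
    ω≡ℓ = trans (sym ω≡) (trans (cong₂ (λ a b → a * 2 ^ (3 * g) + b * ℓ) dn≡0 (cong (1 ∸_) dn≡0)) (*-identityˡ ℓ))

    open Blocks (≤-trans (≤-reflexive ω≡ℓ) (<⇒≤ (n<2^n ℓ)))

    c : ℕ → ℕ
    c a = 2 ^ (a * jQ)

    open Counting.Bound q r fam ω (m₁ * suc ω) c (λ _ → c)
      (fam-tags base _ m₁ (subst (Tags≤ ω) (sym (base-at dn≡0)) (sparse-tags jQ ω (suc ω) ≤-refl)))
      (λ a → ≤-trans (≤-reflexive (fam-count base _ m₁ a)) (≤-trans (*-monoʳ-≤ m₁ (subst (λ B → countTag a B ≤ suc ω * c a) (sym (base-at dn≡0)) (sparse-count jQ a (suc ω))))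
        (≤-reflexive (sym (*-assoc m₁ (suc ω) (c a))))))
      ≤-refl (λ _ _ → ≤-refl)
      (λ _ a a′ → ≤-reflexive (trans (sym (^-distribˡ-+-* 2 (a * jQ) (a′ * jQ))) (cong (2 ^_) (sym (*-distribʳ-+ jQ a a′)))))
      public using (growth; hist-size)

    jQ≤ : jQ ≤ ℓ * 10
    jQ≤ = 2^-cancel (≤-trans (ord≤ Q-order) (≤-reflexive (trans (*-identityʳ _) (D^≡ 10))))

    S₁ S₂ : ℕ
    S₁ = c ω
    S₂ = growth ^ I * c r

    1≤S₁ : 1 ≤ S₁
    1≤S₁ = m^n>0 2 (ω * jQ)

    S₁-order : ∀ {x a} → Order 1 x a → Order S₁ (x * S₁) a
    S₁-order {x} {a} h = subst (Order S₁ (x * S₁)) (+-identityʳ a) (h ⊛ ord {c = 0} (≤-reflexive (sym (*-identityˡ S₁))))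

    open Whole S₁ S₂ 1≤S₁ (*-mono-≤ (m^n>0 growth I) (m^n>0 2 (r * jQ))) large
      (up 1≤S₁ (subst (λ B → Order S₁ (size# B) 2) (sym (base-at dn≡0)) (below (sparse-size jQ ω (suc ω) ≤-refl) (S₁-order (sucᵒ 1≤1 ω-order)))))
      (subst (λ t → Order S₁ (total (pick t sparsePart densePart)) 100) (sym dn≡0)
        (up 1≤S₁ (_⊕_ 1≤S₁ (sucᵒ 1≤1 ω-order ⊛ comm (Q * (suc ω * suc (ω * jQ))) S₁ (S₁-order (Q-order ⊛ (sucᵒ 1≤1 ω-order ⊛ sucᵒ 1≤1 (ω-order ⊛ jQ-order))))) (ord {c = 0} z≤n))))
      (up (*-mono-≤ (m^n>0 growth I) (m^n>0 2 (r * jQ))) (below (hist-size I (c r) (λ a a≤ → ^-monoʳ-≤ 2 (*-monoˡ-≤ jQ a≤)))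
        (sucᵒ 1≤1 r-order ⊛ ord {c = 0} (≤-reflexive (sym (*-identityˡ S₂))))))
      public using (T-order)

    growth≤ : growth ≤ D ^ 50
    growth≤ = ≤-trans (ord≤ (up 1≤1 {growth} {28} {50} (_⊕_ 1≤1 one-order (sq-order ⊛ (sucᵒ 1≤1 ω-order ⊛ (m₁-order ⊛ sucᵒ 1≤1 ω-order)))))) (≤-reflexive (*-identityʳ _))

  module Dense (large : small ≡ 0) (dn≡1 : dn ≡ 1) where

    open Powers

    ω≡2^ : ω ≡ 2 ^ (3 * g)
    ω≡2^ = trans (sym ω≡) (trans (cong₂ (λ a b → a * 2 ^ (3 * g) + b * ℓ) dn≡1 (cong (1 ∸_) dn≡1)) (trans (+-identityʳ _) (*-identityˡ _)))

    12g≤ℓ : 12 * g ≤ ℓ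
    12g≤ℓ = ≤-trans (≤-reflexive (trans (*-comm 12 g) (cong (_* 12) (sym g≡)))) (÷*-≤ ℓ 12)

    open Blocks (≤-trans (≤-reflexive ω≡2^) (^-monoʳ-≤ 2 (≤-trans (*-monoˡ-≤ g (m≤m+n 3 9)) 12g≤ℓ)))

    X′ : ℕ
    X′ = m₁ * (suc ω * (suc (Q + Q) * suc ω))

    fam-counts : ∀ a → countTag a fam ≤ X′ * binom ω a
    fam-counts a = ≤-trans (≤-reflexive (fam-count base _ m₁ a)) (≤-trans (*-monoʳ-≤ m₁ (subst (λ B → countTag a B ≤ suc ω * (suc (Q + Q) * (suc ω * binom ω a))) (sym (base-at dn≡1)) (dense-count ω Q a (suc ω) ≤-refl)))
        (≤-reflexive (solve 4 (λ m w q b → m :* (w :* (q :* (w :* b))) := m :* (w :* (q :* w)) :* b) refl m₁ (suc ω) (suc (Q + Q)) (binom ω a))))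
      where open +-*-Solver

    open Counting.Bound q r fam ω X′ (binom ω) (λ i → binom (i * ω))
      (fam-tags base _ m₁ (subst (Tags≤ ω) (sym (base-at dn≡1)) (dense-tags ω Q (suc ω) ≤-refl)))
      fam-counts
      ≤-refl (λ i a → binom-mono-+ ω (i * ω) a)
      (λ i a a′ → binom-* ω a (i * ω) a′)
      public using (growth; hist-size)

    ω≤Q : ω ≤ Q
    ω≤Q = ≤-trans (≤-trans (m≤m+n ω 1) (≤-trans (m≤m*n (ω + 1) ((ω + 1) * (s ÷ r + 1)) ⦃ >-nonZero (*-mono-≤ {1} {ω + 1} {1} (m≤n+m 1 ω) (m≤n+m 1 (s ÷ r))) ⦄) (≤-reflexive (sym (*-assoc (ω + 1) (ω + 1) _)))))
      (≤-trans (≤-trans (m≤n*m _ 4) (m≤m+n _ 1)) (≤-trans (≤-reflexive x≡) x≤Q))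

    r+r≤d : r + r ≤ d
    r+r≤d = ≤-trans (+-monoʳ-≤ r (<⇒≤ r<s)) (≤-reflexive d≡)

    Iω≤ : I * ω ≤ ω + d
    Iω≤ = ≤-trans (≤-reflexive (trans (cong₂ (λ a b → (a * (d ÷ ω) + b * ((r + r) ÷ ω) + 1) * ω) dn≡1 (cong (1 ∸_) dn≡1))
        (solve 2 (λ x w → (con 1 :* x :+ con 0 :+ con 1) :* w := w :+ x :* w) refl (d ÷ ω) ω))) (+-monoʳ-≤ ω (÷*-≤ d ω))
      where open +-*-Solver

    -- All rounds together have capacity `I * ω ≤ ω + d`. The surplus `ω` from rounding costs a
    -- factor `2 ^ ω`, and `r + r ≤ d` makes the coefficients increase up to `r`.
    choices : ∀ a → a ≤ r → binom (I * ω) a ≤ 2 ^ ω * C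
    choices a a≤ = ≤-trans (subst (binom (I * ω) a ≤_) (cong (λ n → binom n a) (m∸n+n≡m Iω≤)) (binom-mono-+ ((ω + d) ∸ I * ω) (I * ω) a))
      (≤-trans (binom-doubling ω d a (≤-trans (+-mono-≤ a≤ a≤) r+r≤d)) (*-monoʳ-≤ (2 ^ ω) (binom-peak d (≤⇒≤′ a≤) r+r≤d)))

    -- The fourth power in `S₁` is the cost of greedy search: `2 ^ ω ≤ V#` steps, `V#` candidates
    -- and `V# * V#` events.
    S₁ S₂ : ℕ
    S₁ = V# * (V# * (V# * V#))
    S₂ = growth ^ I * (2 ^ ω * C)

    1≤V : 1 ≤ V#
    1≤V = m^n>0 2 Q

    1≤C : 1 ≤ C
    1≤C = subst (λ n → 1 ≤ binom n r) d≡ (binom-≥1 r s)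

    1≤S₁ : 1 ≤ S₁
    1≤S₁ = *-mono-≤ 1≤V (*-mono-≤ 1≤V (*-mono-≤ 1≤V 1≤V))

    1≤S₂ : 1 ≤ S₂
    1≤S₂ = *-mono-≤ (m^n>0 growth I) (*-mono-≤ (m^n>0 2 ω) 1≤C)

    self : ∀ {S} → Order S S 0
    self {S} = ord (≤-reflexive (sym (*-identityˡ S)))

    T#-order : Order V# T# 14
    T#-order = _⊕_ 1≤1 ω-order one-order ⊛ comm ((Q + Q) + 1) (2 ^ ω) (_⊕_ 1≤1 (_⊕_ 1≤1 Q-order Q-order) one-order ⊛ below (^-monoʳ-≤ 2 ω≤Q) (self {V#}))

    V≤S₁ : V# ≤ S₁
    V≤S₁ = m≤m*n V# _ ⦃ >-nonZero (*-mono-≤ 1≤V (*-mono-≤ 1≤V 1≤V)) ⦄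

    raiseⱽ : ∀ {y c} → Order V# y c → Order S₁ y c
    raiseⱽ {y} {c} (ord h) = ord (≤-trans h (*-monoʳ-≤ (D ^ c) V≤S₁))

    raise³ : ∀ {y c} → Order (V# * (V# * V#)) y c → Order S₁ y c
    raise³ {y} {c} (ord h) = ord (≤-trans h (*-monoʳ-≤ (D ^ c) (m≤n*m _ V# ⦃ >-nonZero 1≤V ⦄)))

    V³-order : Order (V# * (V# * V#)) (suc (V# * V#) * V#) 1
    V³-order = subst (λ t → Order t (suc (V# * V#) * V#) 1) (*-comm (V# * V#) V#) (times (sucᵒ (*-mono-≤ 1≤V 1≤V) (self {V# * V#})) (self {V#}))

    part₃ : Order S₁ (suc ω * (suc T# * (V# * ((V# * V#) * (suc Q * suc Q))))) 39
    part₃ = sucᵒ 1≤1 ω-order ⊛ times (sucᵒ 1≤V T#-order) (times (self {V#}) (comm (suc Q * suc Q) (V# * V#) ((sucᵒ 1≤1 Q-order ⊛ sucᵒ 1≤1 Q-order) ⊛ self {V# * V#})))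

    open Whole S₁ S₂ 1≤S₁ 1≤S₂ large
      (up 1≤S₁ (subst (λ B → Order S₁ (size# B) 16) (sym (base-at dn≡1)) (raiseⱽ (below (dense-size ω Q (suc ω)) (sucᵒ 1≤1 ω-order ⊛ T#-order)))))
      (subst (λ t → Order S₁ (total (pick t sparsePart densePart)) 100) (sym dn≡1)
        (up 1≤S₁ (_⊕_ 1≤S₁ (free 1≤S₁ (num 1 ⊛ Q-order)) (_⊕_ 1≤S₁ (raiseⱽ (comm (suc Q) (suc ω * T#) (sucᵒ 1≤1 Q-order ⊛ (sucᵒ 1≤1 ω-order ⊛ T#-order))))
          (_⊕_ 1≤S₁ (raise³ (times (sucᵒ 1≤V T#-order) (self {V# * V#}))) (_⊕_ 1≤S₁ (raise³ V³-order) (_⊕_ 1≤S₁ part₃ (ord {c = 0} z≤n))))))))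
      (up 1≤S₂ (below (hist-size I (2 ^ ω * C) choices) (sucᵒ 1≤1 r-order ⊛ self {S₂})))
      public using (T-order)

    growth≤ : growth ≤ D ^ 50
    growth≤ = ≤-trans (ord≤ (up 1≤1 {growth} {42} {50} (_⊕_ 1≤1 one-order (sq-order ⊛ (sucᵒ 1≤1 ω-order ⊛ (m₁-order ⊛ (sucᵒ 1≤1 ω-order ⊛ (sucᵒ 1≤1 (_⊕_ 1≤1 Q-order Q-order) ⊛ sucᵒ 1≤1 ω-order)))))))) (≤-reflexive (*-identityʳ _))

^-distrib-* : ∀ a b t → (a * b) ^ t ≡ a ^ t * b ^ t
^-distrib-* a b zero    = refl
^-distrib-* a b (suc t) = trans (cong (a * b *_) (^-distrib-* a b t)) (solve 4 (λ a b x y → a :* b :* (x :* y) := a :* x :* (b :* y)) refl a b (a ^ t) (b ^ t))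
  where open +-*-Solver

-- The decisive inequality between powers.

module Claim {r s : ℕ} (P : Params r s) (0<r : 0 < r) (r<s : r < s) (M : ℕ) (1≤M : 1 ≤ M) (1≤g : 1 ≤ Params.g P)
  (ℓ^≤ : Params.ℓ P ^ (400 * M) ≤ 2 ^ Params.g P) where

  open Family# P
  open Asymptotics P 0<r r<s
  open Cases P 0<r r<s using (C; m; module Sparse; module Dense)

  12g≤ℓ : 12 * g ≤ ℓ
  12g≤ℓ = ≤-trans (≤-reflexive (trans (*-comm 12 g) (cong (_* 12) (sym g≡)))) (÷*-≤ ℓ 12)

  ℓ≤12g+12 : ℓ ≤ 12 * g + 12
  ℓ≤12g+12 = ≤-trans (round-up 0<r r<s 12 (s≤s z≤n) ℓ) (≤-reflexive (trans (cong (λ t → (t + 1) * 12) g≡) (solve 1 (λ g → (g :+ con 1) :* con 12 := con 12 :* g :+ con 12) refl g)))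
    where open +-*-Solver

  2≤ℓ : 2 ≤ ℓ
  2≤ℓ = ≤-trans (≤-trans (s≤s (s≤s z≤n)) (*-monoʳ-≤ 12 1≤g)) 12g≤ℓ

  open Orders ℓ 2≤ℓ

  ℓ^-mono : ∀ {a b} → a ≤ b → ℓ ^ a ≤ ℓ ^ b
  ℓ^-mono = D^-mono

  self : ∀ {S} → Order S S 0
  self {S} = ord (≤-reflexive (sym (*-identityˡ S)))

  ℓO : Order 1 ℓ 1
  ℓO = ord (≤-reflexive (sym (trans (*-identityʳ _) (*-identityʳ ℓ))))

  1≤d : 1 ≤ d
  1≤d = <⇒≤ (0<d 0<r r<s)

  1≤C : 1 ≤ C
  1≤C = subst (λ n → 1 ≤ binom n r) d≡ (binom-≥1 r s)

  C≤dC : C ≤ d * C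
  C≤dC = m≤n*m C d ⦃ >-nonZero 1≤d ⦄

  2≤m : 2 ≤ m
  2≤m = ÷-≥ 0<r (≤-trans (≤-reflexive (cong (r +_) (+-identityʳ r))) (≤-trans (+-monoʳ-≤ r (<⇒≤ r<s)) (≤-reflexive d≡)))

  d≤r*2m : d ≤ r * (2 * m)
  d≤r*2m = ≤-trans (round-up 0<r r<s r 0<r d) (≤-trans (*-monoˡ-≤ r (+-monoʳ-≤ m (<⇒≤ 2≤m)))
    (≤-reflexive (solve 2 (λ m r → (m :+ m) :* r := r :* (con 2 :* m)) refl m r)))
    where open +-*-Solver

  m^r≤C : m ^ r ≤ C
  m^r≤C = ≤-trans (^≤binom m r) (subst (λ n → binom (r * m) r ≤ binom n r) (m∸n+n≡m rm≤d) (binom-mono-+ (d ∸ r * m) (r * m) r))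
    where
    rm≤d : r * m ≤ d
    rm≤d = ≤-trans (≤-reflexive (*-comm r m)) (÷*-≤ d r)

  -- A smaller quotient would give `d ≤ 2 ^ (11 * g)`, hence `2 * d ≤ 2 ^ ℓ` from `1 ≤ g` and
  -- `12 * g ≤ ℓ`, against `2 ^ ℓ < 2 * d`.
  wide : r ≤ 2 ^ (10 * g) → 2 ^ g ≤ m
  wide r≤ = ≮⇒≥ λ m< → <⇒≱ D<2d (≤-trans (*-monoʳ-≤ 2 (≤-trans (round-up 0<r r<s r 0<r d) (*-mono-≤ (≤-trans (≤-reflexive (+-comm m 1)) m<) r≤)))
    (≤-trans (≤-reflexive (cong (2 *_) (sym (^-distribˡ-+-* 2 g (10 * g))))) (^-monoʳ-≤ 2 (≤-trans (≤-trans (+-monoˡ-≤ (g + 10 * g) 1≤g) (≤-reflexive (solve 1 (λ g → g :+ (g :+ con 10 :* g) := con 12 :* g) refl g))) 12g≤ℓ))))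
    where open +-*-Solver

  -- Reduces each of the three cases to an estimate of the excess `U` over `d * C`.
  finish : ∀ T U → T ≤ U * (d * C) → U ^ M ≤ d * C → T ^ M ≤ (d * C) ^ suc M
  finish T U T≤ U≤ = ≤-trans (^-monoˡ-≤ M T≤) (≤-trans (≤-reflexive (^-distrib-* U (d * C) M)) (*-monoˡ-≤ ((d * C) ^ M) U≤))

  -- The hypothesis on ℓ lets one factor `2 ^ g` pay for up to 400 factors ℓ, even after raising to
  -- the power `M`.
  polylog : ∀ E t → E ≤ 400 → (ℓ ^ (E * t)) ^ M ≤ (2 ^ g) ^ t
  polylog E t E≤ = begin
    (ℓ ^ (E * t)) ^ M ≡⟨ ^-*-assoc ℓ (E * t) M ⟩
    ℓ ^ (E * t * M)   ≤⟨ ℓ^-mono (≤-trans (≤-reflexive (trans (*-assoc E t M) (trans (cong (E *_) (*-comm t M)) (sym (*-assoc E M t))))) (*-monoˡ-≤ t (*-monoˡ-≤ M E≤))) ⟩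
    ℓ ^ (400 * M * t) ≡⟨ ^-*-assoc ℓ (400 * M) t ⟨
    (ℓ ^ (400 * M)) ^ t ≤⟨ ^-monoˡ-≤ t ℓ^≤ ⟩
    (2 ^ g) ^ t       ∎
    where open ≤-Reasoning

  2^≤ℓ^ : ∀ t → 2 ^ t ≤ ℓ ^ t
  2^≤ℓ^ t = ^-monoˡ-≤ t 2≤ℓ

  d≤q : d ≤ q
  d≤q = ≤-trans (≤-reflexive (sym d≡)) (≤-trans (+-mono-≤ (m≤m*n r s ⦃ >-nonZero (0<s 0<r r<s) ⦄) (m≤n*m s r ⦃ >-nonZero 0<r ⦄))
    (≤-trans (≤-trans (≤-reflexive (cong (r * s +_) (sym (+-identityʳ _)))) (*-monoˡ-≤ (r * s) (s≤s (s≤s (z≤n {2}))))) (<⇒≤ 4rs<q)))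

  p≤q : p ≤ q
  p≤q = ≤-trans (≤2^lg p) (≤-reflexive (cong (2 ^_) j≡))

  -- There are `q ^ r` rows with `q ≤ ℓ ^ 9 * m`, and `m ^ r ≤ C`; the excess is a fixed power of ℓ
  -- per required one. One additional `q` is charged to d.
  small-bound : small ≡ 1 → T-total ^ M ≤ (d * C) ^ suc M
  small-bound small≡1 = finish T-total (ℓ ^ (80 * suc r)) T≤
    -- Of the `suc r` factors `2 ^ g`, one is at most d, and the others are at most `m ^ r ≤ C`.
    (≤-trans (polylog 80 (suc r) (m≤m+n 80 320)) (*-mono-≤ 2^g≤d (≤-trans (^-monoˡ-≤ r (wide r≤2^)) m^r≤C)))
    where
    r≤ℓℓ : r ≤ ℓ * ℓ
    r≤ℓℓ = 1∸-one small≡1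
    r≤2^ : r ≤ 2 ^ (10 * g)
    r≤2^ = ≤-trans r≤ℓℓ (≤-trans (≤-reflexive (cong (ℓ *_) (sym (*-identityʳ ℓ)))) (≤-trans (ℓ^-mono {2} {400 * M} (≤-trans (s≤s (s≤s z≤n)) (*-monoʳ-≤ 400 1≤M)))
      (≤-trans ℓ^≤ (^-monoʳ-≤ 2 (m≤n*m g 10)))))
    2^g≤d : 2 ^ g ≤ d
    2^g≤d = ≤-trans (wide r≤2^) (÷-≤ d r)
    Z : ℕ
    Z = q ^ suc r
    1≤q^r : 1 ≤ q ^ r
    1≤q^r = m^n>0 q ⦃ >-nonZero 1≤q ⦄ r
    q≤Z : q ≤ Z
    q≤Z = m≤m*n q (q ^ r) ⦃ >-nonZero 1≤q^r ⦄
    1≤Z : 1 ≤ Z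
    1≤Z = ≤-trans 1≤q q≤Z
    q²≤Z : q * q ≤ Z
    q²≤Z = *-monoʳ-≤ q (≤-trans (≤-reflexive (sym (*-identityʳ q))) (^-monoʳ-≤ q ⦃ >-nonZero 1≤q ⦄ 0<r))
    qO : Order Z q 0
    qO = below q≤Z self
    dO : Order Z d 0
    dO = below d≤q qO
    pO : Order Z p 0
    pO = below p≤q qO
    rO : Order 1 r 2
    rO = below r≤ℓℓ (ℓO ⊛ ℓO)
    jO : Order 1 j 4
    jO = below (≤-trans (Powers.j≤6ℓ) (*-monoʳ-≤ ℓ (≤ᵇ⇒≤ 6 (2 ^ 3) tt))) (ℓO ⊛ num 3)
    rows≡ : size# rows ≡ q ^ r
    rows≡ = trans (cong (λ t → size# (pick t hist smallRows)) small≡1) (trans (size-ext ε (tuple j r) (2 ^ (r * j))) 2^rj)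
      where
      2^rj : 2 ^ (r * j) ≡ q ^ r
      2^rj = trans (cong (2 ^_) (*-comm r j)) (sym (^-*-assoc 2 j r))
    2^rj : 2 ^ (r * j) ≡ q ^ r
    2^rj = trans (cong (2 ^_) (*-comm r j)) (sym (^-*-assoc 2 j r))
    fillO : Order Z (q ^ r * suc q) 1
    fillO = below (≤-trans (*-monoʳ-≤ (q ^ r) (≤-trans (+-monoˡ-≤ q 1≤q) (≤-reflexive (cong (q +_) (sym (+-identityʳ q))))))
      (≤-reflexive (solve 2 (λ x q → x :* (con 2 :* q) := con 2 :* (q :* x)) refl (q ^ r) q))) (num 1 ⊛ self {Z})
      where open +-*-Solver
    commonO : Order Z (total commonPart) 20
    commonO = up 1≤Z (_⊕_ 1≤Z (num 1 ⊛ dO) (_⊕_ 1≤Z (comm (suc ℓ) (suc d) (sucᵒ 1≤1 ℓO ⊛ sucᵒ 1≤Z dO)) (_⊕_ 1≤Z (num 1 ⊛ pO)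
      (_⊕_ 1≤Z (comm (suc j) (suc p) (sucᵒ 1≤1 jO ⊛ sucᵒ 1≤Z pO)) (_⊕_ 1≤Z qO (_⊕_ 1≤Z (subst (λ t → Order Z (t * suc q) 1) (sym rows≡) fillO)
      (_⊕_ 1≤Z (free 1≤Z one-order) (ord {c = 0} z≤n))))))))
    smallO : Order Z (total smallPart) 20
    smallO = up 1≤Z (_⊕_ 1≤Z (subst (λ t → Order Z (t * suc q) 1) (sym 2^rj) fillO)
      (_⊕_ 1≤Z (subst (λ t → Order Z (t * (q * (suc r * suc (r * j)))) 10) (sym 2^rj)
        (below (≤-reflexive (solve 3 (λ x q y → x :* (q :* y) := y :* (q :* x)) refl (q ^ r) q (suc r * suc (r * j)))) ((sucᵒ 1≤1 rO ⊛ sucᵒ 1≤1 (rO ⊛ jO)) ⊛ self {Z})))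
        (ord {c = 0} z≤n)))
      where open +-*-Solver
    T₀O : Order Z T₀ 25
    T₀O = up 1≤Z (_⊕_ 1≤Z (_⊕_ 1≤Z commonO (_⊕_ 1≤Z (subst (λ t → Order Z (total (pick t largePart smallPart)) 20) (sym small≡1) smallO) (ord {c = 0} z≤n)))
      (comm (suc j * suc j) (q * q) ((sucᵒ 1≤1 jO ⊛ sucᵒ 1≤1 jO) ⊛ below q²≤Z self)))
    factor : Order 1 460000 19
    factor = below (≤ᵇ⇒≤ 460000 (2 ^ 19) tt) (num 19)
    TO : Order Z T-total 55
    TO = up 1≤Z (factor ⊛ comm (Λ * Λ) T₀ (((rO ⊛ ℓO) ⊛ (rO ⊛ ℓO)) ⊛ T₀O))
    rdO : Order d (r * s) 2
    rdO = rO ⊛ below s≤d self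
    q-dO : Order d q 6
    q-dO = up 1≤d (below q≤2p (num 1 ⊛ subst (λ t → Order d t 5) p≡ (_⊕_ 1≤d (num 2 ⊛ rdO) (free 1≤d one-order))))
    d-mO : Order m d 3
    d-mO = below d≤r*2m (rO ⊛ (num 1 ⊛ self {m}))
    q≤ℓ^9m : q ≤ ℓ ^ 9 * m
    q≤ℓ^9m = ≤-trans (ord≤ q-dO) (≤-trans (*-monoʳ-≤ (ℓ ^ 6) (ord≤ d-mO)) (≤-reflexive (trans (sym (*-assoc (ℓ ^ 6) (ℓ ^ 3) m)) (cong (_* m) (sym (^-distribˡ-+-* ℓ 6 3))))))
    T≤ : T-total ≤ ℓ ^ (80 * suc r) * (d * C)
    T≤ = begin
      T-total                                           ≤⟨ ord≤ TO ⟩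
      ℓ ^ 55 * (q * q ^ r)                              ≤⟨ *-monoʳ-≤ (ℓ ^ 55) (*-mono-≤ (ord≤ q-dO) (^-monoˡ-≤ r q≤ℓ^9m)) ⟩
      ℓ ^ 55 * (ℓ ^ 6 * d * (ℓ ^ 9 * m) ^ r)            ≡⟨ cong (λ t → ℓ ^ 55 * (ℓ ^ 6 * d * t)) (^-distrib-* (ℓ ^ 9) m r) ⟩
      ℓ ^ 55 * (ℓ ^ 6 * d * ((ℓ ^ 9) ^ r * m ^ r))      ≤⟨ *-monoʳ-≤ (ℓ ^ 55) (*-monoʳ-≤ (ℓ ^ 6 * d) (*-monoʳ-≤ ((ℓ ^ 9) ^ r) m^r≤C)) ⟩
      ℓ ^ 55 * (ℓ ^ 6 * d * ((ℓ ^ 9) ^ r * C))          ≡⟨ solve 5 (λ a b d x c → a :* (b :* d :* (x :* c)) := a :* b :* x :* (d :* c)) refl (ℓ ^ 55) (ℓ ^ 6) d ((ℓ ^ 9) ^ r) C ⟩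
      ℓ ^ 55 * ℓ ^ 6 * (ℓ ^ 9) ^ r * (d * C)            ≡⟨ cong (_* (d * C)) (trans (cong₂ _*_ (sym (^-distribˡ-+-* ℓ 55 6)) (^-*-assoc ℓ 9 r)) (sym (^-distribˡ-+-* ℓ 61 (9 * r)))) ⟩
      ℓ ^ (61 + 9 * r) * (d * C)                        ≤⟨ *-monoˡ-≤ (d * C) (ℓ^-mono (≤-trans (+-mono-≤ (m≤m+n 61 19) (*-monoˡ-≤ r (m≤m+n 9 71))) (≤-reflexive (sym (*-suc 80 r))))) ⟩
      ℓ ^ (80 * suc r) * (d * C)                        ∎
      where
      open ≤-Reasoning
      open +-*-Solver

  -- Since `ℓ * ℓ < r` and `I * ℓ ≤ 3 * r`, both the fixed powers of D and the factors `growth ^ I`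
  -- amount to 2 to a multiple of r, hence to a power of ℓ per required one. The tuples contribute
  -- `Q ^ r ≤ (ℓ ^ 9 * m) ^ r`. The exponents add up to `343 + 9 = 352`.
  sparse-bound : small ≡ 0 → dn ≡ 0 → T-total ^ M ≤ (d * C) ^ suc M
  sparse-bound large dn≡0 = finish T-total (ℓ ^ (352 * r)) (≤-trans T≤ (*-monoʳ-≤ (ℓ ^ (352 * r)) C≤dC))
    (≤-trans (polylog 352 r (m≤m+n 352 48)) (≤-trans (≤-trans (^-monoˡ-≤ r (wide (<⇒≤ r<2^))) m^r≤C) C≤dC))
    where
    open Sparse large dn≡0 using (S₁; S₂; growth; growth≤; jQ≤; ω≡ℓ; T-order)
    r<2^ : r < 2 ^ (10 * g)
    r<2^ = 1∸-zero (trans dn≡ dn≡0)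
    ℓℓ≤r : ℓ * ℓ ≤ r
    ℓℓ≤r = <⇒≤ (1∸-zero large)
    ℓ≤r : ℓ ≤ r
    ℓ≤r = ≤-trans (m≤m*n ℓ ℓ ⦃ >-nonZero (<⇒≤ 2≤ℓ) ⦄) ℓℓ≤r
    Iℓ≤ : I * ℓ ≤ 3 * r
    Iℓ≤ = begin
      I * ℓ                       ≡⟨ cong₂ (λ a b → (a * (d ÷ ω) + b * ((r + r) ÷ ω) + 1) * ℓ) dn≡0 (cong (1 ∸_) dn≡0) ⟩
      ((r + r) ÷ ω + 0 + 1) * ℓ   ≡⟨ cong (λ t → ((r + r) ÷ t + 0 + 1) * ℓ) ω≡ℓ ⟩
      ((r + r) ÷ ℓ + 0 + 1) * ℓ   ≡⟨ solve 2 (λ y l → (y :+ con 0 :+ con 1) :* l := y :* l :+ l) refl ((r + r) ÷ ℓ) ℓ ⟩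
      (r + r) ÷ ℓ * ℓ + ℓ         ≤⟨ +-mono-≤ (÷*-≤ (r + r) ℓ) ℓ≤r ⟩
      (r + r) + r                 ≡⟨ solve 1 (λ r → r :+ r :+ r := con 3 :* r) refl r ⟩
      3 * r                       ∎
      where
      open ≤-Reasoning
      open +-*-Solver
    ωO : Order 1 (ω + 1) 2
    ωO = _⊕_ 1≤1 (below (≤-reflexive ω≡ℓ) ℓO) one-order
    1≤m : 1 ≤ m
    1≤m = <⇒≤ 2≤m
    s/rO : Order m (s ÷ r + 1) 1
    s/rO = _⊕_ 1≤m (below (÷-≥ 0<r (≤-trans (÷*-≤ s r) s≤d)) self) (below 1≤m self)
    QO : Order m Q 9
    QO = below (<⇒≤ (subst (λ t → 2 ^ t < 2 * x) jQ≡ (2^lg< x (<-trans (s≤s z≤n) 0<x)))) (num 1 ⊛ subst (λ t → Order m t 8) x≡ (_⊕_ 1≤m (num 2 ⊛ ((ωO ⊛ ωO) ⊛ s/rO)) (free 1≤m one-order)))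
    powers : D ^ 183 * (S₁ * growth ^ I) ≤ ℓ ^ (343 * r)
    powers = begin
      D ^ 183 * (S₁ * growth ^ I)                            ≤⟨ *-monoʳ-≤ (D ^ 183) (*-mono-≤ (^-monoʳ-≤ 2 (≤-trans (≤-reflexive (cong (_* jQ) ω≡ℓ)) (*-monoʳ-≤ ℓ jQ≤))) (^-monoˡ-≤ I growth≤)) ⟩
      D ^ 183 * (2 ^ (ℓ * (ℓ * 10)) * (D ^ 50) ^ I)          ≡⟨ cong₂ (λ a b → a * (2 ^ (ℓ * (ℓ * 10)) * b)) (D^≡ 183) (trans (cong (_^ I) (D^≡ 50)) (^-*-assoc 2 (ℓ * 50) I)) ⟩
      2 ^ (ℓ * 183) * (2 ^ (ℓ * (ℓ * 10)) * 2 ^ (ℓ * 50 * I)) ≡⟨ trans (cong (2 ^ (ℓ * 183) *_) (sym (^-distribˡ-+-* 2 (ℓ * (ℓ * 10)) (ℓ * 50 * I)))) (sym (^-distribˡ-+-* 2 (ℓ * 183) _)) ⟩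
      2 ^ (ℓ * 183 + (ℓ * (ℓ * 10) + ℓ * 50 * I))            ≤⟨ ^-monoʳ-≤ 2 (+-mono-≤ (*-monoˡ-≤ 183 ℓ≤r) (+-mono-≤ (≤-trans (≤-reflexive (sym (*-assoc ℓ ℓ 10))) (*-monoˡ-≤ 10 ℓℓ≤r))
                                                                  (≤-trans (≤-reflexive (solve 3 (λ l c i → l :* c :* i := i :* l :* c) refl ℓ 50 I)) (*-monoˡ-≤ 50 Iℓ≤)))) ⟩
      2 ^ (r * 183 + (r * 10 + 3 * r * 50))                  ≡⟨ cong (2 ^_) (solve 1 (λ r → r :* con 183 :+ (r :* con 10 :+ con 3 :* r :* con 50) := con 343 :* r) refl r) ⟩
      2 ^ (343 * r)                                          ≤⟨ 2^≤ℓ^ (343 * r) ⟩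
      ℓ ^ (343 * r)                                          ∎
      where
      open ≤-Reasoning
      open +-*-Solver
    T≤ : T-total ≤ ℓ ^ (352 * r) * C
    T≤ = begin
      T-total                                           ≤⟨ Powers.ord≤ T-order ⟩
      D ^ 183 * (S₁ * (growth ^ I * 2 ^ (r * jQ)))      ≡⟨ solve 4 (λ a b c e → a :* (b :* (c :* e)) := a :* (b :* c) :* e) refl (D ^ 183) S₁ (growth ^ I) (2 ^ (r * jQ)) ⟩
      D ^ 183 * (S₁ * growth ^ I) * 2 ^ (r * jQ)        ≤⟨ *-mono-≤ powers (≤-reflexive (trans (cong (2 ^_) (*-comm r jQ)) (sym (^-*-assoc 2 jQ r)))) ⟩
      ℓ ^ (343 * r) * Q ^ r                             ≤⟨ *-monoʳ-≤ (ℓ ^ (343 * r)) (≤-trans (^-monoˡ-≤ r (ord≤ QO)) (≤-reflexive (^-distrib-* (ℓ ^ 9) m r))) ⟩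
      ℓ ^ (343 * r) * ((ℓ ^ 9) ^ r * m ^ r)             ≤⟨ *-monoʳ-≤ (ℓ ^ (343 * r)) (*-monoʳ-≤ ((ℓ ^ 9) ^ r) m^r≤C) ⟩
      ℓ ^ (343 * r) * ((ℓ ^ 9) ^ r * C)                 ≡⟨ *-assoc (ℓ ^ (343 * r)) ((ℓ ^ 9) ^ r) C ⟨
      ℓ ^ (343 * r) * (ℓ ^ 9) ^ r * C                   ≡⟨ cong (_* C) (trans (cong (ℓ ^ (343 * r) *_) (^-*-assoc ℓ 9 r)) (trans (sym (^-distribˡ-+-* ℓ (343 * r) (9 * r))) (cong (ℓ ^_) (sym (*-distribʳ-+ r 343 9))))) ⟩
      ℓ ^ (352 * r) * C                                 ∎
      where
      open ≤-Reasoning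
      open +-*-Solver

  -- The excess is `2 ^ e` with `e` of order `ℓ + Q + ℓ * I + ω`, a power of ℓ times `2 ^ (9 * g)`.
  -- One spare factor `2 ^ g` absorbs that power and `M`, so `e * M ≤ r`, and `2 ^ r ≤ m ^ r ≤ C`.
  dense-bound : small ≡ 0 → dn ≡ 1 → T-total ^ M ≤ (d * C) ^ suc M
  dense-bound large dn≡1 = finish T-total (2 ^ e) (≤-trans T≤ (*-monoʳ-≤ (2 ^ e) C≤dC))
    (≤-trans (≤-reflexive (^-*-assoc 2 e M)) (≤-trans (^-monoʳ-≤ 2 eM≤r) (≤-trans (≤-trans (^-monoˡ-≤ r 2≤m) m^r≤C) C≤dC)))
    where
    open Dense large dn≡1 using (S₁; S₂; growth; growth≤; ω≡2^; T-order)
    2^≤r : 2 ^ (10 * g) ≤ r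
    2^≤r = 1∸-one (trans dn≡ dn≡1)
    W Z e : ℕ
    W = 2 ^ (9 * g)
    Z = 2 ^ (2 * g)
    e = ℓ * 183 + ((Q + (Q + (Q + Q))) + (ℓ * 50 * I + ω))
    1≤ω : 1 ≤ ω
    1≤ω = ≤-trans (m^n>0 2 (3 * g)) (≤-reflexive (sym ω≡2^))
    1≤W : 1 ≤ W
    1≤W = m^n>0 2 (9 * g)
    -- Rounding in `g` loses at most `2 ^ 12`, which `ℓ ^ 12` absorbs.
    D≤ : ∀ a b → a + b ≡ 12 * g → D ≤ ℓ ^ 12 * 2 ^ a * 2 ^ b
    D≤ a b eq = begin
      2 ^ ℓ                      ≤⟨ ^-monoʳ-≤ 2 ℓ≤12g+12 ⟩
      2 ^ (12 * g + 12)          ≡⟨ ^-distribˡ-+-* 2 (12 * g) 12 ⟩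
      2 ^ (12 * g) * 2 ^ 12      ≤⟨ *-monoʳ-≤ (2 ^ (12 * g)) (2^≤ℓ^ 12) ⟩
      2 ^ (12 * g) * ℓ ^ 12      ≡⟨ *-comm (2 ^ (12 * g)) (ℓ ^ 12) ⟩
      ℓ ^ 12 * 2 ^ (12 * g)      ≡⟨ cong (ℓ ^ 12 *_) (trans (cong (2 ^_) (sym eq)) (^-distribˡ-+-* 2 a b)) ⟩
      ℓ ^ 12 * (2 ^ a * 2 ^ b)   ≡⟨ *-assoc (ℓ ^ 12) (2 ^ a) (2 ^ b) ⟨
      ℓ ^ 12 * 2 ^ a * 2 ^ b     ∎
      where open ≤-Reasoning
    s/rO : Order Z (s ÷ r) 12
    s/rO = ord (÷-bound 0<r (≤-trans (≤-trans s≤d (≤-trans d≤D (D≤ (2 * g) (10 * g) (sym (*-distribʳ-+ g 2 10))))) (*-monoʳ-≤ (ℓ ^ 12 * Z) 2^≤r)))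
    d/ωO : Order W (d ÷ ω) 12
    d/ωO = ord (÷-bound 1≤ω (≤-trans d≤D (≤-trans (D≤ (9 * g) (3 * g) (sym (*-distribʳ-+ g 9 3))) (*-monoʳ-≤ (ℓ ^ 12 * W) (≤-reflexive (sym ω≡2^))))))
    ωO : Order ω (ω + 1) 1
    ωO = _⊕_ 1≤ω (self {ω}) (below 1≤ω (self {ω}))
    1≤ωωZ : 1 ≤ ω * ω * Z
    1≤ωωZ = *-mono-≤ (*-mono-≤ 1≤ω 1≤ω) (m^n>0 2 (2 * g))
    QO′ : Order (ω * ω * Z) Q 19
    QO′ = below (<⇒≤ (subst (λ t → 2 ^ t < 2 * x) jQ≡ (2^lg< x (<-trans (s≤s z≤n) 0<x)))) (num 1 ⊛ subst (λ t → Order (ω * ω * Z) t 18) x≡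
      (_⊕_ 1≤ωωZ (num 2 ⊛ times (times ωO ωO) (_⊕_ (m^n>0 2 (2 * g)) s/rO (free (m^n>0 2 (2 * g)) one-order))) (free 1≤ωωZ one-order)))
    ωωZ≤W : ω * ω * Z ≤ W
    ωωZ≤W = ≤-trans (≤-reflexive (trans (cong (λ t → t * t * Z) ω≡2^) (trans (cong (_* Z) (sym (^-distribˡ-+-* 2 (3 * g) (3 * g)))) (sym (^-distribˡ-+-* 2 (3 * g + 3 * g) (2 * g))))))
      (^-monoʳ-≤ 2 (≤-trans (≤-reflexive (solve 1 (λ g → con 3 :* g :+ con 3 :* g :+ con 2 :* g := con 8 :* g) refl g)) (*-monoˡ-≤ g (n≤1+n 8))))
      where open +-*-Solver
    QO : Order W Q 19
    QO = ord (≤-trans (ord≤ QO′) (*-monoʳ-≤ (ℓ ^ 19) ωωZ≤W))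
    ωWO : Order W ω 0
    ωWO = below (≤-trans (≤-reflexive ω≡2^) (^-monoʳ-≤ 2 (*-monoˡ-≤ g (m≤m+n 3 6)))) self
    IO : Order W I 13
    IO = subst (λ t → Order W t 13) (sym I≡) (_⊕_ 1≤W d/ωO (free 1≤W one-order))
      where
      I≡ : I ≡ d ÷ ω + 1
      I≡ = trans (cong₂ (λ a b → a * (d ÷ ω) + b * ((r + r) ÷ ω) + 1) dn≡1 (cong (1 ∸_) dn≡1)) (cong (_+ 1) (trans (+-identityʳ _) (*-identityˡ _)))
    constant : ∀ c t → {_ : T (c ≤ᵇ 2 ^ t)} → Order 1 c t
    constant c t {h} = below (≤ᵇ⇒≤ c (2 ^ t) h) (num t)
    eO : Order W e 30
    eO = up 1≤W (_⊕_ 1≤W (free 1≤W (ℓO ⊛ constant 183 8)) (_⊕_ 1≤W (_⊕_ 1≤W QO (_⊕_ 1≤W QO (_⊕_ 1≤W QO QO))) (_⊕_ 1≤W ((ℓO ⊛ constant 50 6) ⊛ IO) ωWO)))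
    eM≤r : e * M ≤ r
    eM≤r = begin
      e * M                    ≤⟨ *-mono-≤ (ord≤ eO) (≤-trans (<⇒≤ (n<2^n M)) (2^≤ℓ^ M)) ⟩
      ℓ ^ 30 * W * ℓ ^ M       ≡⟨ solve 3 (λ a w b → a :* w :* b := (a :* b) :* w) refl (ℓ ^ 30) W (ℓ ^ M) ⟩
      ℓ ^ 30 * ℓ ^ M * W       ≡⟨ cong (_* W) (sym (^-distribˡ-+-* ℓ 30 M)) ⟩
      ℓ ^ (30 + M) * W         ≤⟨ *-monoˡ-≤ W (≤-trans (ℓ^-mono (≤-trans (+-monoˡ-≤ M (m≤m*n 30 M ⦃ >-nonZero 1≤M ⦄)) (≤-trans (≤-reflexive (+-comm (30 * M) M)) (*-monoˡ-≤ M (m≤m+n 31 369))))) ℓ^≤) ⟩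
      2 ^ g * 2 ^ (9 * g)      ≡⟨ ^-distribˡ-+-* 2 g (9 * g) ⟨
      2 ^ (10 * g)             ≤⟨ 2^≤r ⟩
      r                        ∎
      where
      open ≤-Reasoning
      open +-*-Solver
    merge : ∀ a b → 2 ^ a * 2 ^ b ≡ 2 ^ (a + b)
    merge a b = sym (^-distribˡ-+-* 2 a b)
    T≤ : T-total ≤ 2 ^ e * C
    T≤ = begin
      T-total                                                ≤⟨ Powers.ord≤ T-order ⟩
      D ^ 183 * (S₁ * (growth ^ I * (2 ^ ω * C)))            ≤⟨ *-monoʳ-≤ (D ^ 183) (*-monoʳ-≤ S₁ (*-monoˡ-≤ (2 ^ ω * C) (^-monoˡ-≤ I growth≤))) ⟩
      D ^ 183 * (S₁ * ((D ^ 50) ^ I * (2 ^ ω * C)))          ≡⟨ solve 5 (λ a b c w x → a :* (b :* (c :* (w :* x))) := a :* (b :* (c :* w)) :* x) refl (D ^ 183) S₁ ((D ^ 50) ^ I) (2 ^ ω) C ⟩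
      D ^ 183 * (S₁ * ((D ^ 50) ^ I * 2 ^ ω)) * C            ≡⟨ cong (_* C) (cong₂ _*_ (D^≡ 183) (cong₂ _*_ four (cong (_* 2 ^ ω) (trans (cong (_^ I) (D^≡ 50)) (^-*-assoc 2 (ℓ * 50) I))))) ⟩
      2 ^ (ℓ * 183) * (2 ^ (Q + (Q + (Q + Q))) * (2 ^ (ℓ * 50 * I) * 2 ^ ω)) * C
        ≡⟨ cong (_* C) (trans (cong (2 ^ (ℓ * 183) *_) (trans (cong (2 ^ (Q + (Q + (Q + Q))) *_) (merge (ℓ * 50 * I) ω)) (merge (Q + (Q + (Q + Q))) _))) (merge (ℓ * 183) _)) ⟩
      2 ^ e * C                                              ∎
      where
      open ≤-Reasoning
      open +-*-Solver
      four : S₁ ≡ 2 ^ (Q + (Q + (Q + Q)))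
      four = trans (cong (2 ^ Q *_) (trans (cong (2 ^ Q *_) (merge Q Q)) (merge Q (Q + Q)))) (merge Q (Q + (Q + Q)))

  bound : T-total ^ M ≤ (d * C) ^ suc M
  bound = [ (λ large → [ sparse-bound large , dense-bound large ]′ (dn-cases 0<r r<s)) , small-bound ]′ (small-cases 0<r r<s)

-- Comparison with real powers given by cuts.

open ℚ using (ℚ; mkℚ; 0ℚ; 1ℚ; ↥_; ↧ₙ_)
open ℤ using (+_; -[1+_])

module Exponents = Algebra.Properties.CommutativeSemiring.Exp (CommutativeRing.commutativeSemiring ℚₚ.+-*-commutativeRing)

ι : ℕ → ℚ
ι n = (+ n) ℚ./ 1

ι≡ : ∀ n → ι n ≡ mkℚ (+ n) 0 (Data.Nat.Coprimality.sym (Data.Nat.Coprimality.1-coprimeTo n))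
ι≡ n = ℚₚ.fromℚᵘ-toℚᵘ (mkℚ (+ n) 0 (Data.Nat.Coprimality.sym (Data.Nat.Coprimality.1-coprimeTo n)))

ι-< : ∀ {m num den} .{c : Data.Nat.Coprimality.Coprime num (suc den)} → m * suc den < num → ι m ℚ.< mkℚ (+ num) den c
ι-< {m} {num} {den} {c} lt = subst (ℚ._< mkℚ (+ num) den c) (sym (ι≡ m))
  (ℚ.*<* (subst₂ ℤ._<_ (ℤₚ.pos-* m (suc den)) (sym (ℤₚ.*-identityʳ (+ num))) (ℤ.+<+ lt)))

<-ι : ∀ {m num den} .{c : Data.Nat.Coprimality.Coprime num (suc den)} → num < m * suc den → mkℚ (+ num) den c ℚ.< ι m
<-ι {m} {num} {den} {c} lt = subst (mkℚ (+ num) den c ℚ.<_) (sym (ι≡ m))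
  (ℚ.*<* (subst₂ ℤ._<_ (sym (ℤₚ.*-identityʳ (+ num))) (ℤₚ.pos-* m (suc den)) (ℤ.+<+ lt)))

ι-mono-< : ∀ {m n} → m < n → ι m ℚ.< ι n
ι-mono-< {m} {n} lt = subst (ι m ℚ.<_) (sym (ι≡ n)) (ι-< {m} (subst (_< n) (sym (*-identityʳ m)) lt))

ι-mono-≤ : ∀ {m n} → m ≤ n → ι m ℚ.≤ ι n
ι-mono-≤ {m} {n} le = ℚₚ.≮⇒≥ λ lt → <⇒≱ (back lt) le
  where
  back : ι n ℚ.< ι m → n < m
  back lt with ℚₚ.drop-*<* (subst₂ ℚ._<_ (ι≡ n) (ι≡ m) lt)
  ... | lt′ = ℤₚ.drop‿+<+ (subst₂ ℤ._<_ (ℤₚ.*-identityʳ (+ n)) (ℤₚ.*-identityʳ (+ m)) lt′)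

ι-* : ∀ m n → ι (m * n) ≡ ι m ℚ.* ι n
ι-* m n = trans (cong (ℚ._/ 1) (ℤₚ.pos-* m n)) (sym (cong₂ ℚ._*_ (ι≡ m) (ι≡ n)))

ι-^ : ∀ m k → ι (m ^ k) ≡ ι m ^ⁿ k
ι-^ m zero    = refl
ι-^ m (suc k) = trans (ι-* m (m ^ k)) (cong (ι m ℚ.*_) (ι-^ m k))

0≤ι : ∀ n → 0ℚ ℚ.≤ ι n
0≤ι n = ι-mono-≤ {0} {n} z≤n

mul-≤ : ∀ {a b c e} → 0ℚ ℚ.≤ b → 0ℚ ℚ.≤ c → a ℚ.≤ b → c ℚ.≤ e → a ℚ.* c ℚ.≤ b ℚ.* e
mul-≤ {a} {b} {c} {e} 0≤b 0≤c a≤b c≤e = ℚₚ.≤-trans (ℚₚ.*-monoʳ-≤-nonNeg c ⦃ ℚ.nonNegative 0≤c ⦄ a≤b) (ℚₚ.*-monoˡ-≤-nonNeg b ⦃ ℚ.nonNegative 0≤b ⦄ c≤e)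

mul-< : ∀ {a b c e} → 0ℚ ℚ.≤ a → 0ℚ ℚ.< e → a ℚ.< b → c ℚ.≤ e → a ℚ.* c ℚ.< b ℚ.* e
mul-< {a} {b} {c} {e} 0≤a 0<e a<b c≤e = ℚₚ.≤-<-trans (ℚₚ.*-monoˡ-≤-nonNeg a ⦃ ℚ.nonNegative 0≤a ⦄ c≤e) (ℚₚ.*-monoˡ-<-pos e ⦃ ℚ.positive 0<e ⦄ a<b)

pow-0≤ : ∀ {x} n → 0ℚ ℚ.≤ x → 0ℚ ℚ.≤ x ^ⁿ n
pow-0≤ zero    _   = 0≤ι 1
pow-0≤ {x} (suc n) 0≤x = ℚₚ.≤-trans (ℚₚ.≤-reflexive (sym (ℚₚ.*-zeroʳ x))) (ℚₚ.*-monoˡ-≤-nonNeg x ⦃ ℚ.nonNegative 0≤x ⦄ (pow-0≤ n 0≤x))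

pow-0< : ∀ {x} n → 0ℚ ℚ.< x → 0ℚ ℚ.< x ^ⁿ n
pow-0< zero    _   = ι-mono-< {0} {1} (s≤s z≤n)
pow-0< {x} (suc n) 0<x = ℚₚ.≤-<-trans (ℚₚ.≤-reflexive (sym (ℚₚ.*-zeroʳ x))) (ℚₚ.*-monoʳ-<-pos x ⦃ ℚ.positive 0<x ⦄ (pow-0< n 0<x))

pow-≤ : ∀ {x y} n → 0ℚ ℚ.≤ x → x ℚ.≤ y → x ^ⁿ n ℚ.≤ y ^ⁿ n
pow-≤ zero    0≤x x≤y = ℚₚ.≤-refl
pow-≤ (suc n) 0≤x x≤y = mul-≤ (ℚₚ.≤-trans 0≤x x≤y) (pow-0≤ n 0≤x) x≤y (pow-≤ n 0≤x x≤y)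

pow-< : ∀ {x y} n → 0 < n → 0ℚ ℚ.≤ x → x ℚ.< y → x ^ⁿ n ℚ.< y ^ⁿ n
pow-< (suc n) _ 0≤x x<y = mul-< 0≤x (pow-0< n (ℚₚ.≤-<-trans 0≤x x<y)) x<y (pow-≤ n 0≤x (ℚₚ.<⇒≤ x<y))

-- From `A / L < u` and `u ^ a < q ^ b`, the claim is compared after raising to the power `b * t`.
-- The free factor `t` lets the inequality between naturals be supplied for a fraction that is not
-- in lowest terms.
root : ∀ {A L U} a b t {u q} → 0 < L → 0ℚ ℚ.< u → 0ℚ ℚ.< q → ι A ℚ.< u ℚ.* ι L → u ^ⁿ a ℚ.< q ^ⁿ b → 0 < t →
  U ^ (b * t) * L ^ (a * t) ≤ A ^ (a * t) → ι U ℚ.< q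
root {A} {L} {U} a b t {u} {q} 0<L 0<u 0<q A< u^a< 0<t nat = ℚₚ.≰⇒> λ q≤U → ℚₚ.<-irrefl refl (begin-strict
  ι A ^ⁿ (a * t)                       ≤⟨ pow-≤ (a * t) (0≤ι A) (ℚₚ.<⇒≤ A<) ⟩
  (u ℚ.* ι L) ^ⁿ (a * t)               ≡⟨ Exponents.^-distrib-* u (ι L) (a * t) ⟩
  u ^ⁿ (a * t) ℚ.* ι L ^ⁿ (a * t)      ≡⟨ cong (ℚ._* ι L ^ⁿ (a * t)) (sym (Exponents.^-assocʳ u a t)) ⟩
  (u ^ⁿ a) ^ⁿ t ℚ.* ι L ^ⁿ (a * t)     <⟨ ℚₚ.*-monoˡ-<-pos (ι L ^ⁿ (a * t)) ⦃ ℚ.positive (pow-0< (a * t) (ι-mono-< {0} {L} 0<L)) ⦄ (pow-< t 0<t (pow-0≤ a (ℚₚ.<⇒≤ 0<u)) u^a<) ⟩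
  (q ^ⁿ b) ^ⁿ t ℚ.* ι L ^ⁿ (a * t)     ≡⟨ cong (ℚ._* ι L ^ⁿ (a * t)) (Exponents.^-assocʳ q b t) ⟩
  q ^ⁿ (b * t) ℚ.* ι L ^ⁿ (a * t)      ≤⟨ ℚₚ.*-monoʳ-≤-nonNeg (ι L ^ⁿ (a * t)) ⦃ ℚ.nonNegative (pow-0≤ (a * t) (0≤ι L)) ⦄ (pow-≤ (b * t) (ℚₚ.<⇒≤ 0<q) q≤U) ⟩
  ι U ^ⁿ (b * t) ℚ.* ι L ^ⁿ (a * t)    ≡⟨ cong₂ ℚ._*_ (sym (ι-^ U (b * t))) (sym (ι-^ L (a * t))) ⟩
  ι (U ^ (b * t)) ℚ.* ι (L ^ (a * t))  ≡⟨ ι-* (U ^ (b * t)) (L ^ (a * t)) ⟨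
  ι (U ^ (b * t) * L ^ (a * t))        ≤⟨ ι-mono-≤ {U ^ (b * t) * L ^ (a * t)} {A ^ (a * t)} nat ⟩
  ι (A ^ (a * t))                      ≡⟨ ι-^ A (a * t) ⟩
  ι A ^ⁿ (a * t)                       ∎)
  where open ℚₚ.≤-Reasoning

2^-cancel-< : ∀ {a b} → 2 ^ a < 2 ^ b → a < b
2^-cancel-< lt = ≰⇒> λ le → <⇒≱ lt (^-monoʳ-≤ 2 le)

log₂-lower : ∀ {m L l} → m ≤ 2 ^ L → lower (log₂ m) l → l ℚ.< ι L
log₂-lower {l = mkℚ -[1+ n ] den c} m≤ (ℚ.*<* () , _)
log₂-lower {m} {L} {mkℚ (+ num) den c} m≤ (_ , lt) = <-ι {L} (2^-cancel-< (<-≤-trans lt (≤-trans (^-monoˡ-≤ (suc den) m≤) (≤-reflexive (^-*-assoc 2 L (suc den))))))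

log₂-upper : ∀ {m κ v} → 2 ^ κ < m → upper (log₂ m) v → ι κ ℚ.< v
log₂-upper {v = mkℚ -[1+ n ] den c} 2^< (ℚ.*<* () , _)
log₂-upper {m} {κ} {mkℚ (+ num) den c} 2^< (_ , lt) = ι-< {κ} (2^-cancel-< (≤-<-trans (≤-trans (≤-reflexive (sym (^-*-assoc 2 κ (suc den)))) (^-monoˡ-≤ (suc den) (<⇒≤ 2^<))) lt))

N-upper : ∀ {r s L u} → (r + s) choose r ≤ 2 ^ L → upper (Defs.N r s) u → 0ℚ ℚ.< u × ι ((r + s) * ((r + s) choose r)) ℚ.< u ℚ.* ι L
N-upper {r} {s} {L} {u} C≤ (0<u , v , w , (0<v , A<v) , (0<w , l , low , 1<wl) , vw<u) = 0<u , (begin-strict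
  ι ((r + s) * ((r + s) choose r)) <⟨ A<v ⟩
  v                           ≡⟨ ℚₚ.*-identityʳ v ⟨
  v ℚ.* 1ℚ                    <⟨ ℚₚ.*-monoʳ-<-pos v ⦃ ℚ.positive 0<v ⦄ 1<wl ⟩
  v ℚ.* (w ℚ.* l)             ≡⟨ ℚₚ.*-assoc v w l ⟨
  v ℚ.* w ℚ.* l               <⟨ ℚₚ.*-monoˡ-<-pos l ⦃ ℚ.positive (proj₁ low) ⦄ vw<u ⟩
  u ℚ.* l                     <⟨ ℚₚ.*-monoʳ-<-pos u ⦃ ℚ.positive 0<u ⦄ (log₂-lower {(r + s) choose r} {L} {l} C≤ low) ⟩
  u ℚ.* ι L                   ∎)
  where open ℚₚ.≤-Reasoning

^ʳ-upper : ∀ {x q} e {a} → ↥ e ≡ + a → upper (x ^ʳ e) q → 0ℚ ℚ.< q × ∃ λ u → upper x u × u ^ⁿ a ℚ.< q ^ⁿ (↧ₙ e)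
^ʳ-upper e eq h with ↥ e | eq
... | + a | refl = h

-- The rational exponent is stored in lowest terms, so its numerator and denominator are accessible
-- only through the cross-multiplied equation.
exponent : ∀ x y → ∃ λ a → ↥ (1ℚ ℚ.+ (+ x) ℚ./ suc y) ≡ + a × a * suc y ≡ (suc y + x) * ↧ₙ (1ℚ ℚ.+ (+ x) ℚ./ suc y)
exponent x y = result (1ℚ ℚ.+ (+ x) ℚ./ suc y) same
  where
  same : ℚ.toℚᵘ (1ℚ ℚ.+ (+ x) ℚ./ suc y) ℚᵘ.≃ ℚᵘ.mkℚᵘ (+ (suc y + x)) y
  same = ℚᵘₚ.≃-trans (ℚₚ.toℚᵘ-homo-+ 1ℚ ((+ x) ℚ./ suc y)) (ℚᵘₚ.≃-trans (ℚᵘₚ.+-congʳ ℚᵘ.1ℚᵘ (ℚₚ.toℚᵘ-fromℚᵘ (ℚᵘ.mkℚᵘ (+ x) y)))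
    (ℚᵘ.*≡* (cong₂ ℤ._*_ (cong₂ ℤ._+_ (ℤₚ.*-identityˡ (+ suc y)) (ℤₚ.*-identityʳ (+ x))) (cong +_ (sym (+-identityʳ (suc y)))))))
  result : ∀ z → ℚ.toℚᵘ z ℚᵘ.≃ ℚᵘ.mkℚᵘ (+ (suc y + x)) y → ∃ λ a → ↥ z ≡ + a × a * suc y ≡ (suc y + x) * ↧ₙ z
  result (mkℚ (+ a) den c) (ℚᵘ.*≡* eq) = a , refl , ℤₚ.+-injective (trans (ℤₚ.pos-* a (suc y)) (trans eq (sym (ℤₚ.pos-* (suc y + x) (suc den)))))
  result (mkℚ -[1+ n ] den c) (ℚᵘ.*≡* ())

N^-upper : ∀ {r s L U q} x y → (r + s) choose r ≤ 2 ^ L → 0 < L →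
  (∀ a b → a * suc y ≡ (suc y + x) * b → ∃ λ t → 0 < t × U ^ (b * t) * L ^ (a * t) ≤ ((r + s) * ((r + s) choose r)) ^ (a * t)) →
  upper (Defs.N r s ^ʳ (1ℚ ℚ.+ (+ x) ℚ./ suc y)) q → ι U ℚ.< q
N^-upper {r} {s} {L} {U} {q} x y C≤ 0<L nat h with exponent x y
... | a , ↥≡ , ratio with ^ʳ-upper {Defs.N r s} {q} (1ℚ ℚ.+ (+ x) ℚ./ suc y) ↥≡ h | nat a _ ratio
... | 0<q , u , up , u^a< | t , 0<t , le with N-upper {r} {s} {L} C≤ up
... | 0<u , A< = root {(r + s) * ((r + s) choose r)} {L} {U} a (↧ₙ (1ℚ ℚ.+ (+ x) ℚ./ suc y)) t 0<L 0<u 0<q A< u^a< 0<t le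

product-upper : ∀ {X : ℝ≥0} {n U κ a} → (∀ q → upper X q → ι U ℚ.< q) → 2 ^ κ < n → a ≤ U * κ → fromℕ a ≤ʳ X *ʳ log₂ n
product-upper {X} {n} {U} {κ} {a} U< 2^κ< a≤ z (0<z , q , v , up , upv , qv<z) = 0<z , (begin-strict
  ι a            ≤⟨ ι-mono-≤ {a} {U * κ} a≤ ⟩
  ι (U * κ)      ≡⟨ ι-* U κ ⟩
  ι U ℚ.* ι κ    ≤⟨ mul-≤ (ℚₚ.<⇒≤ 0<q) (0≤ι κ) (ℚₚ.<⇒≤ (U< q up)) (ℚₚ.<⇒≤ (log₂-upper {n} {κ} 2^κ< upv)) ⟩
  q ℚ.* v        <⟨ qv<z ⟩
  z              ∎)
  where
  open ℚₚ.≤-Reasoning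
  0<q : 0ℚ ℚ.< q
  0<q = ℚₚ.≤-<-trans (0≤ι U) (U< q up)

fromℕ-*ʳ-upper : ∀ {X : ℝ≥0} {U} m → (∀ q → upper X q → ι U ℚ.< q) → ∀ z → upper (X *ʳ fromℕ m) z → ι (U * m) ℚ.< z
fromℕ-*ʳ-upper {X} {U} m U< z (0<z , q , v , up , (0<v , m<v) , qv<z) = begin-strict
  ι (U * m)      ≡⟨ ι-* U m ⟩
  ι U ℚ.* ι m    ≤⟨ mul-≤ (ℚₚ.<⇒≤ (ℚₚ.≤-<-trans (0≤ι U) (U< q up))) (0≤ι m) (ℚₚ.<⇒≤ (U< q up)) (ℚₚ.<⇒≤ m<v) ⟩
  q ℚ.* v        <⟨ qv<z ⟩
  z              ∎
  where open ℚₚ.≤-Reasoning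

fromℕ-1*ʳ-upper : ∀ {X : ℝ≥0} {U} → (∀ q → upper X q → ι U ℚ.< q) → ∀ z → upper (fromℕ 1 *ʳ X) z → ι U ℚ.< z
fromℕ-1*ʳ-upper {X} {U} U< z (0<z , v , q , (0<v , 1<v) , up , vq<z) = begin-strict
  ι U            ≡⟨ ℚₚ.*-identityˡ (ι U) ⟨
  1ℚ ℚ.* ι U     ≤⟨ mul-≤ (ℚₚ.<⇒≤ 0<v) (0≤ι U) (ℚₚ.<⇒≤ 1<v) (ℚₚ.<⇒≤ (U< q up)) ⟩
  v ℚ.* q        <⟨ vq<z ⟩
  z              ∎
  where open ℚₚ.≤-Reasoning

-- The error exponent.

lg-slow : ∀ c ℓ → 2 ^ (8 * c) ≤ ℓ → c * lg ℓ ≤ ℓ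
lg-slow c ℓ large = *-cancelˡ-≤ 2 (<⇒≤ (≤-<-trans (begin
    2 * (c * k)                   ≤⟨ *-monoʳ-≤ 2 (*-monoʳ-≤ c (<⇒≤ k<2[u+1])) ⟩
    2 * (c * (2 * suc u))         ≡⟨ solve 2 (λ c u → con 2 :* (c :* (con 2 :* u)) := con 4 :* c :* u) refl c (suc u) ⟩
    4 * c * suc u                 ≤⟨ *-mono-≤ 4c≤ (n<2^n u) ⟩
    2 ^ u * 2 ^ u                 ≡⟨ ^-distribˡ-+-* 2 u u ⟨
    2 ^ (u + u)                   ≤⟨ ^-monoʳ-≤ 2 (≤-trans (≤-reflexive (solve 1 (λ u → u :+ u := u :* con 2) refl u)) (÷*-≤ k 2)) ⟩
    2 ^ k                         ∎) (2^lg< ℓ (≤-trans (m^n>0 2 (8 * c)) large))))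
  where
  open ≤-Reasoning
  open +-*-Solver
  k u : ℕ
  k = lg ℓ
  -- Half of the logarithm: one factor `2 ^ u` absorbs `4 * c`, the other absorbs `suc u`, and
  -- `2 * suc u` bounds `k`.
  u = k ÷ 2
  k<2[u+1] : k < 2 * suc u
  k<2[u+1] = ≤-trans (s≤s (≤-reflexive (m≡m%n+[m/n]*n k 2))) (≤-trans (+-monoˡ-≤ _ (m%n<n k 2))
    (≤-reflexive (solve 1 (λ u → con 2 :+ u :* con 2 := con 2 :* (con 1 :+ u)) refl (k / 2))))
  8c≤k : 8 * c ≤ k
  8c≤k = ≮⇒≥ λ k< → <⇒≱ (^-monoʳ-< 2 (s≤s (s≤s z≤n)) k<) (≤-trans large (≤2^lg ℓ))
  4c≤ : 4 * c ≤ 2 ^ u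
  4c≤ = ≤-trans (÷-≥ (s≤s z≤n) (≤-trans (≤-reflexive (solve 1 (λ c → con 4 :* c :* con 2 := con 8 :* c) refl c)) 8c≤k)) (<⇒≤ (n<2^n u))

-- Chosen so that `400 * M * lg ℓ ≤ ℓ ÷ 12`, whence `ℓ ^ (400 * M) ≤ 2 ^ (ℓ ÷ 12)` for this `M`. It
-- grows like `lg d / lg (lg d)`, and its reciprocal is the error exponent.
level : ℕ → ℕ
level d = (lg d ÷ 12) ÷ (400 * lg (lg d))

-- Sealed, and proved for variables in place of 400 and 12, because the threshold is doubly
-- exponential and must never be evaluated.
abstract

  threshold : ℕ → ℕ → ℕ → ℕ
  threshold a b M = 2 ^ (2 ^ (8 * (M * (a * b))))

  level-grows : ∀ M → 0 < M → ∀ d → threshold 400 12 M ≤ d → M ≤ level d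
  level-grows M 0<M d = go 400 12 (s≤s z≤n) (s≤s z≤n)
    where
    go : ∀ a b → 0 < a → 0 < b → threshold a b M ≤ d → M ≤ (lg d ÷ b) ÷ (a * lg (lg d))
    go a b 0<a 0<b h = ÷-≥ (*-mono-≤ 0<a (lg-pos ℓ 1<ℓ)) (÷-≥ 0<b (≤-trans (≤-reflexive (solve 4 (λ M a k b → M :* (a :* k) :* b := M :* (a :* b) :* k) refl M a (lg ℓ) b))
        (lg-slow (M * (a * b)) ℓ big)))
      where
      open +-*-Solver
      ℓ : ℕ
      ℓ = lg d
      big : 2 ^ (8 * (M * (a * b))) ≤ ℓ
      big = ≮⇒≥ λ ℓ< → <⇒≱ (^-monoʳ-< 2 (s≤s (s≤s z≤n)) ℓ<) (≤-trans h (≤2^lg d))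
      1<ℓ : 1 < ℓ
      1<ℓ = ≤-trans (^-monoʳ-≤ 2 {1} (≤-trans (*-mono-≤ 0<M (*-mono-≤ 0<a 0<b)) (m≤n*m (M * (a * b)) 8))) big

cost weight : ℕ → ℕ → ℕ
cost r s = budget + (q * q) * (suc j * suc j)
  where open Family# (params r s)
weight r s = 460000 * cost r s

-- Summing over all r makes the bound depend on d alone, as an error term must.
rough : ℕ → ℕ
rough d = Σ< (λ r → weight r (d ∸ r)) d

-- At level 0, which occurs only for small d, the error is simply large enough to cover the whole
-- cost.
slack : ℕ → ℕ → ℚ
slack zero    d = (+ rough d) ℚ./ 1
slack (suc m) d = (+ 1) ℚ./ suc m

slack-tends : TendsToZero (λ d → slack (level d) d)
slack-tends (mkℚ -[1+ n ] den c) (ℚ.*<* ())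
slack-tends (mkℚ (+ zero) den c) (ℚ.*<* lt) = ⊥-elim (<-irrefl refl (drop+ lt))
  where
  drop+ : ∀ {m n} → (+ m) ℤ.< (+ n) → m < n
  drop+ (ℤ.+<+ h) = h
slack-tends (mkℚ (+ suc num) den c) 0<η = threshold 400 12 (2 + den) , λ d h → small (level d) d (level-grows (2 + den) (s≤s z≤n) d h)
  where
  open import Data.Rational.Unnormalised as ℚᵘ using (mkℚᵘ)
  import Data.Rational.Unnormalised.Properties as ℚᵘₚ
  small : ∀ M d → 2 + den ≤ M → ℚ.∣ slack M d ∣ ℚ.< mkℚ (+ suc num) den c
  small (suc m) d le = subst (ℚ._< mkℚ (+ suc num) den c) (sym (ℚₚ.0≤p⇒∣p∣≡p (ℚₚ.toℚᵘ-cancel-≤ (ℚᵘₚ.≤-trans (ℚᵘ.*≤* (ℤ.+≤+ z≤n)) (ℚᵘₚ.≤-reflexive (ℚᵘₚ.≃-sym (ℚₚ.toℚᵘ-fromℚᵘ (mkℚᵘ (+ 1) m))))))))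
    (ℚₚ.toℚᵘ-cancel-< (ℚᵘₚ.<-respˡ-≃ (ℚᵘₚ.≃-sym (ℚₚ.toℚᵘ-fromℚᵘ (mkℚᵘ (+ 1) m))) (ℚᵘ.*<* (ℤ.+<+ (≤-trans (s≤s (≤-reflexive (+-identityʳ (suc den)))) (≤-trans le (m≤m+n (suc m) (num * suc m))))))))

-- The bound `b` is the fuel for repeated halving.
≤2^⌈log₂⌉ : ∀ b x → x ≤ b → x ≤ 2 ^ ⌈log₂ x ⌉
≤2^⌈log₂⌉ b       zero          _  = z≤n
≤2^⌈log₂⌉ b       (suc zero)    _  = m^n>0 2 ⌈log₂ 1 ⌉
≤2^⌈log₂⌉ (suc b) x@(suc (suc y)) le = begin
  x                                 ≡⟨ ⌊n/2⌋+⌈n/2⌉≡n x ⟨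
  ⌊ x /2⌋ + ⌈ x /2⌉                 ≤⟨ +-mono-≤ (≤-trans (⌊n/2⌋≤⌈n/2⌉ x) half≤) (≤-trans half≤ (≤-reflexive (sym (+-identityʳ _)))) ⟩
  2 ^ suc (⌈log₂ x ⌉ ∸ 1)           ≡⟨ cong (2 ^_) (m+[n∸m]≡n (⌈log₂⌉-mono-≤ {2} {x} (s≤s (s≤s z≤n)))) ⟩
  2 ^ ⌈log₂ x ⌉                     ∎
  where
  open ≤-Reasoning
  half≤ : ⌈ x /2⌉ ≤ 2 ^ (⌈log₂ x ⌉ ∸ 1)
  half≤ = subst (λ e → ⌈ x /2⌉ ≤ 2 ^ e) (⌈log₂⌈n/2⌉⌉≡⌈log₂n⌉∸1 x) (≤2^⌈log₂⌉ b ⌈ x /2⌉ (≤-pred (≤-trans (⌈n/2⌉<n y) le)))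

-- The cost against powers of N.

module Bounds {r s : ℕ} (0<r : 0 < r) (r<s : r < s) where

  open Asymptotics (params r s) 0<r r<s using (T-total; Λ)

  U C A : ℕ
  U = weight r s
  C = (r + s) choose r
  A = (r + s) * C

  C≡ : C ≡ binom (r + s) r
  C≡ = C≡binom (r + s) r

  1≤ℓ : 1 ≤ lg (r + s)
  1≤ℓ = Family#.0<ℓ (params r s) 0<r r<s

  1≤Λ : 1 ≤ Λ
  1≤Λ = *-mono-≤ 0<r 1≤ℓ

  3≤d : 3 ≤ r + s
  3≤d = +-mono-≤ 0<r (≤-trans (s≤s 0<r) r<s)

  d≤C : r + s ≤ C
  d≤C = ≤-trans (positive r s 0<r (<-trans 0<r r<s)) (≤-reflexive (sym C≡))
    where
    positive : ∀ a z → 0 < a → 0 < z → a + z ≤ binom (a + z) a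
    positive (suc a) (suc z) _ _ = ≤binom a z

  1≤C : 1 ≤ C
  1≤C = ≤-trans (≤-trans (s≤s z≤n) 3≤d) d≤C

  C≤2^Λ : C ≤ 2 ^ Λ
  C≤2^Λ = ≤-trans (≤-reflexive C≡) (≤-trans (binom≤^ (r + s) r) (≤-trans (^-monoˡ-≤ r (≤2^lg (r + s)))
    (≤-reflexive (trans (^-*-assoc 2 (lg (r + s)) r) (cong (2 ^_) (*-comm (lg (r + s)) r))))))

  power : ∀ M → 1 ≤ M → M ≡ level (r + s) → (U * (Λ * Λ)) ^ M ≤ A ^ suc M
  power M 1≤M eq = subst₂ _≤_ (cong (_^ M) (sym (*-assoc 460000 (cost r s) (Λ * Λ)))) (cong (λ b → ((r + s) * b) ^ suc M) (sym C≡))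
    (Claim.bound (params r s) 0<r r<s M 1≤M (≤-trans 1≤M (≤-trans (≤-reflexive eq) (÷-≤ (lg (r + s) ÷ 12) (400 * lg (lg (r + s)))))) (exponents 400))
    where
    ℓ : ℕ
    ℓ = lg (r + s)
    level≤ : M * (400 * lg ℓ) ≤ ℓ ÷ 12
    level≤ = ≤-trans (≤-reflexive (cong (_* (400 * lg ℓ)) eq)) (÷*-≤ (ℓ ÷ 12) (400 * lg ℓ))
    exponents′ : ∀ a → M * (a * lg ℓ) ≤ ℓ ÷ 12 → ℓ ^ (a * M) ≤ 2 ^ (ℓ ÷ 12)
    exponents′ a h = ≤-trans (^-monoˡ-≤ (a * M) (≤2^lg ℓ)) (≤-trans (≤-reflexive (^-*-assoc 2 (lg ℓ) (a * M)))
      (^-monoʳ-≤ 2 (≤-trans (≤-reflexive (solve 3 (λ l a m → l :* (a :* m) := m :* (a :* l)) refl (lg ℓ) a M)) h)))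
      where open +-*-Solver
    exponents : ∀ a → ℓ ^ (400 * M) ≤ 2 ^ (ℓ ÷ 12)
    exponents _ = exponents′ 400 level≤

  d≡r+s∸r : s ≡ r + s ∸ r
  d≡r+s∸r = sym (m+n∸m≡n r s)

  U≤rough : U ≤ rough (r + s)
  U≤rough = ≤-trans (≤-reflexive (cong (weight r) d≡r+s∸r)) (Σ-term (λ a → weight a (r + s ∸ a)) (m<m+n r (<-trans 0<r r<s)))

  -- At level 0 the logarithm is bounded by `C` itself, so N is at least d, and d to the power
  -- `1 + rough d` exceeds the cost. At a positive level the exponent `1 + 1 / M` of the logarithm
  -- is at most 2, which explains the square of `Λ` in `power`.
  weight< : ∀ M → M ≡ level (r + s) → ∀ q → upper (Defs.N r s ^ʳ (1ℚ ℚ.+ slack M (r + s))) q → ι U ℚ.< q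
  weight< zero    _  q = N^-upper {r} {s} {C} {U} {q} (rough (r + s)) 0 (<⇒≤ (n<2^n C)) 1≤C λ a b ratio → 1 , s≤s z≤n , (begin
    U ^ (b * 1) * C ^ (a * 1)          ≤⟨ *-monoˡ-≤ (C ^ (a * 1)) (≤-trans (^-monoˡ-≤ (b * 1) U≤) (≤-reflexive (trans (^-*-assoc (r + s) (suc (rough (r + s))) (b * 1))
                                            (cong ((r + s) ^_) (trans (cong (suc (rough (r + s)) *_) (*-identityʳ b)) (sym ratio)))))) ⟩
    (r + s) ^ (a * 1) * C ^ (a * 1)    ≡⟨ ^-distrib-* (r + s) C (a * 1) ⟨
    A ^ (a * 1)                        ∎)
    where
    open ≤-Reasoning
    U≤ : U ≤ (r + s) ^ suc (rough (r + s))
    U≤ = ≤-trans U≤rough (≤-trans (<⇒≤ (n<2^n (rough (r + s)))) (≤-trans (^-monoˡ-≤ (rough (r + s)) (≤-trans (n≤1+n 2) 3≤d))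
      (^-monoʳ-≤ (r + s) ⦃ >-nonZero (≤-trans (s≤s z≤n) 3≤d) ⦄ (n≤1+n (rough (r + s))))))
  weight< (suc m) eq q = N^-upper {r} {s} {Λ} {U} {q} 1 m C≤2^Λ 1≤Λ λ a b ratio → suc m , s≤s z≤n , subst (λ e → U ^ (b * suc m) * Λ ^ e ≤ A ^ e) (sym ratio) (begin
    U ^ (b * M) * Λ ^ ((M + 1) * b)    ≤⟨ *-mono-≤ (≤-reflexive (cong (U ^_) (*-comm b M))) (≤-trans (^-monoʳ-≤ Λ ⦃ >-nonZero 1≤Λ ⦄ (≤-trans (*-monoˡ-≤ b (+-monoʳ-≤ M (s≤s (z≤n {m})))) (≤-reflexive (*-distribʳ-+ b M M))))
                                            (≤-reflexive (trans (^-distribˡ-+-* Λ (M * b) (M * b)) (sym (^-distrib-* Λ Λ (M * b)))))) ⟩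
    U ^ (M * b) * (Λ * Λ) ^ (M * b)    ≡⟨ trans (sym (^-distrib-* U (Λ * Λ) (M * b))) (sym (^-*-assoc (U * (Λ * Λ)) M b)) ⟩
    ((U * (Λ * Λ)) ^ M) ^ b            ≤⟨ ^-monoˡ-≤ b (power M (s≤s z≤n) eq) ⟩
    (A ^ suc M) ^ b                    ≡⟨ trans (^-*-assoc A (suc M) b) (cong (λ e → A ^ (e * b)) (+-comm 1 M)) ⟩
    A ^ ((M + 1) * b)                  ∎)
    where
    open ≤-Reasoning
    M : ℕ
    M = suc m

  -- Crude, through `1 + M ≤ 2 * M`, but it makes the cost polynomial in `C`, which the word length
  -- requires.
  weight≤A² : ∀ m → suc m ≡ level (r + s) → U ≤ A * A
  weight≤A² m eq = ≮⇒≥ λ lt → <⇒≱ (^-monoˡ-< (suc m) lt) (≤-trans (^-monoˡ-≤ (suc m) (m≤m*n U (Λ * Λ) ⦃ >-nonZero (*-mono-≤ 1≤Λ 1≤Λ) ⦄))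
    (≤-trans (power (suc m) (s≤s z≤n) eq) (≤-trans (^-monoʳ-≤ A ⦃ >-nonZero (*-mono-≤ (≤-trans (s≤s z≤n) 3≤d) 1≤C) ⦄ (s≤s (m≤n+m (suc m) m)))
      (≤-reflexive (trans (^-distribˡ-+-* A (suc m) (suc m)) (sym (^-distrib-* A A (suc m))))))))

-- The dependence on n.

module Estimates {r s : ℕ} (0<r : 0 < r) (r<s : r < s) (n : ℕ) (r<n : r < n) (s<n : s < n) where

  open Family# (params r s)
  open Core (params r s) 0<r r<s n r<n s<n

  -- `k` is the logarithm of n rounded up, so `κ` is a natural number below `log₂ n`; `3 ≤ n` gives
  -- `k ≤ 2 * κ`.
  T₀ κ B : ℕ
  T₀ = cost r s
  κ = pred k
  B = T₀ * (n * k)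

  3≤n : 3 ≤ n
  3≤n = ≤-trans (s≤s (≤-trans (s≤s 0<r) r<s)) s<n

  2≤k : 2 ≤ k
  2≤k = ≮⇒≥ λ k<2 → <⇒≱ 3≤n (≤-trans (≤2^lg n) (^-monoʳ-≤ 2 {k} {1} (≤-pred k<2)))

  k≡ : k ≡ suc κ
  k≡ = sym (suc-pred k ⦃ >-nonZero (≤-trans (s≤s z≤n) 2≤k) ⦄)

  k≤2κ : k ≤ 2 * κ
  k≤2κ = ≤-trans (≤-reflexive k≡) (≤-trans (+-monoˡ-≤ κ (≤-pred (≤-trans 2≤k (≤-reflexive k≡)))) (≤-reflexive (solve 1 (λ k → k :+ k := con 2 :* k) refl κ)))
    where open +-*-Solver

  2^κ<n : 2 ^ κ < n
  2^κ<n = *-cancelˡ-< 2 (2 ^ κ) n (subst (λ e → 2 ^ e < 2 * n) k≡ (2^lg< n (≤-trans (s≤s z≤n) 3≤n)))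

  1≤k : 1 ≤ k
  1≤k = <⇒≤ 2≤k

  1≤n : 1 ≤ n
  1≤n = ≤-trans (s≤s z≤n) 3≤n

  K≤2n : K ≤ 2 * n
  K≤2n = <⇒≤ (2^lg< n 1≤n)

  k≤n : k ≤ n
  k≤n = lgUpTo-≤ n n

  q≤T₀ : q ≤ T₀
  q≤T₀ = ≤-trans (common≤ (# 4)) (m≤m+n budget _)

  1≤T₀ : 1 ≤ T₀
  1≤T₀ = ≤-trans (common≤ (# 6)) (m≤m+n budget _)

  rowsq≤ : size# rows * suc q ≤ T₀
  rowsq≤ = ≤-trans (common≤ (# 5)) (m≤m+n budget _)

  hash-cost : (q * q) * (suc j * suc j) ≤ T₀
  hash-cost = m≤n+m _ budget

  m+1≤ : suc m ≤ q * k
  m+1≤ = ≤-trans (+-monoˡ-≤ m (*-mono-≤ (proj₁ h) 1≤k)) (≤-reflexive (trans (cong (λ a → e * k + a * k) (proj₂ (proj₂ h)))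
    (trans (sym (*-distribʳ-+ k e e)) (cong (_* k) (trans (cong (_+_ e) (sym (+-identityʳ e))) (sym (proj₁ (proj₂ h))))))))
    where
    e : ℕ
    e = 2 ^ (j ∸ 1)
    h : 0 < e × 2 ^ j ≡ 2 * e × 2 ^ j ÷ 2 ≡ e
    h = half j (0<j 0<r r<s)

  suc≤2 : ∀ {x} → 1 ≤ x → suc x ≤ 2 * x
  suc≤2 {x} 1≤x = ≤-trans (+-monoˡ-≤ x 1≤x) (≤-reflexive (cong (_+_ x) (sym (+-identityʳ x))))

  Y≤ : val Y ≤ 12 * B
  Y≤ = begin
    budget + (suc n * suc k + (suc m * (K * (q * (suc j * suc j))) + suc m * (suc (size# rows) * suc n)))
      ≤⟨ +-mono-≤ term₁ (+-mono-≤ term₂ (+-mono-≤ term₃ term₄)) ⟩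
    B + (4 * B + (2 * B + 4 * B)) ≡⟨ solve 1 (λ b → b :+ (con 4 :* b :+ (con 2 :* b :+ con 4 :* b)) := con 11 :* b) refl B ⟩
    11 * B ≤⟨ *-monoˡ-≤ B (n≤1+n 11) ⟩
    12 * B ∎
    where
    open ≤-Reasoning
    open +-*-Solver
    1≤nk : 1 ≤ n * k
    1≤nk = *-mono-≤ 1≤n 1≤k
    term₁ : budget ≤ B
    term₁ = ≤-trans (m≤m+n budget _) (m≤m*n T₀ (n * k) ⦃ >-nonZero 1≤nk ⦄)
    term₂ : suc n * suc k ≤ 4 * B
    term₂ = ≤-trans (*-mono-≤ (suc≤2 1≤n) (suc≤2 1≤k)) (≤-trans (≤-reflexive (solve 2 (λ n k → (con 2 :* n) :* (con 2 :* k) := con 4 :* (n :* k)) refl n k))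
      (*-monoʳ-≤ 4 (m≤n*m (n * k) T₀ ⦃ >-nonZero 1≤T₀ ⦄)))
    term₃ : suc m * (K * (q * (suc j * suc j))) ≤ 2 * B
    term₃ = ≤-trans (*-mono-≤ m+1≤ (*-monoˡ-≤ (q * (suc j * suc j)) K≤2n))
      (≤-trans (≤-reflexive (solve 4 (λ q k n j → q :* k :* (con 2 :* n :* (q :* j)) := con 2 :* ((q :* q) :* j :* (n :* k))) refl q k n (suc j * suc j)))
        (*-monoʳ-≤ 2 (*-monoˡ-≤ (n * k) hash-cost)))
    rows+q : q * suc (size# rows) ≤ 2 * T₀
    rows+q = ≤-trans (≤-reflexive (trans (*-suc q (size# rows)) (cong (_+_ q) (*-comm q (size# rows)))))
      (+-mono-≤ q≤T₀ (≤-trans (≤-trans (*-monoʳ-≤ (size# rows) (n≤1+n q)) rowsq≤) (≤-reflexive (sym (+-identityʳ T₀)))))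
    term₄ : suc m * (suc (size# rows) * suc n) ≤ 4 * B
    term₄ = ≤-trans (*-mono-≤ m+1≤ (*-monoʳ-≤ (suc (size# rows)) (suc≤2 1≤n)))
      (≤-trans (≤-reflexive (solve 4 (λ q k x n → q :* k :* (x :* (con 2 :* n)) := con 2 :* (q :* x :* (n :* k))) refl q k (suc (size# rows)) n))
        (≤-trans (*-monoʳ-≤ 2 (*-monoˡ-≤ (n * k) rows+q)) (≤-reflexive (solve 2 (λ t n → con 2 :* (con 2 :* t :* n) := con 4 :* (t :* n)) refl T₀ (n * k)))))

  1≤B : 1 ≤ B
  1≤B = *-mono-≤ 1≤T₀ (*-mono-≤ 1≤n 1≤k)

  -- `Y≤` turns `4 + a * val Y` into at most `13 * a * B`, and passing from `k` to `κ` doubles this;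
  -- hence 26.
  time : ∀ a b t → 4 ≤ a → a * 26 ≤ b → t ≤ 4 + a * val Y → t ≤ b * T₀ * n * κ
  time a b t 4≤a ab t≤ = begin
    t                              ≤⟨ t≤ ⟩
    4 + a * val Y                  ≤⟨ +-mono-≤ (*-mono-≤ 4≤a 1≤B) (*-monoʳ-≤ a Y≤) ⟩
    a * B + a * (12 * B)           ≤⟨ ≤-reflexive (solve 2 (λ a b → a :* b :+ a :* (con 12 :* b) := a :* con 13 :* b) refl a B) ⟩
    a * 13 * B                     ≤⟨ *-monoʳ-≤ (a * 13) (*-monoʳ-≤ T₀ (*-monoʳ-≤ n k≤2κ)) ⟩
    a * 13 * (T₀ * (n * (2 * κ)))  ≡⟨ solve 4 (λ a t n k → a :* con 13 :* (t :* (n :* (con 2 :* k))) := a :* con 26 :* t :* n :* k) refl a T₀ n κ ⟩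
    a * 26 * T₀ * n * κ            ≤⟨ *-monoˡ-≤ κ (*-monoˡ-≤ n (*-monoˡ-≤ T₀ ab)) ⟩
    b * T₀ * n * κ                 ∎
    where
    open ≤-Reasoning
    open +-*-Solver

  size≤ : ∀ b → 2 ≤ b → size family ≤ b * T₀ * κ
  size≤ b 2≤b = begin
    size family              ≤⟨ Data.List.Properties.length-deduplicate _ family ⟩
    length family            ≡⟨ family-size ⟩
    m * size# rows           ≤⟨ *-monoˡ-≤ (size# rows) (≤-trans (n≤1+n m) m+1≤) ⟩
    q * k * size# rows       ≡⟨ solve 3 (λ q k x → q :* k :* x := x :* q :* k) refl q k (size# rows) ⟩
    size# rows * q * k       ≤⟨ *-mono-≤ (≤-trans (*-monoʳ-≤ (size# rows) (n≤1+n q)) rowsq≤) k≤2κ ⟩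
    T₀ * (2 * κ)             ≡⟨ solve 2 (λ t k → t :* (con 2 :* k) := con 2 :* t :* k) refl T₀ κ ⟩
    2 * T₀ * κ               ≤⟨ *-monoˡ-≤ κ (*-monoˡ-≤ T₀ 2≤b) ⟩
    b * T₀ * κ               ∎
    where
    open ≤-Reasoning
    open +-*-Solver

  -- Quadratic in n because the total weight in the outer hashing may reach `2 ^ (k + k)`.
  Ω : ℕ
  Ω = 32 * (T₀ * (n * n))

  1≤nn : 1 ≤ n * n
  1≤nn = *-mono-≤ 1≤n 1≤n

  T₀≤Ω : T₀ ≤ Ω
  T₀≤Ω = ≤-trans (m≤m*n T₀ (n * n) ⦃ >-nonZero 1≤nn ⦄) (m≤n*m (T₀ * (n * n)) 32)

  fits : ∀ c x → c ≤ 32 → x ≤ T₀ → c * (x * (n * n)) ≤ Ω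
  fits c x c≤ x≤ = *-mono-≤ c≤ (*-monoˡ-≤ (n * n) x≤)

  double≤ : 2 * n ≤ Ω
  double≤ = ≤-trans (*-monoʳ-≤ 2 (≤-trans (m≤m*n n n ⦃ >-nonZero 1≤n ⦄) (m≤n*m (n * n) 1))) (fits 2 1 (m≤m+n 2 30) 1≤T₀)

  space : suc m * K ≤ Ω
  space = ≤-trans (*-mono-≤ (≤-trans m+1≤ (*-monoʳ-≤ q k≤n)) K≤2n)
    (≤-trans (≤-reflexive (solve 2 (λ q n → q :* n :* (con 2 :* n) := con 2 :* (q :* (n :* n))) refl q n)) (fits 2 q (m≤m+n 2 30) q≤T₀))
    where open +-*-Solver

  heavy : suc (2 ^ (k + k)) * q ≤ Ω
  heavy = ≤-trans (*-monoˡ-≤ q (≤-trans (suc≤2 (m^n>0 2 (k + k))) (*-monoʳ-≤ 2 (≤-trans (≤-reflexive (^-distribˡ-+-* 2 k k)) (*-mono-≤ K≤2n K≤2n)))))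
    (≤-trans (≤-reflexive (solve 2 (λ n q → con 2 :* (con 2 :* n :* (con 2 :* n)) :* q := con 8 :* (q :* (n :* n))) refl n q)) (fits 8 q (m≤m+n 8 24) q≤T₀))
    where open +-*-Solver

  program-run : ∀ w → Ω ^ 9 < 2 ^ w → ∃ λ t → t ≤ 4 + 14000 * val Y × Run w (compile mainS) (initial w n r s) t (concatMap toList family)
  program-run w Ω< = Timed.run w Ω (m≤m*n 32 (T₀ * (n * n)) ⦃ >-nonZero (*-mono-≤ 1≤T₀ 1≤nn) ⦄) Ω< (≤-trans (m≤m+n budget _) T₀≤Ω) double≤ space heavy

-- The word length.

finite-part : ℕ
finite-part = Σ< rough (threshold 400 12 1)

-- Level 0 occurs only below the threshold, so a single constant serves all these d, and the word
-- factor can be fixed in advance.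
rough≤finite-part : ∀ d → level d ≡ 0 → rough d ≤ finite-part
rough≤finite-part d eq = Σ-term rough (≰⇒> λ h → <⇒≱ (level-grows 1 (s≤s z≤n) d h) (≤-reflexive eq))

wordFactor : ℕ
-- 9 is the exponent in `Ω ^ 9 < 2 ^ w`. With `V = n * C`, `Ω ≤ V ^ (10 + finite-part)`: 4 for the
-- constant 32, `4 + finite-part` for the cost, and 2 for `n * n`.
wordFactor = (10 + finite-part) * 9

words : ∀ {r s} (0<r : 0 < r) (r<s : r < s) n (r<n : r < n) (s<n : s < n) →
  Estimates.Ω 0<r r<s n r<n s<n ^ 9 < 2 ^ wordSize wordFactor n r s
words {r} {s} 0<r r<s n r<n s<n = <-≤-trans (≤-<-trans (^-monoˡ-≤ 9 Ω≤) (≤-<-trans (≤-reflexive (^-*-assoc V (10 + finite-part) 9)) (^-monoʳ-< V 2≤V {wordFactor} {suc wordFactor} ≤-refl)))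
  (≤-trans (^-monoˡ-≤ (suc wordFactor) (≤2^⌈log₂⌉ V V ≤-refl)) (≤-reflexive (trans (^-*-assoc 2 ⌈log₂ V ⌉ (suc wordFactor)) (cong (2 ^_) (*-comm ⌈log₂ V ⌉ (suc wordFactor))))))
  where
  open Estimates 0<r r<s n r<n s<n using (Ω; T₀; 3≤n; 1≤n)
  open Bounds 0<r r<s
  V : ℕ
  V = n * C
  n≤V : n ≤ V
  n≤V = m≤m*n n C ⦃ >-nonZero 1≤C ⦄
  C≤V : C ≤ V
  C≤V = m≤n*m C n ⦃ >-nonZero 1≤n ⦄
  2≤V : 2 ≤ V
  2≤V = ≤-trans (≤-trans (n≤1+n 2) 3≤n) n≤V
  V^-mono : ∀ {a b} → a ≤ b → V ^ a ≤ V ^ b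
  V^-mono = ^-monoʳ-≤ V ⦃ >-nonZero (<⇒≤ 2≤V) ⦄
  U≤ : ∀ M → M ≡ level (r + s) → U ≤ V ^ (4 + finite-part)
  U≤ zero eq = ≤-trans U≤rough (≤-trans (rough≤finite-part (r + s) (sym eq)) (≤-trans (<⇒≤ (n<2^n finite-part)) (≤-trans (^-monoˡ-≤ finite-part 2≤V) (V^-mono (m≤n+m finite-part 4)))))
  U≤ (suc m) eq = ≤-trans (weight≤A² m eq) (≤-trans (*-mono-≤ A≤ A≤) (≤-trans (≤-reflexive (solve 1 (λ v → (v :* v) :* (v :* v) := v :* (v :* (v :* (v :* con 1)))) refl V)) (V^-mono (m≤m+n 4 finite-part))))
    where
    open +-*-Solver
    A≤ : A ≤ V * V
    A≤ = *-mono-≤ (≤-trans d≤C C≤V) C≤V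
  Ω≤ : Ω ≤ V ^ (10 + finite-part)
  Ω≤ = ≤-trans (*-mono-≤ {32} {V ^ 4} (≤-trans (≤ᵇ⇒≤ 32 (3 ^ 4) tt) (^-monoˡ-≤ 4 (≤-trans 3≤n n≤V))) (*-mono-≤ (≤-trans (m≤n*m T₀ 460000) (U≤ (level (r + s)) refl)) (*-mono-≤ n≤V n≤V)))
    (≤-reflexive (trans (solve 3 (λ v a b → a :* (b :* (v :* v)) := (a :* (v :* (v :* con 1))) :* b) refl V (V ^ 4) (V ^ (4 + finite-part)))
      (trans (cong (_* V ^ (4 + finite-part)) (sym (^-distribˡ-+-* V 4 2))) (sym (^-distribˡ-+-* V 6 (4 + finite-part))))))
    where open +-*-Solver

open Defs using (N)

theorem1 :
    ∃ λ (ε : ℕ → ℚ) → ∃ λ (δ : ℕ → ℚ) → TendsToZero ε × TendsToZero δ ×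
    (∃ λ (P : Program) → ∃ λ (c : ℕ) → ∃ λ (K : ℕ) →
      (r s d n : ℕ) → 0 < r → r < s → s < d → d ≡ r + s → r < n → s < n →
      ∃ λ (F : Family n) → IsCFF n r s F
        × fromℕ (size F) ≤ʳ N r s ^ʳ (1ℚ ℚ.+ ε d) *ʳ log₂ n
        × (∃ λ (t : ℕ) →
            Run (wordSize c n r s) P (initial (wordSize c n r s) n r s) t (concatMap toList F)
            × fromℕ t ≤ʳ fromℕ K *ʳ N r s ^ʳ (1ℚ ℚ.+ δ d) *ʳ fromℕ n *ʳ log₂ n))
-- One error term serves size and time. All constants already sit in the factor 460000 of `weight`,
-- so the constant of the time bound is 1.
theorem1 = o , o , slack-tends , slack-tends , compile mainS , wordFactor , 1 , correct
  where
  o : ℕ → ℚ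
  o d = slack (level d) d
  correct : (r s d n : ℕ) → 0 < r → r < s → s < d → d ≡ r + s → r < n → s < n →
      ∃ λ (F : Family n) → IsCFF n r s F
        × fromℕ (size F) ≤ʳ Defs.N r s ^ʳ (1ℚ ℚ.+ o d) *ʳ log₂ n
        × (∃ λ (t : ℕ) →
            Run (wordSize wordFactor n r s) (compile mainS) (initial (wordSize wordFactor n r s) n r s) t (concatMap toList F)
            × fromℕ t ≤ʳ fromℕ 1 *ʳ Defs.N r s ^ʳ (1ℚ ℚ.+ o d) *ʳ fromℕ n *ʳ log₂ n)
  correct r s _ n 0<r r<s _ refl r<n s<n = family , family-CFF ,
    product-upper {X} {n} {U} {κ} {size family} U< 2^κ<n (size≤ 460000 (≤ᵇ⇒≤ 2 460000 tt)) , proj₁ run , proj₂ (proj₂ run) ,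
    product-upper {fromℕ 1 *ʳ X *ʳ fromℕ n} {n} {U * n} {κ} {proj₁ run} (fromℕ-*ʳ-upper {fromℕ 1 *ʳ X} {U} n (fromℕ-1*ʳ-upper {X} {U} U<)) 2^κ<n
      -- 14000 is the cost constant derived for `mainS`, and `14000 * 26 ≤ 460000`.
      (time 14000 460000 (proj₁ run) (≤ᵇ⇒≤ 4 14000 tt) (≤ᵇ⇒≤ (14000 * 26) 460000 tt) (proj₁ (proj₂ run)))
    where
    open Core (params r s) 0<r r<s n r<n s<n using (family; family-CFF)
    open Estimates 0<r r<s n r<n s<n using (κ; 2^κ<n; size≤; time; program-run)
    open Bounds 0<r r<s using (U; weight<)
    X : ℝ≥0
    X = Defs.N r s ^ʳ (1ℚ ℚ.+ o (r + s))
    U< : ∀ q → upper X q → ι U ℚ.< q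
    U< = weight< (level (r + s)) refl
    run = program-run (wordSize wordFactor n r s) (words 0<r r<s n r<n s<n)
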